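{- Let $F$ be a non-archimedean local field of arbitrary characteristic (including $2$), $E/F$ a separable quadratic field extension and $T=T_{E/F}\subset SL(2)$ the associated anisotropic torus. Put $\kappa=\varepsilon_{E/F}$. There exist functions $\Gamma_1,\Gamma_{\nu}$ on the set of regular elements $T(F)\setminus\{\pm1\}$ and a constant $c\in\mathbb C$ (independent of $f$, depending on the choice of measures) such that for every $f\in C_c^\infty(SL(2,F))$ there is a neighbourhood $V$ of $1$ in $T(F)$ with $$\mathcal O(t,f)=\Gamma_1(t)\,f(1)+\Gamma_{\nu}(t)\,\mathcal O^{1}(\boldsymbol\nu,f)+c\,\Delta^{\mathcal E}(t)^{ -1}\,\mathcal O^{\kappa}(\boldsymbol\nu,f)$$ for all regular $t\in V$.
   Context: $x\mapsto\overline x$ is the nontrivial element of $\mathrm{Gal}(E/F)$, $\varepsilon_{E/F}:F^\times\to\{\pm1\}$ is the character with kernel $N_{E/F}E^\times$. Fix $\tau\in E\setminus F$; multiplication on $E$ in the basis $\{1,\tau\}$ embeds $E^\times$ in $GL(2,F)$, and $T_{E/F}(F)$ is the image of the norm-one elements, contained in $SL(2,F)$. For regular $t\in T(F)$, $$\mathcal O(t,f)=\int_{T(F)\backslash SL(2,F)}f(x^{ -1}tx)\,dx .$$ If $t$ corresponds to $\gamma\in E^\times$, the transfer factor is $$\Delta^{\mathcal E}(t)=\lambda\cdot\varepsilon_{E/F}\Big(\frac{\gamma-\overline\gamma}{\tau-\overline\tau}\Big)|N_{E/F}(\gamma-\overline\gamma)|_F^{1/2},$$ $\lambda$ being a fixed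 nonzero constant (a fourth root of unity). With $K=SL(2,\mathfrak O_F)$ and for a character $\chi$ of $F^\times$ with $\chi^2=1$, the unipotent $\chi$-orbital integral is $$\mathcal O^{\chi}(\boldsymbol\nu,f)=\int_K\int_F\chi(n)\,f\Big(k^{ -1}\begin{pmatrix}1&n\\0&1\end{pmatrix}k\Big)\,dn\,dk,\qquad \boldsymbol\nu=\begin{pmatrix}1&1\\0&1\end{pmatrix}$$ ($\chi=1$ gives $\mathcal O^1$). Haar measures are fixed. -}

module Defs where

open import Algebra.Bundles using (CommutativeRing; RawRing)
open import Algebra.Morphism.Structures using (module RingMorphisms)
import Algebra.Definitions.RawSemiring as RawSemiringDefs
import Algebra.Properties.Ring as RingProperties
import Algebra.Solver.Ring.NaturalCoefficients.Default as SemiringSolver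
open import Data.Fin.Base using (Fin)
open import Data.Integer.Base as ℤ using (ℤ; +_; -[1+_]; 0ℤ; 1ℤ)
import Data.Integer.Properties as ℤ
open import Data.List.Base using (List)
open import Data.List.Relation.Unary.Any using (Any)
open import Data.Nat.Base as ℕ using (ℕ; zero; suc)
open import Data.Product.Base using (∃; ∃₂; _×_; _,_; proj₁; proj₂)
open import Data.Product.Relation.Binary.Pointwise.NonDependent using (×-setoid)
open import Data.Sign.Base as Sign using (Sign)
open import Data.Sum.Base using (_⊎_; inj₁; inj₂)
open import Data.Unit.Base using (⊤; tt)
open import Function.Bundles using (_⇔_; module Equivalence)
open import Level using (0ℓ)
open import Relation.Binary.Bundles using (Setoid)
open import Relation.Binary.PropositionalEquality as ≡ using (_≡_)
open import Relation.Binary.Structures using (IsTotalOrder)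
import Relation.Binary.Construct.On as On
import Relation.Binary.Reasoning.Setoid as SetoidReasoning
open import Relation.Nullary.Negation.Core using (¬_)
open import Relation.Unary using (Pred)

-- The inverse is made total by the convention 0⁻¹ = 0.
record Field : Set₁ where
  field
    commutativeRing : CommutativeRing 0ℓ 0ℓ
  open CommutativeRing commutativeRing public
  infix 8 _⁻¹
  field
    _⁻¹      : Carrier → Carrier
    ⁻¹-cong  : ∀ {x y} → x ≈ y → x ⁻¹ ≈ y ⁻¹
    0⁻¹      : 0# ⁻¹ ≈ 0#
    *-inverse : ∀ {x} → x ≉ 0# → x * x ⁻¹ ≈ 1#
    1≉0      : 1# ≉ 0#

-- ℝ is characterised, up to isomorphism, as the complete ordered field.
record RealField : Set₁ where
  field
    isField : Field
  open Field isField public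
  infix 4 _≤_
  field
    _≤_          : Carrier → Carrier → Set
    isTotalOrder : IsTotalOrder _≈_ _≤_
    +-monoˡ-≤    : ∀ z {x y} → x ≤ y → x + z ≤ y + z
    *-nonneg     : ∀ {x y} → 0# ≤ x → 0# ≤ y → 0# ≤ x * y

  UpperBound : Pred Carrier 0ℓ → Carrier → Set
  UpperBound P b = ∀ y → P y → y ≤ b

  LeastUpperBound : Pred Carrier 0ℓ → Carrier → Set
  LeastUpperBound P s = UpperBound P s × (∀ b → UpperBound P b → s ≤ b)

  field
    supremum : ∀ P → ∃ P → ∃ (UpperBound P) → ∃ (LeastUpperBound P)

module RealOps (ℝ : RealField) where
  open RealField ℝ
  module ≤ = IsTotalOrder isTotalOrder
  open RingProperties ring using (-‿distribʳ-*; -‿involutive)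
  open SetoidReasoning setoid

  infix 4 _<_
  _<_ : Carrier → Carrier → Set
  x < y = x ≤ y × x ≉ y

  ∣_∣ : Carrier → Carrier
  ∣ x ∣ with ≤.total 0# x
  ... | inj₁ _ = x
  ... | inj₂ _ = - x

  private
    ≤-resp : ∀ {x x′ y y′} → x ≈ x′ → y ≈ y′ → x ≤ y → x′ ≤ y′
    ≤-resp p q r = ≤.trans (≤.reflexive (sym p)) (≤.trans r (≤.reflexive q))

    cancel : ∀ x y → (y + - x) + x ≈ y
    cancel x y = trans (+-assoc y (- x) x) (trans (+-congˡ (-‿inverseˡ x)) (+-identityʳ y))

    neg : ∀ {x} → x ≤ 0# → 0# ≤ - x
    neg {x} p = ≤-resp (-‿inverseʳ x) (+-identityˡ (- x)) (+-monoˡ-≤ (- x) p)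

    *-mono : ∀ {x y z} → 0# ≤ z → x ≤ y → z * x ≤ z * y
    *-mono {x} {y} {z} 0≤z x≤y =
      ≤-resp (+-identityˡ _) lem (+-monoˡ-≤ (z * x) (*-nonneg 0≤z 0≤y-x))
      where
      0≤y-x : 0# ≤ y + - x
      0≤y-x = ≤-resp (-‿inverseʳ x) refl (+-monoˡ-≤ (- x) x≤y)
      lem : z * (y + - x) + z * x ≈ z * y
      lem = trans (sym (distribˡ z _ x)) (*-congˡ (cancel x y))

    0≤1 : 0# ≤ 1#
    0≤1 with ≤.total 0# 1#
    ... | inj₁ p = p
    ... | inj₂ p = ≤-resp refl sq (*-nonneg (neg p) (neg p))
      where
      sq : - 1# * - 1# ≈ 1#
      sq = begin
        - 1# * - 1#   ≈⟨ -‿distribʳ-* (- 1#) 1# ⟨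
        - (- 1# * 1#) ≈⟨ -‿cong (*-identityʳ (- 1#)) ⟩
        - (- 1#)      ≈⟨ -‿involutive 1# ⟩
        1#            ∎

    shift : ∀ {a} b → 0# ≤ a → b ≤ a + b
    shift b p = ≤-resp (+-identityˡ b) refl (+-monoˡ-≤ b p)

    root-bound : ∀ {x y} → 0# ≤ x → y * y ≤ x → y ≤ 1# + x
    root-bound {x} {y} 0≤x yy≤x with ≤.total y (1# + x)
    ... | inj₁ p = p
    ... | inj₂ p =
      ≤.trans y≤yy (≤.trans yy≤x (shift x 0≤1))
      where
      1≤y : 1# ≤ y
      1≤y = ≤.trans (≤-resp refl (+-comm x 1#) (shift 1# 0≤x)) p
      y≤yy : y ≤ y * y
      y≤yy = ≤-resp (*-identityʳ y) refl (*-mono (≤.trans 0≤1 1≤y) 1≤y)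

  BelowRoot : Carrier → Pred Carrier 0ℓ
  BelowRoot x y = y ≤ 0# ⊎ y * y ≤ x

  belowRoot-bounded : ∀ x → ∃ (UpperBound (BelowRoot x))
  belowRoot-bounded x with ≤.total 0# x
  ... | inj₁ 0≤x = 1# + x , λ where
    y (inj₁ y≤0) → ≤.trans y≤0 (≤.trans 0≤x (shift x 0≤1))
    y (inj₂ yy≤x) → root-bound 0≤x yy≤x
  ... | inj₂ x≤0 = 1# + 0# , λ where
    y (inj₁ y≤0) → ≤.trans y≤0 (shift 0# 0≤1)
    y (inj₂ yy≤x) → root-bound ≤.refl (≤.trans yy≤x x≤0)

  -- √ x = sup { y | y ≤ 0 or y² ≤ x }: the square root if 0 ≤ x, and 0 if x < 0.
  √_ : Carrier → Carrier
  √ x = proj₁ (supremum (BelowRoot x) (0# , inj₁ ≤.refl) (belowRoot-bounded x))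

  sumℝ : (ℕ → Carrier) → ℕ → Carrier
  sumℝ a zero    = 0#
  sumℝ a (suc n) = sumℝ a n + a n

  ℂ-setoid : Setoid 0ℓ 0ℓ
  ℂ-setoid = ×-setoid setoid setoid

  -- The pair (a , b) is a + bi.
  ℂ-rawRing : RawRing 0ℓ 0ℓ
  ℂ-rawRing = record
    { Carrier = Setoid.Carrier ℂ-setoid
    ; _≈_     = Setoid._≈_ ℂ-setoid
    ; _+_     = λ (a , b) (c , d) → a + c , b + d
    ; _*_     = λ (a , b) (c , d) → a * c - b * d , a * d + b * c
    ; -_      = λ (a , b) → - a , - b
    ; 0#      = 0# , 0#
    ; 1#      = 1# , 0#
    }

  ℂ : Set
  ℂ = RawRing.Carrier ℂ-rawRing

  fromℝ : Carrier → ℂ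
  fromℝ a = a , 0#

  infix 8 _⁻¹ᶜ
  _⁻¹ᶜ : ℂ → ℂ
  (a , b) ⁻¹ᶜ = a * d ⁻¹ , - b * d ⁻¹
    where
    d : Carrier
    d = a * a + b * b

record Space : Set₁ where
  field
    Point : Set
    Open  : Pred Point 0ℓ → Set

-- The topology in which the sets { y | Near n x y } are a basis of
-- neighbourhoods of x.
nearSpace : (A : Set) → (ℤ → A → A → Set) → Space
nearSpace A Near = record
  { Point = A
  ; Open  = λ U → ∀ x → U x → ∃ λ n → ∀ y → Near n x y → U y
  }

Compact : (X : Space) → Pred (Space.Point X) 0ℓ → Set₁
Compact X C =
  ∀ {I : Set} (U : I → Pred Point 0ℓ) → (∀ i → Open (U i)) →
  (∀ x → C x → ∃ λ i → U i x) →
  ∃ λ (is : List I) → ∀ x → C x → Any (λ i → U i x) is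
  where open Space X

-- C_c^∞(X, A): the locally constant functions of compact support.
record Cc∞ (X : Space) (A : RawRing 0ℓ 0ℓ) : Set₁ where
  open Space X
  open RawRing A
  field
    fun             : Point → Carrier
    locallyConstant : ∀ x → ∃ λ U → Open U × U x × (∀ y → U y → fun y ≈ fun x)
    compactSupport  : ∃ λ C → Compact X C × (∀ x → ¬ (fun x ≈ 0#) → C x)

open Cc∞ public using (fun)

module Integration (ℝ : RealField) where
  open RealField ℝ
  open RealOps ℝ

  -- On a totally disconnected locally compact space, (nonzero) Radon
  -- measures are the same as (nonzero) positive linear forms on C_c^∞.
  record Measure (X : Space) : Set₁ where
    open Space X
    field
      ∫        : Cc∞ X rawRing → Carrier
      additive : ∀ φ ψ θ → (∀ x → fun θ x ≈ fun φ x + fun ψ x) → ∫ θ ≈ ∫ φ + ∫ ψ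
      scalar   : ∀ r φ ψ → (∀ x → fun ψ x ≈ r * fun φ x) → ∫ ψ ≈ r * ∫ φ
      positive : ∀ φ → (∀ x → 0# ≤ fun φ x) → 0# ≤ ∫ φ
      nonzero  : ∃ λ φ → ∫ φ ≉ 0#

  InvariantUnder : ∀ {X} → Measure X → (Space.Point X → Space.Point X) → Set₁
  InvariantUnder μ a = ∀ φ ψ → (∀ x → fun ψ x ≈ fun φ (a x)) → ∫ ψ ≈ ∫ φ
    where open Measure μ

  -- "h ≤ Σⱼ ψⱼ", the sum being +∞ where the partial sums are unbounded.
  DominatedBy : ∀ {X} → (Space.Point X → Carrier) → (ℕ → Cc∞ X rawRing) → Set
  DominatedBy h ψ =
    ∀ x r → (∀ n → sumℝ (λ j → fun (ψ j) x) n ≤ r) → h x ≤ r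

  -- Lebesgue integral (Daniell's construction): h is integrable with
  -- integral L iff it is the limit of test functions φ for the seminorm
  -- h ↦ ∫* |h|, where ∫* g = inf { Σⱼ ∫ ψⱼ | ψⱼ ≥ 0, g ≤ Σⱼ ψⱼ }, and
  -- L is the limit of the ∫ φ.
  HasIntegralℝ : ∀ {X} → Measure X → (Space.Point X → Carrier) → Carrier → Set₁
  HasIntegralℝ {X} μ h L =
    ∀ ε → 0# < ε →
    ∃ λ (φ : Cc∞ X rawRing) → ∃ λ (ψ : ℕ → Cc∞ X rawRing) →
      (∀ j x → 0# ≤ fun (ψ j) x) ×
      DominatedBy {X} (λ x → ∣ h x - fun φ x ∣) ψ ×
      (∀ n → sumℝ (λ j → ∫ (ψ j)) n ≤ ε) ×
      ∣ ∫ φ - L ∣ ≤ ε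
    where open Measure μ

  HasIntegral : ∀ {X} → Measure X → (Space.Point X → ℂ) → ℂ → Set₁
  HasIntegral μ h (a , b) =
    HasIntegralℝ μ (λ x → proj₁ (h x)) a × HasIntegralℝ μ (λ x → proj₂ (h x)) b

data ℤ∞ : Set where
  fin : ℤ → ℤ∞
  ∞   : ℤ∞

infix 4 _≼_
_≼_ : ℤ → ℤ∞ → Set
n ≼ fin m = n ℤ.≤ m
n ≼ ∞     = ⊤

infixl 6 _⊕_
_⊕_ : ℤ∞ → ℤ∞ → ℤ∞
fin m ⊕ fin n = fin (m ℤ.+ n)
fin m ⊕ ∞     = ∞
∞     ⊕ n     = ∞

-- A field complete for a normalised discrete valuation with finite
-- residue field.
record LocalField : Set₁ where
  field
    isField : Field
  open Field isField public
  field
    v        : Carrier → ℤ∞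
    v-cong   : ∀ {x y} → x ≈ y → v x ≡ v y
    v-∞      : ∀ x → v x ≡ ∞ ⇔ x ≈ 0#
    v-*      : ∀ x y → v (x * y) ≡ v x ⊕ v y
    v-+      : ∀ n x y → n ≼ v x → n ≼ v y → n ≼ v (x + y)
    ϖ        : Carrier
    v-ϖ      : v ϖ ≡ fin 1ℤ

  CauchySequence : (ℕ → Carrier) → Set
  CauchySequence s = ∀ n → ∃ λ N → ∀ i j → N ℕ.≤ i → N ℕ.≤ j → n ≼ v (s i - s j)

  ConvergesTo : (ℕ → Carrier) → Carrier → Set
  ConvergesTo s l = ∀ n → ∃ λ N → ∀ i → N ℕ.≤ i → n ≼ v (s i - l)

  field
    complete : ∀ s → CauchySequence s → ∃ (ConvergesTo s)
    -- residue is a system of representatives of the residue field,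
    -- which thus has q elements.
    q                  : ℕ
    residue            : Fin q → Carrier
    residue-integral   : ∀ i → 0ℤ ≼ v (residue i)
    residue-injective  : ∀ i j → 1ℤ ≼ v (residue i - residue j) → i ≡ j
    residue-surjective : ∀ x → 0ℤ ≼ v x → ∃ λ i → 1ℤ ≼ v (x - residue i)

  Fˣ : Set
  Fˣ = ∃ λ x → x ≉ 0#

  Integral : Carrier → Set
  Integral x = 0ℤ ≼ v x

  NearF : ℤ → Carrier → Carrier → Set
  NearF n x y = n ≼ v (x - y)

  F-space : Space
  F-space = nearSpace Carrier NearF

  -- A character with χ² = 1 takes its values in {±1}.
  record QuadraticCharacter : Set where
    field
      χ          : Fˣ → Sign
      χ-cong     : ∀ x y → proj₁ x ≈ proj₁ y → χ x ≡ χ y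
      χ-*        : ∀ x y z → proj₁ z ≈ proj₁ x * proj₁ y → χ z ≡ χ x Sign.* χ y
      continuous : ∀ x → ∃ λ n → ∀ y → NearF n (proj₁ x) (proj₁ y) → χ y ≡ χ x

  open QuadraticCharacter public using (χ)

  𝟙 : QuadraticCharacter
  𝟙 = record
    { χ          = λ _ → Sign.+
    ; χ-cong     = λ _ _ _ → ≡.refl
    ; χ-*        = λ _ _ _ _ → ≡.refl
    ; continuous = λ _ → 0ℤ , λ _ _ → ≡.refl
    }

module SL₂ (F : LocalField) where
  open LocalField F
  open RingProperties ring using (-‿distribˡ-*; -‿distribʳ-*; -‿involutive)
  open SetoidReasoning setoid

  -- The matrix with rows (a b) and (c d).
  record SL2 : Set where
    constructor mat
    field
      a b c d : Carrier
      det     : a * d - b * c ≈ 1#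

  open SL2 public

  infix 4 _≋_
  _≋_ : SL2 → SL2 → Set
  g ≋ h = a g ≈ a h × b g ≈ b h × c g ≈ c h × d g ≈ d h

  SL2-setoid : Setoid 0ℓ 0ℓ
  SL2-setoid = record
    { Carrier       = SL2
    ; _≈_           = _≋_
    ; isEquivalence = record
      { refl  = refl , refl , refl , refl
      ; sym   = λ (p , q , r , s) → sym p , sym q , sym r , sym s
      ; trans = λ (p , q , r , s) (p′ , q′ , r′ , s′) →
                  trans p p′ , trans q q′ , trans r r′ , trans s s′
      }
    }

  private
    open SemiringSolver commutativeSemiring using (solve; _:+_; _:*_; _:=_; con)

    det⁺ : ∀ {x y} → x - y ≈ 1# → x ≈ 1# + y
    det⁺ {x} {y} p = begin
      x              ≈⟨ +-identityʳ x ⟨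
      x + 0#         ≈⟨ +-congˡ (-‿inverseˡ y) ⟨
      x + (- y + y)  ≈⟨ +-assoc x (- y) y ⟨
      (x - y) + y    ≈⟨ +-congʳ p ⟩
      1# + y         ∎

    det⁻ : ∀ {x y} → x ≈ 1# + y → x - y ≈ 1#
    det⁻ {x} {y} p = begin
      x - y          ≈⟨ +-congʳ p ⟩
      (1# + y) - y   ≈⟨ +-assoc 1# y (- y) ⟩
      1# + (y - y)   ≈⟨ +-congˡ (-‿inverseʳ y) ⟩
      1# + 0#        ≈⟨ +-identityʳ 1# ⟩
      1#             ∎

    det-· : ∀ a b c d a′ b′ c′ d′ → a * d ≈ 1# + b * c → a′ * d′ ≈ 1# + b′ * c′ →
            (a * a′ + b * c′) * (c * b′ + d * d′) ≈
            1# + (a * b′ + b * d′) * (c * a′ + d * c′)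
    det-· a b c d a′ b′ c′ d′ p p′ = begin
      (a * a′ + b * c′) * (c * b′ + d * d′)
        ≈⟨ solve 8 (λ a b c d a′ b′ c′ d′ →
             (a :* a′ :+ b :* c′) :* (c :* b′ :+ d :* d′) :=
             (a :* d) :* (a′ :* d′) :+ (b :* c) :* (b′ :* c′) :+
               (a :* a′ :* c :* b′ :+ b :* c′ :* d :* d′))
             refl a b c d a′ b′ c′ d′ ⟩
      (a * d) * (a′ * d′) + (b * c) * (b′ * c′) + S
        ≈⟨ +-congʳ (+-congʳ (*-cong p p′)) ⟩
      (1# + b * c) * (1# + b′ * c′) + (b * c) * (b′ * c′) + S
        ≈⟨ solve 3 (λ y y′ s →
             (con 1 :+ y) :* (con 1 :+ y′) :+ y :* y′ :+ s :=
             con 1 :+ ((con 1 :+ y) :* y′ :+ y :* (con 1 :+ y′) :+ s))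
             refl (b * c) (b′ * c′) S ⟩
      1# + ((1# + b * c) * (b′ * c′) + (b * c) * (1# + b′ * c′) + S)
        ≈⟨ +-congˡ (+-congʳ (+-cong (*-congʳ p) (*-congˡ p′))) ⟨
      1# + ((a * d) * (b′ * c′) + (b * c) * (a′ * d′) + S)
        ≈⟨ solve 8 (λ a b c d a′ b′ c′ d′ →
             con 1 :+ ((a :* d) :* (b′ :* c′) :+ (b :* c) :* (a′ :* d′) :+
               (a :* a′ :* c :* b′ :+ b :* c′ :* d :* d′)) :=
             con 1 :+ (a :* b′ :+ b :* d′) :* (c :* a′ :+ d :* c′))
             refl a b c d a′ b′ c′ d′ ⟩
      1# + (a * b′ + b * d′) * (c * a′ + d * c′) ∎
      where
      S : Carrier
      S = a * a′ * c * b′ + b * c′ * d * d′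

    neg-neg : ∀ x y → - x * - y ≈ x * y
    neg-neg x y = begin
      - x * - y     ≈⟨ -‿distribˡ-* x (- y) ⟨
      - (x * - y)   ≈⟨ -‿cong (-‿distribʳ-* x y) ⟨
      - (- (x * y)) ≈⟨ -‿involutive (x * y) ⟩
      x * y         ∎

  infixl 7 _·_
  _·_ : SL2 → SL2 → SL2
  mat a b c d p · mat a′ b′ c′ d′ p′ =
    mat (a * a′ + b * c′) (a * b′ + b * d′) (c * a′ + d * c′) (c * b′ + d * d′)
        (det⁻ (det-· a b c d a′ b′ c′ d′ (det⁺ p) (det⁺ p′)))

  inv : SL2 → SL2
  inv (mat a b c d p) =
    mat d (- b) (- c) a (trans (+-cong (*-comm d a) (-‿cong (neg-neg b c))) p)

  unipotent : Carrier → SL2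
  unipotent n = mat 1# n 0# 1# (det⁻ (trans (*-identityʳ 1#)
    (sym (trans (+-congˡ (zeroʳ n)) (+-identityʳ 1#)))))

  I : SL2
  I = unipotent 0#

  -I : SL2
  -I = mat (- 1#) 0# 0# (- 1#) (det⁻ (trans (neg-neg 1# 1#)
    (trans (*-identityʳ 1#) (sym (trans (+-congˡ (zeroʳ 0#)) (+-identityʳ 1#))))))

  NearG : ℤ → SL2 → SL2 → Set
  NearG n g h = NearF n (a g) (a h) × NearF n (b g) (b h) ×
                NearF n (c g) (c h) × NearF n (d g) (d h)

  G-space : Space
  G-space = nearSpace SL2 NearG

  record K : Set where
    constructor intg
    field
      g  : SL2
      aᵒ : Integral (a g)
      bᵒ : Integral (b g)
      cᵒ : Integral (c g)
      dᵒ : Integral (d g)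

  K-space : Space
  K-space = nearSpace K (λ n k l → NearG n (K.g k) (K.g l))

  private
    ⊕-nonneg : ∀ m n → 0ℤ ≼ m → 0ℤ ≼ n → 0ℤ ≼ m ⊕ n
    ⊕-nonneg (fin m) (fin n) p q = ℤ.+-mono-≤ p q
    ⊕-nonneg (fin m) ∞       p q = tt
    ⊕-nonneg ∞       n       p q = tt

    *ᵒ : ∀ {x y} → Integral x → Integral y → Integral (x * y)
    *ᵒ {x} {y} p q = ≡.subst (0ℤ ≼_) (≡.sym (v-* x y)) (⊕-nonneg (v x) (v y) p q)

    dotᵒ : ∀ {x y z w} → Integral x → Integral y → Integral z → Integral w →
           Integral (x * y + z * w)
    dotᵒ p q r s = v-+ 0ℤ _ _ (*ᵒ p q) (*ᵒ r s)

  infixl 7 _·ᴷ_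
  _·ᴷ_ : K → K → K
  intg g p q r s ·ᴷ intg g′ p′ q′ r′ s′ =
    intg (g · g′) (dotᵒ p p′ q r′) (dotᵒ p q′ q s′) (dotᵒ r p′ s r′) (dotᵒ r q′ s s′)

-- E/F together with an element τ of E ∖ F and the nontrivial element
-- x ↦ bar x of Gal(E/F).
record SeparableQuadraticExtension (F : LocalField) : Set₁ where
  module F = LocalField F
  field
    isField : Field
  open Field isField public
  open RingMorphisms
  field
    ι      : F.Carrier → Carrier
    ι-hom  : IsRingHomomorphism F.rawRing rawRing ι
    -- [E : F] = 2: {1, τ} is a basis (its independence amounts to τ ∉ F).
    τ      : Carrier
    τ∉F    : ∀ x → τ ≉ ι x
    span   : ∀ x → ∃₂ λ a b → x ≈ ι a + ι b * τ
    -- Every x ∈ E ∖ F is a simple root of its minimal polynomial X² + sX + n.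
    separable : ∀ x → (∀ y → x ≉ ι y) → ∀ s n →
                x * x + ι s * x + ι n ≈ 0# → x + x + ι s ≉ 0#
    bar            : Carrier → Carrier
    bar-iso        : IsRingIsomorphism rawRing rawRing bar
    bar-ι          : ∀ x → bar (ι x) ≈ ι x
    bar-nontrivial : ∃ λ x → bar x ≉ x

  -- The coefficient of 1 in the basis {1, τ}; on elements of F it is
  -- the inverse of ι.
  toF : Carrier → F.Carrier
  toF x = proj₁ (span x)

  Norm : Carrier → F.Carrier
  Norm x = toF (x * bar x)

module OrbitalIntegrals (ℝ : RealField) (F : LocalField)
                        (E : SeparableQuadraticExtension F) where
  open RealOps ℝ public using (ℂ; ℂ-setoid; ℂ-rawRing; fromℝ; _⁻¹ᶜ; √_)
  open Integration ℝ public
  open LocalField F public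
    using (F-space; QuadraticCharacter; 𝟙; χ; Fˣ)
  open SL₂ F public
  private
    module ℝ = RealField ℝ
    module F = LocalField F
    module E = SeparableQuadraticExtension E

  open RawRing ℂ-rawRing public
    using () renaming (_≈_ to _≈ᶜ_; _+_ to _+ᶜ_; _*_ to _*ᶜ_; 1# to 1ᶜ)
  open RawSemiringDefs (RawRing.rawSemiring ℂ-rawRing) public
    using () renaming (_^_ to _^ᶜ_)

  open RawSemiringDefs (RawRing.rawSemiring ℝ.rawRing) using (_^_) renaming (_×_ to _×ℝ_)

  qℝ : ℝ.Carrier
  qℝ = F.q ×ℝ ℝ.1#

  -- |x|_F = q^(- v x)
  ∣_∣F : F.Carrier → ℝ.Carrier
  ∣ x ∣F with F.v x
  ... | fin (+ n)    = (qℝ ℝ.⁻¹) ^ n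
  ... | fin -[1+ n ] = qℝ ^ suc n
  ... | ∞            = ℝ.0#

  signℝ : Sign → ℝ.Carrier
  signℝ Sign.+ = ℝ.1#
  signℝ Sign.- = ℝ.- ℝ.1#

  -- A character of Fˣ, extended to F by 0.
  extend : QuadraticCharacter → F.Carrier → ℝ.Carrier
  extend ω x with F.v x in eq
  ... | ∞     = ℝ.0#
  ... | fin m = signℝ (χ ω (x , x≉0))
    where
    x≉0 : x F.≉ F.0#
    x≉0 x≈0 with ≡.trans (≡.sym eq) (Equivalence.from (F.v-∞ x) x≈0)
    ... | ()

  -- ω = ε_{E/F}
  HasNormKernel : QuadraticCharacter → Set
  HasNormKernel ω =
    ∀ x → χ ω x ≡ Sign.+ ⇔ (∃ λ y → y E.≉ E.0# × E.Norm y F.≈ proj₁ x)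

  -- g is the matrix of the multiplication by γ in the basis {1, τ},
  -- its columns being the coordinates of γ·1 and γ·τ.
  Represents : SL2 → E.Carrier → Set
  Represents g γ =
    γ E.≈ E.ι (a g) E.+ E.ι (c g) E.* E.τ ×
    γ E.* E.τ E.≈ E.ι (b g) E.+ E.ι (d g) E.* E.τ

  record T : Set where
    field
      t          : SL2
      γ          : E.Carrier
      norm-one   : E.Norm γ F.≈ F.1#
      represents : Represents t γ

  record RegularT : Set where
    field
      elt  : T
    open T elt public
    field
      t≉I  : ¬ (t ≋ I)
      t≉-I : ¬ (t ≋ -I)

  RegularT-setoid : Setoid 0ℓ 0ℓ
  RegularT-setoid = On.setoid SL2-setoid RegularT.t

  -- T(F)\SL(2,F) with the quotient topology: subsets and functions are
  -- identified with T(F)-invariant ones on SL(2,F).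
  T\G-space : Space
  T\G-space = record
    { Point = SL2
    ; Open  = λ U → Space.Open G-space U × (∀ (s : T) x → U x ⇔ U (T.t s · x))
    }

  IsHaarF : Measure F-space → Set₁
  IsHaarF dn = ∀ x → InvariantUnder dn (x F.+_)

  IsHaarK : Measure K-space → Set₁
  IsHaarK dk = ∀ k → InvariantUnder dk (k ·ᴷ_)

  IsInvariantT\G : Measure T\G-space → Set₁
  IsInvariantT\G dx = ∀ g → InvariantUnder dx (_· g)

  -- 𝒪(t, f) exists and equals A.
  IsOrbitalIntegral : Measure T\G-space → RegularT → Cc∞ G-space ℂ-rawRing → ℂ → Set₁
  IsOrbitalIntegral dx s f A =
    HasIntegral dx (λ x → fun f (inv x · RegularT.t s · x)) A

  -- 𝒪^ω(ν, f) exists, as an iterated integral, and equals A.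
  IsUnipotentIntegral : Measure K-space → Measure F-space → QuadraticCharacter →
                        Cc∞ G-space ℂ-rawRing → ℂ → Set₁
  IsUnipotentIntegral dk dn ω f A =
    ∃ λ (J : K → ℂ) →
      (∀ k → HasIntegral dn
         (λ n → fromℝ (extend ω n) *ᶜ fun f (inv (K.g k) · unipotent n · K.g k)) (J k)) ×
      HasIntegral dk J A

  transferFactor : ℂ → QuadraticCharacter → RegularT → ℂ
  transferFactor l ε s =
    l *ᶜ fromℝ (extend ε (E.toF (δ E.* (E.τ E.- E.bar E.τ) E.⁻¹)) ℝ.* √ ∣ E.Norm δ ∣F)
    where
    δ : E.Carrier
    δ = RegularT.γ s E.- E.bar (RegularT.γ s)

{-# OPTIONS --safe #-}
-- Write τ² = s τ − n and let Q be the norm form x² + s x y + n y². If x ∈ SL(2,F)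
-- has columns z, w and Θ is the matrix of τ, then x⁻¹ Θ x has upper right entry
-- b = − Q(w) and upper left entry p, and x⁻¹ t x = a + c x⁻¹ Θ x for the torus
-- element t of a + c τ. Right invariance under the lower triangular matrices and
-- the Weyl element, which maps (p , b) to (s − p , Q(−p , 1) / b), forces the
-- measure of {p ∈ P^e , b ∈ b₀ (1 + P^m)} to be C q^(−e−m) for every b₀ ∈ − N(E^×),
-- as soon as κ is trivial on 1 + P^m; for other b₀ this set is empty.
--
-- A test function vanishing at 1 is, near the unipotent set, a combination of
-- indicator functions of balls centred at conjugates k⁻¹ u(n₀) k, k ∈ K. For such a
-- ball and t close to 1, 𝒪(t, ·) is the measure of one of the sets above, with
-- b₀ = n₀ / c, while 𝒪^χ(ν, ·) is χ(n₀) times a product of two volumes. As b₀ ∈ − N(E^×)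
-- is detected by (1 + κ(− c) κ(n₀)) / 2, the former is a combination of 𝒪^1 and 𝒪^κ
-- with coefficients proportional to |c|⁻¹ and κ(c) |c|⁻¹. An arbitrary f is reduced
-- to this case by subtracting f(1) times the indicator function of K.
module Submission where

open import Defs
open import Algebra.Bundles using (CommutativeRing; RawRing)
import Algebra.Definitions.RawSemiring as RawSemiringDefs
open import Algebra.Morphism.Structures using (module RingMorphisms)
import Algebra.Properties.CommutativeMonoid.Sum as SumProperties
import Algebra.Properties.Ring as RingProperties
import Algebra.Properties.Semiring.Mult.TCOptimised as MultOpt
import Algebra.Solver.Ring as RingSolver
import Algebra.Solver.Ring.AlmostCommutativeRing as ACR
open import Axiom.ExcludedMiddle using (ExcludedMiddle)
open import Data.Empty using (⊥; ⊥-elim)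
open import Data.Fin.Base using (Fin; zero; suc)
open import Data.Integer.Base as ℤ using (ℤ; +_; -[1+_]; 0ℤ; 1ℤ)
import Data.Integer.Properties as ℤ
import Data.Integer.Solver as ℤSolver
open import Data.List.Base as List using (List; []; _∷_; _++_)
open import Data.List.Membership.Propositional.Properties using (∈-allFin)
open import Data.List.Relation.Unary.All as All using (All; []; _∷_)
open import Data.List.Relation.Unary.Any using (Any; here; there)
import Data.List.Relation.Unary.Any.Properties as AnyP
open import Data.Maybe.Base using (Maybe; just; nothing)
open import Data.Nat.Base as ℕ using (ℕ; zero; suc)
import Data.Nat.Properties as ℕ
open import Data.Product.Base using (∃; ∃₂; _×_; _,_; proj₁; proj₂)
open import Data.Sign.Base as Sign using (Sign)
import Data.Sign.Properties as Sign
import Data.Sum.Base as Sum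
open import Data.Sum.Base using (_⊎_; inj₁; inj₂)
open import Data.Unit.Base using (⊤; tt)
open import Function.Bundles using (Func; _⇔_; mk⇔; module Equivalence)
open import Level using (0ℓ)
open import Relation.Binary.PropositionalEquality as ≡ using (_≡_)
import Relation.Binary.Reasoning.Setoid as SetoidReasoning
open import Relation.Nullary.Decidable.Core using (Dec; yes; no)
open import Relation.Nullary.Negation.Core using (¬_)
open import Relation.Unary using (Pred)

-- The measure `dx` is given only as a right invariant positive form, so each volume has to come
-- from invariance and from cutting a set into q translates. The pair (p , b) makes this possible:
-- it determines x⁻¹ Θ x, the lower left entry r being fixed by p (s - p) - b r = n, and since the
-- norm form is anisotropic, bounds on b and r bound x, so that boxes and orbital integrands have
-- compact support. The form Q is never diagonalised, so that characteristic 2 is treated like any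
-- other. The radius of a ball around u(n₀) must be small relative to v(n₀), by the conductor of κ,
-- for κ to be constant on it. A ball containing 1 is never small in this sense, which is why f(1)
-- is removed first. There χ, extended by 0, also fails to be locally constant: for the indicator
-- function of K the unipotent integral is a limit and not the integral of a test function. Γ₁ is
-- defined by requiring the expansion to be exact for that function. The constant c collects λ, κ(-
-- 1), the square root of |N(τ - bar τ)| and a ratio of volumes.

-- Ring and field identities.

module IntegerSolver (R : CommutativeRing 0ℓ 0ℓ) where
  open CommutativeRing R
  open RingProperties ring
  open MultOpt semiring renaming (_×_ to _⋆_)
  open SetoidReasoning setoid

  -- The canonical map from the integers serves as coefficient map of the solver: identities with
  -- signs are decided by integer arithmetic although equality in `R` is not decidable.
  ⟦_⟧ℤ : ℤ → Carrier
  ⟦ + n ⟧ℤ      = n ⋆ 1#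
  ⟦ -[1+ n ] ⟧ℤ = - (suc n ⋆ 1#)

  private
    suc-⋆ : ∀ n → suc n ⋆ 1# ≈ 1# + n ⋆ 1#
    suc-⋆ n = ×-homo-+ 1# 1 n

    -0≈0 : - 0# ≈ 0#
    -0≈0 = -0#≈0#

    neg-homo : ∀ i → ⟦ ℤ.- i ⟧ℤ ≈ - ⟦ i ⟧ℤ
    neg-homo (+ zero)   = sym -0≈0
    neg-homo (+ suc n)  = refl
    neg-homo -[1+ n ]   = sym (-‿involutive _)

    cancel : ∀ x y z → (x + y) - (x + z) ≈ y - z
    cancel x y z = begin
      (x + y) - (x + z)     ≈⟨ +-congˡ (-‿+-comm x z) ⟨
      (x + y) + (- x - z)   ≈⟨ +-congʳ (+-comm x y) ⟩
      (y + x) + (- x - z)   ≈⟨ +-assoc y x _ ⟩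
      y + (x + (- x - z))   ≈⟨ +-congˡ (+-assoc x (- x) (- z)) ⟨
      y + ((x - x) - z)     ≈⟨ +-congˡ (+-congʳ (-‿inverseʳ x)) ⟩
      y + (0# - z)          ≈⟨ +-congˡ (+-identityˡ _) ⟩
      y - z                 ∎

    ⊖-homo : ∀ m n → ⟦ m ℤ.⊖ n ⟧ℤ ≈ m ⋆ 1# - n ⋆ 1#
    ⊖-homo zero    zero    = trans (sym (+-identityˡ _)) (+-congˡ (sym -0≈0))
    ⊖-homo zero    (suc n) = sym (+-identityˡ _)
    ⊖-homo (suc m) zero    = sym (trans (+-congˡ -0≈0) (+-identityʳ _))
    ⊖-homo (suc m) (suc n) = begin
      ⟦ suc m ℤ.⊖ suc n ⟧ℤ                ≡⟨ ≡.cong ⟦_⟧ℤ (ℤ.[1+m]⊖[1+n]≡m⊖n m n) ⟩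
      ⟦ m ℤ.⊖ n ⟧ℤ                        ≈⟨ ⊖-homo m n ⟩
      m ⋆ 1# - n ⋆ 1#                     ≈⟨ cancel 1# _ _ ⟨
      (1# + m ⋆ 1#) - (1# + n ⋆ 1#)       ≈⟨ +-cong (suc-⋆ m) (-‿cong (suc-⋆ n)) ⟨
      suc m ⋆ 1# - suc n ⋆ 1#             ∎

    +-homo : ∀ i j → ⟦ i ℤ.+ j ⟧ℤ ≈ ⟦ i ⟧ℤ + ⟦ j ⟧ℤ
    +-homo (+ m)    (+ n)    = ×-homo-+ 1# m n
    +-homo (+ m)    -[1+ n ] = ⊖-homo m (suc n)
    +-homo -[1+ m ] (+ n)    = trans (⊖-homo n (suc m)) (+-comm _ _)
    +-homo -[1+ m ] -[1+ n ] = begin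
      - (suc (suc (m ℕ.+ n)) ⋆ 1#)         ≡⟨ ≡.cong (λ k → - (suc k ⋆ 1#)) (≡.sym (ℕ.+-suc m n)) ⟩
      - ((suc m ℕ.+ suc n) ⋆ 1#)           ≈⟨ -‿cong (×-homo-+ 1# (suc m) (suc n)) ⟩
      - (suc m ⋆ 1# + suc n ⋆ 1#)          ≈⟨ -‿+-comm _ _ ⟨
      - (suc m ⋆ 1#) + - (suc n ⋆ 1#)      ∎

    ◃⁺ : ∀ m → ⟦ Sign.+ ℤ.◃ m ⟧ℤ ≈ m ⋆ 1#
    ◃⁺ m = reflexive (≡.cong ⟦_⟧ℤ (ℤ.+◃n≡+n m))

    ◃⁻ : ∀ m → ⟦ Sign.- ℤ.◃ m ⟧ℤ ≈ - (m ⋆ 1#)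
    ◃⁻ m = trans (reflexive (≡.cong ⟦_⟧ℤ (ℤ.-◃n≡-n m))) (neg-homo (+ m))

    *-homo : ∀ i j → ⟦ i ℤ.* j ⟧ℤ ≈ ⟦ i ⟧ℤ * ⟦ j ⟧ℤ
    *-homo (+ m)    (+ n)    = trans (◃⁺ (m ℕ.* n)) (×1-homo-* m n)
    *-homo (+ m)    -[1+ n ] = begin
      ⟦ Sign.- ℤ.◃ (m ℕ.* suc n) ⟧ℤ     ≈⟨ ◃⁻ (m ℕ.* suc n) ⟩
      - ((m ℕ.* suc n) ⋆ 1#)              ≈⟨ -‿cong (×1-homo-* m (suc n)) ⟩
      - (m ⋆ 1# * suc n ⋆ 1#)             ≈⟨ -‿distribʳ-* _ _ ⟩
      m ⋆ 1# * - (suc n ⋆ 1#)             ∎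
    *-homo -[1+ m ] (+ n)    = begin
      ⟦ Sign.- ℤ.◃ (suc m ℕ.* n) ⟧ℤ     ≈⟨ ◃⁻ (suc m ℕ.* n) ⟩
      - ((suc m ℕ.* n) ⋆ 1#)              ≈⟨ -‿cong (×1-homo-* (suc m) n) ⟩
      - (suc m ⋆ 1# * n ⋆ 1#)             ≈⟨ -‿distribˡ-* _ _ ⟩
      - (suc m ⋆ 1#) * n ⋆ 1#             ∎
    *-homo -[1+ m ] -[1+ n ] = begin
      (suc m ℕ.* suc n) ⋆ 1#              ≈⟨ ×1-homo-* (suc m) (suc n) ⟩
      suc m ⋆ 1# * suc n ⋆ 1#             ≈⟨ -‿involutive _ ⟨
      - (- (suc m ⋆ 1# * suc n ⋆ 1#))     ≈⟨ -‿cong (-‿distribʳ-* _ _) ⟩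
      - (suc m ⋆ 1# * - (suc n ⋆ 1#))     ≈⟨ -‿distribˡ-* _ _ ⟩
      - (suc m ⋆ 1#) * - (suc n ⋆ 1#)     ∎

    ℤ-rawRing : RawRing 0ℓ 0ℓ
    ℤ-rawRing = record
      { Carrier = ℤ ; _≈_ = _≡_ ; _+_ = ℤ._+_ ; _*_ = ℤ._*_ ; -_ = ℤ.-_ ; 0# = 0ℤ ; 1# = 1ℤ }

    target : ACR.AlmostCommutativeRing 0ℓ 0ℓ
    target = ACR.fromCommutativeRing R

    homomorphism : ℤ-rawRing ACR.-Raw-AlmostCommutative⟶ target
    homomorphism = record
      { ⟦_⟧    = ⟦_⟧ℤ
      ; +-homo = +-homo
      ; *-homo = *-homo
      ; -‿homo = neg-homo
      ; 0-homo = refl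
      ; 1-homo = refl
      }

    coeff≟ : ∀ i j → Maybe (⟦ i ⟧ℤ ≈ ⟦ j ⟧ℤ)
    coeff≟ i j with i ℤ.≟ j
    ... | yes i≡j = just (reflexive (≡.cong ⟦_⟧ℤ i≡j))
    ... | no  _   = nothing

  open RingSolver ℤ-rawRing target homomorphism coeff≟ public
    using (solve; con; _:+_; _:*_; _:-_; :-_; _:=_)
  :1 : ∀ {n} → RingSolver.Polynomial ℤ-rawRing target homomorphism coeff≟ n
  :1 = con 1ℤ
  :0 : ∀ {n} → RingSolver.Polynomial ℤ-rawRing target homomorphism coeff≟ n
  :0 = con 0ℤ

module FieldLemmas (K : Field) where
  open Field K
  open IntegerSolver commutativeRing public
  open SetoidReasoning setoid

  *-inverseˡ : ∀ {x} → x ≉ 0# → x ⁻¹ * x ≈ 1#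
  *-inverseˡ x≉0 = trans (*-comm _ _) (*-inverse x≉0)

  ≉-resp : ∀ {x y} → x ≈ y → x ≉ 0# → y ≉ 0#
  ≉-resp x≈y x≉0 y≈0 = x≉0 (trans x≈y y≈0)

  *-cancelˡ : ∀ {x y z} → x ≉ 0# → x * y ≈ x * z → y ≈ z
  *-cancelˡ {x} {y} {z} x≉0 eq = begin
    y               ≈⟨ *-identityˡ y ⟨
    1# * y          ≈⟨ *-congʳ (*-inverseˡ x≉0) ⟨
    (x ⁻¹ * x) * y  ≈⟨ *-assoc _ _ _ ⟩
    x ⁻¹ * (x * y)  ≈⟨ *-congˡ eq ⟩
    x ⁻¹ * (x * z)  ≈⟨ *-assoc _ _ _ ⟨
    (x ⁻¹ * x) * z  ≈⟨ *-congʳ (*-inverseˡ x≉0) ⟩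
    1# * z          ≈⟨ *-identityˡ z ⟩
    z               ∎

  *-zero-cancel : ∀ {x y} → x ≉ 0# → x * y ≈ 0# → y ≈ 0#
  *-zero-cancel x≉0 eq = *-cancelˡ x≉0 (trans eq (sym (zeroʳ _)))

  *-≉0 : ∀ {x y} → x ≉ 0# → y ≉ 0# → x * y ≉ 0#
  *-≉0 x≉0 y≉0 eq = y≉0 (*-zero-cancel x≉0 eq)

  ⁻¹-≉0 : ∀ {x} → x ≉ 0# → x ⁻¹ ≉ 0#
  ⁻¹-≉0 x≉0 eq = 1≉0 (trans (sym (*-inverse x≉0)) (trans (*-congˡ eq) (zeroʳ _)))

  ⁻¹-unique : ∀ {x y} → x ≉ 0# → x * y ≈ 1# → y ≈ x ⁻¹
  ⁻¹-unique x≉0 eq = *-cancelˡ x≉0 (trans eq (sym (*-inverse x≉0)))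

  -‿≉0 : ∀ {x} → x ≉ 0# → - x ≉ 0#
  -‿≉0 {x} x≉0 eq = x≉0 (begin
    x         ≈⟨ solve 1 (λ x → x := :- (:- x)) refl x ⟩
    - (- x)   ≈⟨ -‿cong eq ⟩
    - 0#      ≈⟨ solve 0 (:- :0 := :0) refl ⟩
    0#        ∎)

  x-y≈0⇒x≈y : ∀ {x y} → x - y ≈ 0# → x ≈ y
  x-y≈0⇒x≈y {x} {y} eq = begin
    x            ≈⟨ solve 2 (λ x y → x := (x :- y) :+ y) refl x y ⟩
    (x - y) + y  ≈⟨ +-congʳ eq ⟩
    0# + y       ≈⟨ +-identityˡ y ⟩
    y            ∎

  x≈y⇒x-y≈0 : ∀ {x y} → x ≈ y → x - y ≈ 0#
  x≈y⇒x-y≈0 {x} {y} eq = trans (+-congʳ eq) (-‿inverseʳ y)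

-- Integers, valuations and digits.

module ℤS = ℤSolver.+-*-Solver
module ℤR = RingProperties ℤ.+-*-ring

-- Inequalities between valuations are reduced to known ones by exhibiting equal differences, and
-- the equality of differences is a ring identity.
≤-by : ∀ {a b c d} → c ℤ.≤ d → b ℤ.- a ≡ d ℤ.- c → a ℤ.≤ b
≤-by c≤d eq = ℤ.0≤i-j⇒j≤i (≡.subst (0ℤ ℤ.≤_) (≡.sym eq) (ℤ.i≤j⇒0≤j-i c≤d))

≤-by₂ : ∀ {a b c d e f} → c ℤ.≤ d → e ℤ.≤ f → b ℤ.- a ≡ (d ℤ.- c) ℤ.+ (f ℤ.- e) → a ℤ.≤ b
≤-by₂ c≤d e≤f eq = ℤ.0≤i-j⇒j≤i
  (≡.subst (0ℤ ℤ.≤_) (≡.sym eq) (ℤ.+-mono-≤ (ℤ.i≤j⇒0≤j-i c≤d) (ℤ.i≤j⇒0≤j-i e≤f)))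

≤-split : ∀ i j → i ℤ.+ 1ℤ ℤ.≤ j ⊎ j ℤ.≤ i
≤-split i j with j ℤ.≤? i
... | yes j≤i = inj₂ j≤i
... | no  j≰i = inj₁ (≡.subst (ℤ._≤ j) (ℤ.+-comm 1ℤ i) (ℤ.i<j⇒suc[i]≤j (ℤ.≰⇒> j≰i)))

i+1≰i : ∀ {i} → ¬ (i ℤ.+ 1ℤ ℤ.≤ i)
i+1≰i {i} p with ≤-by {1ℤ} {0ℤ} p (solve 1 (λ i → con 0ℤ :- con 1ℤ := i :- (i :+ con 1ℤ)) ≡.refl i)
  where open ℤS
... | ℤ.+≤+ ()

i≤i+1 : ∀ i → i ℤ.≤ i ℤ.+ 1ℤ
i≤i+1 i = ≤-by {c = 0ℤ} {1ℤ} (ℤ.+≤+ ℕ.z≤n)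
  (solve 1 (λ i → (i :+ con 1ℤ) :- i := con 1ℤ :- con 0ℤ) ≡.refl i)
  where open ℤS

i+i≡0⇒i≡0 : ∀ {i} → i ℤ.+ i ≡ 0ℤ → i ≡ 0ℤ
i+i≡0⇒i≡0 {+ zero} _ = ≡.refl

fin-injective : ∀ {m n} → fin m ≡ fin n → m ≡ n
fin-injective ≡.refl = ≡.refl

≼-mono : ∀ {m n} k → m ℤ.≤ n → n ≼ k → m ≼ k
≼-mono (fin k) m≤n n≤k = ℤ.≤-trans m≤n n≤k
≼-mono ∞       m≤n n≤k = tt

⊕-mono-≼ : ∀ m n k l → m ≼ k → n ≼ l → m ℤ.+ n ≼ k ⊕ l
⊕-mono-≼ m n (fin k) (fin l) p r = ℤ.+-mono-≤ p r
⊕-mono-≼ m n (fin k) ∞       p r = tt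
⊕-mono-≼ m n ∞       l       p r = tt

module Valuation (F : LocalField) where
  open LocalField F hiding (zero)
  open FieldLemmas isField public
  open SetoidReasoning setoid

  -- The fractional ideal of order n. All estimates over F are congruences modulo these ideals.
  P : ℤ → Carrier → Set
  P n x = n ≼ v x

  P-resp : ∀ {n x y} → x ≈ y → P n x → P n y
  P-resp {n} x≈y = ≡.subst (n ≼_) (v-cong x≈y)

  P-mono : ∀ {m n x} → m ℤ.≤ n → P n x → P m x
  P-mono {x = x} = ≼-mono (v x)

  P-0 : ∀ n → P n 0#
  P-0 n = ≡.subst (n ≼_) (≡.sym (Equivalence.from (v-∞ 0#) refl)) tt

  P-≈0 : ∀ {n x} → x ≈ 0# → P n x
  P-≈0 {n} x≈0 = P-resp (sym x≈0) (P-0 n)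

  P-+ : ∀ {n x y} → P n x → P n y → P n (x + y)
  P-+ {n} {x} {y} = v-+ n x y

  P-* : ∀ {m n x y} → P m x → P n y → P (m ℤ.+ n) (x * y)
  P-* {m} {n} {x} {y} p r =
    ≡.subst (m ℤ.+ n ≼_) (≡.sym (v-* x y)) (⊕-mono-≼ m n (v x) (v y) p r)

  val-exists : ∀ {x} → x ≉ 0# → ∃ λ k → v x ≡ fin k
  val-exists {x} x≉0 with v x in eq
  ... | fin k = k , ≡.refl
  ... | ∞     = ⊥-elim (x≉0 (Equivalence.to (v-∞ x) eq))

  val⇒≉0 : ∀ {x k} → v x ≡ fin k → x ≉ 0#
  val⇒≉0 {x} eq x≈0 with ≡.trans (≡.sym eq) (Equivalence.from (v-∞ x) x≈0)
  ... | ()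

  val-resp : ∀ {x y k} → x ≈ y → v x ≡ fin k → v y ≡ fin k
  val-resp x≈y eq = ≡.trans (≡.sym (v-cong x≈y)) eq

  val-* : ∀ {x y k l} → v x ≡ fin k → v y ≡ fin l → v (x * y) ≡ fin (k ℤ.+ l)
  val-* {x} {y} p r = ≡.trans (v-* x y) (≡.cong₂ _⊕_ p r)

  val⇒P : ∀ {x k} → v x ≡ fin k → P k x
  val⇒P eq = ≡.subst (_ ≼_) (≡.sym eq) ℤ.≤-refl

  P-val : ∀ {n x k} → v x ≡ fin k → P n x → n ℤ.≤ k
  P-val eq p = ≡.subst (_ ≼_) eq p

  private
    -- The valuation of 1 equals its own double, hence is 0; then twice the valuation of x is 0. It
    -- is wanted for x = 1 and x = - 1.
    v1 : ∀ {x} → x * x ≈ 1# → v x ≡ fin 0ℤ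
    v1 {x} eq with val-exists {x} (λ x≈0 → 1≉0 (trans (sym eq) (trans (*-congʳ x≈0) (zeroˡ _))))
                 | val-exists 1≉0
    ... | k , vx | l , v₁ = ≡.trans vx (≡.cong fin k≡0)
      where
      l≡0 : l ≡ 0ℤ
      l≡0 = ℤR.+-cancelˡ l _ _ (≡.trans (fin-injective (≡.trans (≡.sym (val-* v₁ v₁))
        (val-resp (sym (*-identityˡ 1#)) v₁))) (≡.sym (ℤ.+-identityʳ l)))
      2k≡0 : k ℤ.+ k ≡ 0ℤ
      2k≡0 = fin-injective (≡.trans (≡.sym (val-* vx vx)) (≡.trans (v-cong eq) (≡.trans v₁ (≡.cong fin l≡0))))
      k≡0 : k ≡ 0ℤ
      k≡0 = i+i≡0⇒i≡0 2k≡0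

  val-1 : v 1# ≡ fin 0ℤ
  val-1 = v1 (*-identityˡ 1#)

  val-neg : ∀ {x k} → v x ≡ fin k → v (- x) ≡ fin k
  val-neg {x} {k} eq = ≡.trans (v-cong (solve 1 (λ x → :- x := (:- :1) :* x) refl x))
    (≡.trans (val-* (v1 (solve 0 ((:- :1) :* (:- :1) := :1) refl)) eq) (≡.cong fin (ℤ.+-identityˡ k)))

  P-neg : ∀ {n x} → P n x → P n (- x)
  P-neg {n} {x} p = P-resp (solve 1 (λ x → (:- :1) :* x := :- x) refl x)
    (≡.subst (λ k → P k (- 1# * x)) (ℤ.+-identityˡ n) (P-* (val⇒P (val-neg val-1)) p))

  P-- : ∀ {n x y} → P n x → P n y → P n (x - y)
  P-- p r = P-+ p (P-neg r)

  P-swap : ∀ {n x y} → P n (x - y) → P n (y - x)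
  P-swap {x = x} {y} p = P-resp (solve 2 (λ x y → :- (x :- y) := y :- x) refl x y) (P-neg p)

  P-trans : ∀ {n x y z} → P n (x - y) → P n (y - z) → P n (x - z)
  P-trans {x = x} {y} {z} p r =
    P-resp (solve 3 (λ x y z → (x :- y) :+ (y :- z) := x :- z) refl x y z) (P-+ p r)

  P-1 : P 0ℤ 1#
  P-1 = val⇒P val-1

  P-cast : ∀ {m n x} → m ≡ n → P m x → P n x
  P-cast ≡.refl p = p

  P-*ˡ : ∀ {n x y} → P 0ℤ x → P n y → P n (x * y)
  P-*ˡ p r = P-cast (ℤ.+-identityˡ _) (P-* p r)

  P-*ʳ : ∀ {n x y} → P n x → P 0ℤ y → P n (x * y)
  P-*ʳ p r = P-cast (ℤ.+-identityʳ _) (P-* p r)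

  val-⁻¹ : ∀ {x k} → v x ≡ fin k → v (x ⁻¹) ≡ fin (ℤ.- k)
  val-⁻¹ {x} {k} eq with val-exists (⁻¹-≉0 (val⇒≉0 eq))
  ... | l , vl = ≡.trans vl (≡.cong fin (ℤR.+-cancelˡ k _ _ (≡.trans k+l≡0 (≡.sym (ℤ.+-inverseʳ k)))))
    where
    k+l≡0 : k ℤ.+ l ≡ 0ℤ
    k+l≡0 = fin-injective (≡.trans (≡.sym (val-* eq vl)) (≡.trans (v-cong (*-inverse (val⇒≉0 eq))) val-1))

  P-cancel : ∀ {n x y k} → v x ≡ fin k → P (k ℤ.+ n) (x * y) → P n y
  P-cancel {n} {x} {y} {k} eq p = P-resp cancel (P-cast arith (P-* (val⇒P (val-⁻¹ eq)) p))
    where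
    cancel : x ⁻¹ * (x * y) ≈ y
    cancel = trans (sym (*-assoc _ _ _)) (trans (*-congʳ (*-inverseˡ (val⇒≉0 eq))) (*-identityˡ y))
    arith : ℤ.- k ℤ.+ (k ℤ.+ n) ≡ n
    arith = ℤS.solve 2 (λ k n → ℤS.:- k ℤS.:+ (k ℤS.:+ n) ℤS.:= n) ≡.refl k n

  val-from : ∀ {x k} → P k x → ¬ P (k ℤ.+ 1ℤ) x → v x ≡ fin k
  val-from {x} {k} p ¬p with v x
  ... | ∞     = ⊥-elim (¬p tt)
  ... | fin l with ≤-split k l
  ...   | inj₁ k+1≤l = ⊥-elim (¬p k+1≤l)
  ...   | inj₂ l≤k   = ≡.cong fin (ℤ.≤-antisym l≤k p)

  val-+ : ∀ {x y k m} → v x ≡ fin k → P m y → k ℤ.+ 1ℤ ℤ.≤ m → v (x + y) ≡ fin k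
  val-+ {x} {y} {k} eq p k<m = val-from (P-+ (val⇒P eq) (P-mono (i≤i+1 k) p′))
    (λ r → i+1≰i (P-val eq (P-resp (solve 2 (λ x y → (x :+ y) :- y := x) refl x y) (P-- r p′))))
    where
    p′ : P (k ℤ.+ 1ℤ) y
    p′ = P-mono k<m p

  val-near : ∀ {x y k m} → v x ≡ fin k → P m (x - y) → k ℤ.+ 1ℤ ℤ.≤ m → v y ≡ fin k
  val-near {x} {y} eq p k<m =
    val-resp (solve 2 (λ x y → x :+ (y :- x) := y) refl x y) (val-+ eq (P-swap p) k<m)

  ϖ^ : ℕ → Carrier
  ϖ^ zero    = 1#
  ϖ^ (suc n) = ϖ * ϖ^ n

  ϖᶻ : ℤ → Carrier
  ϖᶻ (+ n)      = ϖ^ n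
  ϖᶻ (-[1+ n ]) = (ϖ^ (suc n)) ⁻¹

  val-ϖ^ : ∀ n → v (ϖ^ n) ≡ fin (+ n)
  val-ϖ^ zero    = val-1
  val-ϖ^ (suc n) = val-* v-ϖ (val-ϖ^ n)

  val-ϖᶻ : ∀ k → v (ϖᶻ k) ≡ fin k
  val-ϖᶻ (+ n)      = val-ϖ^ n
  val-ϖᶻ (-[1+ n ]) = val-⁻¹ (val-ϖ^ (suc n))

  -- Representatives of the quotient of `P k` by `P (k + 1)`. Every subdivision below is indexed by
  -- these q elements.
  digit : ℤ → Fin q → Carrier
  digit k j = ϖᶻ k * residue j

  P-digit : ∀ k j → P k (digit k j)
  P-digit k j = P-*ʳ (val⇒P (val-ϖᶻ k)) (residue-integral j)

  digit-exists : ∀ {k x} → P k x → ∃ λ j → P (k ℤ.+ 1ℤ) (x - digit k j)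
  digit-exists {k} {x} p with residue-surjective (ϖᶻ k ⁻¹ * x) y∈O
    where
    y∈O : P 0ℤ (ϖᶻ k ⁻¹ * x)
    y∈O = P-cast (ℤ.+-inverseˡ k) (P-* (val⇒P (val-⁻¹ (val-ϖᶻ k))) p)
  ... | j , r = j , P-resp eq (P-* (val⇒P (val-ϖᶻ k)) r)
    where
    eq : ϖᶻ k * (ϖᶻ k ⁻¹ * x - residue j) ≈ x - digit k j
    eq = begin
      ϖᶻ k * (ϖᶻ k ⁻¹ * x - residue j)      ≈⟨ solve 4 (λ w w′ x r → w :* (w′ :* x :- r) := (w :* w′) :* x :- w :* r) refl (ϖᶻ k) (ϖᶻ k ⁻¹) x (residue j) ⟩
      ϖᶻ k * ϖᶻ k ⁻¹ * x - digit k j         ≈⟨ +-congʳ (*-congʳ (*-inverse (val⇒≉0 (val-ϖᶻ k)))) ⟩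
      1# * x - digit k j                     ≈⟨ +-congʳ (*-identityˡ x) ⟩
      x - digit k j                          ∎

  digit-injective : ∀ {k i j} → P (k ℤ.+ 1ℤ) (digit k i - digit k j) → i ≡ j
  digit-injective {k} {i} {j} p = residue-injective i j (P-cancel (val-ϖᶻ k)
    (P-resp (solve 3 (λ w r r′ → w :* r :- w :* r′ := w :* (r :- r′)) refl (ϖᶻ k) (residue i) (residue j)) p))

  digit-unique : ∀ {k i j x} → P (k ℤ.+ 1ℤ) (x - digit k i) → P (k ℤ.+ 1ℤ) (x - digit k j) → i ≡ j
  digit-unique {k} p r = digit-injective {k} (P-trans (P-swap p) r)

  abstract
    -- 0 and 1 are incongruent modulo the maximal ideal. The bound makes the powers q^(-n) tend to
    -- 0.
    2≤q : 2 ℕ.≤ q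
    2≤q = two (proj₁ r₀) (proj₁ r₁) distinct
      where
      two : ∀ {n} (i j : Fin n) → ¬ (i ≡ j) → 2 ℕ.≤ n
      two {suc zero}    zero zero i≢j = ⊥-elim (i≢j ≡.refl)
      two {suc (suc n)} _    _    _   = ℕ.s≤s (ℕ.s≤s ℕ.z≤n)
      r₀ : ∃ λ i → P 1ℤ (0# - residue i)
      r₀ = residue-surjective 0# (P-0 0ℤ)
      r₁ : ∃ λ i → P 1ℤ (1# - residue i)
      r₁ = residue-surjective 1# P-1
      distinct : ¬ (proj₁ r₀ ≡ proj₁ r₁)
      distinct eq = i+1≰i (P-val val-1 (P-resp (solve 1 (λ x → (:1 :- x) :- (:0 :- x) := :1) refl (residue (proj₁ r₁)))
        (P-- (proj₂ r₁) (≡.subst (λ i → P 1ℤ (0# - residue i)) eq (proj₂ r₀)))))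

-- Real numbers: order, square roots, powers of q.

module RealLemmas (em : ExcludedMiddle 0ℓ) (ℝ : RealField) where
  open RealField ℝ hiding (zero)
  open RealOps ℝ
  open FieldLemmas isField public
  open SetoidReasoning setoid
  open SumProperties +-commutativeMonoid public using (sum)
  open SumProperties +-commutativeMonoid using (sum-cong-≋)
  open RawSemiringDefs (RawRing.rawSemiring rawRing) public using (_^_) renaming (_×_ to _⋆_)

  ≤-resp : ∀ {x x′ y y′} → x ≈ x′ → y ≈ y′ → x ≤ y → x′ ≤ y′
  ≤-resp p q r = ≤.trans (≤.reflexive (sym p)) (≤.trans r (≤.reflexive q))

  ≤-respˡ : ∀ {x x′ y} → x ≈ x′ → x ≤ y → x′ ≤ y
  ≤-respˡ p = ≤-resp p refl

  ≤-respʳ : ∀ {x y y′} → y ≈ y′ → x ≤ y → x ≤ y′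
  ≤-respʳ = ≤-resp refl

  x≤y⇒0≤y-x : ∀ {x y} → x ≤ y → 0# ≤ y - x
  x≤y⇒0≤y-x {x} p = ≤-resp (-‿inverseʳ x) refl (+-monoˡ-≤ (- x) p)

  0≤y-x⇒x≤y : ∀ {x y} → 0# ≤ y - x → x ≤ y
  0≤y-x⇒x≤y {x} {y} p = ≤-resp (+-identityˡ x) (solve 2 (λ x y → (y :- x) :+ x := y) refl x y) (+-monoˡ-≤ x p)

  neg-mono-≤ : ∀ {x y} → x ≤ y → - y ≤ - x
  neg-mono-≤ {x} {y} p = 0≤y-x⇒x≤y (≤-respʳ (solve 2 (λ x y → y :- x := :- x :- (:- y)) refl x y) (x≤y⇒0≤y-x p))

  x≤0⇒0≤-x : ∀ {x} → x ≤ 0# → 0# ≤ - x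
  x≤0⇒0≤-x p = ≤-respˡ (solve 0 (:- :0 := :0) refl) (neg-mono-≤ p)

  +-mono-≤ : ∀ {x y z w} → x ≤ y → z ≤ w → x + z ≤ y + w
  +-mono-≤ {x} {y} {z} {w} p q =
    ≤.trans (+-monoˡ-≤ z p) (≤-resp (+-comm z y) (+-comm w y) (+-monoˡ-≤ y q))

  *-monoˡ-≤ : ∀ {x y z} → 0# ≤ z → x ≤ y → z * x ≤ z * y
  *-monoˡ-≤ {x} {y} {z} 0≤z p = 0≤y-x⇒x≤y
    (≤-respʳ (solve 3 (λ x y z → z :* (y :- x) := z :* y :- z :* x) refl x y z) (*-nonneg 0≤z (x≤y⇒0≤y-x p)))

  *-mono-≤ : ∀ {x y z w} → 0# ≤ x → 0# ≤ w → x ≤ y → z ≤ w → x * z ≤ y * w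
  *-mono-≤ {x} {y} {z} {w} 0≤x 0≤w p q =
    ≤.trans (*-monoˡ-≤ 0≤x q) (≤-resp (*-comm w x) (*-comm w y) (*-monoˡ-≤ 0≤w p))

  0≤x² : ∀ x → 0# ≤ x * x
  0≤x² x with ≤.total 0# x
  ... | inj₁ p = *-nonneg p p
  ... | inj₂ p = ≤-respʳ (solve 1 (λ x → (:- x) :* (:- x) := x :* x) refl x) (*-nonneg (x≤0⇒0≤-x p) (x≤0⇒0≤-x p))

  0≤1 : 0# ≤ 1#
  0≤1 = ≤-respʳ (*-identityˡ 1#) (0≤x² 1#)

  1≰0 : ¬ (1# ≤ 0#)
  1≰0 p = 1≉0 (≤.antisym p 0≤1)

  ≥1⇒≉0 : ∀ {x} → 1# ≤ x → x ≉ 0#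
  ≥1⇒≉0 p x≈0 = 1≰0 (≤-respʳ x≈0 p)

  0≤⁻¹ : ∀ {x} → 0# ≤ x → 0# ≤ x ⁻¹
  0≤⁻¹ {x} 0≤x with em {x ≈ 0#}
  ... | yes x≈0 = ≤.reflexive (sym (trans (⁻¹-cong x≈0) 0⁻¹))
  ... | no  x≉0 = ≤-respʳ
    (begin
      x * (x ⁻¹ * x ⁻¹)  ≈⟨ *-assoc _ _ _ ⟨
      (x * x ⁻¹) * x ⁻¹  ≈⟨ *-congʳ (*-inverse x≉0) ⟩
      1# * x ⁻¹          ≈⟨ *-identityˡ _ ⟩
      x ⁻¹               ∎)
    (*-nonneg 0≤x (0≤x² (x ⁻¹)))

  x²+y²≈0⇒x≈0 : ∀ {x y} → x * x + y * y ≈ 0# → x ≈ 0#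
  x²+y²≈0⇒x≈0 {x} {y} eq with em {x ≈ 0#}
  ... | yes x≈0 = x≈0
  ... | no  x≉0 = ⊥-elim (*-≉0 x≉0 x≉0 (≤.antisym
    (≤-resp (+-identityʳ _) eq (+-mono-≤ (≤.refl {x * x}) (0≤x² y))) (0≤x² x)))

  ∣∣-≤ : ∀ {x e} → x ≤ e → - x ≤ e → ∣ x ∣ ≤ e
  ∣∣-≤ {x} p q with ≤.total 0# x
  ... | inj₁ _ = p
  ... | inj₂ _ = q

  ∣∣-nonneg : ∀ x → 0# ≤ ∣ x ∣
  ∣∣-nonneg x with ≤.total 0# x
  ... | inj₁ p = p
  ... | inj₂ p = x≤0⇒0≤-x p

  x≤∣x∣ : ∀ x → x ≤ ∣ x ∣
  x≤∣x∣ x with ≤.total 0# x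
  ... | inj₁ p = ≤.refl
  ... | inj₂ p = ≤.trans p (x≤0⇒0≤-x p)

  -x≤∣x∣ : ∀ x → - x ≤ ∣ x ∣
  -x≤∣x∣ x with ≤.total 0# x
  ... | inj₁ p = ≤.trans (≤-respʳ (solve 0 (:- :0 := :0) refl) (neg-mono-≤ p)) p
  ... | inj₂ p = ≤.refl

  0≤n⋆1 : ∀ n → 0# ≤ n ⋆ 1#
  0≤n⋆1 zero    = ≤.refl
  0≤n⋆1 (suc n) = ≤-respˡ (+-identityˡ 0#) (+-mono-≤ 0≤1 (0≤n⋆1 n))

  ⋆1-mono : ∀ {m n} → m ℕ.≤ n → m ⋆ 1# ≤ n ⋆ 1#
  ⋆1-mono {n = n} ℕ.z≤n = 0≤n⋆1 n
  ⋆1-mono (ℕ.s≤s p)     = +-mono-≤ ≤.refl (⋆1-mono p)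

  -- Otherwise the natural numbers have a supremum s, and s - 1 is still an upper bound because n +
  -- 1 ≤ s for every n.
  archimedean : ∀ x → ∃ λ n → x ≤ n ⋆ 1#
  archimedean x with em {∃ λ n → x ≤ n ⋆ 1#}
  ... | yes p = p
  ... | no ¬p = ⊥-elim (1≰0 (≤-resp (solve 1 (λ s → (s :- (s :- :1)) := :1) refl s)
                                 (solve 1 (λ s → ((s :- :1) :- (s :- :1)) := :0) refl s)
                                 (+-monoˡ-≤ (- (s - 1#)) (least (s - 1#) s-1-bound))))
    where
    S : Pred Carrier 0ℓ
    S y = ∃ λ n → y ≤ n ⋆ 1#
    x-bound : UpperBound S x
    x-bound y (n , y≤n) with ≤.total y x
    ... | inj₁ y≤x = y≤x
    ... | inj₂ x≤y = ⊥-elim (¬p (n , ≤.trans x≤y y≤n))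
    sup : ∃ (LeastUpperBound S)
    sup = supremum S (0# , 0 , ≤.refl) (x , x-bound)
    s : Carrier
    s = proj₁ sup
    least = proj₂ (proj₂ sup)
    s-1-bound : UpperBound S (s - 1#)
    s-1-bound y (n , y≤n) = ≤.trans y≤n (≤-resp (solve 1 (λ x → (:1 :+ x) :- :1 := x) refl (n ⋆ 1#)) refl
      (+-monoˡ-≤ (- 1#) (proj₁ (proj₂ sup) (suc n ⋆ 1#) (suc n , ≤.refl))))

  √-isLUB : ∀ x → LeastUpperBound (BelowRoot x) (√ x)
  √-isLUB x = proj₂ (supremum (BelowRoot x) (0# , inj₁ ≤.refl) (belowRoot-bounded x))

  private
    cancel⁻¹ : ∀ {α} → α ≉ 0# → ∀ y → α * (α ⁻¹ * y) ≈ y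
    cancel⁻¹ α≉0 y = trans (sym (*-assoc _ _ _)) (trans (*-congʳ (*-inverse α≉0)) (*-identityˡ y))

    √-scale-≤ : ∀ {α x} → 0# ≤ α → α ≉ 0# → √ (α * α * x) ≤ α * √ x
    √-scale-≤ {α} {x} 0≤α α≉0 = proj₂ (√-isLUB (α * α * x)) _ bound
      where
      bound : UpperBound (BelowRoot (α * α * x)) (α * √ x)
      bound y y∈ = ≤-resp (cancel⁻¹ α≉0 y) refl (*-monoˡ-≤ 0≤α (proj₁ (√-isLUB x) (α ⁻¹ * y) (y′∈ y∈)))
        where
        y′∈ : BelowRoot (α * α * x) y → BelowRoot x (α ⁻¹ * y)
        y′∈ (inj₁ y≤0)  = inj₁ (≤-respʳ (zeroʳ _) (*-monoˡ-≤ (0≤⁻¹ 0≤α) y≤0))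
        y′∈ (inj₂ yy≤x) = inj₂ (≤-resp
          (solve 2 (λ a y → a :* a :* (y :* y) := (a :* y) :* (a :* y)) refl (α ⁻¹) y)
          (begin
            α ⁻¹ * α ⁻¹ * (α * α * x)        ≈⟨ solve 3 (λ a a′ x → a′ :* a′ :* (a :* a :* x) := (a :* a′) :* ((a :* a′) :* x)) refl α (α ⁻¹) x ⟩
            (α * α ⁻¹) * ((α * α ⁻¹) * x)    ≈⟨ *-cong (*-inverse α≉0) (*-congʳ (*-inverse α≉0)) ⟩
            1# * (1# * x)                    ≈⟨ solve 1 (λ x → :1 :* (:1 :* x) := x) refl x ⟩
            x                                ∎)
          (*-monoˡ-≤ (0≤x² (α ⁻¹)) yy≤x))

  √-cong : ∀ {x y} → x ≈ y → √ x ≈ √ y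
  √-cong x≈y = ≤.antisym (half x≈y) (half (sym x≈y))
    where
    half : ∀ {x y} → x ≈ y → √ x ≤ √ y
    half {x} {y} x≈y = proj₂ (√-isLUB x) _ λ where
      z (inj₁ p) → proj₁ (√-isLUB y) z (inj₁ p)
      z (inj₂ p) → proj₁ (√-isLUB y) z (inj₂ (≤-respʳ x≈y p))

  -- Comparing suprema gives one inequality for every positive scalar; the reverse one is the same
  -- inequality for α⁻¹.
  √-scale : ∀ {α x} → 0# ≤ α → α ≉ 0# → √ (α * α * x) ≈ α * √ x
  √-scale {α} {x} 0≤α α≉0 = ≤.antisym (√-scale-≤ 0≤α α≉0)
    (≤-respʳ (cancel⁻¹ α≉0 _) (*-monoˡ-≤ 0≤α (≤-respˡ (√-cong eq) (√-scale-≤ (0≤⁻¹ 0≤α) (⁻¹-≉0 α≉0)))))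
    where
    eq : α ⁻¹ * α ⁻¹ * (α * α * x) ≈ x
    eq = begin
      α ⁻¹ * α ⁻¹ * (α * α * x)        ≈⟨ solve 3 (λ a a′ x → a′ :* a′ :* (a :* a :* x) := a :* (a′ :* (a :* (a′ :* x)))) refl α (α ⁻¹) x ⟩
      α * (α ⁻¹ * (α * (α ⁻¹ * x)))    ≈⟨ cancel⁻¹ α≉0 _ ⟩
      α * (α ⁻¹ * x)                   ≈⟨ cancel⁻¹ α≉0 _ ⟩
      x                                ∎

  -- If 1 ≤ x then 1 is below the root; if x ≤ 1 then x itself is, since x² ≤ x.
  √-≉0 : ∀ {x} → 0# ≤ x → x ≉ 0# → √ x ≉ 0#
  √-≉0 {x} 0≤x x≉0 √x≈0 with ≤.total 1# x
  ... | inj₁ 1≤x = 1≰0 (≤-respʳ √x≈0 (proj₁ (√-isLUB x) 1# (inj₂ (≤-respˡ (sym (*-identityˡ 1#)) 1≤x))))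
  ... | inj₂ x≤1 = x≉0 (≤.antisym
    (≤-respʳ √x≈0 (proj₁ (√-isLUB x) x (inj₂ (≤-respʳ (*-identityʳ x) (*-monoˡ-≤ 0≤x x≤1))))) 0≤x)

  sum-cong : ∀ {n} {f g : Fin n → Carrier} → (∀ i → f i ≈ g i) → sum f ≈ sum g
  sum-cong = sum-cong-≋

  sum-zero : ∀ {n} {f : Fin n → Carrier} → (∀ i → f i ≈ 0#) → sum f ≈ 0#
  sum-zero {zero}  _  = refl
  sum-zero {suc n} f≈0 = trans (+-cong (f≈0 zero) (sum-zero (λ i → f≈0 (suc i)))) (+-identityˡ 0#)

  sum-single : ∀ {n} {f : Fin n → Carrier} (j : Fin n) → (∀ i → ¬ (i ≡ j) → f i ≈ 0#) → sum f ≈ f j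
  sum-single {suc n} zero    z = trans (+-congˡ (sum-zero (λ i → z (suc i) λ ()))) (+-identityʳ _)
  sum-single {suc n} (suc j) z = trans (+-cong (z zero λ ()) (sum-single j (λ i i≢j → z (suc i) λ where ≡.refl → i≢j ≡.refl)))
    (+-identityˡ _)

  sum-const : ∀ {n} {f : Fin n → Carrier} {x} → (∀ i → f i ≈ x) → sum f ≈ n ⋆ 1# * x
  sum-const {zero}  _   = sym (zeroˡ _)
  sum-const {suc n} {x = x} f≈x = trans (+-cong (trans (f≈x zero) (sym (*-identityˡ x))) (sum-const (λ i → f≈x (suc i))))
    (sym (distribʳ x 1# (n ⋆ 1#)))

  -- qp k = q^(-k)
  module Powers (q : ℕ) (2≤q : 2 ℕ.≤ q) where
    Q : Carrier
    Q = q ⋆ 1#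

    2≤Q : 1# + 1# ≤ Q
    2≤Q = ≤-respˡ (+-congˡ (+-identityʳ 1#)) (⋆1-mono 2≤q)

    1≤Q : 1# ≤ Q
    1≤Q = ≤.trans (≤-respˡ (+-identityʳ 1#) (+-mono-≤ ≤.refl 0≤1)) 2≤Q

    0≤Q : 0# ≤ Q
    0≤Q = ≤.trans 0≤1 1≤Q

    Q≉0 : Q ≉ 0#
    Q≉0 = ≥1⇒≉0 1≤Q

    qp : ℤ → Carrier
    qp (+ n)      = (Q ⁻¹) ^ n
    qp (-[1+ n ]) = Q ^ suc n

    ^-≉0 : ∀ {x} n → x ≉ 0# → x ^ n ≉ 0#
    ^-≉0 zero    x≉0 = 1≉0
    ^-≉0 (suc n) x≉0 = *-≉0 x≉0 (^-≉0 n x≉0)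

    ^-nonneg : ∀ {x} n → 0# ≤ x → 0# ≤ x ^ n
    ^-nonneg zero    0≤x = 0≤1
    ^-nonneg (suc n) 0≤x = *-nonneg 0≤x (^-nonneg n 0≤x)

    qp-≉0 : ∀ k → qp k ≉ 0#
    qp-≉0 (+ n)      = ^-≉0 n (⁻¹-≉0 Q≉0)
    qp-≉0 (-[1+ n ]) = ^-≉0 (suc n) Q≉0

    qp-nonneg : ∀ k → 0# ≤ qp k
    qp-nonneg (+ n)      = ^-nonneg n (0≤⁻¹ 0≤Q)
    qp-nonneg (-[1+ n ]) = ^-nonneg (suc n) 0≤Q

    private
      down : ∀ {x y} → x ≈ Q * y → y ≈ Q ⁻¹ * x
      down {x} {y} eq = begin
        y                 ≈⟨ *-identityˡ y ⟨
        1# * y            ≈⟨ *-congʳ (*-inverseˡ Q≉0) ⟨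
        (Q ⁻¹ * Q) * y    ≈⟨ *-assoc _ _ _ ⟩
        Q ⁻¹ * (Q * y)    ≈⟨ *-congˡ eq ⟨
        Q ⁻¹ * x          ∎

    -- All dependence of volumes on a radius is obtained from this: cutting into q pieces of equal
    -- volume is the hypothesis `step`.
    geometric : ∀ (g : ℤ → Carrier) → (∀ k → g k ≈ Q * g (k ℤ.+ 1ℤ)) → ∀ k → g k ≈ qp k * g 0ℤ
    geometric g step (+ zero)  = sym (*-identityˡ _)
    geometric g step (+ suc n) = begin
      g (+ suc n)                   ≡⟨ ≡.cong (λ m → g (+ m)) (ℕ.+-comm 1 n) ⟩
      g (+ n ℤ.+ 1ℤ)                ≈⟨ down (step (+ n)) ⟩
      Q ⁻¹ * g (+ n)                ≈⟨ *-congˡ (geometric g step (+ n)) ⟩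
      Q ⁻¹ * (qp (+ n) * g 0ℤ)      ≈⟨ *-assoc _ _ _ ⟨
      qp (+ suc n) * g 0ℤ           ∎
    geometric g step -[1+ zero ]  = trans (step -[1+ 0 ]) (*-congʳ (sym (*-identityʳ Q)))
    geometric g step -[1+ suc n ] = begin
      g -[1+ suc n ]                ≈⟨ step -[1+ suc n ] ⟩
      Q * g -[1+ n ]                ≈⟨ *-congˡ (geometric g step -[1+ n ]) ⟩
      Q * (qp -[1+ n ] * g 0ℤ)      ≈⟨ *-assoc _ _ _ ⟨
      qp -[1+ suc n ] * g 0ℤ        ∎

    geometricℕ : ∀ (g : ℕ → Carrier) → (∀ n → g n ≈ Q * g (suc n)) → ∀ n → g n ≈ qp (+ n) * g 0
    geometricℕ g step zero    = sym (*-identityˡ _)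
    geometricℕ g step (suc n) = begin
      g (suc n)                     ≈⟨ down (step n) ⟩
      Q ⁻¹ * g n                    ≈⟨ *-congˡ (geometricℕ g step n) ⟩
      Q ⁻¹ * (qp (+ n) * g 0)       ≈⟨ *-assoc _ _ _ ⟨
      qp (+ suc n) * g 0            ∎

    qp-step : ∀ k → qp k ≈ Q * qp (k ℤ.+ 1ℤ)
    qp-step (+ n) = begin
      qp (+ n)                      ≈⟨ *-identityˡ _ ⟨
      1# * qp (+ n)                 ≈⟨ *-congʳ (*-inverse Q≉0) ⟨
      (Q * Q ⁻¹) * qp (+ n)         ≈⟨ *-assoc _ _ _ ⟩
      Q * qp (+ suc n)              ≡⟨ ≡.cong (λ m → Q * qp (+ m)) (ℕ.+-comm 1 n) ⟩
      Q * qp (+ n ℤ.+ 1ℤ)           ∎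
    qp-step -[1+ zero ]  = refl
    qp-step -[1+ suc n ] = refl

    qp-+ : ∀ k l → qp (k ℤ.+ l) ≈ qp k * qp l
    qp-+ k l = trans (geometric (λ i → qp (i ℤ.+ l)) step k) (*-congˡ (reflexive (≡.cong qp (ℤ.+-identityˡ l))))
      where
      step : ∀ i → qp (i ℤ.+ l) ≈ Q * qp (i ℤ.+ 1ℤ ℤ.+ l)
      step i = trans (qp-step (i ℤ.+ l)) (*-congˡ (reflexive (≡.cong qp
        (ℤS.solve 2 (λ i l → (i ℤS.:+ l) ℤS.:+ ℤS.con 1ℤ ℤS.:= (i ℤS.:+ ℤS.con 1ℤ) ℤS.:+ l) ≡.refl i l))))

    n≤Q^n : ∀ n → 1# + n ⋆ 1# ≤ Q ^ n
    n≤Q^n zero    = ≤.reflexive (+-identityʳ 1#)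
    n≤Q^n (suc n) = ≤.trans (+-mono-≤ 1≤Q^n (n≤Q^n n))
      (≤-respˡ (solve 1 (λ x → (:1 :+ :1) :* x := x :+ x) refl (Q ^ n))
        (*-mono-≤ (≤.trans 0≤1 (≤-respˡ (+-identityʳ 1#) (+-mono-≤ ≤.refl 0≤1))) (^-nonneg n 0≤Q) 2≤Q ≤.refl))
      where
      1≤Q^n : 1# ≤ Q ^ n
      1≤Q^n = ≤.trans (≤-respˡ (+-identityʳ 1#) (+-mono-≤ ≤.refl (0≤n⋆1 n))) (n≤Q^n n)

    -- Bernoulli's inequality 1 + n ≤ qⁿ combined with the Archimedean property.
    qp-small : ∀ B {ε} → 0# < ε → ∃ λ n → B * qp (+ n) ≤ ε
    qp-small B {ε} (0≤ε , 0≉ε) with archimedean (B * ε ⁻¹)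
    ... | n , p = n , ≤-resp eq₁ eq₂ (*-monoˡ-≤ (*-nonneg 0≤ε (qp-nonneg (+ n))) Bε⁻¹≤Q^n)
      where
      ε≉0 : ε ≉ 0#
      ε≉0 e = 0≉ε (sym e)
      Bε⁻¹≤Q^n : B * ε ⁻¹ ≤ Q ^ n
      Bε⁻¹≤Q^n = ≤.trans p (≤.trans (≤-respˡ (+-identityˡ _) (+-mono-≤ 0≤1 ≤.refl)) (n≤Q^n n))
      eq₁ : ε * qp (+ n) * (B * ε ⁻¹) ≈ B * qp (+ n)
      eq₁ = begin
        ε * qp (+ n) * (B * ε ⁻¹)    ≈⟨ solve 4 (λ e w b e′ → e :* w :* (b :* e′) := (e :* e′) :* (b :* w)) refl ε (qp (+ n)) B (ε ⁻¹) ⟩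
        (ε * ε ⁻¹) * (B * qp (+ n))  ≈⟨ *-congʳ (*-inverse ε≉0) ⟩
        1# * (B * qp (+ n))          ≈⟨ *-identityˡ _ ⟩
        B * qp (+ n)                 ∎
      inv-pow : ∀ n → qp (+ n) * Q ^ n ≈ 1#
      inv-pow zero    = *-identityˡ 1#
      inv-pow (suc n) = begin
        Q ⁻¹ * qp (+ n) * (Q * Q ^ n)    ≈⟨ solve 4 (λ a b c d → a :* b :* (c :* d) := (c :* a) :* (b :* d)) refl (Q ⁻¹) (qp (+ n)) Q (Q ^ n) ⟩
        (Q * Q ⁻¹) * (qp (+ n) * Q ^ n)  ≈⟨ *-cong (*-inverse Q≉0) (inv-pow n) ⟩
        1# * 1#                          ≈⟨ *-identityˡ 1# ⟩
        1#                               ∎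
      eq₂ : ε * qp (+ n) * Q ^ n ≈ ε
      eq₂ = trans (*-assoc _ _ _) (trans (*-congˡ (inv-pow n)) (*-identityʳ ε))

-- Heine-Borel compactness over a local field.

i≤∣i∣ : ∀ i → i ℤ.≤ + ℤ.∣ i ∣
i≤∣i∣ (+ n)    = ℤ.≤-refl
i≤∣i∣ -[1+ n ] = ℤ.-≤+

i≤n+∣i-n∣ : ∀ i n → i ℤ.≤ n ℤ.+ + ℤ.∣ i ℤ.- n ∣
i≤n+∣i-n∣ i n = ≤-by (i≤∣i∣ (i ℤ.- n))
  (ℤS.solve 3 (λ i n a → (n ℤS.:+ a) ℤS.:- i ℤS.:= a ℤS.:- (i ℤS.:- n)) ≡.refl i n (+ ℤ.∣ i ℤ.- n ∣))

≤-∣-∣ : ∀ {i n k} → ℤ.∣ i ℤ.- n ∣ ℕ.≤ k → i ℤ.≤ n ℤ.+ + k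
≤-∣-∣ {i} {n} p = ℤ.≤-trans (i≤n+∣i-n∣ i n) (ℤ.+-monoʳ-≤ n (ℤ.+≤+ p))

-- Without a finite subcover, some piece of arbitrarily small diameter would have
-- none, and these pieces shrink to a point.
module HeineBorel (em : ExcludedMiddle 0ℓ) (F : LocalField) where
  open LocalField F hiding (zero)
  open Valuation F

  -- The set is presented by d coordinates in F so that F, SL(2,F) and K are treated at once. The
  -- hypothesis `closed` says that a limit of the coordinates of points is again the coordinates of
  -- a point.
  module _ {A : Set} {d : ℕ} (e : Fin d → A → Carrier) (Near : ℤ → A → A → Set)
           (near : ∀ {n x y} → (∀ i → P n (e i x - e i y)) → Near n x y)
           (closed : (s : ℕ → A) (l : Fin d → Carrier) → (∀ i → ConvergesTo (λ k → e i (s k)) (l i)) →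
                     ∃ λ x → ∀ i → e i x ≈ l i)
           (N : ℤ) where

    Bounded : Pred A 0ℓ
    Bounded x = ∀ i → P N (e i x)

    module Cover {I : Set} (U : I → Pred A 0ℓ) (U-open : ∀ i → Space.Open (nearSpace A Near) (U i))
                 (cover : ∀ x → Bounded x → ∃ λ i → U i x) where
      Covered : Pred A 0ℓ → Set
      Covered S = ∃ λ (is : List I) → ∀ x → S x → Any (λ i → U i x) is

      Diam : ℤ → Pred A 0ℓ → Fin d → Set
      Diam n S i = ∀ x y → S x → S y → P n (e i x - e i y)

      point : ∀ S → ¬ Covered S → ∃ S
      point S ¬cov with em {∃ S}
      ... | yes p = p
      ... | no ¬p = ⊥-elim (¬cov ([] , λ x x∈S → ⊥-elim (¬p (x , x∈S))))

      module Split {n : ℤ} (S : Pred A 0ℓ) (i : Fin d) (x₀ : A) where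
        piece : Fin q → Pred A 0ℓ
        piece j x = S x × P (n ℤ.+ 1ℤ) ((e i x - e i x₀) - digit n j)

        diam-piece : ∀ j → Diam (n ℤ.+ 1ℤ) (piece j) i
        diam-piece j x y (_ , p) (_ , r) = P-resp
          (solve 4 (λ x x₀ y w → ((x :- x₀) :- w) :- ((y :- x₀) :- w) := x :- y) refl (e i x) (e i x₀) (e i y) (digit n j))
          (P-- p r)

        glue : (∀ j → Covered (piece j)) → (∀ x → S x → P n (e i x - e i x₀)) → Covered S
        glue cov bound = List.concat (List.tabulate (λ j → proj₁ (cov j))) , λ x x∈S →
          AnyP.concat⁺ (AnyP.tabulate⁺ (proj₁ (digit-exists (bound x x∈S)))
            (proj₂ (cov _) x (x∈S , proj₂ (digit-exists (bound x x∈S)))))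

      -- If all q pieces had finite subcovers, their concatenation would be one for S; so some piece
      -- has none.
      split : ∀ {n} S i → ¬ Covered S → Diam n S i →
              ∃ λ S′ → (∀ {x} → S′ x → S x) × ¬ Covered S′ × Diam (n ℤ.+ 1ℤ) S′ i
      split {n} S i ¬cov diam = search em
        where
        x₀ : A
        x₀ = proj₁ (point S ¬cov)
        open Split {n} S i x₀
        search : Dec (∃ λ j → ¬ Covered (piece j)) →
                 ∃ λ S′ → (∀ {x} → S′ x → S x) × ¬ Covered S′ × Diam (n ℤ.+ 1ℤ) S′ i
        search (yes (j , ¬cov-j)) = piece j , proj₁ , ¬cov-j , diam-piece j
        search (no ¬bad) = ⊥-elim (¬cov (glue cov (λ x x∈S → diam x x₀ x∈S (proj₂ (point S ¬cov)))))
          where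
          cov : ∀ j → Covered (piece j)
          cov j with em {Covered (piece j)}
          ... | yes c = c
          ... | no ¬c = ⊥-elim (¬bad (j , ¬c))

      refine : ∀ {n} (is : List (Fin d)) S → ¬ Covered S → (∀ i → Diam n S i) →
               ∃ λ S′ → (∀ {x} → S′ x → S x) × ¬ Covered S′ × All (Diam (n ℤ.+ 1ℤ) S′) is
      refine []       S ¬cov diam = S , (λ p → p) , ¬cov , []
      refine (i ∷ is) S ¬cov diam with refine is S ¬cov diam
      ... | S₁ , S₁⊆S , ¬cov₁ , diam₁ with split S₁ i ¬cov₁ (λ x y p r → diam i x y (S₁⊆S p) (S₁⊆S r))
      ... | S₂ , S₂⊆S₁ , ¬cov₂ , diam₂ = S₂ , (λ p → S₁⊆S (S₂⊆S₁ p)) , ¬cov₂ ,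
              diam₂ ∷ All.map (λ D x y p r → D x y (S₂⊆S₁ p) (S₂⊆S₁ r)) diam₁

      record Bad (n : ℤ) : Set₁ where
        field
          S    : Pred A 0ℓ
          ¬cov : ¬ Covered S
          diam : ∀ i → Diam n S i

      module _ {n} (B : Bad n) where
        open Bad B
        refined = refine (List.allFin d) S ¬cov diam
        smaller : Bad (n ℤ.+ 1ℤ)
        smaller = record
          { S    = proj₁ refined
          ; ¬cov = proj₁ (proj₂ (proj₂ refined))
          ; diam = λ i → All.lookup (proj₂ (proj₂ (proj₂ refined))) (∈-allFin i)
          }
        smaller-⊆ : ∀ {x} → Bad.S smaller x → S x
        smaller-⊆ = proj₁ (proj₂ refined)

      module Shrink (¬covered : ¬ Covered Bounded) where
        level : ℕ → ℤ
        level zero    = N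
        level (suc k) = level k ℤ.+ 1ℤ

        level-+ : ∀ k → level k ≡ N ℤ.+ + k
        level-+ zero    = ≡.sym (ℤ.+-identityʳ N)
        level-+ (suc k) = ≡.trans (≡.cong (ℤ._+ 1ℤ) (level-+ k))
          (≡.trans (ℤ.+-assoc N (+ k) 1ℤ) (≡.cong (λ m → N ℤ.+ + m) (ℕ.+-comm k 1)))

        bad : ∀ k → Bad (level k)
        bad zero    = record { S = Bounded ; ¬cov = ¬covered ; diam = λ i x y p r → P-- (p i) (r i) }
        bad (suc k) = smaller (bad k)

        nested : ∀ {j k} → j ℕ.≤ k → ∀ {x} → Bad.S (bad k) x → Bad.S (bad j) x
        nested {j} j≤k = go (ℕ.≤⇒≤′ j≤k)
          where
          go : ∀ {k} → j ℕ.≤′ k → ∀ {x} → Bad.S (bad k) x → Bad.S (bad j) x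
          go ℕ.≤′-refl             p = p
          go (ℕ.≤′-step {k′} j≤k′) p = go j≤k′ (smaller-⊆ (bad k′) p)

        s : ℕ → A
        s k = proj₁ (point _ (Bad.¬cov (bad k)))

        s∈ : ∀ {j k} → j ℕ.≤ k → Bad.S (bad j) (s k)
        s∈ {k = k} j≤k = nested j≤k (proj₂ (point _ (Bad.¬cov (bad k))))

        small : ∀ n k → ℤ.∣ n ℤ.- N ∣ ℕ.≤ k → ∀ {x y} → Bad.S (bad k) x → Bad.S (bad k) y →
                ∀ i → P n (e i x - e i y)
        small n k n≤k {x} {y} p r i = P-mono
          (≡.subst (n ℤ.≤_) (≡.sym (level-+ k)) (≤-∣-∣ {n} {N} n≤k)) (Bad.diam (bad k) i x y p r)

        limit : ∀ i → ∃ (ConvergesTo (λ k → e i (s k)))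
        limit i = complete _ (λ n → ℤ.∣ n ℤ.- N ∣ , λ j k j≥ k≥ →
          small n ℤ.∣ n ℤ.- N ∣ ℕ.≤-refl (s∈ j≥) (s∈ k≥) i)

        x : A
        x = proj₁ (closed s (λ i → proj₁ (limit i)) (λ i → proj₂ (limit i)))

        converges : ∀ i → ConvergesTo (λ k → e i (s k)) (e i x)
        converges i n = proj₁ conv , λ k k≥ → P-resp (+-congˡ (-‿cong (sym e≈l))) (proj₂ conv k k≥)
          where
          conv = proj₂ (limit i) n
          e≈l  = proj₂ (closed s (λ i → proj₁ (limit i)) (λ i → proj₂ (limit i))) i

        x-bounded : Bounded x
        x-bounded i = P-resp (solve 2 (λ a l → a :- (a :- l) := l) refl (e i (s K)) (e i x))
          (P-- (s∈ {0} {K} ℕ.z≤n i) (proj₂ (converges i N) K ℕ.≤-refl))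
          where
          K : ℕ
          K = proj₁ (converges i N)

        close : ∀ n y → Bad.S (bad ℤ.∣ n ℤ.- N ∣) y → ∀ i → P n (e i x - e i y)
        close n y y∈ i = P-trans {x = e i x} {y = e i (s m)} {z = e i y}
          (P-swap (proj₂ (converges i n) m (ℕ.m≤m⊔n K k)))
          (small n k ℕ.≤-refl (s∈ (ℕ.m≤n⊔m K k)) y∈ i)
          where
          k K m : ℕ
          k = ℤ.∣ n ℤ.- N ∣
          K = proj₁ (converges i n)
          m = K ℕ.⊔ k

        contradiction : ⊥
        contradiction = Bad.¬cov (bad ℤ.∣ n ℤ.- N ∣)
          (i₀ ∷ [] , λ y y∈ → here (proj₂ ball y (near (close n y y∈))))
          where
          i₀   = proj₁ (cover x x-bounded)
          ball = U-open i₀ x (proj₂ (cover x x-bounded))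
          n    = proj₁ ball

    abstract
      bounded-compact : Compact (nearSpace A Near) Bounded
      bounded-compact U U-open cover with em {Cover.Covered U U-open cover Bounded}
      ... | yes covered = covered
      ... | no ¬covered = ⊥-elim (Cover.Shrink.contradiction U U-open cover ¬covered)

-- Test functions and their integrals.

-- Common description of the spaces F, K, SL(2,F) and of the quotient by T. In the quotient the
-- points are still matrices and the open sets are required to be invariant; for the others the
-- relation is empty.
record NearStructure (X : Space) : Set₁ where
  open Space X
  field
    Near      : ℤ → Point → Point → Set
    near-mono : ∀ {m n x y} → m ℤ.≤ n → Near n x y → Near m x y
    -- The points identified in the quotient.
    _~_       : Point → Point → Set
    open⇒near : ∀ {U} → Open U → ∀ x → U x → ∃ λ n → ∀ y → Near n x y → U y
    open⇒~    : ∀ {U} → Open U → ∀ {x y} → x ~ y → U x → U y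
    mkOpen    : ∀ {U} → (∀ x → U x → ∃ λ n → ∀ y → Near n x y → U y) →
                (∀ {x y} → x ~ y → U x ⇔ U y) → Open U

nearStructure : ∀ {A Near} → (∀ {m n x y} → m ℤ.≤ n → Near n x y → Near m x y) →
                NearStructure (nearSpace A Near)
nearStructure {A} {Near} mono = record
  { Near = Near ; near-mono = mono ; _~_ = λ _ _ → ⊥ ; open⇒near = λ U-open → U-open
  ; open⇒~ = λ _ () ; mkOpen = λ p _ → p }

compact-∪ : ∀ X {C D} → Compact X C → Compact X D → Compact X (λ x → C x ⊎ D x)
compact-∪ X C-comp D-comp U U-open cover
  with C-comp U U-open (λ x p → cover x (inj₁ p)) | D-comp U U-open (λ x p → cover x (inj₂ p))
... | is , p | js , r = is ++ js , λ where
  x (inj₁ x∈C) → AnyP.++⁺ˡ (p x x∈C)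
  x (inj₂ x∈D) → AnyP.++⁺ʳ is (r x x∈D)

compact-⊥ : ∀ X → Compact X (λ _ → ⊥)
compact-⊥ X U U-open cover = [] , λ _ ()

module TestFunctions (em : ExcludedMiddle 0ℓ) (ℝ : RealField) where
  open RealField ℝ hiding (zero)
  open RealOps ℝ
  open RealLemmas em ℝ
  open Integration ℝ
  open SetoidReasoning setoid

  𝟏 : Set → Carrier
  𝟏 A with em {A}
  ... | yes _ = 1#
  ... | no  _ = 0#

  𝟏-yes : ∀ {A} → A → 𝟏 A ≈ 1#
  𝟏-yes {A} a with em {A}
  ... | yes _ = refl
  ... | no ¬a = ⊥-elim (¬a a)

  𝟏-no : ∀ {A} → ¬ A → 𝟏 A ≈ 0#
  𝟏-no {A} ¬a with em {A}
  ... | yes a = ⊥-elim (¬a a)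
  ... | no  _ = refl

  𝟏-cong : ∀ {A B} → (A → B) → (B → A) → 𝟏 A ≈ 𝟏 B
  𝟏-cong {A} {B} f g with em {B}
  ... | yes b = 𝟏-yes (g b)
  ... | no ¬b = 𝟏-no (λ a → ¬b (f a))

  𝟏-nonneg : ∀ A → 0# ≤ 𝟏 A
  𝟏-nonneg A with em {A}
  ... | yes _ = 0≤1
  ... | no  _ = ≤.refl

  𝟏≉0 : ∀ {A} → 𝟏 A ≉ 0# → A
  𝟏≉0 {A} p with em {A}
  ... | yes a = a
  ... | no  _ = ⊥-elim (p refl)

  -- The form in which finite additivity is applied: a set cut into disjoint pieces indexed by
  -- digits.
  𝟏-partition : ∀ {n A} {B : Fin n → Set} → (A → ∃ B) → (∀ j → B j → A) → (∀ {i j} → B i → B j → i ≡ j) →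
                𝟏 A ≈ sum (λ j → 𝟏 (B j))
  𝟏-partition {A = A} {B} total sound unique with em {A}
  ... | yes a = sym (trans (sum-single (proj₁ (total a)) λ i i≢ → 𝟏-no (λ b → i≢ (unique b (proj₂ (total a)))))
                  (𝟏-yes (proj₂ (total a))))
  ... | no ¬a = sym (sum-zero (λ j → 𝟏-no (λ b → ¬a (sound j b))))

  module OnSpace {X : Space} (N : NearStructure X) where
    open Space X
    open NearStructure N

    record Smooth (h : Point → Carrier) : Set where
      field
        local : ∀ x → ∃ λ n → ∀ y → Near n x y → h y ≈ h x
        invar : ∀ {x y} → x ~ y → h x ≈ h y

    open Smooth

    CompactlySupported : (Point → Carrier) → Set₁
    CompactlySupported h = ∃ λ C → Compact X C × (∀ x → h x ≉ 0# → C x)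

    mkCc : (h : Point → Carrier) → Smooth h → CompactlySupported h → Cc∞ X rawRing
    mkCc h sm supp = record
      { fun = h
      ; locallyConstant = λ x → (λ y → h y ≈ h x) ,
          mkOpen (λ y hy≈hx → proj₁ (local sm y) , λ z near → trans (proj₂ (local sm y) z near) hy≈hx)
                 (λ x~y → mk⇔ (λ p → trans (sym (invar sm x~y)) p) (λ p → trans (invar sm x~y) p)) ,
          refl , λ y p → p
      ; compactSupport = supp
      }

    smooth : (φ : Cc∞ X rawRing) → Smooth (fun φ)
    smooth φ = record
      { local = λ x → let U , U-open , Ux , const = Cc∞.locallyConstant φ x
                          n , ball = open⇒near U-open x Ux
                      in n , λ y near → const y (ball y near)
      ; invar = λ {x} {y} x~y → let U , U-open , Ux , const = Cc∞.locallyConstant φ x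
                                in sym (const y (open⇒~ U-open x~y Ux))
      }

    smooth-+ : ∀ {g h} → Smooth g → Smooth h → Smooth (λ x → g x + h x)
    smooth-+ sg sh = record
      { local = λ x → let m , p = local sg x ; n , r = local sh x
                      in m ℤ.⊔ n , λ y near → +-cong (p y (near-mono (ℤ.i≤i⊔j m n) near)) (r y (near-mono (ℤ.i≤j⊔i m n) near))
      ; invar = λ x~y → +-cong (invar sg x~y) (invar sh x~y)
      }

    smooth-* : ∀ {g h} → Smooth g → Smooth h → Smooth (λ x → g x * h x)
    smooth-* sg sh = record
      { local = λ x → let m , p = local sg x ; n , r = local sh x
                      in m ℤ.⊔ n , λ y near → *-cong (p y (near-mono (ℤ.i≤i⊔j m n) near)) (r y (near-mono (ℤ.i≤j⊔i m n) near))
      ; invar = λ x~y → *-cong (invar sg x~y) (invar sh x~y)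
      }

    smooth-const : ∀ c → Smooth (λ _ → c)
    smooth-const c = record { local = λ _ → 0ℤ , λ _ _ → refl ; invar = λ _ → refl }

    smooth-𝟏 : ∀ {S : Pred Point 0ℓ} → (∀ x → ∃ λ n → ∀ y → Near n x y → (S y → S x) × (S x → S y)) →
               (∀ {x y} → x ~ y → (S x → S y) × (S y → S x)) → Smooth (λ x → 𝟏 (S x))
    smooth-𝟏 loc inv = record
      { local = λ x → proj₁ (loc x) , λ y near → let f , g = proj₂ (loc x) y near in 𝟏-cong f g
      ; invar = λ x~y → let f , g = inv x~y in 𝟏-cong f g
      }

    infixl 6 _⊞_
    _⊞_ : Cc∞ X rawRing → Cc∞ X rawRing → Cc∞ X rawRing
    φ ⊞ ψ = mkCc (λ x → fun φ x + fun ψ x) (smooth-+ (smooth φ) (smooth ψ))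
      (let C , C-comp , p = Cc∞.compactSupport φ ; D , D-comp , r = Cc∞.compactSupport ψ
       in (λ x → C x ⊎ D x) , compact-∪ X C-comp D-comp , λ x → support (p x) (r x))
      where
      support : ∀ {a b} {C D : Set} → (a ≉ 0# → C) → (b ≉ 0# → D) → a + b ≉ 0# → C ⊎ D
      support {a} p r a+b≉0 with em {a ≈ 0#}
      ... | yes a≈0 = inj₂ (r (λ b≈0 → a+b≉0 (trans (+-cong a≈0 b≈0) (+-identityˡ 0#))))
      ... | no  a≉0 = inj₁ (p a≉0)

    infixr 7 _⊡_
    _⊡_ : Carrier → Cc∞ X rawRing → Cc∞ X rawRing
    c ⊡ φ = mkCc (λ x → c * fun φ x) (smooth-* (smooth-const c) (smooth φ))
      (let C , C-comp , p = Cc∞.compactSupport φ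
       in C , C-comp , λ x cφ≉0 → p x (λ φ≈0 → cφ≉0 (trans (*-congˡ φ≈0) (zeroʳ c))))

    𝟎 : Cc∞ X rawRing
    𝟎 = mkCc (λ _ → 0#) (smooth-const 0#) ((λ _ → ⊥) , compact-⊥ X , λ x p → ⊥-elim (p refl))

    abstract
      -- The level sets of φ are open and cover its support, so finitely many values occur there;
      -- the sum of their absolute values is a bound.
      bounded : (φ : Cc∞ X rawRing) → ∃ λ B → ∀ x → fun φ x ≤ B × - fun φ x ≤ B
      bounded φ = B , λ x → bound x
        where
        U : Carrier → Pred Point 0ℓ
        U r x = fun φ x ≈ r
        cover : ∃ λ (rs : List Carrier) → ∀ x → proj₁ (Cc∞.compactSupport φ) x → Any (λ r → U r x) rs
        cover = proj₁ (proj₂ (Cc∞.compactSupport φ)) U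
          (λ r → mkOpen (λ x φx≈r → let n , p = local (smooth φ) x in n , λ y near → trans (p y near) φx≈r)
            (λ x~y → mk⇔ (λ p → trans (sym (invar (smooth φ) x~y)) p) (λ p → trans (invar (smooth φ) x~y) p)))
          (λ x _ → fun φ x , refl)
        total : List Carrier → Carrier
        total []       = 0#
        total (r ∷ rs) = ∣ r ∣ + total rs
        total-nonneg : ∀ rs → 0# ≤ total rs
        total-nonneg []       = ≤.refl
        total-nonneg (r ∷ rs) = ≤-respˡ (+-identityˡ 0#) (+-mono-≤ (∣∣-nonneg r) (total-nonneg rs))
        B : Carrier
        B = total (proj₁ cover)
        in-total : ∀ x rs → Any (λ r → U r x) rs → fun φ x ≤ total rs × - fun φ x ≤ total rs
        in-total x (r ∷ rs) (here eq) =
          ≤-resp (trans (+-identityʳ r) (sym eq)) refl (+-mono-≤ (x≤∣x∣ r) (total-nonneg rs)) ,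
          ≤-resp (trans (+-identityʳ _) (-‿cong (sym eq))) refl (+-mono-≤ (-x≤∣x∣ r) (total-nonneg rs))
        in-total x (r ∷ rs) (there p) =
          let q₁ , q₂ = in-total x rs p
          in ≤-respˡ (+-identityˡ _) (+-mono-≤ (∣∣-nonneg r) q₁) , ≤-respˡ (+-identityˡ _) (+-mono-≤ (∣∣-nonneg r) q₂)
        bound : ∀ x → fun φ x ≤ B × - fun φ x ≤ B
        bound x with em {fun φ x ≈ 0#}
        ... | yes φ≈0 = ≤-respˡ (sym φ≈0) (total-nonneg (proj₁ cover)) ,
                        ≤-respˡ (trans (solve 0 (:0 := :- :0) refl) (-‿cong (sym φ≈0))) (total-nonneg (proj₁ cover))
        ... | no  φ≉0 = in-total x (proj₁ cover) (proj₂ cover x (proj₂ (proj₂ (Cc∞.compactSupport φ)) x φ≉0))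

    module Integrals (μ : Measure X) where
      open Measure μ

      ∫-cong : ∀ φ ψ → (∀ x → fun φ x ≈ fun ψ x) → ∫ φ ≈ ∫ ψ
      ∫-cong φ ψ eq = trans (scalar 1# ψ φ (λ x → trans (eq x) (sym (*-identityˡ _)))) (*-identityˡ _)

      ∫-zero : ∀ φ → (∀ x → fun φ x ≈ 0#) → ∫ φ ≈ 0#
      ∫-zero φ eq = trans (scalar 0# φ φ (λ x → trans (eq x) (sym (zeroˡ _)))) (zeroˡ _)

      ∫-lin : ∀ α φ ψ θ → (∀ x → fun θ x ≈ α * fun φ x + fun ψ x) → ∫ θ ≈ α * ∫ φ + ∫ ψ
      ∫-lin α φ ψ θ eq = trans (additive (α ⊡ φ) ψ θ eq) (+-congʳ (scalar α φ (α ⊡ φ) (λ _ → refl)))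

      ∫-mono : ∀ φ ψ → (∀ x → fun φ x ≤ fun ψ x) → ∫ φ ≤ ∫ ψ
      ∫-mono φ ψ φ≤ψ = ≤-resp (+-identityˡ _) (trans (+-comm _ _) (sym eq)) (+-monoˡ-≤ (∫ φ) 0≤∫)
        where
        χ : Cc∞ X rawRing
        χ = ψ ⊞ (- 1# ⊡ φ)
        χ≈ : ∀ x → fun χ x ≈ fun ψ x - fun φ x
        χ≈ x = solve 2 (λ a b → b :+ (:- :1) :* a := b :- a) refl (fun φ x) (fun ψ x)
        0≤∫ : 0# ≤ ∫ χ
        0≤∫ = positive χ (λ x → ≤-respʳ (sym (χ≈ x)) (x≤y⇒0≤y-x (φ≤ψ x)))
        eq : ∫ ψ ≈ ∫ φ + ∫ χ
        eq = additive φ χ ψ (λ x → trans (solve 2 (λ a b → b := a :+ (b :- a)) refl (fun φ x) (fun ψ x)) (+-congˡ (sym (χ≈ x))))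

      ∫-sum : ∀ {n} (φs : Fin n → Cc∞ X rawRing) φ → (∀ x → fun φ x ≈ sum (λ j → fun (φs j) x)) →
              ∫ φ ≈ sum (λ j → ∫ (φs j))
      ∫-sum {zero}  φs φ eq = ∫-zero φ eq
      ∫-sum {suc n} φs φ eq = trans (additive (φs zero) rest φ (λ x → trans (eq x) (+-congˡ (sym (rest≈ (λ j → φs (suc j)) x)))))
        (+-congˡ (∫-sum (λ j → φs (suc j)) rest (rest≈ (λ j → φs (suc j)))))
        where
        total : ∀ {n} → (Fin n → Cc∞ X rawRing) → Cc∞ X rawRing
        total {zero}  _  = 𝟎
        total {suc n} φs = φs zero ⊞ total (λ j → φs (suc j))
        rest : Cc∞ X rawRing
        rest = total (λ j → φs (suc j))
        rest≈ : ∀ {n} (φs : Fin n → Cc∞ X rawRing) x → fun (total φs) x ≈ sum (λ j → fun (φs j) x)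
        rest≈ {zero}  φs x = refl
        rest≈ {suc n} φs x = +-congˡ (rest≈ (λ j → φs (suc j)) x)

      -- The test function approximates itself, for every ε, with the zero series as dominating
      -- series.
      hasIntegral-test : ∀ {h} φ → (∀ x → h x ≈ fun φ x) → HasIntegralℝ μ h (∫ φ)
      hasIntegral-test {h} φ eq ε (0≤ε , _) = φ , (λ _ → 𝟎) , (λ _ _ → ≤.refl) ,
        (λ x r sums → ≤.trans (abs-zero (x≈y⇒x-y≈0 (eq x))) (sums 0)) ,
        (λ n → ≤.trans (≤.reflexive (sum-𝟎 n)) 0≤ε) , ≤.trans (abs-zero (-‿inverseʳ _)) 0≤ε
        where
        abs-zero : ∀ {x} → x ≈ 0# → ∣ x ∣ ≤ 0#
        abs-zero x≈0 = ∣∣-≤ (≤.reflexive x≈0) (≤.reflexive (trans (-‿cong x≈0) (solve 0 (:- :0 := :0) refl)))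
        sum-𝟎 : ∀ n → sumℝ (λ _ → ∫ 𝟎) n ≈ 0#
        sum-𝟎 zero    = refl
        sum-𝟎 (suc n) = trans (+-cong (sum-𝟎 n) (∫-zero 𝟎 (λ _ → refl))) (+-identityˡ 0#)

-- Continuity over F, and compactness in F, SL(2,F) and K.

module Continuity (F : LocalField) {A : Set} (Near : ℤ → A → A → Set)
                  (near-mono : ∀ {m n x y} → m ℤ.≤ n → Near n x y → Near m x y) where
  open LocalField F hiding (zero)
  open Valuation F

  Cont : (A → Carrier) → Set
  Cont e = ∀ x n → ∃ λ m → ∀ y → Near m x y → P n (e x - e y)

  cont-const : ∀ c → Cont (λ _ → c)
  cont-const c x n = 0ℤ , λ y _ → P-≈0 (-‿inverseʳ c)

  cont-+ : ∀ {e f} → Cont e → Cont f → Cont (λ x → e x + f x)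
  cont-+ {e} {f} ce cf x n = let m , p = ce x n ; k , r = cf x n in m ℤ.⊔ k , λ y near →
    P-resp (solve 4 (λ a b c d → (a :- b) :+ (c :- d) := (a :+ c) :- (b :+ d)) refl (e x) (e y) (f x) (f y))
      (P-+ (p y (near-mono (ℤ.i≤i⊔j m k) near)) (r y (near-mono (ℤ.i≤j⊔i m k) near)))

  cont-neg : ∀ {e} → Cont e → Cont (λ x → - e x)
  cont-neg {e} ce x n = let m , p = ce x n in m , λ y near →
    P-resp (solve 2 (λ a b → :- (a :- b) := :- a :- (:- b)) refl (e x) (e y)) (P-neg (p y near))

  private
    lower : ∀ x → ∃ λ k → P (ℤ.- + k) x
    lower x with v x
    ... | ∞     = 0 , tt
    ... | fin k = ℤ.∣ k ∣ , ≡.subst (ℤ.- + ℤ.∣ k ∣ ℤ.≤_) (ℤ.neg-involutive k)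
                    (ℤ.neg-mono-≤ (≡.subst (ℤ.- k ℤ.≤_) (≡.cong +_ (ℤ.∣-i∣≡∣i∣ k)) (i≤∣i∣ (ℤ.- k))))

  -- The increment of the product is written with the increments and the values at `x` only, so that
  -- lower bounds for the valuations at the single point `x` suffice.
  cont-* : ∀ {e f} → Cont e → Cont f → Cont (λ x → e x * f x)
  cont-* {e} {f} ce cf x n =
    let A , p = lower (e x) ; B , r = lower (f x)
        -- A and B bound the orders of the poles of e(x) and f(x); this precision absorbs both and
        -- leaves n.
        k = ℤ.∣ n ∣ ℕ.+ (A ℕ.+ B)
        m₁ , ne = ce x (+ k) ; m₂ , nf = cf x (+ k)
    in m₁ ℤ.⊔ m₂ , λ y near →
      let de = ne y (near-mono (ℤ.i≤i⊔j m₁ m₂) near) ; df = nf y (near-mono (ℤ.i≤j⊔i m₁ m₂) near)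
      in P-resp (solve 4 (λ a b c d → (a :- b) :* c :+ a :* (c :- d) :- (a :- b) :* (c :- d) := a :* c :- b :* d)
                   refl (e x) (e y) (f x) (f y))
           (P-- (P-+ (P-mono (bound A B) (P-* de r))
                     (P-mono (≡.subst (n ℤ.≤_) (≡.trans (≡.cong (λ j → + (ℤ.∣ n ∣ ℕ.+ j) ℤ.- + A) (ℕ.+-comm B A))
                                 (ℤ.+-comm (+ k) (ℤ.- + A))) (bound B A)) (P-* p df)))
                (P-mono (ℤ.≤-trans (i≤∣i∣ n) (ℤ.+≤+ (ℕ.≤-trans (ℕ.m≤m+n ℤ.∣ n ∣ _) (ℕ.m≤m+n k k)))) (P-* de df)))
    where
    bound : ∀ A B → n ℤ.≤ + (ℤ.∣ n ∣ ℕ.+ (A ℕ.+ B)) ℤ.- + B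
    bound A B = ≤-by₂ {c = n} {d = + ℤ.∣ n ∣} {e = 0ℤ} {f = + A} (i≤∣i∣ n) (ℤ.+≤+ ℕ.z≤n)
      (ℤS.solve 4 (λ n i A B → ((i ℤS.:+ (A ℤS.:+ B)) ℤS.:- B) ℤS.:- n ℤS.:=
        (i ℤS.:- n) ℤS.:+ (A ℤS.:- ℤS.con 0ℤ)) ≡.refl n (+ ℤ.∣ n ∣) (+ A) (+ B))

  cont-ball : ∀ {e} → Cont e → ∀ n c x → ∃ λ m → ∀ y → Near m x y →
              (P n (e y - c) → P n (e x - c)) × (P n (e x - c) → P n (e y - c))
  cont-ball {e} ce n c x = let m , p = ce x n in m , λ y near →
    (λ r → P-trans (p y near) r) , (λ r → P-trans (P-swap (p y near)) r)

pattern #0 = zero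
pattern #1 = suc zero
pattern #2 = suc (suc zero)
pattern #3 = suc (suc (suc zero))

module GroupSpaces (em : ExcludedMiddle 0ℓ) (F : LocalField) where
  open LocalField F hiding (zero)
  open Valuation F public
  open HeineBorel em F
  open SL₂ F
  open SetoidReasoning setoid

  P-all : ∀ {x} → (∀ n → P n x) → x ≈ 0#
  P-all {x} all with em {x ≈ 0#}
  ... | yes p = p
  ... | no ¬p = ⊥-elim (i+1≰i (P-val (proj₂ (val-exists ¬p)) (all (proj₁ (val-exists ¬p) ℤ.+ 1ℤ))))

  nearF-mono : ∀ {m n x y} → m ℤ.≤ n → NearF n x y → NearF m x y
  nearF-mono = P-mono

  nearG-mono : ∀ {m n x y} → m ℤ.≤ n → NearG n x y → NearG m x y
  nearG-mono m≤n (p , q , r , s) = P-mono m≤n p , P-mono m≤n q , P-mono m≤n r , P-mono m≤n s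

  nearG-refl : ∀ {n x y} → x ≋ y → NearG n x y
  nearG-refl (p , q , r , s) = P-≈0 (x≈y⇒x-y≈0 p) , P-≈0 (x≈y⇒x-y≈0 q) , P-≈0 (x≈y⇒x-y≈0 r) , P-≈0 (x≈y⇒x-y≈0 s)

  nearG-sym : ∀ {n x y} → NearG n x y → NearG n y x
  nearG-sym (p , q , r , s) = P-swap p , P-swap q , P-swap r , P-swap s

  nearG-trans : ∀ {n x y z} → NearG n x y → NearG n y z → NearG n x z
  nearG-trans (p , q , r , s) (p′ , q′ , r′ , s′) = P-trans p p′ , P-trans q q′ , P-trans r r′ , P-trans s s′

  ≋-refl : ∀ {x} → x ≋ x
  ≋-refl = refl , refl , refl , refl

  B : ℤ → SL2 → Set
  B n x = P n (a x) × P n (b x) × P n (c x) × P n (d x)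

  entry : Fin 4 → SL2 → Carrier
  entry #0 = a
  entry #1 = b
  entry #2 = c
  entry #3 = d

  P-closed : ∀ {n s l} → ConvergesTo s l → (∀ k → P n (s k)) → P n l
  P-closed {n} {s} {l} conv all = P-resp (solve 2 (λ x l → x :- (x :- l) := l) refl (s J) l)
    (P-- (all J) (proj₂ (conv n) J ℕ.≤-refl))
    where
    J : ℕ
    J = proj₁ (conv n)

  private
    Near₄ : ℤ → (Fin 4 → Carrier) → (Fin 4 → Carrier) → Set
    Near₄ n x y = ∀ i → P n (x i - y i)

    open Continuity F Near₄ (λ m≤n p i → P-mono m≤n (p i))

    det₄ : (Fin 4 → Carrier) → Carrier
    det₄ x = x #0 * x #3 - x #1 * x #2

    det₄-cont : Cont det₄
    det₄-cont = cont-+ (cont-* (coord #0) (coord #3)) (cont-neg (cont-* (coord #1) (coord #2)))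
      where
      coord : ∀ i → Cont (λ x → x i)
      coord i x n = n , λ y near → near i

    -- The determinant is continuous, so SL(2,F) is closed in the space of matrices; this is the
    -- closedness demanded by the compactness argument.
    det-limit : (s : ℕ → SL2) (l : Fin 4 → Carrier) → (∀ i → ConvergesTo (λ k → entry i (s k)) (l i)) →
                det₄ l ≈ 1#
    det-limit s l conv = x-y≈0⇒x≈y (P-all close)
      where
      close : ∀ n → P n (det₄ l - 1#)
      close n = P-resp (+-congˡ (-‿cong (det (s J))))
        (proj₂ (det₄-cont l n) (λ i → entry i (s J)) (λ i → P-swap (proj₂ (conv i m) J (J≥ i))))
        where
        m : ℤ
        m = proj₁ (det₄-cont l n)
        k : Fin 4 → ℕ
        k i = proj₁ (conv i m)
        J : ℕ
        J = k #0 ℕ.⊔ (k #1 ℕ.⊔ (k #2 ℕ.⊔ k #3))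
        J≥ : ∀ i → k i ℕ.≤ J
        J≥ #0 = ℕ.m≤m⊔n (k #0) _
        J≥ #1 = ℕ.≤-trans (ℕ.m≤m⊔n (k #1) _) (ℕ.m≤n⊔m (k #0) _)
        J≥ #2 = ℕ.≤-trans (ℕ.≤-trans (ℕ.m≤m⊔n (k #2) (k #3)) (ℕ.m≤n⊔m (k #1) _)) (ℕ.m≤n⊔m (k #0) _)
        J≥ #3 = ℕ.≤-trans (ℕ.≤-trans (ℕ.m≤n⊔m (k #2) (k #3)) (ℕ.m≤n⊔m (k #1) _)) (ℕ.m≤n⊔m (k #0) _)

    toMat : (l : Fin 4 → Carrier) → det₄ l ≈ 1# → SL2
    toMat l eq = mat (l #0) (l #1) (l #2) (l #3) eq

    entry-toMat : ∀ l eq i → entry i (toMat l eq) ≈ l i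
    entry-toMat l eq #0 = refl
    entry-toMat l eq #1 = refl
    entry-toMat l eq #2 = refl
    entry-toMat l eq #3 = refl

    tuple : ∀ {n} x → (∀ i → P n (entry i x)) → B n x
    tuple x p = p #0 , p #1 , p #2 , p #3

    untuple : ∀ {n} x → B n x → ∀ i → P n (entry i x)
    untuple x (p , q , r , s) #0 = p
    untuple x (p , q , r , s) #1 = q
    untuple x (p , q , r , s) #2 = r
    untuple x (p , q , r , s) #3 = s

    compact-⇔ : ∀ X {C D : Pred (Space.Point X) 0ℓ} → (∀ x → C x → D x) → (∀ x → D x → C x) →
                Compact X C → Compact X D
    compact-⇔ X C⊆D D⊆C comp U U-open cover with comp U U-open (λ x p → cover x (C⊆D x p))
    ... | is , p = is , λ x x∈D → p x (D⊆C x x∈D)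

    near₄ : ∀ {n x y} → (∀ i → P n (entry i x - entry i y)) → NearG n x y
    near₄ p = p #0 , p #1 , p #2 , p #3

  F-compact : ∀ N → Compact F-space (P N)
  F-compact N = compact-⇔ F-space (λ x p → p zero) (λ x p _ → p)
    (bounded-compact {d = 1} (λ _ x → x) NearF (λ p → p zero) (λ s l conv → l zero , λ where zero → refl) N)

  G-compact : ∀ N → Compact G-space (B N)
  G-compact N = compact-⇔ G-space tuple untuple
    (bounded-compact entry NearG near₄
      (λ s l conv → toMat l (det-limit s l conv) , entry-toMat l (det-limit s l conv)) N)

  K-compact : Compact K-space (λ _ → ⊤)
  K-compact = compact-⇔ K-space (λ _ _ → tt) (λ k _ → untuple (K.g k) (K.aᵒ k , K.bᵒ k , K.cᵒ k , K.dᵒ k))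
    (bounded-compact (λ i k → entry i (K.g k)) (λ n k l → NearG n (K.g k) (K.g l))
      (λ {n} {x} {y} → near₄ {n} {K.g x} {K.g y})
      (λ s l conv →
        let x = toMat l (det-limit (λ k → K.g (s k)) l conv)
            integral : ∀ i → P 0ℤ (l i)
            integral i = P-closed (conv i) (λ k → untuple (K.g (s k)) (K.aᵒ (s k) , K.bᵒ (s k) , K.cᵒ (s k) , K.dᵒ (s k)) i)
        in intg x (integral #0) (integral #1) (integral #2) (integral #3) ,
           entry-toMat l (det-limit (λ k → K.g (s k)) l conv))
      0ℤ)

  F-near : NearStructure F-space
  F-near = nearStructure nearF-mono

  G-near : NearStructure G-space
  G-near = nearStructure (λ {m} {n} {x} {y} → nearG-mono {m} {n} {x} {y})

  K-near : NearStructure K-space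
  K-near = nearStructure (λ {m} {n} {x} {y} → nearG-mono {m} {n} {K.g x} {K.g y})

  P-exists : ∀ x → ∃ λ k → P k x
  P-exists x with v x
  ... | ∞     = 0ℤ , tt
  ... | fin k = k , ℤ.≤-refl

  B-mono : ∀ {m n} x → m ℤ.≤ n → B n x → B m x
  B-mono {m} {n} x m≤n (p , q , r , s) = P-mono {m} {n} m≤n p , P-mono {m} {n} m≤n q , P-mono {m} {n} m≤n r , P-mono {m} {n} m≤n s

  B-exists : ∀ x → ∃ λ n → B n x
  B-exists x = let k₁ , p₁ = P-exists (a x) ; k₂ , p₂ = P-exists (b x)
                   k₃ , p₃ = P-exists (c x) ; k₄ , p₄ = P-exists (d x)
               in (k₁ ℤ.⊓ k₂) ℤ.⊓ (k₃ ℤ.⊓ k₄) ,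
                  P-mono (ℤ.≤-trans (ℤ.i⊓j≤i (k₁ ℤ.⊓ k₂) _) (ℤ.i⊓j≤i k₁ k₂)) p₁ ,
                  P-mono (ℤ.≤-trans (ℤ.i⊓j≤i (k₁ ℤ.⊓ k₂) _) (ℤ.i⊓j≤j k₁ k₂)) p₂ ,
                  P-mono (ℤ.≤-trans (ℤ.i⊓j≤j (k₁ ℤ.⊓ k₂) _) (ℤ.i⊓j≤i k₃ k₄)) p₃ ,
                  P-mono (ℤ.≤-trans (ℤ.i⊓j≤j (k₁ ℤ.⊓ k₂) _) (ℤ.i⊓j≤j k₃ k₄)) p₄

  B-near : ∀ {n} x y → NearG n x y → B n x → B n y
  B-near x y (p , q , r , s) (p′ , q′ , r′ , s′) = go p p′ , go q q′ , go r r′ , go s s′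
    where
    go : ∀ {n x y} → P n (x - y) → P n x → P n y
    go {x = x} {y} p r = P-resp (solve 2 (λ x y → x :- (x :- y) := y) refl x y) (P-- r p)

-- The norm form of E/F.

module NormForm (em : ExcludedMiddle 0ℓ) (F₀ : LocalField) (E : SeparableQuadraticExtension F₀) where
  open SeparableQuadraticExtension E hiding (zero)
  open FieldLemmas isField
  private module FV = FieldLemmas F.isField
  open SetoidReasoning setoid
  open RingMorphisms
  private
    module ι = IsRingHomomorphism ι-hom
    module bar = IsRingIsomorphism bar-iso

  ι-sub : ∀ x y → ι (x F.- y) ≈ ι x - ι y
  ι-sub x y = trans (ι.+-homo x _) (+-congˡ (ι.-‿homo y))

  ι-≈0 : ∀ {x} → ι x ≈ 0# → x F.≈ F.0#
  ι-≈0 {x} eq with em {x F.≈ F.0#}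
  ... | yes p = p
  ... | no ¬p = ⊥-elim (1≉0 (begin
    1#                   ≈⟨ ι.1#-homo ⟨
    ι F.1#               ≈⟨ ι.⟦⟧-cong (F.*-inverse ¬p) ⟨
    ι (x F.* x F.⁻¹)     ≈⟨ ι.*-homo x _ ⟩
    ι x * ι (x F.⁻¹)     ≈⟨ *-congʳ eq ⟩
    0# * ι (x F.⁻¹)      ≈⟨ zeroˡ _ ⟩
    0#                   ∎))

  independent : ∀ {x y} → ι x + ι y * τ ≈ 0# → x F.≈ F.0# × y F.≈ F.0#
  independent {x} {y} eq with em {y F.≈ F.0#}
  ... | yes y≈0 = ι-≈0 (begin
    ι x               ≈⟨ +-identityʳ _ ⟨
    ι x + 0#          ≈⟨ +-congˡ (zeroˡ τ) ⟨
    ι x + 0# * τ      ≈⟨ +-congˡ (*-congʳ (trans (ι.⟦⟧-cong y≈0) ι.0#-homo)) ⟨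
    ι x + ι y * τ     ≈⟨ eq ⟩
    0#                ∎) , y≈0
  ... | no y≉0 = ⊥-elim (τ∉F (F.- x F.* y F.⁻¹) (*-cancelˡ (λ ιy≈0 → y≉0 (ι-≈0 ιy≈0)) (begin
    ι y * τ                               ≈⟨ solve 2 (λ x z → z := (x :+ z) :- x) refl (ι x) (ι y * τ) ⟩
    (ι x + ι y * τ) - ι x                 ≈⟨ +-congʳ eq ⟩
    0# - ι x                              ≈⟨ solve 1 (λ x → :0 :- x := (:- x) :* :1) refl (ι x) ⟩
    - ι x * 1#                            ≈⟨ *-congˡ (trans (sym ι.1#-homo) (trans (ι.⟦⟧-cong (F.sym (F.*-inverse y≉0))) (ι.*-homo y _))) ⟩
    - ι x * (ι y * ι (y F.⁻¹))            ≈⟨ solve 3 (λ x y w → (:- x) :* (y :* w) := y :* ((:- x) :* w)) refl (ι x) (ι y) (ι (y F.⁻¹)) ⟩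
    ι y * (- ι x * ι (y F.⁻¹))            ≈⟨ *-congˡ (*-congʳ (ι.-‿homo x)) ⟨
    ι y * (ι (F.- x) * ι (y F.⁻¹))        ≈⟨ *-congˡ (ι.*-homo _ _) ⟨
    ι y * ι (F.- x F.* y F.⁻¹)            ∎)))

  coordinates-unique : ∀ {x y x′ y′} → ι x + ι y * τ ≈ ι x′ + ι y′ * τ → x F.≈ x′ × y F.≈ y′
  coordinates-unique {x} {y} {x′} {y′} eq = FV.x-y≈0⇒x≈y (proj₁ zero-coords) , FV.x-y≈0⇒x≈y (proj₂ zero-coords)
    where
    zero-coords : x F.- x′ F.≈ F.0# × y F.- y′ F.≈ F.0#
    zero-coords = independent (begin
      ι (x F.- x′) + ι (y F.- y′) * τ          ≈⟨ +-cong (ι-sub x x′) (*-congʳ (ι-sub y y′)) ⟩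
      (ι x - ι x′) + (ι y - ι y′) * τ          ≈⟨ solve 5 (λ x x′ y y′ t → (x :- x′) :+ (y :- y′) :* t := (x :+ y :* t) :- (x′ :+ y′ :* t)) refl (ι x) (ι x′) (ι y) (ι y′) τ ⟩
      (ι x + ι y * τ) - (ι x′ + ι y′ * τ)      ≈⟨ x≈y⇒x-y≈0 eq ⟩
      0#                                       ∎)

  toF-≈ : ∀ {y x} → y ≈ ι x → toF y F.≈ x
  toF-≈ {y} {x} eq = F.sym (proj₁ (coordinates-unique (begin
    ι x + ι F.0# * τ                                   ≈⟨ +-congˡ (trans (*-congʳ ι.0#-homo) (zeroˡ τ)) ⟩
    ι x + 0#                                           ≈⟨ +-identityʳ _ ⟩
    ι x                                                ≈⟨ eq ⟨
    y                                                  ≈⟨ proj₂ (proj₂ (span y)) ⟩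
    ι (proj₁ (span y)) + ι (proj₁ (proj₂ (span y))) * τ ∎)))

  -- τ² = s τ − n, so that s and n are the trace and the norm of τ.
  s n : F.Carrier
  s = proj₁ (proj₂ (span (τ * τ)))
  n = F.- proj₁ (span (τ * τ))

  Q : F.Carrier → F.Carrier → F.Carrier
  Q x y = x F.* x F.+ s F.* x F.* y F.+ n F.* y F.* y

  τ² : τ * τ ≈ ι s * τ - ι n
  τ² = begin
    τ * τ                                            ≈⟨ proj₂ (proj₂ (span (τ * τ))) ⟩
    ι (proj₁ (span (τ * τ))) + ι s * τ               ≈⟨ solve 2 (λ x y → x :+ y := y :- (:- x)) refl (ι (proj₁ (span (τ * τ)))) (ι s * τ) ⟩
    ι s * τ - - ι (proj₁ (span (τ * τ)))             ≈⟨ +-congˡ (-‿cong (ι.-‿homo _)) ⟨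
    ι s * τ - ι n                                    ∎

  bar-expand : ∀ {x p r} → x ≈ ι p + ι r * τ → bar x ≈ ι p + ι r * bar τ
  bar-expand {x} {p} {r} eq = begin
    bar x                          ≈⟨ bar.⟦⟧-cong eq ⟩
    bar (ι p + ι r * τ)            ≈⟨ bar.+-homo _ _ ⟩
    bar (ι p) + bar (ι r * τ)      ≈⟨ +-cong (bar-ι p) (trans (bar.*-homo _ _) (*-congʳ (bar-ι r))) ⟩
    ι p + ι r * bar τ              ∎

  -- The conjugation is determined by its value at τ, and it is nontrivial. In every characteristic
  -- this is the nonvanishing of the discriminant.
  τ≉barτ : τ - bar τ ≉ 0#
  τ≉barτ eq = proj₂ bar-nontrivial (begin
    bar x                    ≈⟨ bar-expand (proj₂ (proj₂ (span x))) ⟩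
    ι _ + ι _ * bar τ        ≈⟨ +-congˡ (*-congˡ (x-y≈0⇒x≈y eq)) ⟨
    ι _ + ι _ * τ            ≈⟨ proj₂ (proj₂ (span x)) ⟨
    x                        ∎)
    where
    x : Carrier
    x = proj₁ bar-nontrivial

  -- τ and its conjugate are both roots of X² - s X + n, and they are distinct; subtracting the two
  -- equations and dividing by τ - bar τ gives the sum of the roots.
  trace-τ : τ + bar τ ≈ ι s
  trace-τ = x-y≈0⇒x≈y (*-zero-cancel τ≉barτ (begin
    (τ - bar τ) * ((τ + bar τ) - ι s)                            ≈⟨ solve 3 (λ t u s → (t :- u) :* ((t :+ u) :- s) := (t :* t :- s :* t) :- (u :* u :- s :* u)) refl τ (bar τ) (ι s) ⟩
    (τ * τ - ι s * τ) - (bar τ * bar τ - ι s * bar τ)            ≈⟨ +-cong (+-congʳ τ²) (-‿cong (+-congʳ bar-τ²)) ⟩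
    (ι s * τ - ι n - ι s * τ) - (ι s * bar τ - ι n - ι s * bar τ) ≈⟨ solve 3 (λ a b c → ((a :- c) :- a) :- ((b :- c) :- b) := :0) refl (ι s * τ) (ι s * bar τ) (ι n) ⟩
    0#                                                           ∎))
    where
    bar-τ² : bar τ * bar τ ≈ ι s * bar τ - ι n
    bar-τ² = begin
      bar τ * bar τ             ≈⟨ bar.*-homo τ τ ⟨
      bar (τ * τ)               ≈⟨ bar.⟦⟧-cong τ² ⟩
      bar (ι s * τ - ι n)       ≈⟨ bar.+-homo _ _ ⟩
      bar (ι s * τ) + bar (- ι n) ≈⟨ +-cong (trans (bar.*-homo _ _) (*-congʳ (bar-ι s))) (trans (bar.-‿homo _) (-‿cong (bar-ι n))) ⟩
      ι s * bar τ - ι n         ∎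

  norm-τ : τ * bar τ ≈ ι n
  norm-τ = begin
    τ * bar τ                     ≈⟨ solve 2 (λ t u → t :* u := (t :+ u) :* t :- t :* t) refl τ (bar τ) ⟩
    (τ + bar τ) * τ - τ * τ       ≈⟨ +-cong (*-congʳ trace-τ) (-‿cong τ²) ⟩
    ι s * τ - (ι s * τ - ι n)     ≈⟨ solve 2 (λ a b → a :- (a :- b) := b) refl (ι s * τ) (ι n) ⟩
    ι n                           ∎

  norm-expand : ∀ {x p r} → x ≈ ι p + ι r * τ → x * bar x ≈ ι (Q p r)
  norm-expand {x} {p} {r} eq = begin
    x * bar x                                               ≈⟨ *-cong eq (bar-expand eq) ⟩
    (ι p + ι r * τ) * (ι p + ι r * bar τ)                   ≈⟨ solve 4 (λ p r t u → (p :+ r :* t) :* (p :+ r :* u) := p :* p :+ (t :+ u) :* p :* r :+ (t :* u) :* r :* r) refl (ι p) (ι r) τ (bar τ) ⟩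
    ι p * ι p + (τ + bar τ) * ι p * ι r + (τ * bar τ) * ι r * ι r ≈⟨ +-cong (+-congˡ (*-congʳ (*-congʳ trace-τ))) (*-congʳ (*-congʳ norm-τ)) ⟩
    ι p * ι p + ι s * ι p * ι r + ι n * ι r * ι r           ≈⟨ +-cong (+-cong (ι.*-homo p p) (ι-*₃ s p r)) (ι-*₃ n r r) ⟨
    ι (p F.* p) + ι (s F.* p F.* r) + ι (n F.* r F.* r)     ≈⟨ trans (ι.+-homo _ _) (+-congʳ (ι.+-homo _ _)) ⟨
    ι (Q p r)                                               ∎
    where
    ι-*₃ : ∀ x y z → ι (x F.* y F.* z) ≈ ι x * ι y * ι z
    ι-*₃ x y z = trans (ι.*-homo _ _) (*-congʳ (ι.*-homo _ _))

  Norm-≈ : ∀ {x p r} → x ≈ ι p + ι r * τ → Norm x F.≈ Q p r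
  Norm-≈ eq = toF-≈ (norm-expand eq)

  bar-≈0 : ∀ {x} → bar x ≈ 0# → x ≈ 0#
  bar-≈0 {x} eq = bar.injective (trans eq (sym bar.0#-homo))

  -- Q is the norm of p + r τ, a product of two elements of the field E. All compactness modulo T
  -- rests on this.
  Q-anisotropic : ∀ {p r} → Q p r F.≈ F.0# → p F.≈ F.0# × r F.≈ F.0#
  Q-anisotropic {p} {r} eq with em {ι p + ι r * τ ≈ 0#}
  ... | yes x≈0 = independent x≈0
  ... | no  x≉0 = independent (bar-≈0 (*-zero-cancel x≉0
        (trans (norm-expand refl) (trans (ι.⟦⟧-cong eq) ι.0#-homo))))

  -- Minus the discriminant of the minimal polynomial of τ. Its absolute value enters the transfer
  -- factor, hence the constant c.
  D : F.Carrier
  D = Norm (τ - bar τ)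

  private
    ι-D : (τ - bar τ) * bar (τ - bar τ) ≈ ι D
    ι-D = trans norm (ι.⟦⟧-cong (F.sym (toF-≈ norm)))
      where
      norm = norm-expand (proj₂ (proj₂ (span (τ - bar τ))))

  D≉0 : D F.≉ F.0#
  D≉0 eq = *-≉0 τ≉barτ (λ b → τ≉barτ (bar-≈0 b)) (trans ι-D (trans (ι.⟦⟧-cong eq) ι.0#-homo))

  -- For γ = a + c τ the difference γ - bar γ is c (τ - bar τ), so the transfer factor depends on
  -- the torus element only through its lower left entry c.
  module Difference {γ a c} (eq : γ ≈ ι a + ι c * τ) where
    δ : Carrier
    δ = γ - bar γ

    δ≈ : δ ≈ ι c * (τ - bar τ)
    δ≈ = trans (+-cong eq (-‿cong (bar-expand eq)))
      (solve 4 (λ a c t u → (a :+ c :* t) :- (a :+ c :* u) := c :* (t :- u)) refl (ι a) (ι c) τ (bar τ))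

    ratio : toF (δ * (τ - bar τ) ⁻¹) F.≈ c
    ratio = toF-≈ (begin
      δ * (τ - bar τ) ⁻¹                       ≈⟨ *-congʳ δ≈ ⟩
      ι c * (τ - bar τ) * (τ - bar τ) ⁻¹       ≈⟨ *-assoc _ _ _ ⟩
      ι c * ((τ - bar τ) * (τ - bar τ) ⁻¹)     ≈⟨ *-congˡ (*-inverse τ≉barτ) ⟩
      ι c * 1#                                 ≈⟨ *-identityʳ _ ⟩
      ι c                                      ∎)

    norm-δ : Norm δ F.≈ c F.* c F.* D
    norm-δ = toF-≈ (begin
      δ * bar δ                                                ≈⟨ *-cong δ≈ (trans (bar.⟦⟧-cong δ≈) (trans (bar.*-homo _ _) (*-congʳ (bar-ι c)))) ⟩
      (ι c * (τ - bar τ)) * (ι c * bar (τ - bar τ))            ≈⟨ solve 3 (λ c d e → (c :* d) :* (c :* e) := (c :* c) :* (d :* e)) refl (ι c) (τ - bar τ) (bar (τ - bar τ)) ⟩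
      (ι c * ι c) * ((τ - bar τ) * bar (τ - bar τ))            ≈⟨ *-cong (sym (ι.*-homo c c)) ι-D ⟩
      ι (c F.* c) * ι D                                        ≈⟨ ι.*-homo _ _ ⟨
      ι (c F.* c F.* D)                                        ∎)

  second-column : ∀ {γ a b c d} → γ ≈ ι a + ι c * τ → γ * τ ≈ ι b + ι d * τ →
                  b F.≈ F.- (c F.* n) × d F.≈ a F.+ c F.* s
  second-column {γ} {a} {b} {c} {d} eq₁ eq₂ = coordinates-unique (begin
    ι b + ι d * τ                                     ≈⟨ eq₂ ⟨
    γ * τ                                             ≈⟨ *-congʳ eq₁ ⟩
    (ι a + ι c * τ) * τ                               ≈⟨ solve 3 (λ a c t → (a :+ c :* t) :* t := a :* t :+ c :* (t :* t)) refl (ι a) (ι c) τ ⟩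
    ι a * τ + ι c * (τ * τ)                           ≈⟨ +-congˡ (*-congˡ τ²) ⟩
    ι a * τ + ι c * (ι s * τ - ι n)                   ≈⟨ solve 5 (λ a c s n t → a :* t :+ c :* (s :* t :- n) := :- (c :* n) :+ (a :+ c :* s) :* t) refl (ι a) (ι c) (ι s) (ι n) τ ⟩
    - (ι c * ι n) + (ι a + ι c * ι s) * τ             ≈⟨ +-cong (-‿cong (sym (ι.*-homo c n))) (*-congʳ (+-congˡ (sym (ι.*-homo c s)))) ⟩
    - ι (c F.* n) + (ι a + ι (c F.* s)) * τ           ≈⟨ +-cong (sym (ι.-‿homo _)) (*-congʳ (sym (ι.+-homo _ _))) ⟩
    ι (F.- (c F.* n)) + ι (a F.+ c F.* s) * τ         ∎)

-- Coordinates on the quotient of SL(2,F) by T.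

module TorusQuotient (em : ExcludedMiddle 0ℓ) (ℝ : RealField) (F : LocalField)
                     (E : SeparableQuadraticExtension F) where
  open LocalField F hiding (zero)
  open GroupSpaces em F
  open NormForm em F E using (s; n; Q; second-column)
  open OrbitalIntegrals ℝ F E hiding (F-space; 𝟙; χ; Fˣ; QuadraticCharacter)
  open SetoidReasoning setoid

  Q-cong : ∀ {x y x′ y′} → x ≈ x′ → y ≈ y′ → Q x y ≈ Q x′ y′
  Q-cong p r = +-cong (+-cong (*-cong p p) (*-cong (*-congˡ p) r)) (*-cong (*-congˡ r) r)

  -- The matrix x⁻¹ Θ x, where Θ is the multiplication by τ, has entries
  -- pc x , bc x , rc x , s − pc x.
  pc bc rc : SL2 → Carrier
  pc x = - (n * c x * d x) - b x * (a x + s * c x)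
  bc x = - Q (b x) (d x)
  rc x = Q (a x) (c x)

  det-value : ∀ x → a x * d x ≈ 1# + b x * c x
  det-value x = trans (solve 2 (λ p r → p := (p :- r) :+ r) refl (a x * d x) (b x * c x)) (+-congʳ (det x))

  module TorusElement (t : T) where
    ta tc : Carrier
    ta = a (T.t t)
    tc = c (T.t t)

    columns : b (T.t t) ≈ - (tc * n) × d (T.t t) ≈ ta + tc * s
    columns = second-column (proj₁ (T.represents t)) (proj₂ (T.represents t))

    Q-one : Q ta tc ≈ 1#
    Q-one = begin
      Q ta tc                                        ≈⟨ solve 4 (λ a c s n → a :* a :+ s :* a :* c :+ n :* c :* c := a :* (a :+ c :* s) :- (:- (c :* n)) :* c) refl ta tc s n ⟩
      ta * (ta + tc * s) - (- (tc * n)) * tc         ≈⟨ +-cong (*-congˡ (proj₂ columns)) (-‿cong (*-congʳ (proj₁ columns))) ⟨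
      a (T.t t) * d (T.t t) - b (T.t t) * c (T.t t)  ≈⟨ det (T.t t) ⟩
      1#                                             ∎

    private
      top : ∀ y w → ta * y + b (T.t t) * w ≈ ta * y + - (tc * n) * w
      top y w = +-congˡ (*-congʳ (proj₁ columns))
      bot : ∀ y w → tc * y + d (T.t t) * w ≈ tc * y + (ta + tc * s) * w
      bot y w = +-congˡ (*-congʳ (proj₂ columns))

      -- Multiplicativity of the norm: a torus element acts on a column as multiplication by an
      -- element of E of norm 1.
      Q-mult : ∀ y w → Q (ta * y + b (T.t t) * w) (tc * y + d (T.t t) * w) ≈ Q y w
      Q-mult y w = begin
        Q (ta * y + b (T.t t) * w) (tc * y + d (T.t t) * w)      ≈⟨ Q-cong (top y w) (bot y w) ⟩
        Q (ta * y + - (tc * n) * w) (tc * y + (ta + tc * s) * w) ≈⟨ solve 6 (λ a c y w s n →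
             let X = a :* y :+ (:- (c :* n)) :* w
                 Y = c :* y :+ (a :+ c :* s) :* w
             in X :* X :+ s :* X :* Y :+ n :* Y :* Y :=
                (a :* a :+ s :* a :* c :+ n :* c :* c) :* (y :* y :+ s :* y :* w :+ n :* w :* w)) refl ta tc y w s n ⟩
        Q ta tc * Q y w                                          ≈⟨ *-congʳ Q-one ⟩
        1# * Q y w                                               ≈⟨ *-identityˡ _ ⟩
        Q y w                                                    ∎

    bc-invariant : ∀ x → bc (T.t t · x) ≈ bc x
    bc-invariant x = -‿cong (Q-mult (b x) (d x))

    rc-invariant : ∀ x → rc (T.t t · x) ≈ rc x
    rc-invariant x = Q-mult (a x) (c x)

    pc-invariant : ∀ x → pc (T.t t · x) ≈ pc x
    pc-invariant x = begin
      pc (T.t t · x)  ≈⟨ +-cong (-‿cong (*-cong (*-congˡ (bot (a x) (c x))) (bot (b x) (d x))))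
                                (-‿cong (*-cong (top (b x) (d x)) (+-cong (top (a x) (c x)) (*-congˡ (bot (a x) (c x)))))) ⟩
      _               ≈⟨ solve 8 (λ A C s n α β γ δ →
             let X  = A :* α :+ (:- (C :* n)) :* γ
                 Y  = C :* α :+ (A :+ C :* s) :* γ
                 X′ = A :* β :+ (:- (C :* n)) :* δ
                 Y′ = C :* β :+ (A :+ C :* s) :* δ
             in :- (n :* Y :* Y′) :- X′ :* (X :+ s :* Y) :=
                (A :* A :+ s :* A :* C :+ n :* C :* C) :* (:- (n :* γ :* δ) :- β :* (α :+ s :* γ)))
             refl ta tc s n (a x) (b x) (c x) (d x) ⟩
      Q ta tc * pc x  ≈⟨ *-congʳ Q-one ⟩
      1# * pc x       ≈⟨ *-identityˡ _ ⟩
      pc x            ∎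

    conj-b : ∀ x → b (inv x · T.t t · x) ≈ tc * bc x
    conj-b x = begin
      b (inv x · T.t t · x)  ≈⟨ solve 6 (λ A B C D β δ → (δ :* A :+ (:- β) :* C) :* β :+ (δ :* B :+ (:- β) :* D) :* δ
                                  := δ :* A :* β :- β :* C :* β :+ δ :* B :* δ :- β :* D :* δ)
                                  refl ta (b (T.t t)) tc (d (T.t t)) (b x) (d x) ⟩
      _                      ≈⟨ +-cong (+-congˡ (*-congʳ (*-congˡ (proj₁ columns)))) (-‿cong (*-congʳ (*-congˡ (proj₂ columns)))) ⟩
      _                      ≈⟨ solve 6 (λ A C s n β δ → δ :* A :* β :- β :* C :* β :+ δ :* (:- (C :* n)) :* δ :- β :* (A :+ C :* s) :* δ
                                  := C :* (:- (β :* β :+ s :* β :* δ :+ n :* δ :* δ))) refl ta tc s n (b x) (d x) ⟩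
      tc * bc x              ∎

    conj-c : ∀ x → c (inv x · T.t t · x) ≈ tc * rc x
    conj-c x = begin
      c (inv x · T.t t · x)  ≈⟨ solve 6 (λ A B C D α γ → ((:- γ) :* A :+ α :* C) :* α :+ ((:- γ) :* B :+ α :* D) :* γ
                                  := α :* C :* α :- γ :* A :* α :- γ :* B :* γ :+ α :* D :* γ)
                                  refl ta (b (T.t t)) tc (d (T.t t)) (a x) (c x) ⟩
      _                      ≈⟨ +-cong (+-congˡ (-‿cong (*-congʳ (*-congˡ (proj₁ columns))))) (*-congʳ (*-congˡ (proj₂ columns))) ⟩
      _                      ≈⟨ solve 6 (λ A C s n α γ → α :* C :* α :- γ :* A :* α :- γ :* (:- (C :* n)) :* γ :+ α :* (A :+ C :* s) :* γ
                                  := C :* (α :* α :+ s :* α :* γ :+ n :* γ :* γ)) refl ta tc s n (a x) (c x) ⟩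
      tc * rc x              ∎

    conj-a : ∀ x → a (inv x · T.t t · x) ≈ ta + tc * pc x
    conj-a x = begin
      a (inv x · T.t t · x)  ≈⟨ solve 8 (λ A B C D α β γ δ → (δ :* A :+ (:- β) :* C) :* α :+ (δ :* B :+ (:- β) :* D) :* γ
                                  := A :* (α :* δ) :- β :* C :* α :+ δ :* B :* γ :- β :* D :* γ)
                                  refl ta (b (T.t t)) tc (d (T.t t)) (a x) (b x) (c x) (d x) ⟩
      _                      ≈⟨ +-cong (+-cong (+-congʳ (*-congˡ (det-value x))) (*-congʳ (*-congˡ (proj₁ columns)))) (-‿cong (*-congʳ (*-congˡ (proj₂ columns)))) ⟩
      _                      ≈⟨ solve 8 (λ A C s n α β γ δ → A :* (:1 :+ β :* γ) :- β :* C :* α :+ δ :* (:- (C :* n)) :* γ :- β :* (A :+ C :* s) :* γ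
                                  := A :+ C :* (:- (n :* γ :* δ) :- β :* (α :+ s :* γ))) refl ta tc s n (a x) (b x) (c x) (d x) ⟩
      ta + tc * pc x         ∎

    conj-d : ∀ x → d (inv x · T.t t · x) ≈ ta + tc * (s - pc x)
    conj-d x = begin
      d (inv x · T.t t · x)  ≈⟨ solve 8 (λ A B C D α β γ δ → ((:- γ) :* A :+ α :* C) :* β :+ ((:- γ) :* B :+ α :* D) :* δ
                                  := D :* (α :* δ) :- γ :* A :* β :+ α :* C :* β :- γ :* B :* δ)
                                  refl ta (b (T.t t)) tc (d (T.t t)) (a x) (b x) (c x) (d x) ⟩
      _                      ≈⟨ +-cong (+-congʳ (+-congʳ (*-cong (proj₂ columns) (det-value x)))) (-‿cong (*-congʳ (*-congˡ (proj₁ columns)))) ⟩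
      _                      ≈⟨ solve 8 (λ A C s n α β γ δ → (A :+ C :* s) :* (:1 :+ β :* γ) :- γ :* A :* β :+ α :* C :* β :- γ :* (:- (C :* n)) :* δ
                                  := A :+ C :* (s :- (:- (n :* γ :* δ) :- β :* (α :+ s :* γ)))) refl ta tc s n (a x) (b x) (c x) (d x) ⟩
      ta + tc * (s - pc x)   ∎

  -- x⁻¹ Θ x has trace s and determinant n, like Θ, so p (s - p) - b r = n. Since b is never 0, r is
  -- a function of p and b.
  bc*-rc : ∀ x → bc x * - rc x ≈ Q (- pc x) 1#
  bc*-rc x = begin
    bc x * - rc x
      ≈⟨ solve 6 (λ s n α β γ δ →
          (:- (β :* β :+ s :* β :* δ :+ n :* δ :* δ)) :* (:- (α :* α :+ s :* α :* γ :+ n :* γ :* γ)) :=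
          (let p = :- (n :* γ :* δ) :- β :* (α :+ s :* γ) ; Δ = α :* δ :- β :* γ
           in (:- p) :* (:- p) :+ s :* (:- p) :* Δ :+ n :* Δ :* Δ)) refl s n (a x) (b x) (c x) (d x) ⟩
    Q (- pc x) (a x * d x - b x * c x)
      ≈⟨ Q-cong refl (det x) ⟩
    Q (- pc x) 1# ∎

  -- On (p , b) the elements `lower y`, `diag α` and `weyl` act on the right by (p + y b , b), (p ,
  -- α² b) and (s - p , Q(- p , 1) / b). The first moves p at will, the other two move b within its
  -- class modulo norms.
  lower : Carrier → SL2
  lower y = mat 1# 0# y 1# (solve 1 (λ y → :1 :* :1 :- :0 :* y := :1) refl y)

  diag : ∀ α → α ≉ 0# → SL2
  diag α α≉0 = mat (α ⁻¹) 0# 0# α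
    (trans (solve 2 (λ x y → x :* y :- :0 :* :0 := y :* x) refl (α ⁻¹) α) (*-inverse α≉0))

  weyl : SL2
  weyl = mat 0# 1# (- 1#) 0# (solve 0 (:0 :* :0 :- :1 :* (:- :1) := :1) refl)

  pc-lower : ∀ y x → pc (x · lower y) ≈ pc x + y * bc x
  pc-lower y x = solve 7 (λ s n y α β γ δ →
      let α′ = α :* :1 :+ β :* y ; β′ = α :* :0 :+ β :* :1 ; γ′ = γ :* :1 :+ δ :* y ; δ′ = γ :* :0 :+ δ :* :1
      in :- (n :* γ′ :* δ′) :- β′ :* (α′ :+ s :* γ′) :=
         (:- (n :* γ :* δ) :- β :* (α :+ s :* γ)) :+ y :* (:- (β :* β :+ s :* β :* δ :+ n :* δ :* δ)))
    refl s n y (a x) (b x) (c x) (d x)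

  bc-lower : ∀ y x → bc (x · lower y) ≈ bc x
  bc-lower y x = -‿cong (Q-cong (solve 2 (λ α β → α :* :0 :+ β :* :1 := β) refl (a x) (b x))
                                (solve 2 (λ α β → α :* :0 :+ β :* :1 := β) refl (c x) (d x)))

  bc-diag : ∀ α α≉0 x → bc (x · diag α α≉0) ≈ α * α * bc x
  bc-diag α α≉0 x = solve 7 (λ s n e α β γ δ →
      let β′ = α :* :0 :+ β :* e ; δ′ = γ :* :0 :+ δ :* e
      in :- (β′ :* β′ :+ s :* β′ :* δ′ :+ n :* δ′ :* δ′) := e :* e :* (:- (β :* β :+ s :* β :* δ :+ n :* δ :* δ)))
    refl s n α (a x) (b x) (c x) (d x)

  pc-diag : ∀ α α≉0 x → pc (x · diag α α≉0) ≈ pc x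
  pc-diag α α≉0 x = begin
    pc (x · diag α α≉0)  ≈⟨ solve 8 (λ s n e e′ α β γ δ →
        let α′ = α :* e′ :+ β :* :0 ; β′ = α :* :0 :+ β :* e ; γ′ = γ :* e′ :+ δ :* :0 ; δ′ = γ :* :0 :+ δ :* e
        in :- (n :* γ′ :* δ′) :- β′ :* (α′ :+ s :* γ′) := (e :* e′) :* (:- (n :* γ :* δ) :- β :* (α :+ s :* γ)))
        refl s n α (α ⁻¹) (a x) (b x) (c x) (d x) ⟩
    (α * α ⁻¹) * pc x    ≈⟨ *-congʳ (*-inverse α≉0) ⟩
    1# * pc x            ≈⟨ *-identityˡ _ ⟩
    pc x                 ∎

  bc-weyl : ∀ x → bc (x · weyl) ≈ - rc x
  bc-weyl x = -‿cong (Q-cong (solve 2 (λ α β → α :* :1 :+ β :* :0 := α) refl (a x) (b x))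
                             (solve 2 (λ α β → α :* :1 :+ β :* :0 := α) refl (c x) (d x)))

  pc-weyl : ∀ x → pc (x · weyl) ≈ s - pc x
  pc-weyl x = begin
    pc (x · weyl)  ≈⟨ solve 6 (λ s n α β γ δ →
        let α′ = α :* :0 :+ β :* (:- :1) ; β′ = α :* :1 :+ β :* :0 ; γ′ = γ :* :0 :+ δ :* (:- :1) ; δ′ = γ :* :1 :+ δ :* :0
        in :- (n :* γ′ :* δ′) :- β′ :* (α′ :+ s :* γ′) :=
           s :* (α :* δ :- β :* γ) :- (:- (n :* γ :* δ) :- β :* (α :+ s :* γ)))
        refl s n (a x) (b x) (c x) (d x) ⟩
    s * (a x * d x - b x * c x) - pc x  ≈⟨ +-congʳ (trans (*-congˡ (det x)) (*-identityʳ s)) ⟩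
    s - pc x       ∎

  T\G-near : NearStructure T\G-space
  T\G-near = record
    { Near      = NearG
    ; near-mono = λ {m} {n} {x} {y} → nearG-mono {m} {n} {x} {y}
    ; _~_       = λ x y → ∃ λ (t : T) → y ≡ T.t t · x
    ; open⇒near = proj₁
    ; open⇒~    = λ { (_ , inv) {x} (t , ≡.refl) → Equivalence.to (inv t x) }
    ; mkOpen    = λ near inv → near , λ t x → inv (t , ≡.refl)
    }

  B-compact : ∀ N → Compact T\G-space (B N)
  B-compact N U U-open = G-compact N U (λ i → proj₁ (U-open i))

  open Continuity F NearG (λ {m} {n} {x} {y} → nearG-mono {m} {n} {x} {y}) public

  cont-a : Cont a
  cont-a x n = n , λ y (p , _) → p
  cont-b : Cont b
  cont-b x n = n , λ y (_ , p , _) → p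
  cont-c : Cont c
  cont-c x n = n , λ y (_ , _ , p , _) → p
  cont-d : Cont d
  cont-d x n = n , λ y (_ , _ , _ , p) → p

  cont-Q : ∀ {e f} → Cont e → Cont f → Cont (λ x → Q (e x) (f x))
  cont-Q ce cf = cont-+ (cont-+ (cont-* ce ce) (cont-* (cont-* (cont-const s) ce) cf)) (cont-* (cont-* (cont-const n) cf) cf)

  cont-bc : Cont bc
  cont-bc = cont-neg (cont-Q cont-b cont-d)

  cont-pc : Cont pc
  cont-pc = cont-+ (cont-neg (cont-* (cont-* (cont-const n) cont-c) cont-d))
                   (cont-neg (cont-* cont-b (cont-+ cont-a (cont-* (cont-const s) cont-c))))

-- Compactness of boxes in the coordinates p and b.

module NonVanishing (em : ExcludedMiddle 0ℓ) (F : LocalField) {A : Set} (Near : ℤ → A → A → Set)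
                    (near-mono : ∀ {m n x y} → m ℤ.≤ n → Near n x y → Near m x y) where
  open LocalField F hiding (zero)
  open Valuation F
  open Continuity F Near (λ {m} {n} {x} {y} → near-mono {m} {n} {x} {y})

  abstract
    -- At each point of C and S the finite valuation of e gives a bound valid nearby, and finitely
    -- many of these bounds suffice. The closed condition `S` is a premise inside the covering sets,
    -- so that points outside S are covered trivially.
    compact-avoid : ∀ {C S : Pred A 0ℓ} {e} → Compact (nearSpace A Near) C →
                    (∀ x → ∃ λ n → ∀ y → Near n x y → S y → S x) → Cont e →
                    (∀ x → C x → S x → e x ≉ 0#) → ∃ λ k → ∀ x → C x → S x → ¬ P k (e x)
    compact-avoid {C} {S} {e} comp S-local ce nonzero with comp U U-open cover
      where
      U : ℤ → Pred A 0ℓ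
      U k x = S x → ¬ P k (e x)
      U-open : ∀ k → Space.Open (nearSpace A Near) (U k)
      U-open k x ¬p = let m , near = ce x k ; n , back = S-local x in m ℤ.⊔ n , λ y nr s r →
        ¬p (back y (near-mono {n} {_} {x} {y} (ℤ.i≤j⊔i m n) nr) s)
          (P-resp {k} (solve 2 (λ x y → (x :- y) :+ y := x) refl (e x) (e y)) (P-+ (near y (near-mono {m} {_} {x} {y} (ℤ.i≤i⊔j m n) nr)) r))
      cover : ∀ x → C x → ∃ λ k → U k x
      cover x x∈C = cases em
        where
        cases : Dec (S x) → ∃ λ k → U k x
        cases (yes s) = let k , vk = val-exists (nonzero x x∈C s) in k ℤ.+ 1ℤ , λ _ p → i+1≰i (P-val vk p)
        cases (no ¬s) = 0ℤ , λ s → ⊥-elim (¬s s)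
    ... | ks , p = max ks , λ x x∈C s → below ks s (p x x∈C)
      where
      max : List ℤ → ℤ
      max []       = 0ℤ
      max (k ∷ ks) = k ℤ.⊔ max ks
      below : ∀ ks {x} → S x → Any (λ k → S x → ¬ P k (e x)) ks → ¬ P (max ks) (e x)
      below (k ∷ ks) s (here ¬p) r = ¬p s (P-mono (ℤ.i≤i⊔j k (max ks)) r)
      below (k ∷ ks) s (there p) r = below ks s p (P-mono (ℤ.i≤j⊔i k (max ks)) r)

-- A crude lower bound for k / 2, sufficient because only the existence of some bound matters.
half : ℤ → ℤ
half k = ℤ.- + ℤ.∣ k ∣

half-≤ : ∀ {k i} → k ℤ.≤ i ℤ.+ i → half k ℤ.≤ i
half-≤ {k} {+ i}      _ = ℤ.≤-trans (ℤ.neg-≤-pos {ℤ.∣ k ∣} {0}) (ℤ.+≤+ ℕ.z≤n)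
half-≤ {+ k} { -[1+ i ]} ()
half-≤ { -[1+ k ]} { -[1+ i ]} (ℤ.-≤- p) = ℤ.-≤- (ℕ.≤-trans (ℕ.m≤m+n i i) (ℕ.≤-trans (ℕ.n≤1+n _) p))

module Boxes (em : ExcludedMiddle 0ℓ) (ℝ : RealField) (F : LocalField)
             (E : SeparableQuadraticExtension F) where
  open LocalField F hiding (zero)
  open GroupSpaces em F
  open NormForm em F E using (s; n; Q; Q-anisotropic)
  open TorusQuotient em ℝ F E
  open OrbitalIntegrals ℝ F E hiding (F-space; 𝟙; χ; Fˣ; QuadraticCharacter)
  open TestFunctions em ℝ
  open OnSpace T\G-near public
  open SetoidReasoning setoid
  private
    module ℝ = RealField ℝ

  private
    module C₁ = Continuity F NearF (λ {m} {n} {x} {y} → nearF-mono {m} {n} {x} {y})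

    cont-id : C₁.Cont (λ x → x)
    cont-id x n = n , λ y p → p

    cont-Q₁ : ∀ {e f} → C₁.Cont e → C₁.Cont f → C₁.Cont (λ x → Q (e x) (f x))
    cont-Q₁ ce cf = C₁.cont-+ (C₁.cont-+ (C₁.cont-* ce ce) (C₁.cont-* (C₁.cont-* (C₁.cont-const s) ce) cf))
                              (C₁.cont-* (C₁.cont-* (C₁.cont-const n) cf) cf)

    open NonVanishing em F NearF (λ {m} {n} {x} {y} → nearF-mono {m} {n} {x} {y})

    abstract
     -- Anisotropy of Q and compactness of the ring of integers. Together with `away₂` this covers
     -- all vectors after division by the coordinate of smaller valuation.
     away₁ : ∃ λ k → ∀ x → P 0ℤ x → ¬ P k (Q x 1#)
     away₁ = let k , p = compact-avoid {S = λ _ → ⊤} (F-compact 0ℤ) (λ _ → 0ℤ , λ _ _ _ → tt) (cont-Q₁ cont-id (C₁.cont-const 1#))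
                   (λ x _ _ eq → 1≉0 (proj₂ (Q-anisotropic eq))) in k , λ x x∈O → p x x∈O tt

     away₂ : ∃ λ k → ∀ x → P 0ℤ x → ¬ P k (Q 1# x)
     away₂ = let k , p = compact-avoid {S = λ _ → ⊤} (F-compact 0ℤ) (λ _ → 0ℤ , λ _ _ _ → tt) (cont-Q₁ (C₁.cont-const 1#) cont-id)
                   (λ x _ _ eq → 1≉0 (proj₁ (Q-anisotropic eq))) in k , λ x x∈O → p x x∈O tt

  Q-scale : ∀ t x y → Q (t * x) (t * y) ≈ t * t * Q x y
  Q-scale t x y = solve 5 (λ s n t x y → (t :* x) :* (t :* x) :+ s :* (t :* x) :* (t :* y) :+ n :* (t :* y) :* (t :* y)
    := t :* t :* (x :* x :+ s :* x :* y :+ n :* y :* y)) refl s n t x y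

  cont-Q-1 : C₁.Cont (λ x → Q (- x) 1#)
  cont-Q-1 = cont-Q₁ (C₁.cont-neg cont-id) (C₁.cont-const 1#)

  private
    ratio : ∀ {x k} y → v x ≡ fin k → x * (x ⁻¹ * y) ≈ y
    ratio y vx = trans (sym (*-assoc _ _ _)) (trans (*-congʳ (*-inverse (val⇒≉0 vx))) (*-identityˡ y))

    -- The coordinate of smaller valuation controls Q.
    dominant : ∀ {x k A j Z} → v x ≡ fin k → ¬ P A Z → P j (x * x * Z) → half (j ℤ.- A) ℤ.≤ k
    dominant {x} {k} {A} {j} {Z} vx ¬p r with ≤-split (k ℤ.+ k) (j ℤ.- A)
    ... | inj₂ j-A≤2k = half-≤ j-A≤2k
    ... | inj₁ 2k<j-A = ⊥-elim (¬p (P-cancel (val-* vx vx) (P-mono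
          (≤-by₂ {c = k ℤ.+ k ℤ.+ 1ℤ} {d = j ℤ.- A} {e = 0ℤ} {f = 1ℤ} 2k<j-A (ℤ.+≤+ ℕ.z≤n)
            (ℤS.solve 3 (λ k j A → j ℤS.:- (k ℤS.:+ k ℤS.:+ A) ℤS.:=
               ((j ℤS.:- A) ℤS.:- (k ℤS.:+ k ℤS.:+ ℤS.con 1ℤ)) ℤS.:+ (ℤS.con 1ℤ ℤS.:- ℤS.con 0ℤ)) ≡.refl k j A)) r)))

    smaller : ∀ {x y k} → v x ≡ fin k → P k y → P 0ℤ (x ⁻¹ * y)
    smaller {k = k} vx p = P-cast (ℤ.+-inverseˡ k) (P-* (val⇒P (val-⁻¹ vx)) p)

  -- Dividing by the coordinate of smaller valuation makes the other one integral and Q bounded away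
  -- from 0, while Q scales by a square.
  Q-bounded : ∀ j → ∃ λ N → ∀ x y → P j (Q x y) → P N x × P N y
  Q-bounded j = N , bound
    where
    A₁ A₂ N : ℤ
    A₁ = proj₁ away₁
    A₂ = proj₁ away₂
    N  = half (j ℤ.- A₁) ℤ.⊓ half (j ℤ.- A₂)
    fromx : ∀ x y {k} → v x ≡ fin k → P k y → P j (Q x y) → P N x × P N y
    fromx x y {k} vx p r = P-mono N≤k (val⇒P vx) , P-mono N≤k p
      where
      N≤k : N ℤ.≤ k
      N≤k = ℤ.≤-trans (ℤ.i⊓j≤j (half (j ℤ.- A₁)) (half (j ℤ.- A₂)))
        (dominant {x} {k} {A₂} {j} {Q 1# (x ⁻¹ * y)} vx (proj₂ away₂ (x ⁻¹ * y) (smaller vx p))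
        (P-resp {j} {Q x y} {x * x * Q 1# (x ⁻¹ * y)}
          (trans (Q-cong (sym (*-identityʳ x)) (sym (ratio y vx))) (Q-scale x 1# (x ⁻¹ * y))) r))
    fromy : ∀ x y {k} → v y ≡ fin k → P k x → P j (Q x y) → P N x × P N y
    fromy x y {k} vy p r = P-mono N≤k p , P-mono N≤k (val⇒P vy)
      where
      N≤k : N ℤ.≤ k
      N≤k = ℤ.≤-trans (ℤ.i⊓j≤i (half (j ℤ.- A₁)) (half (j ℤ.- A₂)))
        (dominant {y} {k} {A₁} {j} {Q (y ⁻¹ * x) 1#} vy (proj₂ away₁ (y ⁻¹ * x) (smaller vy p))
        (P-resp {j} {Q x y} {y * y * Q (y ⁻¹ * x) 1#}
          (trans (Q-cong (sym (ratio x vy)) (sym (*-identityʳ y))) (Q-scale y (y ⁻¹ * x) 1#)) r))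
    bound : ∀ x y → P j (Q x y) → P N x × P N y
    bound x y r with em {x ≈ 0#} | em {y ≈ 0#}
    ... | yes x≈0 | yes y≈0 = P-≈0 x≈0 , P-≈0 y≈0
    ... | yes x≈0 | no  y≉0 = fromy x y (proj₂ (val-exists y≉0)) (P-≈0 x≈0) r
    ... | no  x≉0 | yes y≈0 = fromx x y (proj₂ (val-exists x≉0)) (P-≈0 y≈0) r
    ... | no  x≉0 | no  y≉0 with val-exists x≉0 | val-exists y≉0
    ...   | k , vx | l , vy with ℤ.≤-total k l
    ...     | inj₁ k≤l = fromx x y vx (P-mono k≤l (val⇒P vy)) r
    ...     | inj₂ l≤k = fromy x y vy (P-mono l≤k (val⇒P vx)) r

  abstract
    -- The norms of the two columns of x are r and - b, so bounding them bounds all entries. This is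
    -- how anisotropy of T yields compact supports on the quotient.
    bc-rc-bounded : ∀ j → ∃ λ N → ∀ x → P j (bc x) → P j (rc x) → B N x
    bc-rc-bounded j = let N , bound = Q-bounded j in N , λ x p r →
      let pb , pd = bound (b x) (d x) (P-resp (solve 1 (λ x → :- (:- x) := x) refl (Q (b x) (d x))) (P-neg p))
          pa , pc = bound (a x) (c x) r
      in pa , pb , pc , pd

  -- The second radius will always be k + m + 1 with k = v(b₀), so that v(b) = k on the whole box
  -- and m measures relative precision.
  Box : Carrier → ℤ → Carrier → ℤ → SL2 → Set
  Box p₀ e b₀ M x = P e (pc x - p₀) × P M (bc x - b₀)

  module _ (p₀ : Carrier) (e : ℤ) (b₀ : Carrier) {k : ℤ} (vb : v b₀ ≡ fin k) (m : ℕ) where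
    k<M : k ℤ.+ 1ℤ ℤ.≤ k ℤ.+ + suc m
    k<M = ℤ.+-monoʳ-≤ k (ℤ.+≤+ (ℕ.s≤s ℕ.z≤n))

    box-val : ∀ {y} → P (k ℤ.+ + suc m) (y - b₀) → v y ≡ fin k
    box-val p = val-near vb (P-swap p) k<M

    private
      -- b r = p (s - p) - n is bounded because p is, and b has the fixed valuation k.
      rc-bounded : ∃ λ j → ∀ x → Box p₀ e b₀ (k ℤ.+ + suc m) x → P j (rc x)
      rc-bounded =
        let l₁ , q₁ = P-exists p₀ ; l₂ , q₂ = P-exists s ; l₃ , q₃ = P-exists n
            l = (e ℤ.⊓ l₁) ℤ.⊓ l₂ ; i = (l ℤ.+ l) ℤ.⊓ l₃
        in ℤ.- k ℤ.+ i , λ x (p , r) →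
          let pp : P l (pc x)
              pp = P-mono (ℤ.i⊓j≤i (e ℤ.⊓ l₁) l₂) (P-resp (solve 2 (λ x y → (x :- y) :+ y := x) refl (pc x) p₀)
                     (P-+ (P-mono (ℤ.i⊓j≤i e l₁) p) (P-mono (ℤ.i⊓j≤j e l₁) q₁)))
              ps : P l (s - pc x)
              ps = P-- (P-mono (ℤ.i⊓j≤j (e ℤ.⊓ l₁) l₂) q₂) pp
              prod : P i (bc x * rc x)
              prod = P-resp (trans (solve 3 (λ p s n → p :* (s :- p) :- n := :- ((:- p) :* (:- p) :+ s :* (:- p) :* :1 :+ n :* :1 :* :1)) refl (pc x) s n)
                              (trans (-‿cong (sym (bc*-rc x))) (solve 2 (λ b r → :- (b :* (:- r)) := b :* r) refl (bc x) (rc x))))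
                       (P-- (P-mono (ℤ.i⊓j≤i (l ℤ.+ l) l₃) (P-* pp ps)) (P-mono (ℤ.i⊓j≤j (l ℤ.+ l) l₃) q₃))
          in P-cancel (box-val r) (P-cast (ℤS.solve 2 (λ k i → i ℤS.:= k ℤS.:+ (ℤS.:- k ℤS.:+ i)) ≡.refl k i) prod)

      support : ∃ λ N → ∀ x → Box p₀ e b₀ (k ℤ.+ + suc m) x → B N x
      support = let j , pr = rc-bounded ; N , pB = bc-rc-bounded (j ℤ.⊓ k) in N , λ x bx →
        pB x (P-mono (ℤ.i⊓j≤j j k) (val⇒P (box-val (proj₂ bx)))) (P-mono (ℤ.i⊓j≤i j k) (pr x bx))

    abstract
      box : Cc∞ T\G-space ℝ.rawRing
      box = mkCc (λ x → 𝟏 (Box p₀ e b₀ (k ℤ.+ + suc m) x))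
        (smooth-𝟏
          (λ x → let m₁ , near₁ = cont-ball cont-pc e p₀ x ; m₂ , near₂ = cont-ball cont-bc (k ℤ.+ + suc m) b₀ x
                 in m₁ ℤ.⊔ m₂ , λ y near →
                    let f₁ , g₁ = near₁ y (nearG-mono {x = x} {y} (ℤ.i≤i⊔j m₁ m₂) near)
                        f₂ , g₂ = near₂ y (nearG-mono {x = x} {y} (ℤ.i≤j⊔i m₁ m₂) near)
                    in (λ (p , r) → f₁ p , f₂ r) , (λ (p , r) → g₁ p , g₂ r))
          (λ { {x} (t , ≡.refl) →
             let open TorusElement t
             in (λ (p , r) → P-resp (+-congʳ (sym (pc-invariant x))) p , P-resp (+-congʳ (sym (bc-invariant x))) r) ,
                (λ (p , r) → P-resp (+-congʳ (pc-invariant x)) p , P-resp (+-congʳ (bc-invariant x)) r) }))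
        (B (proj₁ support) , B-compact _ , λ x nz → proj₂ support x (𝟏≉0 nz))

      box-fun : ∀ x → fun box x ℝ.≈ 𝟏 (Box p₀ e b₀ (k ℤ.+ + suc m) x)
      box-fun x = ℝ.refl

  box-≈ : ∀ p₀ e b₀ {k} (vb : v b₀ ≡ fin k) m p₁ e₁ b₁ {l} (vb₁ : v b₁ ≡ fin l) m₁ x y →
          (Box p₀ e b₀ (k ℤ.+ + suc m) x → Box p₁ e₁ b₁ (l ℤ.+ + suc m₁) y) →
          (Box p₁ e₁ b₁ (l ℤ.+ + suc m₁) y → Box p₀ e b₀ (k ℤ.+ + suc m) x) →
          fun (box p₀ e b₀ vb m) x ℝ.≈ fun (box p₁ e₁ b₁ vb₁ m₁) y
  box-≈ p₀ e b₀ vb m p₁ e₁ b₁ vb₁ m₁ x y to from =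
    ℝ.trans (box-fun p₀ e b₀ vb m x) (ℝ.trans (𝟏-cong to from) (ℝ.sym (box-fun p₁ e₁ b₁ vb₁ m₁ y)))

-- Volumes of boxes from right invariance.

module Volumes (em : ExcludedMiddle 0ℓ) (ℝ : RealField) (F : LocalField) (E : SeparableQuadraticExtension F)
               (dx : Integration.Measure ℝ (OrbitalIntegrals.T\G-space ℝ F E))
               (dx-invariant : OrbitalIntegrals.IsInvariantT\G ℝ F E dx) where
  open LocalField F hiding (zero)
  open GroupSpaces em F
  open NormForm em F E using (s; n; Q; Q-anisotropic)
  open TorusQuotient em ℝ F E
  open OrbitalIntegrals ℝ F E hiding (F-space; 𝟙; χ; Fˣ; QuadraticCharacter)
  open TestFunctions em ℝ
  open Boxes em ℝ F E
  open Integrals dx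
  open Measure dx using (∫)
  private
    module ℝ = RealField ℝ
    module R = RealLemmas em ℝ
    module PW = R.Powers q 2≤q

  vol : Carrier → ℤ → (b₀ : Carrier) {k : ℤ} → v b₀ ≡ fin k → ℕ → ℝ.Carrier
  vol p₀ e b₀ vb m = ∫ (box p₀ e b₀ vb m)

  vol-cong : ∀ {p₀ p₁ b₀ b₁ k l} e (vb₀ : v b₀ ≡ fin k) (vb₁ : v b₁ ≡ fin l) m → p₀ ≈ p₁ → b₀ ≈ b₁ →
             vol p₀ e b₀ vb₀ m ℝ.≈ vol p₁ e b₁ vb₁ m
  vol-cong {p₀} {p₁} {b₀} {b₁} {k} e vb₀ vb₁ m p₀≈p₁ b₀≈b₁ =
    go (fin-injective (≡.trans (≡.sym vb₀) (≡.trans (v-cong b₀≈b₁) vb₁))) vb₁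
    where
    go : ∀ {l} → k ≡ l → (vb₁ : v b₁ ≡ fin l) → vol p₀ e b₀ vb₀ m ℝ.≈ vol p₁ e b₁ vb₁ m
    go ≡.refl vb₁ = ∫-cong (box p₀ e b₀ vb₀ m) (box p₁ e b₁ vb₁ m) λ x → box-≈ p₀ e b₀ vb₀ m p₁ e b₁ vb₁ m x x
      (λ (p , r) → P-resp {e} (+-congˡ (-‿cong p₀≈p₁)) p , P-resp {k ℤ.+ + suc m} (+-congˡ (-‿cong b₀≈b₁)) r)
      (λ (p , r) → P-resp {e} (+-congˡ (-‿cong (sym p₀≈p₁))) p , P-resp {k ℤ.+ + suc m} (+-congˡ (-‿cong (sym b₀≈b₁))) r)

  radius-suc : ∀ k m → k ℤ.+ + suc (suc m) ≡ k ℤ.+ + suc m ℤ.+ 1ℤ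
  radius-suc k m = ≡.trans (≡.cong (λ j → k ℤ.+ + j) (ℕ.+-comm 1 (suc m))) (≡.sym (ℤ.+-assoc k (+ suc m) 1ℤ))

  private
    regroup : ∀ x y z → (x - y) - z ≈ x - (y + z)
    regroup = solve 3 (λ x y z → (x :- y) :- z := x :- (y :+ z)) refl

  shifted : ∀ {b₀ k} → v b₀ ≡ fin k → ∀ m j → v (b₀ + digit (k ℤ.+ + suc m) j) ≡ fin k
  shifted {b₀} {k} vb m j = val-+ vb (P-digit (k ℤ.+ + suc m) j) (k<M 0# 0ℤ b₀ vb m)

  split-b : ∀ p₀ e b₀ {k} (vb : v b₀ ≡ fin k) m →
            vol p₀ e b₀ vb m ℝ.≈ R.sum (λ j → vol p₀ e (b₀ + digit (k ℤ.+ + suc m) j) (shifted vb m j) (suc m))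
  split-b p₀ e b₀ {k} vb m =
    ∫-sum (λ j → box p₀ e (b₀ + digit M j) (shifted vb m j) (suc m)) (box p₀ e b₀ vb m)
      (λ x → ℝ.trans (box-fun p₀ e b₀ vb m x) (pieces x))
    where
    M : ℤ
    M = k ℤ.+ + suc m
    M⁺ : ℤ
    M⁺ = k ℤ.+ + suc (suc m)
    M⁺≡ : M⁺ ≡ M ℤ.+ 1ℤ
    M⁺≡ = radius-suc k m
    to : ∀ x → Box p₀ e b₀ M x → ∃ λ j → Box p₀ e (b₀ + digit M j) M⁺ x
    to x (p , r) = let j , r′ = digit-exists {M} {bc x - b₀} r in
      j , p , P-resp {M⁺} (regroup (bc x) b₀ (digit M j)) (P-cast (≡.sym M⁺≡) r′)
    from : ∀ x j → Box p₀ e (b₀ + digit M j) M⁺ x → Box p₀ e b₀ M x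
    from x j (p , r) = p , P-resp {M} (solve 3 (λ x y z → (x :- (y :+ z)) :+ z := x :- y) refl (bc x) b₀ (digit M j))
      (P-+ (P-mono {M} {M⁺} (≡.subst (M ℤ.≤_) (≡.sym M⁺≡) (i≤i+1 M)) r) (P-digit M j))
    piece : ∀ x j → P M⁺ (bc x - (b₀ + digit M j)) → P (M ℤ.+ 1ℤ) ((bc x - b₀) - digit M j)
    piece x j r = P-resp {M ℤ.+ 1ℤ} (sym (regroup (bc x) b₀ (digit M j))) (P-cast M⁺≡ r)
    pieces : ∀ x → 𝟏 (Box p₀ e b₀ M x) ℝ.≈ R.sum (λ j → fun (box p₀ e (b₀ + digit M j) (shifted vb m j) (suc m)) x)
    pieces x = ℝ.trans (𝟏-partition {A = Box p₀ e b₀ M x} {λ j → Box p₀ e (b₀ + digit M j) M⁺ x} (to x) (from x)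
      (λ {i} {j} (_ , r) (_ , r′) → digit-unique {M} {i} {j} {bc x - b₀} (piece x i r) (piece x j r′)))
      (R.sum-cong (λ j → ℝ.sym (box-fun p₀ e (b₀ + digit M j) (shifted vb m j) (suc m) x)))

  split-p : ∀ p₀ e b₀ {k} (vb : v b₀ ≡ fin k) m →
            vol p₀ e b₀ vb m ℝ.≈ R.sum (λ j → vol (p₀ + digit e j) (e ℤ.+ 1ℤ) b₀ vb m)
  split-p p₀ e b₀ {k} vb m =
    ∫-sum (λ j → box (p₀ + digit e j) (e ℤ.+ 1ℤ) b₀ vb m) (box p₀ e b₀ vb m)
      (λ x → ℝ.trans (box-fun p₀ e b₀ vb m x) (pieces x))
    where
    M : ℤ
    M = k ℤ.+ + suc m
    piece : ∀ x j → P (e ℤ.+ 1ℤ) (pc x - (p₀ + digit e j)) → P (e ℤ.+ 1ℤ) ((pc x - p₀) - digit e j)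
    piece x j = P-resp {e ℤ.+ 1ℤ} (sym (regroup (pc x) p₀ (digit e j)))
    pieces : ∀ x → 𝟏 (Box p₀ e b₀ M x) ℝ.≈ R.sum (λ j → fun (box (p₀ + digit e j) (e ℤ.+ 1ℤ) b₀ vb m) x)
    pieces x = ℝ.trans (𝟏-partition {A = Box p₀ e b₀ M x} {λ j → Box (p₀ + digit e j) (e ℤ.+ 1ℤ) b₀ M x}
      (λ (p , r) → let j , p′ = digit-exists {e} {pc x - p₀} p in
        j , P-resp {e ℤ.+ 1ℤ} (regroup (pc x) p₀ (digit e j)) p′ , r)
      (λ j (p , r) → P-resp {e} (solve 3 (λ x y z → (x :- (y :+ z)) :+ z := x :- y) refl (pc x) p₀ (digit e j))
        (P-+ (P-mono {e} {e ℤ.+ 1ℤ} (i≤i+1 e) p) (P-digit e j)) , r)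
      (λ {i} {j} (p , _) (p′ , _) → digit-unique {e} {i} {j} {pc x - p₀} (piece x i p) (piece x j p′)))
      (R.sum-cong (λ j → ℝ.sym (box-fun (p₀ + digit e j) (e ℤ.+ 1ℤ) b₀ vb m x)))

  -- Translation by `lower y` with y = (p₁ - p₀) / b₀ moves p by y b. This is p₁ - p₀ up to the
  -- error (p₁ - p₀)(b - b₀) / b₀ in P^(f+m+1), which the last hypothesis makes invisible at radius
  -- e.
  shift : ∀ p₀ p₁ e b₀ {k} (vb : v b₀ ≡ fin k) m f → P f (p₁ - p₀) → e ℤ.≤ f ℤ.+ + suc m →
          vol p₀ e b₀ vb m ℝ.≈ vol p₁ e b₀ vb m
  shift p₀ p₁ e b₀ {k} vb m f Δ e≤ =
    dx-invariant (lower y) (box p₁ e b₀ vb m) (box p₀ e b₀ vb m) λ x → box-≈ p₀ e b₀ vb m p₁ e b₀ vb m x (x · lower y)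
      (λ (p , r) → P-resp (sym (move x)) (P-+ p (small x r)) , P-resp (+-congʳ (sym (bc-lower y x))) r)
      (λ (p , r) → let r′ = P-resp (+-congʳ (bc-lower y x)) r in
        P-resp (trans (+-congʳ (move x)) (solve 2 (λ u w → (u :+ w) :- w := u) refl (pc x - p₀) (w x))) (P-- p (small x r′)) , r′)
    where
    y : Carrier
    y = (p₁ - p₀) * b₀ ⁻¹
    w : SL2 → Carrier
    w x = (p₁ - p₀) * (b₀ ⁻¹ * (bc x - b₀))
    move : ∀ x → pc (x · lower y) - p₁ ≈ (pc x - p₀) + w x
    move x = begin
      pc (x · lower y) - p₁                    ≈⟨ +-congʳ (pc-lower y x) ⟩
      (pc x + y * bc x) - p₁                   ≈⟨ solve 5 (λ p p₀ p₁ i B → (p :+ ((p₁ :- p₀) :* i) :* B) :- p₁ := (p :- p₀) :+ ((p₁ :- p₀) :* i :* B :- (p₁ :- p₀) :* :1)) refl (pc x) p₀ p₁ (b₀ ⁻¹) (bc x) ⟩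
      (pc x - p₀) + ((p₁ - p₀) * b₀ ⁻¹ * bc x - (p₁ - p₀) * 1#) ≈⟨ +-congˡ (+-congˡ (-‿cong (*-congˡ (*-inverseˡ (val⇒≉0 vb))))) ⟨
      (pc x - p₀) + ((p₁ - p₀) * b₀ ⁻¹ * bc x - (p₁ - p₀) * (b₀ ⁻¹ * b₀)) ≈⟨ +-congˡ (solve 4 (λ t i B b → t :* i :* B :- t :* (i :* b) := t :* (i :* (B :- b))) refl (p₁ - p₀) (b₀ ⁻¹) (bc x) b₀) ⟩
      (pc x - p₀) + w x                        ∎
      where open SetoidReasoning setoid
    small : ∀ x → P (k ℤ.+ + suc m) (bc x - b₀) → P e (w x)
    small x r = P-mono (≡.subst (e ℤ.≤_) arith e≤) (P-* Δ (P-* (val⇒P (val-⁻¹ vb)) r))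
      where
      arith : f ℤ.+ + suc m ≡ f ℤ.+ (ℤ.- k ℤ.+ (k ℤ.+ + suc m))
      arith = ℤS.solve 3 (λ f k m → f ℤS.:+ m ℤS.:= f ℤS.:+ (ℤS.:- k ℤS.:+ (k ℤS.:+ m))) ≡.refl f k (+ suc m)

  private
    -- When the error is too large for `shift`, the box is subdivided in b; each subdivision gains
    -- one unit of relative precision.
    shift-by : ∀ j p₀ p₁ e b₀ {k} (vb : v b₀ ≡ fin k) m f → P f (p₁ - p₀) → e ℤ.≤ f ℤ.+ + (j ℕ.+ suc m) →
               vol p₀ e b₀ vb m ℝ.≈ vol p₁ e b₀ vb m
    shift-by zero    p₀ p₁ e b₀ vb m f Δ e≤ = shift p₀ p₁ e b₀ vb m f Δ e≤
    shift-by (suc j) p₀ p₁ e b₀ vb m f Δ e≤ = ℝ.trans (split-b p₀ e b₀ vb m) (ℝ.trans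
      (R.sum-cong (λ i → shift-by j p₀ p₁ e _ (shifted vb m i) (suc m) f Δ
        (≡.subst (λ l → e ℤ.≤ f ℤ.+ + l) (≡.sym (ℕ.+-suc j (suc m))) e≤)))
      (ℝ.sym (split-b p₁ e b₀ vb m)))

  shift-any : ∀ p₀ p₁ e b₀ {k} (vb : v b₀ ≡ fin k) m → vol p₀ e b₀ vb m ℝ.≈ vol p₁ e b₀ vb m
  shift-any p₀ p₁ e b₀ vb m = let f , Δ = P-exists (p₁ - p₀) in
    -- With |e - f| subdivisions the required bound follows from e ≤ f + |e - f|.
    shift-by ℤ.∣ e ℤ.- f ∣ p₀ p₁ e b₀ vb m f Δ (≤-∣-∣ {e} {f} (ℕ.m≤m+n _ (suc m)))

  refine-p : ∀ p₀ e b₀ {k} (vb : v b₀ ≡ fin k) m → vol p₀ e b₀ vb m ℝ.≈ PW.Q ℝ.* vol p₀ (e ℤ.+ 1ℤ) b₀ vb m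
  refine-p p₀ e b₀ vb m = ℝ.trans (split-p p₀ e b₀ vb m)
    (R.sum-const (λ j → shift-any (p₀ + digit e j) p₀ (e ℤ.+ 1ℤ) b₀ vb m))

  vol-p : ∀ p₀ e b₀ {k} (vb : v b₀ ≡ fin k) m → vol p₀ e b₀ vb m ℝ.≈ PW.qp e ℝ.* vol p₀ 0ℤ b₀ vb m
  vol-p p₀ e b₀ vb m = PW.geometric (λ e → vol p₀ e b₀ vb m) (λ e → refine-p p₀ e b₀ vb m) e

  scale : ∀ p₀ e b₀ {k} (vb : v b₀ ≡ fin k) m α {i} (vα : v α ≡ fin i) →
          vol p₀ e b₀ vb m ℝ.≈ vol p₀ e (α * α * b₀) (val-* (val-* vα vα) vb) m
  scale p₀ e b₀ {k} vb m α {i} vα =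
    dx-invariant (diag α (val⇒≉0 vα)) (box p₀ e (α * α * b₀) (val-* (val-* vα vα) vb) m) (box p₀ e b₀ vb m) λ x →
    box-≈ p₀ e b₀ vb m p₀ e (α * α * b₀) (val-* (val-* vα vα) vb) m x (x · diag α (val⇒≉0 vα))
      (λ (p , r) → P-resp (+-congʳ (sym (pc-diag α (val⇒≉0 vα) x))) p ,
        P-resp (trans (factor (bc x)) (+-congʳ (sym (bc-diag α (val⇒≉0 vα) x)))) (P-cast arith (P-* (val⇒P (val-* vα vα)) r)))
      (λ (p , r) → P-resp (+-congʳ (pc-diag α (val⇒≉0 vα) x)) p ,
        P-cancel (val-* vα vα) (P-cast (≡.sym arith) (P-resp (trans (+-congʳ (bc-diag α (val⇒≉0 vα) x)) (sym (factor (bc x)))) r)))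
    where
    factor : ∀ y → α * α * (y - b₀) ≈ α * α * y - α * α * b₀
    factor y = solve 3 (λ α y b → α :* α :* (y :- b) := α :* α :* y :- α :* α :* b) refl α y b₀
    arith : (i ℤ.+ i) ℤ.+ (k ℤ.+ + suc m) ≡ ((i ℤ.+ i) ℤ.+ k) ℤ.+ + suc m
    arith = ≡.sym (ℤ.+-assoc (i ℤ.+ i) k (+ suc m))

  private
    -- Division preserves relative precision: b₀ (b′ - b₀′) = (N - N₀) - (b - b₀) b′.
    quotient-near : ∀ {b b₀ b′ b₀′ N N₀ k h} m → v b₀ ≡ fin k → v N₀ ≡ fin h → b * b′ ≈ N → b₀ * b₀′ ≈ N₀ →
                    P (h ℤ.+ + suc m) (N - N₀) → P (k ℤ.+ + suc m) (b - b₀) →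
                    P ((h ℤ.- k) ℤ.+ + suc m) (b′ - b₀′)
    quotient-near {b} {b₀} {b′} {b₀′} {N} {N₀} {k} {h} m vb₀ vN₀ bb′ b₀b₀′ close p =
      P-cancel vb₀ (P-cast arith₂ (P-resp eq (P-- close (P-cast arith₁ (P-* p (val⇒P vb′))))))
      where
      open SetoidReasoning setoid
      vb : v b ≡ fin k
      vb = val-near vb₀ (P-swap p) (k<M 0# 0ℤ b₀ vb₀ m)
      vN : v N ≡ fin h
      vN = val-near vN₀ (P-swap close) (k<M 0# 0ℤ N₀ vN₀ m)
      vb′ : v b′ ≡ fin (h ℤ.- k)
      vb′ = ≡.trans (v-cong (begin
        b′                ≈⟨ *-identityˡ b′ ⟨
        1# * b′           ≈⟨ *-congʳ (*-inverseˡ (val⇒≉0 vb)) ⟨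
        (b ⁻¹ * b) * b′   ≈⟨ solve 3 (λ i b c → (i :* b) :* c := (b :* c) :* i) refl (b ⁻¹) b b′ ⟩
        (b * b′) * b ⁻¹   ≈⟨ *-congʳ bb′ ⟩
        N * b ⁻¹          ∎)) (val-* vN (val-⁻¹ vb))
      eq : (N - N₀) - (b - b₀) * b′ ≈ b₀ * (b′ - b₀′)
      eq = begin
        (N - N₀) - (b - b₀) * b′              ≈⟨ +-congʳ (+-cong bb′ (-‿cong b₀b₀′)) ⟨
        (b * b′ - b₀ * b₀′) - (b - b₀) * b′   ≈⟨ solve 4 (λ b b₀ b′ b₀′ → (b :* b′ :- b₀ :* b₀′) :- (b :- b₀) :* b′ := b₀ :* (b′ :- b₀′)) refl b b₀ b′ b₀′ ⟩
        b₀ * (b′ - b₀′)                       ∎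
      arith₁ : (k ℤ.+ + suc m) ℤ.+ (h ℤ.- k) ≡ h ℤ.+ + suc m
      arith₁ = ℤS.solve 3 (λ k h m → (k ℤS.:+ m) ℤS.:+ (h ℤS.:- k) ℤS.:= h ℤS.:+ m) ≡.refl k h (+ suc m)
      arith₂ : h ℤ.+ + suc m ≡ k ℤ.+ ((h ℤ.- k) ℤ.+ + suc m)
      arith₂ = ℤS.solve 3 (λ k h m → h ℤS.:+ m ℤS.:= k ℤS.:+ ((h ℤS.:- k) ℤS.:+ m)) ≡.refl k h (+ suc m)

  -- The Weyl element sends b to Q(- p , 1) / b. The hypothesis keeps Q(- p , 1) constant to
  -- relative precision m + 1 over the box, so the image is again a box; the reverse inclusion is
  -- the same argument with the two factors exchanged.
  reflect : ∀ p₀ e b₀ {k} (vb : v b₀ ≡ fin k) m {h} (vN : v (Q (- p₀) 1#) ≡ fin h) →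
            (∀ p → P e (p - p₀) → P (h ℤ.+ + suc m) (Q (- p) 1# - Q (- p₀) 1#)) →
            vol p₀ e b₀ vb m ℝ.≈ vol (s - p₀) e (Q (- p₀) 1# * b₀ ⁻¹) (val-* vN (val-⁻¹ vb)) m
  reflect p₀ e b₀ {k} vb m {h} vN close =
    dx-invariant weyl (box (s - p₀) e b₀′ vb′ m) (box p₀ e b₀ vb m) λ x → box-≈ p₀ e b₀ vb m (s - p₀) e b₀′ vb′ m x (x · weyl)
      (λ (p , r) → P-resp (trans (flip p₀ (pc x)) (+-congʳ (sym (pc-weyl x)))) (P-neg p) ,
        P-resp (+-congʳ (sym (bc-weyl x))) (quotient-near m vb vN (bc*-rc x) b₀b₀′ (close (pc x) p) r))
      (λ (p , r) → let p′ = P-resp (trans (+-congʳ (pc-weyl x)) (sym (flip p₀ (pc x)))) p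
                       p″ = P-resp (solve 1 (λ x → :- (:- x) := x) refl (pc x - p₀)) (P-neg p′) in
        p″ , P-cast arith (quotient-near m vb′ vN (trans (*-comm _ _) (bc*-rc x)) (trans (*-comm _ _) b₀b₀′)
               (close (pc x) p″) (P-resp (+-congʳ (bc-weyl x)) r)))
    where
    open SetoidReasoning setoid
    b₀′ : Carrier
    b₀′ = Q (- p₀) 1# * b₀ ⁻¹
    vb′ : v b₀′ ≡ fin (h ℤ.- k)
    vb′ = val-* vN (val-⁻¹ vb)
    b₀b₀′ : b₀ * b₀′ ≈ Q (- p₀) 1#
    b₀b₀′ = begin
      b₀ * (Q (- p₀) 1# * b₀ ⁻¹)   ≈⟨ solve 3 (λ b N i → b :* (N :* i) := N :* (b :* i)) refl b₀ (Q (- p₀) 1#) (b₀ ⁻¹) ⟩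
      Q (- p₀) 1# * (b₀ * b₀ ⁻¹)   ≈⟨ *-congˡ (*-inverse (val⇒≉0 vb)) ⟩
      Q (- p₀) 1# * 1#             ≈⟨ *-identityʳ _ ⟩
      Q (- p₀) 1#                  ∎
    flip : ∀ p₀ p → - (p - p₀) ≈ (s - p) - (s - p₀)
    flip p₀ p = solve 3 (λ s p p₀ → :- (p :- p₀) := (s :- p) :- (s :- p₀)) refl s p p₀
    arith : (h ℤ.- (h ℤ.- k)) ℤ.+ + suc m ≡ k ℤ.+ + suc m
    arith = ℤS.solve 3 (λ h k m → (h ℤS.:- (h ℤS.:- k)) ℤS.:+ m ℤS.:= k ℤS.:+ m) ≡.refl h k (+ suc m)

  -- The radius in p only contributes the factor q^(-e), so one radius decides for all. `reflect` is
  -- available only for a small one.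
  vol-≈ : ∀ e₁ {b₀ b₁ k l} (vb₀ : v b₀ ≡ fin k) (vb₁ : v b₁ ≡ fin l) m →
          vol 0# e₁ b₀ vb₀ m ℝ.≈ vol 0# e₁ b₁ vb₁ m → ∀ e → vol 0# e b₀ vb₀ m ℝ.≈ vol 0# e b₁ vb₁ m
  vol-≈ e₁ {b₀} {b₁} vb₀ vb₁ m eq e = ℝ.trans (vol-p 0# e b₀ vb₀ m) (ℝ.trans (ℝ.*-congˡ base) (ℝ.sym (vol-p 0# e b₁ vb₁ m)))
    where
    base : vol 0# 0ℤ b₀ vb₀ m ℝ.≈ vol 0# 0ℤ b₁ vb₁ m
    base = R.*-cancelˡ (PW.qp-≉0 e₁) (ℝ.trans (ℝ.sym (vol-p 0# e₁ b₀ vb₀ m)) (ℝ.trans eq (vol-p 0# e₁ b₁ vb₁ m)))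

  private
    -- The centre is moved from 0 to p₀, reflected to s - p₀ and moved back to 0; this replaces b₀
    -- by Q(- p₀ , 1) / b₀. Scaling by b₀² turns the latter into b₀ Q(- p₀ , 1).
    vol-Q-1 : ∀ p₀ e b₀ {k} (vb : v b₀ ≡ fin k) m {l} (vb′ : v (b₀ * Q (- p₀) 1#) ≡ fin l) →
              vol 0# e b₀ vb m ℝ.≈ vol 0# e (b₀ * Q (- p₀) 1#) vb′ m
    vol-Q-1 p₀ e b₀ {k} vb m vb′ = vol-≈ e₁ vb vb′ m
      (ℝ.trans (shift-any 0# p₀ e₁ b₀ vb m)
      (ℝ.trans (reflect p₀ e₁ b₀ vb m vN (λ p Δ → P-swap (proj₂ near p (P-swap Δ))))
      (ℝ.trans (shift-any (s - p₀) 0# e₁ _ (val-* vN (val-⁻¹ vb)) m)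
      (ℝ.trans (scale 0# e₁ _ (val-* vN (val-⁻¹ vb)) m b₀ vb)
               (vol-cong e₁ _ vb′ m refl eq))))) e
      where
      open SetoidReasoning setoid
      N≉0 : Q (- p₀) 1# ≉ 0#
      N≉0 eq = 1≉0 (proj₂ (Q-anisotropic eq))
      h : ℤ
      h = proj₁ (val-exists N≉0)
      vN : v (Q (- p₀) 1#) ≡ fin h
      vN = proj₂ (val-exists N≉0)
      near = cont-Q-1 p₀ (h ℤ.+ + suc m)
      e₁ : ℤ
      e₁ = proj₁ near
      eq : b₀ * b₀ * (Q (- p₀) 1# * b₀ ⁻¹) ≈ b₀ * Q (- p₀) 1#
      eq = begin
        b₀ * b₀ * (Q (- p₀) 1# * b₀ ⁻¹)     ≈⟨ solve 3 (λ b N i → b :* b :* (N :* i) := (b :* i) :* (b :* N)) refl b₀ (Q (- p₀) 1#) (b₀ ⁻¹) ⟩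
        (b₀ * b₀ ⁻¹) * (b₀ * Q (- p₀) 1#)   ≈⟨ *-congʳ (*-inverse (val⇒≉0 vb)) ⟩
        1# * (b₀ * Q (- p₀) 1#)             ≈⟨ *-identityˡ _ ⟩
        b₀ * Q (- p₀) 1#                    ∎

  private
    module NormCase (x y : Carrier) (N≉0 : Q x y ≉ 0#) (e : ℤ) (b₀ : Carrier) {k : ℤ} (vb : v b₀ ≡ fin k) (m : ℕ)
                    {l : ℤ} (vb′ : v (b₀ * Q x y) ≡ fin l) where
      open SetoidReasoning setoid

      rational : y ≈ 0# → vol 0# e b₀ vb m ℝ.≈ vol 0# e (b₀ * Q x y) vb′ m
      rational y≈0 = ℝ.trans (scale 0# e b₀ vb m x vx) (vol-cong e (val-* (val-* vx vx) vb) vb′ m refl eq)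
        where
        Q≈x² : Q x y ≈ x * x
        Q≈x² = trans (Q-cong refl y≈0) (solve 3 (λ s n x → x :* x :+ s :* x :* :0 :+ n :* :0 :* :0 := x :* x) refl s n x)
        x≉0 : x ≉ 0#
        x≉0 x≈0 = N≉0 (trans Q≈x² (trans (*-congʳ x≈0) (zeroˡ x)))
        vx = proj₂ (val-exists x≉0)
        eq : x * x * b₀ ≈ b₀ * Q x y
        eq = trans (*-comm _ _) (*-congˡ (sym Q≈x²))

      irrational : y ≉ 0# → vol 0# e b₀ vb m ℝ.≈ vol 0# e (b₀ * Q x y) vb′ m
      irrational y≉0 = ℝ.trans (vol-Q-1 p₀ e b₀ vb m vN₀)
        (ℝ.trans (scale 0# e (b₀ * Q (- p₀) 1#) vN₀ m y vy) (vol-cong e (val-* (val-* vy vy) vN₀) vb′ m refl eq))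
        where
        p₀ : Carrier
        -- Chosen so that y² Q(- p₀ , 1) = Q(x , y).
        p₀ = - (y ⁻¹ * x)
        N₀≉0 : b₀ * Q (- p₀) 1# ≉ 0#
        N₀≉0 = *-≉0 (val⇒≉0 vb) (λ eq → 1≉0 (proj₂ (Q-anisotropic eq)))
        vN₀ = proj₂ (val-exists N₀≉0)
        vy  = proj₂ (val-exists y≉0)
        y*-p₀ : y * - p₀ ≈ x
        y*-p₀ = begin
          y * - - (y ⁻¹ * x)   ≈⟨ solve 3 (λ y i x → y :* (:- (:- (i :* x))) := (y :* i) :* x) refl y (y ⁻¹) x ⟩
          (y * y ⁻¹) * x       ≈⟨ *-congʳ (*-inverse y≉0) ⟩
          1# * x               ≈⟨ *-identityˡ x ⟩
          x                    ∎
        eq : y * y * (b₀ * Q (- p₀) 1#) ≈ b₀ * Q x y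
        eq = begin
          y * y * (b₀ * Q (- p₀) 1#)     ≈⟨ solve 3 (λ y b N → y :* y :* (b :* N) := b :* (y :* y :* N)) refl y b₀ (Q (- p₀) 1#) ⟩
          b₀ * (y * y * Q (- p₀) 1#)     ≈⟨ *-congˡ (Q-scale y (- p₀) 1#) ⟨
          b₀ * Q (y * - p₀) (y * 1#)     ≈⟨ *-congˡ (Q-cong y*-p₀ (*-identityʳ y)) ⟩
          b₀ * Q x y                     ∎

  -- The diagonal, lower triangular and Weyl elements move b₀ to b₀ y² and to
  -- b₀ Q (x, 1), hence to any b₀ Q (x, y).
  vol-norm : ∀ x y → Q x y ≉ 0# → ∀ e b₀ {k} (vb : v b₀ ≡ fin k) m {l} (vb′ : v (b₀ * Q x y) ≡ fin l) →
             vol 0# e b₀ vb m ℝ.≈ vol 0# e (b₀ * Q x y) vb′ m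
  vol-norm x y N≉0 e b₀ vb m vb′ = cases em
    where
    open NormCase x y N≉0 e b₀ vb m vb′
    cases : Dec (y ≈ 0#) → vol 0# e b₀ vb m ℝ.≈ vol 0# e (b₀ * Q x y) vb′ m
    cases (yes y≈0) = rational y≈0
    cases (no  y≉0) = irrational y≉0

  IsNorm : Carrier → Set
  IsNorm x = x ≉ 0# × ∃₂ λ p r → Q p r ≈ x

  module _ (m₀ : ℕ) (norms : ∀ x → P (+ suc m₀) (x - 1#) → IsNorm x) where
    private
      val-1′ : v (- 1#) ≡ fin 0ℤ
      val-1′ = val-neg val-1

      from-1 : ∀ e b₀ {k} (vb : v b₀ ≡ fin k) m → IsNorm (- b₀) → vol 0# e (- 1#) val-1′ m ℝ.≈ vol 0# e b₀ vb m
      from-1 e b₀ vb m (-b₀≉0 , p , r , N) = ℝ.trans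
        (vol-norm p r (λ eq → -b₀≉0 (trans (sym N) eq)) e (- 1#) val-1′ m (≡.trans (v-cong eq) vb))
        (vol-cong e (≡.trans (v-cong eq) vb) vb m refl eq)
        where
        eq : - 1# * Q p r ≈ b₀
        eq = trans (*-congˡ N) (solve 1 (λ b → (:- :1) :* (:- b) := b) refl b₀)

      -- The q subboxes have centres - u with u in 1 + P^(m₀+1). These u are norms, so by `vol-norm`
      -- the subboxes all have the same volume.
      refine-b : ∀ e i → vol 0# e (- 1#) val-1′ (m₀ ℕ.+ i) ℝ.≈ PW.Q ℝ.* vol 0# e (- 1#) val-1′ (m₀ ℕ.+ suc i)
      refine-b e i = ℝ.trans (split-b 0# e (- 1#) val-1′ (m₀ ℕ.+ i)) (R.sum-const (λ j →
        ℝ.trans (ℝ.sym (from-1 e (b′ j) (shifted val-1′ (m₀ ℕ.+ i) j) (suc (m₀ ℕ.+ i)) (norms (- b′ j) (close j))))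
        (ℝ.reflexive (≡.cong (vol 0# e (- 1#) val-1′) (≡.sym (ℕ.+-suc m₀ i))))))
        where
        M : ℤ
        M = 0ℤ ℤ.+ + suc (m₀ ℕ.+ i)
        b′ : Fin q → Carrier
        b′ j = - 1# + digit M j
        close : ∀ j → P (+ suc m₀) (- b′ j - 1#)
        close j = P-resp {+ suc m₀} (solve 1 (λ x → :- x := (:- ((:- :1) :+ x)) :- :1) refl (digit M j))
          (P-neg (P-mono {+ suc m₀} {M} (ℤ.+≤+ (ℕ.s≤s (ℕ.m≤m+n m₀ i))) (P-digit M j)))

    -- The volume of the set p ∈ O, b ∈ - 1 + P^(m₀+1), the unit in which the other volumes are
    -- expressed.
    density : ℝ.Carrier
    density = vol 0# 0ℤ (- 1#) val-1′ (m₀ ℕ.+ 0)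

    vol-value : ∀ e b₀ {k} (vb : v b₀ ≡ fin k) i → IsNorm (- b₀) →
                vol 0# e b₀ vb (m₀ ℕ.+ i) ℝ.≈ PW.qp e ℝ.* (PW.qp (+ i) ℝ.* density)
    vol-value e b₀ vb i norm = ℝ.trans (ℝ.sym (from-1 e b₀ vb (m₀ ℕ.+ i) norm))
      (ℝ.trans (vol-p 0# e (- 1#) val-1′ (m₀ ℕ.+ i))
        (ℝ.*-congˡ (PW.geometricℕ (λ i → vol 0# 0ℤ (- 1#) val-1′ (m₀ ℕ.+ i)) (refine-b 0ℤ) i)))

-- Conjugation in SL(2,F).

module Conjugation (em : ExcludedMiddle 0ℓ) (F : LocalField) where
  open LocalField F hiding (zero)
  open SL₂ F
  open GroupSpaces em F

  -- Abstract, since comparing two conjugates by unfolding them would compare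
  -- the proofs that their determinants are 1.
  abstract
    cj : SL2 → SL2 → SL2
    cj x t = inv x · t · x

    cj-≋ : ∀ x t → cj x t ≋ inv x · t · x
    cj-≋ x t = refl , refl , refl , refl

  invᴷ : K → K
  invᴷ k = intg (inv (K.g k)) (K.dᵒ k) (P-neg (K.bᵒ k)) (P-neg (K.cᵒ k)) (K.aᵒ k)

  ≋-sym : ∀ {x y} → x ≋ y → y ≋ x
  ≋-sym (p , q , r , s) = sym p , sym q , sym r , sym s

  ·-congʳ : ∀ x x′ y → x ≋ x′ → x · y ≋ x′ · y
  ·-congʳ x x′ y (p , q , r , s) =
    +-cong (*-congʳ p) (*-congʳ q) , +-cong (*-congʳ p) (*-congʳ q) ,
    +-cong (*-congʳ r) (*-congʳ s) , +-cong (*-congʳ r) (*-congʳ s)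

  ·-congˡ : ∀ x y y′ → y ≋ y′ → x · y ≋ x · y′
  ·-congˡ x y y′ (p , q , r , s) =
    +-cong (*-congˡ p) (*-congˡ r) , +-cong (*-congˡ q) (*-congˡ s) ,
    +-cong (*-congˡ p) (*-congˡ r) , +-cong (*-congˡ q) (*-congˡ s)

  ·-assoc : ∀ x y z → (x · y) · z ≋ x · (y · z)
  ·-assoc x y z = go (a x) (b x) (a z) (c z) , go (a x) (b x) (b z) (d z) , go (c x) (d x) (a z) (c z) , go (c x) (d x) (b z) (d z)
    where
    go : ∀ α β ζ η → (α * a y + β * c y) * ζ + (α * b y + β * d y) * η ≈ α * (a y * ζ + b y * η) + β * (c y * ζ + d y * η)
    go α β ζ η = solve 8 (λ α β p q r s ζ η → (α :* p :+ β :* r) :* ζ :+ (α :* q :+ β :* s) :* η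
      := α :* (p :* ζ :+ q :* η) :+ β :* (r :* ζ :+ s :* η)) refl α β (a y) (b y) (c y) (d y) ζ η

  inverseʳ : ∀ x → x · inv x ≋ I
  inverseʳ x =
    trans (solve 4 (λ a b c d → a :* d :+ b :* (:- c) := a :* d :- b :* c) refl (a x) (b x) (c x) (d x)) (det x) ,
    solve 2 (λ a b → a :* (:- b) :+ b :* a := :0) refl (a x) (b x) ,
    solve 2 (λ c d → c :* d :+ d :* (:- c) := :0) refl (c x) (d x) ,
    trans (solve 4 (λ a b c d → c :* (:- b) :+ d :* a := a :* d :- b :* c) refl (a x) (b x) (c x) (d x)) (det x)

  inverseˡ : ∀ x → inv x · x ≋ I
  inverseˡ x =
    trans (solve 4 (λ a b c d → d :* a :+ (:- b) :* c := a :* d :- b :* c) refl (a x) (b x) (c x) (d x)) (det x) ,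
    solve 2 (λ b d → d :* b :+ (:- b) :* d := :0) refl (b x) (d x) ,
    solve 2 (λ a c → (:- c) :* a :+ a :* c := :0) refl (a x) (c x) ,
    trans (solve 4 (λ a b c d → (:- c) :* b :+ a :* d := a :* d :- b :* c) refl (a x) (b x) (c x) (d x)) (det x)

  identityˡ : ∀ x → I · x ≋ x
  identityˡ x = go (a x) (c x) , go (b x) (d x) , go′ (a x) (c x) , go′ (b x) (d x)
    where
    go : ∀ y z → 1# * y + 0# * z ≈ y
    go = solve 2 (λ y z → :1 :* y :+ :0 :* z := y) refl
    go′ : ∀ y z → 0# * y + 1# * z ≈ z
    go′ = solve 2 (λ y z → :0 :* y :+ :1 :* z := z) refl

  identityʳ : ∀ x → x · I ≋ x
  identityʳ x = go (a x) (b x) , go′ (a x) (b x) , go (c x) (d x) , go′ (c x) (d x)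
    where
    go : ∀ y z → y * 1# + z * 0# ≈ y
    go = solve 2 (λ y z → y :* :1 :+ z :* :0 := y) refl
    go′ : ∀ y z → y * 0# + z * 1# ≈ z
    go′ = solve 2 (λ y z → y :* :0 :+ z :* :1 := z) refl

  inv-· : ∀ x y → inv (x · y) ≋ inv y · inv x
  inv-· x y =
    solve 4 (λ c d b′ d′ → c :* b′ :+ d :* d′ := d′ :* d :+ (:- b′) :* (:- c)) refl (c x) (d x) (b y) (d y) ,
    solve 4 (λ a b b′ d′ → :- (a :* b′ :+ b :* d′) := d′ :* (:- b) :+ (:- b′) :* a) refl (a x) (b x) (b y) (d y) ,
    solve 4 (λ c d a′ c′ → :- (c :* a′ :+ d :* c′) := (:- c′) :* d :+ a′ :* (:- c)) refl (c x) (d x) (a y) (c y) ,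
    solve 4 (λ a b a′ c′ → a :* a′ :+ b :* c′ := (:- c′) :* (:- b) :+ a′ :* a) refl (a x) (b x) (a y) (c y)

  inv-cong : ∀ x y → x ≋ y → inv x ≋ inv y
  inv-cong x y (p , q , r , s) = s , -‿cong q , -‿cong r , p

  open SetoidReasoning SL2-setoid

  cj-cong : ∀ x y t → x ≋ y → cj x t ≋ cj y t
  cj-cong x y t p = begin
    cj x t          ≈⟨ cj-≋ x t ⟩
    inv x · t · x   ≈⟨ ·-congʳ (inv x · t) (inv y · t) x (·-congʳ (inv x) (inv y) t (inv-cong x y p)) ⟩
    inv y · t · x   ≈⟨ ·-congˡ (inv y · t) x y p ⟩
    inv y · t · y   ≈⟨ cj-≋ y t ⟨
    cj y t          ∎

  cj-· : ∀ x g t → cj (x · g) t ≋ cj g (cj x t)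
  cj-· x g t = begin
    cj (x · g) t                    ≈⟨ cj-≋ (x · g) t ⟩
    inv (x · g) · t · (x · g)       ≈⟨ ·-congʳ (inv (x · g) · t) (inv g · inv x · t) (x · g) (·-congʳ (inv (x · g)) (inv g · inv x) t (inv-· x g)) ⟩
    inv g · inv x · t · (x · g)     ≈⟨ ·-congʳ (inv g · inv x · t) (inv g · (inv x · t)) (x · g) (·-assoc (inv g) (inv x) t) ⟩
    inv g · (inv x · t) · (x · g)   ≈⟨ ·-assoc (inv g · (inv x · t)) x g ⟨
    inv g · (inv x · t) · x · g     ≈⟨ ·-congʳ (inv g · (inv x · t) · x) (inv g · (inv x · t · x)) g (·-assoc (inv g) (inv x · t) x) ⟩
    inv g · (inv x · t · x) · g     ≈⟨ ·-congʳ (inv g · cj x t) (inv g · (inv x · t · x)) g (·-congˡ (inv g) (cj x t) (inv x · t · x) (cj-≋ x t)) ⟨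
    inv g · cj x t · g              ≈⟨ cj-≋ g (cj x t) ⟨
    cj g (cj x t)                   ∎

  cj-I : ∀ t → cj I t ≋ t
  cj-I t = begin
    cj I t          ≈⟨ cj-≋ I t ⟩
    inv I · t · I   ≈⟨ identityʳ (inv I · t) ⟩
    inv I · t       ≈⟨ ·-congʳ (inv I) I t (refl , -0≈0 , -0≈0 , refl) ⟩
    I · t           ≈⟨ identityˡ t ⟩
    t               ∎
    where
    -0≈0 : - 0# ≈ 0#
    -0≈0 = solve 0 (:- :0 := :0) refl

  cj-inv : ∀ g t → cj (inv g) (cj g t) ≋ t
  cj-inv g t = begin
    cj (inv g) (cj g t)   ≈⟨ cj-· g (inv g) t ⟨
    cj (g · inv g) t      ≈⟨ cj-cong (g · inv g) I t (inverseʳ g) ⟩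
    cj I t                ≈⟨ cj-I t ⟩
    t                     ∎

  inv-cj : ∀ g t → cj g (cj (inv g) t) ≋ t
  inv-cj g t = begin
    cj g (cj (inv g) t)   ≈⟨ cj-· (inv g) g t ⟨
    cj (inv g · g) t      ≈⟨ cj-cong (inv g · g) I t (inverseˡ g) ⟩
    cj I t                ≈⟨ cj-I t ⟩
    t                     ∎

  private
    row : ∀ {n α β x y x′ y′} → P 0ℤ α → P 0ℤ β → P n (x - x′) → P n (y - y′) → P n ((α * x + β * y) - (α * x′ + β * y′))
    row {n} {α} {β} {x} {y} {x′} {y′} p r s t = P-resp {n}
      (solve 6 (λ α β x y x′ y′ → α :* (x :- x′) :+ β :* (y :- y′) := (α :* x :+ β :* y) :- (α :* x′ :+ β :* y′)) refl α β x y x′ y′)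
      (P-+ (P-*ˡ {n} p s) (P-*ˡ {n} r t))

    column : ∀ {n α β x y x′ y′} → P 0ℤ α → P 0ℤ β → P n (x - x′) → P n (y - y′) → P n ((x * α + y * β) - (x′ * α + y′ * β))
    column {n} {α} {β} {x} {y} {x′} {y′} p r s t = P-resp {n}
      (solve 6 (λ α β x y x′ y′ → α :* (x :- x′) :+ β :* (y :- y′) := (x :* α :+ y :* β) :- (x′ :* α :+ y′ :* β)) refl α β x y x′ y′)
      (P-+ (P-*ˡ {n} p s) (P-*ˡ {n} r t))

  near-left : ∀ {n} (k : K) x y → NearG n x y → NearG n (K.g k · x) (K.g k · y)
  near-left {n} k x y (p , q , r , s) =
    row {n} {α} {β} {a x} {c x} {a y} {c y} (K.aᵒ k) (K.bᵒ k) p r , row {n} {α} {β} {b x} {d x} {b y} {d y} (K.aᵒ k) (K.bᵒ k) q s ,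
    row {n} {γ} {δ} {a x} {c x} {a y} {c y} (K.cᵒ k) (K.dᵒ k) p r , row {n} {γ} {δ} {b x} {d x} {b y} {d y} (K.cᵒ k) (K.dᵒ k) q s
    where
    α = a (K.g k) ; β = b (K.g k) ; γ = c (K.g k) ; δ = d (K.g k)

  near-right : ∀ {n} (k : K) x y → NearG n x y → NearG n (x · K.g k) (y · K.g k)
  near-right {n} k x y (p , q , r , s) =
    column {n} {α} {γ} {a x} {b x} {a y} {b y} (K.aᵒ k) (K.cᵒ k) p q , column {n} {β} {δ} {a x} {b x} {a y} {b y} (K.bᵒ k) (K.dᵒ k) p q ,
    column {n} {α} {γ} {c x} {d x} {c y} {d y} (K.aᵒ k) (K.cᵒ k) r s , column {n} {β} {δ} {c x} {d x} {c y} {d y} (K.bᵒ k) (K.dᵒ k) r s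
    where
    α = a (K.g k) ; β = b (K.g k) ; γ = c (K.g k) ; δ = d (K.g k)

  near-≋ : ∀ {n x x′ y y′} → x ≋ x′ → y ≋ y′ → NearG n x y → NearG n x′ y′
  near-≋ {n} {x} {x′} {y} {y′} p q near = nearG-trans {n} {x′} {x} {y′} (nearG-refl {n} {x′} {x} (≋-sym {x} {x′} p))
    (nearG-trans {n} {x} {y} {y′} near (nearG-refl {n} {y} {y′} q))

  -- Elements of K and their inverses have integral entries, so both multiplications preserve
  -- congruences.
  near-cj : ∀ {n} (k : K) x y → NearG n x y → NearG n (cj (K.g k) x) (cj (K.g k) y)
  near-cj {n} k x y near = near-≋ {n} {inv (K.g k) · x · K.g k} {cj (K.g k) x} {inv (K.g k) · y · K.g k} {cj (K.g k) y}
    (≋-sym {cj (K.g k) x} {inv (K.g k) · x · K.g k} (cj-≋ (K.g k) x)) (≋-sym {cj (K.g k) y} {inv (K.g k) · y · K.g k} (cj-≋ (K.g k) y))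
    (near-right k (inv (K.g k) · x) (inv (K.g k) · y) (near-left (invᴷ k) x y near))

  near-move : ∀ {n} (k : K) x y → NearG n (cj (K.g k) x) y → NearG n x (cj (inv (K.g k)) y)
  near-move {n} k x y near = near-≋ {n} {cj (inv (K.g k)) (cj (K.g k) x)} {x} {cj (inv (K.g k)) y} {cj (inv (K.g k)) y}
    (cj-inv (K.g k) x) (≋-refl {cj (inv (K.g k)) y}) (near-cj (invᴷ k) (cj (K.g k) x) y near)

  near-back : ∀ {n} (k : K) x y → NearG n x (cj (inv (K.g k)) y) → NearG n (cj (K.g k) x) y
  near-back {n} k x y near = near-≋ {n} {cj (K.g k) x} {cj (K.g k) x} {cj (K.g k) (cj (inv (K.g k)) y)} {y}
    (≋-refl {cj (K.g k) x}) (inv-cj (K.g k) y) (near-cj k x (cj (inv (K.g k)) y) near)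

-- Haar measures on F and on K.

module HaarField (em : ExcludedMiddle 0ℓ) (ℝ : RealField) (F : LocalField)
                 (dn : Integration.Measure ℝ (LocalField.F-space F))
                 (dn-invariant : ∀ x → Integration.InvariantUnder ℝ dn (LocalField._+_ F x)) where
  open LocalField F hiding (zero)
  open GroupSpaces em F
  open TestFunctions em ℝ
  open OnSpace F-near public
  open Integration ℝ
  open Integrals dn public
  open Measure dn
  private
    module ℝ = RealField ℝ
    module R = RealLemmas em ℝ
  open RealOps ℝ using (∣_∣; module ≤)
  module PW = R.Powers q 2≤q

  private
    near-ball : ∀ M c x → ∃ λ m → ∀ y → NearF m x y → (P M (y - c) → P M (x - c)) × (P M (x - c) → P M (y - c))
    near-ball M c x = M , λ y near → (λ p → P-trans near p) , (λ p → P-trans (P-swap near) p)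

  abstract
    bounded-support : (φ : Cc∞ F-space ℝ.rawRing) → ∃ λ N → ∀ x → fun φ x ℝ.≉ ℝ.0# → P N x
    bounded-support φ with proj₁ (proj₂ (Cc∞.compactSupport φ)) P
                             (λ k x p → k , λ y near → P-resp {k} (solve 2 (λ x y → x :- (x :- y) := y) refl x y) (P-- p near))
                             (λ x _ → P-exists x)
    ... | ks , cover = low ks , λ x nz → below ks (cover x (proj₂ (proj₂ (Cc∞.compactSupport φ)) x nz))
      where
      low : List ℤ → ℤ
      low []       = 0ℤ
      low (k ∷ ks) = k ℤ.⊓ low ks
      below : ∀ ks {x} → Any (λ k → P k x) ks → P (low ks) x
      below (k ∷ ks) (here p)  = P-mono (ℤ.i⊓j≤i k (low ks)) p
      below (k ∷ ks) (there p) = P-mono (ℤ.i⊓j≤j k (low ks)) (below ks p)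

  abstract
    ball : Carrier → ℤ → Cc∞ F-space ℝ.rawRing
    ball c M = mkCc (λ x → 𝟏 (P M (x - c))) (smooth-𝟏 (near-ball M c) (λ ()))
      (let k , p = P-exists c in P (M ℤ.⊓ k) , F-compact (M ℤ.⊓ k) , λ x nz →
        P-resp {M ℤ.⊓ k} (solve 2 (λ x c → (x :- c) :+ c := x) refl x c)
          (P-+ (P-mono {M ℤ.⊓ k} {M} (ℤ.i⊓j≤i M k) (𝟏≉0 nz)) (P-mono {M ℤ.⊓ k} {k} (ℤ.i⊓j≤j M k) p)))

    ball-fun : ∀ c M x → fun (ball c M) x ℝ.≈ 𝟏 (P M (x - c))
    ball-fun c M x = ℝ.refl

  ball-translate : ∀ c y M → ∫ (ball c M) ℝ.≈ ∫ (ball (y + c) M)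
  ball-translate c y M = dn-invariant y (ball (y + c) M) (ball c M) λ x →
    ℝ.trans (ball-fun c M x) (ℝ.trans (𝟏-cong (P-resp {M} (sym (eq x))) (P-resp {M} (eq x))) (ℝ.sym (ball-fun (y + c) M (y + x))))
    where
    eq : ∀ x → (y + x) - (y + c) ≈ x - c
    eq x = solve 3 (λ x y c → (y :+ x) :- (y :+ c) := x :- c) refl x y c

  ball-split : ∀ M → ∫ (ball 0# M) ℝ.≈ PW.Q ℝ.* ∫ (ball 0# (M ℤ.+ 1ℤ))
  ball-split M = ℝ.trans (∫-sum (λ j → ball (digit M j + 0#) (M ℤ.+ 1ℤ)) (ball 0# M) pieces)
    (R.sum-const (λ j → ℝ.sym (ball-translate 0# (digit M j) (M ℤ.+ 1ℤ))))
    where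
    eq : ∀ x w → (x - 0#) - w ≈ x - (w + 0#)
    eq x w = solve 2 (λ x w → (x :- :0) :- w := x :- (w :+ :0)) refl x w
    pieces : ∀ x → fun (ball 0# M) x ℝ.≈ R.sum (λ j → fun (ball (digit M j + 0#) (M ℤ.+ 1ℤ)) x)
    pieces x = ℝ.trans (ball-fun 0# M x) (ℝ.trans
      (𝟏-partition {A = P M (x - 0#)} {λ j → P (M ℤ.+ 1ℤ) (x - (digit M j + 0#))}
        (λ p → let j , r = digit-exists {M} {x - 0#} p in j , P-resp {M ℤ.+ 1ℤ} (eq x (digit M j)) r)
        (λ j p → P-resp {M} (solve 2 (λ x w → (x :- (w :+ :0)) :+ w := x :- :0) refl x (digit M j))
          (P-+ (P-mono {M} {M ℤ.+ 1ℤ} (i≤i+1 M) p) (P-digit M j)))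
        (λ {i} {j} p r → digit-unique {M} {i} {j} {x - 0#} (P-resp {M ℤ.+ 1ℤ} (sym (eq x (digit M i))) p)
                                                          (P-resp {M ℤ.+ 1ℤ} (sym (eq x (digit M j))) r)))
      (R.sum-cong (λ j → ℝ.sym (ball-fun (digit M j + 0#) (M ℤ.+ 1ℤ) x))))

  volO : ℝ.Carrier
  volO = ∫ (ball 0# 0ℤ)

  vol-ball₀ : ∀ M → ∫ (ball 0# M) ℝ.≈ PW.qp M ℝ.* volO
  vol-ball₀ = PW.geometric (λ M → ∫ (ball 0# M)) ball-split

  vol-ball : ∀ c M → ∫ (ball c M) ℝ.≈ PW.qp M ℝ.* volO
  vol-ball c M = ℝ.trans (∫-cong (ball c M) (ball (c + 0#) M) λ x → ℝ.trans (ball-fun c M x)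
      (ℝ.trans (𝟏-cong (P-resp {M} (eq x)) (P-resp {M} (sym (eq x)))) (ℝ.sym (ball-fun (c + 0#) M x))))
    (ℝ.trans (ℝ.sym (ball-translate 0# c M)) (vol-ball₀ M))
    where
    eq : ∀ x → x - c ≈ x - (c + 0#)
    eq x = +-congˡ (-‿cong (sym (+-identityʳ c)))

  volO-nonneg : ℝ.0# ℝ.≤ volO
  volO-nonneg = positive (ball 0# 0ℤ) λ x → R.≤-respʳ (ℝ.sym (ball-fun 0# 0ℤ x)) (𝟏-nonneg _)

  -- If O had volume 0, so would every ball. A test function lies between two opposite multiples of
  -- the indicator function of a ball, so all integrals would vanish.
  volO≉0 : volO ℝ.≉ ℝ.0#
  volO≉0 volO≈0 = proj₂ nonzero (≤.antisym (upper φ (λ x → proj₁ (bound x)))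
    (R.≤-resp (R.solve 0 (R.:- R.:0 R.:= R.:0) ℝ.refl) -∫φ (R.neg-mono-≤ (upper (ℝ.- ℝ.1# ⊡ φ) (λ x → R.≤-respˡ (neg (fun φ x)) (proj₂ (bound x)))))))
    where
    φ = proj₁ nonzero
    N = proj₁ (bounded-support φ)
    C = proj₁ (bounded φ)
    C⁺ = ∣ C ∣
    neg : ∀ y → ℝ.- y ℝ.≈ ℝ.- ℝ.1# ℝ.* y
    neg y = R.solve 1 (λ y → R.:- y R.:= (R.:- R.:1) R.:* y) ℝ.refl y
    -∫φ : ℝ.- ∫ (ℝ.- ℝ.1# ⊡ φ) ℝ.≈ ∫ φ
    -∫φ = ℝ.trans (ℝ.-‿cong (scalar (ℝ.- ℝ.1#) φ (ℝ.- ℝ.1# ⊡ φ) (λ _ → ℝ.refl)))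
      (R.solve 1 (λ y → R.:- ((R.:- R.:1) R.:* y) R.:= y) ℝ.refl (∫ φ))
    dom = C⁺ ⊡ ball 0# N
    dom≥0 : ∀ x → ℝ.0# ℝ.≤ fun dom x
    dom≥0 x = ℝ.*-nonneg (R.∣∣-nonneg C) (R.≤-respʳ (ℝ.sym (ball-fun 0# N x)) (𝟏-nonneg (P N (x - 0#))))
    dom≈ : ∀ x → fun φ x ℝ.≉ ℝ.0# → C⁺ ℝ.≈ fun dom x
    dom≈ x nz = ℝ.trans (ℝ.sym (ℝ.*-identityʳ C⁺)) (ℝ.*-congˡ (ℝ.sym (ℝ.trans (ball-fun 0# N x)
      (𝟏-yes (P-resp {N} (solve 1 (λ x → x := x :- :0) refl x) (proj₂ (bounded-support φ) x nz))))))
    cases : ∀ x → Dec (fun φ x ℝ.≈ ℝ.0#) → fun φ x ℝ.≤ fun dom x × ℝ.- fun φ x ℝ.≤ fun dom x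
    cases x (yes z) = R.≤-respˡ (ℝ.sym z) (dom≥0 x) ,
                      R.≤-respˡ (ℝ.trans (R.solve 0 (R.:0 R.:= R.:- R.:0) ℝ.refl) (ℝ.-‿cong (ℝ.sym z))) (dom≥0 x)
    cases x (no nz) = R.≤-respʳ (dom≈ x nz) (≤.trans (proj₁ (proj₂ (bounded φ) x)) (R.x≤∣x∣ C)) ,
                      R.≤-respʳ (dom≈ x nz) (≤.trans (proj₂ (proj₂ (bounded φ) x)) (R.x≤∣x∣ C))
    bound : ∀ x → fun φ x ℝ.≤ fun dom x × ℝ.- fun φ x ℝ.≤ fun dom x
    bound x = cases x em
    upper : ∀ ψ → (∀ x → fun ψ x ℝ.≤ fun dom x) → ∫ ψ ℝ.≤ ℝ.0#
    upper ψ ψ≤dom = R.≤-respʳ (ℝ.trans (scalar C⁺ (ball 0# N) dom (λ _ → ℝ.refl)) (ℝ.trans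
      (ℝ.*-congˡ (ℝ.trans (vol-ball₀ N) (ℝ.trans (ℝ.*-congˡ volO≈0) (ℝ.zeroʳ _)))) (ℝ.zeroʳ _))) (∫-mono ψ dom ψ≤dom)

module HaarCompact (em : ExcludedMiddle 0ℓ) (ℝ : RealField) (F : LocalField)
                   (dk : Integration.Measure ℝ (SL₂.K-space F))
                   (dk-invariant : ∀ k → Integration.InvariantUnder ℝ dk (SL₂._·ᴷ_ F k)) where
  open LocalField F hiding (zero)
  open SL₂ F
  open GroupSpaces em F
  open Conjugation em F using (near-left)
  open TestFunctions em ℝ
  open OnSpace K-near public
  open Integration ℝ
  open Integrals dk public
  open Measure dk
  private
    module ℝ = RealField ℝ
    module R = RealLemmas em ℝ
  open RealOps ℝ using (module ≤)
  module PW = R.Powers q 2≤q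

  mkCcK : (h : K → ℝ.Carrier) → (∀ k → ∃ λ n → ∀ l → NearG n (K.g k) (K.g l) → h l ℝ.≈ h k) → Cc∞ K-space ℝ.rawRing
  mkCcK h loc = mkCc h (record { local = loc ; invar = λ () }) ((λ _ → ⊤) , K-compact , λ _ _ → tt)

  one : Cc∞ K-space ℝ.rawRing
  one = mkCcK (λ _ → ℝ.1#) (λ _ → 0ℤ , λ _ _ → ℝ.refl)

  volK : ℝ.Carrier
  volK = ∫ one

  volK≉0 : volK ℝ.≉ ℝ.0#
  volK≉0 volK≈0 = proj₂ nonzero (≤.antisym (upper φ (λ x → proj₁ (proj₂ (bounded φ) x)))
    (R.≤-resp (R.solve 0 (R.:- R.:0 R.:= R.:0) ℝ.refl) -∫φ
      (R.neg-mono-≤ (upper (ℝ.- ℝ.1# ⊡ φ) (λ x → R.≤-respˡ (neg (fun φ x)) (proj₂ (proj₂ (bounded φ) x)))))))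
    where
    φ = proj₁ nonzero
    C = proj₁ (bounded φ)
    neg : ∀ y → ℝ.- y ℝ.≈ ℝ.- ℝ.1# ℝ.* y
    neg y = R.solve 1 (λ y → R.:- y R.:= (R.:- R.:1) R.:* y) ℝ.refl y
    -∫φ : ℝ.- ∫ (ℝ.- ℝ.1# ⊡ φ) ℝ.≈ ∫ φ
    -∫φ = ℝ.trans (ℝ.-‿cong (scalar (ℝ.- ℝ.1#) φ (ℝ.- ℝ.1# ⊡ φ) (λ _ → ℝ.refl)))
      (R.solve 1 (λ y → R.:- ((R.:- R.:1) R.:* y) R.:= y) ℝ.refl (∫ φ))
    upper : ∀ ψ → (∀ x → fun ψ x ℝ.≤ C) → ∫ ψ ℝ.≤ ℝ.0#
    upper ψ ψ≤C = R.≤-respʳ (ℝ.trans (scalar C one (C ⊡ one) (λ _ → ℝ.refl)) (ℝ.trans (ℝ.*-congˡ volK≈0) (ℝ.zeroʳ C)))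
      (∫-mono ψ (C ⊡ one) (λ x → R.≤-respʳ (ℝ.sym (ℝ.*-identityʳ C)) (ψ≤C x)))

  lowerᴷ : ∀ y → P 0ℤ y → K
  lowerᴷ y p = intg (mat 1# 0# y 1# (solve 1 (λ y → :1 :* :1 :- :0 :* y := :1) refl y)) P-1 (P-0 0ℤ) p P-1

  weylᴷ : K
  weylᴷ = intg (mat 0# 1# (- 1#) 0# (solve 0 (:0 :* :0 :- :1 :* (:- :1) := :1) refl)) (P-0 0ℤ) P-1 (P-neg P-1) (P-0 0ℤ)

  Q+1≉0 : PW.Q ℝ.+ ℝ.1# ℝ.≉ ℝ.0#
  Q+1≉0 = R.≥1⇒≉0 (R.≤-respˡ (ℝ.+-identityˡ ℝ.1#) (R.+-mono-≤ PW.0≤Q ≤.refl))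

  module _ (k₀ : K) where
    A C : K → Carrier
    A k = a (K.g (k ·ᴷ k₀))
    C k = c (K.g (k ·ᴷ k₀))

    A-integral : ∀ k → P 0ℤ (A k)
    A-integral k = K.aᵒ (k ·ᴷ k₀)

    C-integral : ∀ k → P 0ℤ (C k)
    C-integral k = K.cᵒ (k ·ᴷ k₀)

    C-lower : ∀ y p k → C (lowerᴷ y p ·ᴷ k) ≈ y * A k + C k
    C-lower y p k = solve 7 (λ y a b c d a₀ c₀ →
        (y :* a :+ :1 :* c) :* a₀ :+ (y :* b :+ :1 :* d) :* c₀ := y :* (a :* a₀ :+ b :* c₀) :+ (c :* a₀ :+ d :* c₀))
      refl y (a (K.g k)) (b (K.g k)) (c (K.g k)) (d (K.g k)) (a (K.g k₀)) (c (K.g k₀))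

    C-weyl : ∀ k → C (weylᴷ ·ᴷ k) ≈ - A k
    C-weyl k = solve 6 (λ a b c d a₀ c₀ →
        ((:- :1) :* a :+ :0 :* c) :* a₀ :+ ((:- :1) :* b :+ :0 :* d) :* c₀ := :- (a :* a₀ :+ b :* c₀))
      refl (a (K.g k)) (b (K.g k)) (c (K.g k)) (d (K.g k)) (a (K.g k₀)) (c (K.g k₀))

    not-both : ∀ k → P 1ℤ (A k) → ¬ P 1ℤ (C k)
    not-both k p r = i+1≰i (P-val val-1 (P-resp {1ℤ} (det (K.g (k ·ᴷ k₀)))
      (P-- (P-*ʳ {1ℤ} p (K.dᵒ (k ·ᴷ k₀))) (P-*ˡ {1ℤ} (K.bᵒ (k ·ᴷ k₀)) r))))

    A-unit : ∀ k → ¬ P 1ℤ (A k) → v (A k) ≡ fin 0ℤ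
    A-unit k = val-from (A-integral k)

    abstract
      -- Indicator function of the congruence subgroup of level 𝔭^m (lower left entry in P^m),
      -- translated on the right by k₀⁻¹. As `dk` is given as left invariant, the volume is computed
      -- for each k₀ directly.
      ψ : ℕ → Cc∞ K-space ℝ.rawRing
      ψ m = mkCcK (λ k → 𝟏 (P (+ m) (C k))) λ k → + m , λ l near → 𝟏-cong (P-resp-near k l near) (P-resp-near l k (nearG-sym {x = K.g k} {K.g l} near))
        where
        P-resp-near : ∀ k l → NearG (+ m) (K.g k) (K.g l) → P (+ m) (C l) → P (+ m) (C k)
        P-resp-near k l (_ , _ , pc , pd) p = P-resp {+ m}
          (solve 6 (λ c d c′ d′ a₀ c₀ → (c′ :* a₀ :+ d′ :* c₀) :+ ((c :- c′) :* a₀ :+ (d :- d′) :* c₀) := c :* a₀ :+ d :* c₀) refl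
            (c (K.g k)) (d (K.g k)) (c (K.g l)) (d (K.g l)) (a (K.g k₀)) (c (K.g k₀)))
          (P-+ p (P-+ (P-*ʳ {+ m} pc (K.aᵒ k₀)) (P-*ʳ {+ m} pd (K.cᵒ k₀))))

      ψ-fun : ∀ m k → fun (ψ m) k ℝ.≈ 𝟏 (P (+ m) (C k))
      ψ-fun m k = ℝ.refl

    private
      -digit-integral : ∀ m j → P 0ℤ (- digit (+ m) j)
      -digit-integral m j = P-neg (P-mono {0ℤ} {+ m} (ℤ.+≤+ ℕ.z≤n) (P-digit (+ m) j))

      slide : ∀ m → Fin q → K
      slide m j = lowerᴷ (- digit (+ m) j) (-digit-integral m j)

      Piece : ∀ m → K → Fin q → Set
      Piece m k j = P (+ suc m) (C (slide m j ·ᴷ k))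

      slide-C : ∀ m k j → C (slide m j ·ᴷ k) ≈ C k - digit (+ m) j * A k
      slide-C m k j = trans (C-lower (- digit (+ m) j) (-digit-integral m j) k) (solve 3 (λ y A C → (:- y) :* A :+ C := C :- y :* A) refl (digit (+ m) j) (A k) (C k))

      +suc : ∀ m → + suc m ≡ + m ℤ.+ 1ℤ
      +suc m = ≡.cong +_ (ℕ.+-comm 1 m)

      piece⇒ : ∀ m k j → Piece m k j → P (+ m) (C k)
      piece⇒ m k j p = P-resp {+ m} (trans (+-congʳ (slide-C m k j)) (solve 2 (λ C w → (C :- w) :+ w := C) refl (C k) (digit (+ m) j * A k)))
        (P-+ (P-mono {+ m} {+ suc m} (ℤ.+≤+ (ℕ.n≤1+n m)) p) (P-*ʳ {+ m} (P-digit (+ m) j) (A-integral k)))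

      module Unit (m : ℕ) (k : K) (unit : v (A k) ≡ fin 0ℤ) where
        u : Carrier
        u = C k * A k ⁻¹
        uA : ∀ w → (u - w) * A k ≈ C k - w * A k
        uA w = begin
          (C k * A k ⁻¹ - w) * A k             ≈⟨ solve 4 (λ C i w A → (C :* i :- w) :* A := C :* (A :* i) :- w :* A) refl (C k) (A k ⁻¹) w (A k) ⟩
          C k * (A k * A k ⁻¹) - w * A k       ≈⟨ +-congʳ (trans (*-congˡ (*-inverse (val⇒≉0 unit))) (*-identityʳ (C k))) ⟩
          C k - w * A k                        ∎
          where open SetoidReasoning setoid
        to-u : ∀ j → Piece m k j → P (+ m ℤ.+ 1ℤ) (u - digit (+ m) j)
        to-u j p = P-cancel unit (P-cast (≡.trans (+suc m) (≡.sym (ℤ.+-identityˡ _)))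
          (P-resp {+ suc m} (trans (slide-C m k j) (trans (sym (uA (digit (+ m) j))) (*-comm _ _))) p))
        exists : P (+ m) (C k) → ∃ (Piece m k)
        exists p = let j , r = digit-exists {+ m} {u} (P-cast (ℤ.+-identityʳ (+ m)) (P-* p (val⇒P (val-⁻¹ unit)))) in
          j , P-resp {+ suc m} (trans (uA (digit (+ m) j)) (sym (slide-C m k j))) (P-cast (≡.sym (+suc m)) (P-*ʳ {+ m ℤ.+ 1ℤ} r (A-integral k)))
        unique : ∀ {i j} → Piece m k i → Piece m k j → i ≡ j
        unique {i} {j} p r = digit-unique {+ m} {i} {j} {u} (to-u i p) (to-u j r)

      slide-ψ : ∀ m j → Cc∞ K-space ℝ.rawRing
      slide-ψ m j = mkCcK (λ k → fun (ψ (suc m)) (slide m j ·ᴷ k)) λ k →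
        let n , near = Smooth.local (smooth (ψ (suc m))) (slide m j ·ᴷ k) in n , λ l nr → near (slide m j ·ᴷ l) (near-left (slide m j) (K.g k) (K.g l) nr)

      ∫-slide : ∀ m j → ∫ (slide-ψ m j) ℝ.≈ ∫ (ψ (suc m))
      ∫-slide m j = dk-invariant (slide m j) (ψ (suc m)) (slide-ψ m j) (λ k → ℝ.refl)

      sum-slides : ∀ m k → R.sum (λ j → fun (slide-ψ m j) k) ℝ.≈ R.sum (λ j → 𝟏 (Piece m k j))
      sum-slides m k = R.sum-cong (λ j → ψ-fun (suc m) (slide m j ·ᴷ k))

    -- Lower triangular elements act by C ↦ C + y A. Where C lies in P^m with m ≥ 1, A is a unit, so
    -- exactly one digit w gives C - w A ∈ P^(m+1): the set splits into q left translates of the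
    -- next one.
    ψ-step : ∀ i → ∫ (ψ (suc i)) ℝ.≈ PW.Q ℝ.* ∫ (ψ (suc (suc i)))
    ψ-step i = ℝ.trans (∫-sum (slide-ψ m) (ψ m) pieces) (R.sum-const (∫-slide m))
      where
      m : ℕ
      m = suc i
      unit : ∀ k → P (+ m) (C k) → v (A k) ≡ fin 0ℤ
      unit k p = A-unit k (λ r → not-both k r (P-mono {1ℤ} {+ m} (ℤ.+≤+ (ℕ.s≤s ℕ.z≤n)) p))
      pieces : ∀ k → fun (ψ m) k ℝ.≈ R.sum (λ j → fun (slide-ψ m j) k)
      pieces k = ℝ.trans (ψ-fun m k) (ℝ.trans
        (𝟏-partition {A = P (+ m) (C k)} {Piece m k}
          (λ p → Unit.exists m k (unit k p) p) (piece⇒ m k)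
          (λ {i} p r → Unit.unique m k (unit k (piece⇒ m k i p)) p r))
        (ℝ.sym (sum-slides m k)))

    -- The first column (A , C) modulo 𝔭 is one of the q + 1 points of a projective line: either A
    -- is a unit and a digit of C / A is selected, or A is not and the Weyl element exchanges the
    -- two entries.
    ψ-total : volK ℝ.≈ (PW.Q ℝ.+ ℝ.1#) ℝ.* ∫ (ψ 1)
    ψ-total = ℝ.trans (additive total flip one (λ k → ℝ.sym (cases k em)))
      (ℝ.trans (ℝ.+-cong (ℝ.trans (∫-sum (slide-ψ 0) total (λ _ → ℝ.refl)) (R.sum-const (∫-slide 0)))
                         (dk-invariant weylᴷ (ψ 1) flip (λ _ → ℝ.refl)))
        (R.solve 2 (λ q x → q R.:* x R.:+ x R.:= (q R.:+ R.:1) R.:* x) ℝ.refl PW.Q (∫ (ψ 1))))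
      where
      smooth-sum : ∀ {n} (φs : Fin n → Cc∞ K-space ℝ.rawRing) → Smooth (λ k → R.sum (λ j → fun (φs j) k))
      smooth-sum {zero}  φs = smooth-const ℝ.0#
      smooth-sum {suc n} φs = smooth-+ (smooth (φs zero)) (smooth-sum (λ j → φs (suc j)))
      total : Cc∞ K-space ℝ.rawRing
      total = mkCcK (λ k → R.sum (λ j → fun (slide-ψ 0 j) k)) (Smooth.local (smooth-sum (slide-ψ 0)))
      flip : Cc∞ K-space ℝ.rawRing
      flip = mkCcK (λ k → fun (ψ 1) (weylᴷ ·ᴷ k)) λ k →
        let n , near = Smooth.local (smooth (ψ 1)) (weylᴷ ·ᴷ k) in n , λ l nr → near (weylᴷ ·ᴷ l) (near-left weylᴷ (K.g k) (K.g l) nr)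
      flip-fun : ∀ k → fun flip k ℝ.≈ 𝟏 (P 1ℤ (A k))
      flip-fun k = ℝ.trans (ψ-fun 1 (weylᴷ ·ᴷ k)) (𝟏-cong
        (λ p → P-resp {1ℤ} (trans (-‿cong (C-weyl k)) (solve 1 (λ x → :- (:- x) := x) refl (A k))) (P-neg p))
        (λ p → P-resp {1ℤ} (sym (C-weyl k)) (P-neg p)))
      cases : ∀ k → Dec (P 1ℤ (A k)) → fun total k ℝ.+ fun flip k ℝ.≈ ℝ.1#
      cases k (yes p) = ℝ.trans (ℝ.+-cong
        (ℝ.trans (sum-slides 0 k) (R.sum-zero (λ j → 𝟏-no (λ r → not-both k p (P-resp {1ℤ}
          (trans (+-congʳ (slide-C 0 k j)) (solve 2 (λ C w → (C :- w) :+ w := C) refl (C k) (digit 0ℤ j * A k)))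
          (P-+ r (P-*ˡ {1ℤ} (P-digit 0ℤ j) p)))))))
        (ℝ.trans (flip-fun k) (𝟏-yes p))) (ℝ.+-identityˡ ℝ.1#)
      cases k (no ¬p) = ℝ.trans (ℝ.+-cong
        (ℝ.trans (sum-slides 0 k) (ℝ.trans (ℝ.sym (𝟏-partition {A = ⊤} {Piece 0 k}
          (λ _ → Unit.exists 0 k (A-unit k ¬p) (C-integral k)) (λ _ _ → tt) (Unit.unique 0 k (A-unit k ¬p)))) (𝟏-yes tt)))
        (ℝ.trans (flip-fun k) (𝟏-no ¬p))) (ℝ.+-identityʳ ℝ.1#)

    vol-ψ : ∀ i → ∫ (ψ (suc i)) ℝ.≈ PW.qp (+ i) ℝ.* ((PW.Q ℝ.+ ℝ.1#) ℝ.⁻¹ ℝ.* volK)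
    vol-ψ i = ℝ.trans (PW.geometricℕ (λ i → ∫ (ψ (suc i))) ψ-step i) (ℝ.*-congˡ base)
      where
      base : ∫ (ψ 1) ℝ.≈ (PW.Q ℝ.+ ℝ.1#) ℝ.⁻¹ ℝ.* volK
      base = R.*-cancelˡ Q+1≉0 (ℝ.trans (ℝ.sym ψ-total) (ℝ.trans (ℝ.sym (ℝ.*-identityˡ volK))
        (ℝ.trans (ℝ.*-congʳ (ℝ.sym (ℝ.*-inverse Q+1≉0))) (ℝ.*-assoc _ _ _))))

-- Quadratic characters extended by 0 and their integral over the integers.

module Characters (em : ExcludedMiddle 0ℓ) (ℝ : RealField) (F : LocalField) (E : SeparableQuadraticExtension F) where
  open LocalField F hiding (zero)
  open GroupSpaces em F
  open OrbitalIntegrals ℝ F E using (extend; signℝ)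
  private
    module ℝ = RealField ℝ
    module R = RealLemmas em ℝ
  open RealOps ℝ using (module ≤)

  module _ (ω : QuadraticCharacter) where
    open QuadraticCharacter ω hiding (χ)

    -- extend is defined by a with-abstraction on v x that keeps the equation
    -- v x ≡ w; to abstract v x in the goal but not on the left of that equation,
    -- x is written as h u and as h z, which are equal by η for ⊤ only.
    private
      v-unit : ∀ (h : ⊤ → Carrier) (u z : ⊤) → v (h z) ≡ v (h u)
      v-unit h u z = ≡.refl

      extend-unit-≉0 : ∀ (h : ⊤ → Carrier) u z (x≉0 : h z ≉ 0#) → extend ω (h u) ≡ signℝ (χ ω (h z , x≉0))
      extend-unit-≉0 h u z x≉0 with v (h u) | v-unit h u z
      ... | ∞     | eq = ⊥-elim (x≉0 (Equivalence.to (v-∞ (h z)) eq))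
      ... | fin k | eq = ≡.cong signℝ (χ-cong _ _ refl)

      extend-unit-≈0 : ∀ (h : ⊤ → Carrier) u z → h z ≈ 0# → extend ω (h u) ≡ ℝ.0#
      extend-unit-≈0 h u z x≈0 with v (h u) | v-unit h u z
      ... | ∞     | eq = ≡.refl
      ... | fin k | eq = ⊥-elim (val⇒≉0 eq x≈0)

    extend-≉0 : ∀ x (x≉0 : x ≉ 0#) → extend ω x ≡ signℝ (χ ω (x , x≉0))
    extend-≉0 x = extend-unit-≉0 (λ _ → x) tt tt

    extend-≈0 : ∀ x → x ≈ 0# → extend ω x ≡ ℝ.0#
    extend-≈0 x = extend-unit-≈0 (λ _ → x) tt tt

    extend-cong : ∀ {x y} → x ≈ y → extend ω x ≡ extend ω y
    extend-cong {x} {y} x≈y = cases em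
      where
      cases : Dec (x ≈ 0#) → extend ω x ≡ extend ω y
      cases (yes z) = ≡.trans (extend-≈0 x z) (≡.sym (extend-≈0 y (trans (sym x≈y) z)))
      cases (no nz) = ≡.trans (extend-≉0 x nz) (≡.trans (≡.cong signℝ (χ-cong _ _ x≈y))
        (≡.sym (extend-≉0 y (λ z → nz (trans x≈y z)))))

    extend-local : ∀ x → x ≉ 0# → ∃ λ n → ∀ y → NearF n x y → extend ω y ≡ extend ω x
    extend-local x x≉0 =
      let k , vx = val-exists x≉0 ; m , const = continuous (x , x≉0)
      in (k ℤ.+ 1ℤ) ℤ.⊔ m , λ y near →
        let y≉0 = val⇒≉0 (val-near {m = k ℤ.+ 1ℤ} vx (P-mono {k ℤ.+ 1ℤ} (ℤ.i≤i⊔j (k ℤ.+ 1ℤ) m) near) ℤ.≤-refl)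
        in ≡.trans (extend-≉0 y y≉0) (≡.trans
             (≡.cong signℝ (const (y , y≉0) (P-mono {m} (ℤ.i≤j⊔i (k ℤ.+ 1ℤ) m) near))) (≡.sym (extend-≉0 x x≉0)))

    sign-≤1 : ∀ σ → signℝ σ ℝ.≤ ℝ.1# × ℝ.- signℝ σ ℝ.≤ ℝ.1#
    sign-≤1 Sign.+ = ≤.refl , ≤.trans (R.≤-respʳ (R.solve 0 (R.:- R.:0 R.:= R.:0) ℝ.refl) (R.neg-mono-≤ R.0≤1)) R.0≤1
    sign-≤1 Sign.- = ≤.trans (R.≤-respʳ (R.solve 0 (R.:- R.:0 R.:= R.:0) ℝ.refl) (R.neg-mono-≤ R.0≤1)) R.0≤1 ,
                     ≤.reflexive (R.solve 0 (R.:- (R.:- R.:1) R.:= R.:1) ℝ.refl)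

    extend-≤1 : ∀ x → extend ω x ℝ.≤ ℝ.1# × ℝ.- extend ω x ℝ.≤ ℝ.1#
    extend-≤1 x = cases em
      where
      cases : Dec (x ≈ 0#) → extend ω x ℝ.≤ ℝ.1# × ℝ.- extend ω x ℝ.≤ ℝ.1#
      cases (yes z) = ≡.subst (λ e → e ℝ.≤ ℝ.1# × ℝ.- e ℝ.≤ ℝ.1#) (≡.sym (extend-≈0 x z))
        (R.0≤1 , R.≤-respˡ (R.solve 0 (R.:0 R.:= R.:- R.:0) ℝ.refl) R.0≤1)
      cases (no nz) = ≡.subst (λ e → e ℝ.≤ ℝ.1# × ℝ.- e ℝ.≤ ℝ.1#) (≡.sym (extend-≉0 x nz)) (sign-≤1 (χ ω (x , nz)))

-- ∫_O ω(n) dn as the limit of the integrals over O ∖ P^N.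
module ImproperIntegral (em : ExcludedMiddle 0ℓ) (ℝ : RealField) (F : LocalField) (E : SeparableQuadraticExtension F)
                        (dn : Integration.Measure ℝ (LocalField.F-space F))
                        (dn-invariant : ∀ x → Integration.InvariantUnder ℝ dn (LocalField._+_ F x))
                        (ω : LocalField.QuadraticCharacter F) where
  open LocalField F hiding (zero)
  open GroupSpaces em F
  open TestFunctions em ℝ
  open Integration ℝ
  open OrbitalIntegrals ℝ F E using (extend)
  open HaarField em ℝ F dn dn-invariant
  open Characters em ℝ F E
  open Measure dn
  private
    module ℝ = RealField ℝ
    module R = RealLemmas em ℝ
  open RealOps ℝ using (∣_∣; module ≤; sumℝ)

  Shell : ℕ → Carrier → Set
  Shell N x = P 0ℤ x × ¬ P (+ N) x

  private
    near-P : ∀ {k n x y} → k ℤ.≤ n → NearF n x y → P k x → P k y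
    near-P {k} {n} {x} {y} k≤n near p = P-resp {k} (solve 2 (λ x y → x :- (x :- y) := y) refl x y) (P-- p (P-mono {k} {n} k≤n near))

    shell-local : ∀ N x → Dec (P (+ N) x) → ∃ λ n → ∀ y → NearF n x y →
                  extend ω y ℝ.* 𝟏 (Shell N y) ℝ.≈ extend ω x ℝ.* 𝟏 (Shell N x)
    shell-local N x (yes p) = + N , λ y near →
      ℝ.trans (ℝ.trans (ℝ.*-congˡ (𝟏-no (λ (_ , ¬r) → ¬r (near-P {+ N} ℤ.≤-refl near p)))) (ℝ.zeroʳ _))
      (ℝ.sym (ℝ.trans (ℝ.*-congˡ (𝟏-no (λ (_ , ¬r) → ¬r p))) (ℝ.zeroʳ _)))
    shell-local N x (no ¬p) =
      let m , const = extend-local ω x (λ x≈0 → ¬p (P-≈0 x≈0))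
          k = + N ℤ.⊔ m
      in k , λ y near → ℝ.*-cong (ℝ.reflexive (const y (P-mono {m} {k} (ℤ.i≤j⊔i (+ N) m) near)))
           (𝟏-cong (transfer {k} y x (ℤ.i≤i⊔j (+ N) m) (P-swap near)) (transfer {k} x y (ℤ.i≤i⊔j (+ N) m) near))
      where
      transfer : ∀ {k} x y → + N ℤ.≤ k → NearF k x y → Shell N x → Shell N y
      transfer {k} x y N≤k near (p , ¬r) = near-P {0ℤ} {k} (ℤ.≤-trans (ℤ.+≤+ ℕ.z≤n) N≤k) near p ,
        λ r → ¬r (near-P {+ N} {k} N≤k (P-swap near) r)

  abstract
    -- Locally constant because `Shell N` stays away from 0, the only point where the extended
    -- character jumps.
    shell : ℕ → Cc∞ F-space ℝ.rawRing
    shell N = mkCc (λ x → extend ω x ℝ.* 𝟏 (Shell N x)) (record { local = λ x → shell-local N x em ; invar = λ () })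
      (P 0ℤ , F-compact 0ℤ , λ x nz → proj₁ (𝟏≉0 (λ z → nz (ℝ.trans (ℝ.*-congˡ z) (ℝ.zeroʳ _)))))

    shell-fun : ∀ N x → fun (shell N) x ℝ.≈ extend ω x ℝ.* 𝟏 (Shell N x)
    shell-fun N x = ℝ.refl

  S : ℕ → ℝ.Carrier
  S N = ∫ (shell N)

  private
    ext1 : ∀ N x A → 𝟏 A ℝ.≈ 𝟏 (P (+ N) x) →
           extend ω x ℝ.* 𝟏 A ℝ.≤ 𝟏 (P (+ N) x) × ℝ.- (extend ω x ℝ.* 𝟏 A) ℝ.≤ 𝟏 (P (+ N) x)
    ext1 N x A eq =
      R.≤-resp (R.solve 2 (λ a b → b R.:* a R.:= a R.:* b) ℝ.refl (extend ω x) (𝟏 A)) (ℝ.trans (ℝ.*-identityʳ _) eq)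
        (R.*-monoˡ-≤ (𝟏-nonneg A) (proj₁ (extend-≤1 ω x))) ,
      R.≤-resp (R.solve 2 (λ a b → b R.:* (R.:- a) R.:= R.:- (a R.:* b)) ℝ.refl (extend ω x) (𝟏 A)) (ℝ.trans (ℝ.*-identityʳ _) eq)
        (R.*-monoˡ-≤ (𝟏-nonneg A) (proj₂ (extend-≤1 ω x)))

    Ring : ℕ → Carrier → Set
    Ring N x = P (+ N) x × ¬ P (+ suc N) x

    ring-bound : ∀ N x → extend ω x ℝ.* 𝟏 (Ring N x) ℝ.≤ 𝟏 (P (+ N) x) × ℝ.- (extend ω x ℝ.* 𝟏 (Ring N x)) ℝ.≤ 𝟏 (P (+ N) x)
    ring-bound N x = cases em
      where
      below : ∀ {t} → t ℝ.≈ ℝ.0# → t ℝ.≤ 𝟏 (P (+ N) x) × ℝ.- t ℝ.≤ 𝟏 (P (+ N) x)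
      below z = R.≤-respˡ (ℝ.sym z) (𝟏-nonneg _) , R.≤-respˡ (ℝ.trans (R.solve 0 (R.:0 R.:= R.:- R.:0) ℝ.refl) (ℝ.-‿cong (ℝ.sym z))) (𝟏-nonneg _)
      cases : Dec (Ring N x) → extend ω x ℝ.* 𝟏 (Ring N x) ℝ.≤ 𝟏 (P (+ N) x) × ℝ.- (extend ω x ℝ.* 𝟏 (Ring N x)) ℝ.≤ 𝟏 (P (+ N) x)
      cases (yes r) = ext1 N x (Ring N x) (ℝ.trans (𝟏-yes r) (ℝ.sym (𝟏-yes (proj₁ r))))
      cases (no ¬r) = below (ℝ.trans (ℝ.*-congˡ (𝟏-no ¬r)) (ℝ.zeroʳ _))

    shell-suc : ∀ N x → 𝟏 (Shell (suc N) x) ℝ.≈ 𝟏 (Shell N x) ℝ.+ 𝟏 (Ring N x)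
    shell-suc N x = cases em em
      where
      cases : Dec (Shell N x) → Dec (Ring N x) → 𝟏 (Shell (suc N) x) ℝ.≈ 𝟏 (Shell N x) ℝ.+ 𝟏 (Ring N x)
      cases (yes (p , ¬r)) (yes (r , _)) = ⊥-elim (¬r r)
      cases (yes (p , ¬r)) (no ¬s) = ℝ.trans (𝟏-yes (p , λ t → ¬r (P-mono {+ N} {+ suc N} (ℤ.+≤+ (ℕ.n≤1+n N)) t)))
        (ℝ.sym (ℝ.trans (ℝ.+-cong (𝟏-yes (p , ¬r)) (𝟏-no ¬s)) (ℝ.+-identityʳ _)))
      cases (no ¬s) (yes (r , ¬t)) = ℝ.trans (𝟏-yes (P-mono {0ℤ} {+ N} (ℤ.+≤+ ℕ.z≤n) r , ¬t))
        (ℝ.sym (ℝ.trans (ℝ.+-cong (𝟏-no ¬s) (𝟏-yes (r , ¬t))) (ℝ.+-identityˡ _)))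
      cases (no ¬s) (no ¬t) = ℝ.trans (𝟏-no (λ (p , ¬u) → ¬s (p , λ r → ¬t (r , ¬u))))
        (ℝ.sym (ℝ.trans (ℝ.+-cong (𝟏-no ¬s) (𝟏-no ¬t)) (ℝ.+-identityˡ _)))

    P-0-≈ : ∀ N x → fun (ball 0# (+ N)) x ℝ.≈ 𝟏 (P (+ N) x)
    P-0-≈ N x = ℝ.trans (ball-fun 0# (+ N) x) (𝟏-cong (P-resp {+ N} eq) (P-resp {+ N} (sym eq)))
      where
      eq : x - 0# ≈ x
      eq = solve 1 (λ x → x :- :0 := x) refl x

    -- Consecutive integrals differ by that of ω over P^N minus P^(N+1), where |ω| ≤ 1; this is at
    -- most the volume of P^N.
    step : ∀ N → S (suc N) ℝ.≤ S N ℝ.+ PW.qp (+ N) ℝ.* volO × S N ℝ.≤ S (suc N) ℝ.+ PW.qp (+ N) ℝ.* volO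
    step N =
      R.≤-respʳ (sum-with (shell N)) (∫-mono (shell (suc N)) (shell N ⊞ ball 0# (+ N)) λ x →
        R.≤-resp (ℝ.sym (grow x)) (ℝ.+-cong (ℝ.sym (shell-fun N x)) (ℝ.sym (P-0-≈ N x))) (R.+-mono-≤ ≤.refl (proj₁ (ring-bound N x)))) ,
      R.≤-respʳ (sum-with (shell (suc N))) (∫-mono (shell N) (shell (suc N) ⊞ ball 0# (+ N)) λ x →
        R.≤-resp (ℝ.trans (shrink x) (ℝ.sym (shell-fun N x))) (ℝ.+-congˡ (ℝ.sym (P-0-≈ N x))) (R.+-mono-≤ ≤.refl (proj₂ (ring-bound N x))))
      where
      grow : ∀ x → fun (shell (suc N)) x ℝ.≈ extend ω x ℝ.* 𝟏 (Shell N x) ℝ.+ extend ω x ℝ.* 𝟏 (Ring N x)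
      grow x = ℝ.trans (shell-fun (suc N) x) (ℝ.trans (ℝ.*-congˡ (shell-suc N x)) (ℝ.distribˡ _ _ _))
      shrink : ∀ x → fun (shell (suc N)) x ℝ.+ ℝ.- (extend ω x ℝ.* 𝟏 (Ring N x)) ℝ.≈ extend ω x ℝ.* 𝟏 (Shell N x)
      shrink x = ℝ.trans (ℝ.+-congʳ (grow x)) (R.solve 2 (λ a b → (a R.:+ b) R.:- b R.:= a) ℝ.refl (extend ω x ℝ.* 𝟏 (Shell N x)) (extend ω x ℝ.* 𝟏 (Ring N x)))
      sum-with : ∀ φ → ∫ (φ ⊞ ball 0# (+ N)) ℝ.≈ ∫ φ ℝ.+ PW.qp (+ N) ℝ.* volO
      sum-with φ = ℝ.trans (additive φ (ball 0# (+ N)) (φ ⊞ ball 0# (+ N)) (λ _ → ℝ.refl)) (ℝ.+-congˡ (vol-ball₀ (+ N)))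

  -- S N − err N increases and S N + err N decreases.
  err : ℕ → ℝ.Carrier
  err N = PW.qp (+ N) ℝ.* (volO ℝ.+ volO)

  private
    err-nonneg : ∀ N → ℝ.0# ℝ.≤ err N
    err-nonneg N = ℝ.*-nonneg (PW.qp-nonneg (+ N)) (R.≤-respˡ (ℝ.+-identityˡ _) (R.+-mono-≤ volO-nonneg volO-nonneg))

    -- As q ≥ 2, twice q^(-N-1) is at most q^(-N), which leaves one summand q^(-N) vol(O) for the
    -- next step. This is why `err` carries the factor 2.
    err-suc : ∀ N → err (suc N) ℝ.+ PW.qp (+ N) ℝ.* volO ℝ.≤ err N
    err-suc N = R.≤-resp (R.solve 3 (λ p r w → (R.:1 R.:+ R.:1) R.:* (p R.:* w) R.:+ r R.:* w R.:= p R.:* (w R.:+ w) R.:+ r R.:* w) ℝ.refl p′ p volO)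
      (R.solve 2 (λ p w → p R.:* w R.:+ p R.:* w R.:= p R.:* (w R.:+ w)) ℝ.refl p volO)
      (R.+-mono-≤ (R.≤-respʳ (ℝ.trans (ℝ.sym (ℝ.*-assoc _ _ _)) (ℝ.*-congʳ (ℝ.sym pQ)))
        (R.*-mono-≤ (≤.trans R.0≤1 (R.≤-respˡ (ℝ.+-identityʳ ℝ.1#) (R.+-mono-≤ ≤.refl R.0≤1)))
          (ℝ.*-nonneg (PW.qp-nonneg (+ suc N)) volO-nonneg) PW.2≤Q ≤.refl)) ≤.refl)
      where
      p p′ : ℝ.Carrier
      p  = PW.qp (+ N)
      p′ = PW.qp (+ suc N)
      pQ : p ℝ.≈ PW.Q ℝ.* p′
      pQ = ℝ.trans (PW.qp-step (+ N)) (ℝ.*-congˡ (ℝ.reflexive (≡.cong (λ i → PW.qp (+ i)) (ℕ.+-comm N 1))))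

    lower upper : ℕ → ℝ.Carrier
    lower N = S N ℝ.- err N
    upper N = S N ℝ.+ err N

    shuffle : ∀ {s s′ e e′ w} → s ℝ.≤ s′ ℝ.+ w → e′ ℝ.+ w ℝ.≤ e → s ℝ.- e ℝ.≤ s′ ℝ.- e′
    shuffle {s} {s′} {e} {e′} {w} p r = R.0≤y-x⇒x≤y (R.≤-resp (ℝ.+-identityˡ ℝ.0#)
      (R.solve 5 (λ s s′ e e′ w → ((s′ R.:+ w) R.:- s) R.:+ (e R.:- (e′ R.:+ w)) R.:= (s′ R.:- e′) R.:- (s R.:- e)) ℝ.refl s s′ e e′ w)
      (R.+-mono-≤ (R.x≤y⇒0≤y-x p) (R.x≤y⇒0≤y-x r)))

    lower-step : ∀ N → lower N ℝ.≤ lower (suc N)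
    lower-step N = shuffle (proj₂ (step N)) (err-suc N)

    upper-step : ∀ N → upper (suc N) ℝ.≤ upper N
    upper-step N = R.0≤y-x⇒x≤y (R.≤-resp (ℝ.+-identityˡ ℝ.0#)
      (R.solve 5 (λ s s′ e e′ w → ((s R.:+ w) R.:- s′) R.:+ (e R.:- (e′ R.:+ w)) R.:= (s R.:+ e) R.:- (s′ R.:+ e′)) ℝ.refl (S N) (S (suc N)) (err N) (err (suc N)) (PW.qp (+ N) ℝ.* volO))
      (R.+-mono-≤ (R.x≤y⇒0≤y-x (proj₁ (step N))) (R.x≤y⇒0≤y-x (err-suc N))))

    lower-mono : ∀ N i → lower N ℝ.≤ lower (i ℕ.+ N)
    lower-mono N zero    = ≤.refl
    lower-mono N (suc i) = ≤.trans (lower-mono N i) (lower-step (i ℕ.+ N))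

    upper-mono : ∀ N i → upper (i ℕ.+ N) ℝ.≤ upper N
    upper-mono N zero    = ≤.refl
    upper-mono N (suc i) = ≤.trans (upper-step (i ℕ.+ N)) (upper-mono N i)

    lower≤upper : ∀ N → lower N ℝ.≤ upper N
    lower≤upper N = R.+-mono-≤ ≤.refl (≤.trans (R.≤-respʳ (R.solve 0 (R.:- R.:0 R.:= R.:0) ℝ.refl) (R.neg-mono-≤ (err-nonneg N))) (err-nonneg N))

    crossing : ∀ M N → lower M ℝ.≤ upper N
    crossing M N = ≤.trans (lower-mono M N) (≤.trans (lower≤upper (N ℕ.+ M))
      (R.≤-respˡ (ℝ.reflexive (≡.cong upper (ℕ.+-comm M N))) (upper-mono N M)))

    Below : Pred ℝ.Carrier 0ℓ
    Below y = ∃ λ N → y ℝ.≤ lower N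

    bounds : ∀ N → ℝ.UpperBound Below (upper N)
    bounds N y (M , y≤) = ≤.trans y≤ (crossing M N)

  abstract
    limit : ∃ (ℝ.LeastUpperBound Below)
    limit = ℝ.supremum Below (lower 0 , 0 , ≤.refl) (upper 0 , bounds 0)

  L : ℝ.Carrier
  L = proj₁ limit

  S-close : ∀ N → S N ℝ.- L ℝ.≤ err N × L ℝ.- S N ℝ.≤ err N
  S-close N =
    R.≤-resp (R.solve 3 (λ s e l → (s R.:- e) R.:+ (e R.:- l) R.:= s R.:- l) ℝ.refl (S N) (err N) L)
             (R.solve 2 (λ e l → l R.:+ (e R.:- l) R.:= e) ℝ.refl (err N) L)
             (ℝ.+-monoˡ-≤ (err N ℝ.- L) (proj₁ (proj₂ limit) (lower N) (N , ≤.refl))) ,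
    R.≤-respʳ (R.solve 2 (λ s e → (s R.:+ e) R.:- s R.:= e) ℝ.refl (S N) (err N))
             (ℝ.+-monoˡ-≤ (ℝ.- S N) (proj₂ (proj₂ limit) (upper N) (bounds N)))

  private
    abs-* : ∀ α {t e} → t ℝ.≤ e → ℝ.- t ℝ.≤ e → α ℝ.* t ℝ.≤ ∣ α ∣ ℝ.* e × ℝ.- (α ℝ.* t) ℝ.≤ ∣ α ∣ ℝ.* e
    abs-* α {t} {e} p r with ≤.total ℝ.0# α
    ... | inj₁ 0≤α = R.*-monoˡ-≤ 0≤α p , R.≤-respˡ (R.solve 2 (λ a t → a R.:* (R.:- t) R.:= R.:- (a R.:* t)) ℝ.refl α t) (R.*-monoˡ-≤ 0≤α r)
    ... | inj₂ α≤0 = R.≤-respˡ (R.solve 2 (λ a t → (R.:- a) R.:* (R.:- t) R.:= a R.:* t) ℝ.refl α t) (R.*-monoˡ-≤ (R.x≤0⇒0≤-x α≤0) r) ,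
                     R.≤-respˡ (R.solve 2 (λ a t → (R.:- a) R.:* t R.:= R.:- (a R.:* t)) ℝ.refl α t) (R.*-monoˡ-≤ (R.x≤0⇒0≤-x α≤0) p)

  -- The approximation is θ + α `shell N`. The difference lives on P^N and is dominated by |α| times
  -- the indicator function there, a single term with integral tending to 0.
  hasIntegral-extend : ∀ {h} θ α → (∀ x → h x ℝ.≈ fun θ x ℝ.+ α ℝ.* (extend ω x ℝ.* 𝟏 (P 0ℤ x))) →
                       HasIntegralℝ dn h (∫ θ ℝ.+ α ℝ.* L)
  hasIntegral-extend {h} θ α eq ε 0<ε = φ , ψ , ψ-nonneg , dominated , small , close
    where
    N : ℕ
    -- One choice serves twice: |α| `err N` ≤ ε bounds both the dominating integral and the distance
    -- from the limit.
    N = proj₁ (PW.qp-small (∣ α ∣ ℝ.* (volO ℝ.+ volO)) 0<ε)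
    αerr≤ε : ∣ α ∣ ℝ.* err N ℝ.≤ ε
    αerr≤ε = R.≤-respˡ (R.solve 3 (λ a w p → a R.:* w R.:* p R.:= a R.:* (p R.:* w)) ℝ.refl ∣ α ∣ (volO ℝ.+ volO) (PW.qp (+ N)))
      (proj₂ (PW.qp-small (∣ α ∣ ℝ.* (volO ℝ.+ volO)) 0<ε))
    φ : Cc∞ F-space ℝ.rawRing
    φ = θ ⊞ α ⊡ shell N
    ψ₀ : Cc∞ F-space ℝ.rawRing
    ψ₀ = ∣ α ∣ ⊡ ball 0# (+ N)
    ψ : ℕ → Cc∞ F-space ℝ.rawRing
    ψ zero    = ψ₀
    ψ (suc _) = 𝟎
    ψ₀-fun : ∀ x → fun ψ₀ x ℝ.≈ ∣ α ∣ ℝ.* 𝟏 (P (+ N) x)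
    ψ₀-fun x = ℝ.*-congˡ (P-0-≈ N x)
    ψ-nonneg : ∀ j x → ℝ.0# ℝ.≤ fun (ψ j) x
    ψ-nonneg zero    x = R.≤-respʳ (ℝ.sym (ψ₀-fun x)) (ℝ.*-nonneg (R.∣∣-nonneg α) (𝟏-nonneg _))
    ψ-nonneg (suc _) x = ≤.refl
    split : ∀ x → Dec (P (+ N) x) → 𝟏 (P 0ℤ x) ℝ.≈ 𝟏 (Shell N x) ℝ.+ 𝟏 (P (+ N) x)
    split x (yes p) = ℝ.trans (𝟏-yes (P-mono {0ℤ} {+ N} (ℤ.+≤+ ℕ.z≤n) p))
      (ℝ.sym (ℝ.trans (ℝ.+-cong (𝟏-no (λ (_ , ¬r) → ¬r p)) (𝟏-yes p)) (ℝ.+-identityˡ _)))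
    split x (no ¬p) = ℝ.trans (𝟏-cong (λ r → r , ¬p) proj₁) (ℝ.sym (ℝ.trans (ℝ.+-congˡ (𝟏-no ¬p)) (ℝ.+-identityʳ _)))
    difference : ∀ x → h x ℝ.- fun φ x ℝ.≈ α ℝ.* (extend ω x ℝ.* 𝟏 (P (+ N) x))
    difference x = ℝ.trans (ℝ.+-cong (ℝ.trans (eq x) (ℝ.+-congˡ (ℝ.*-congˡ (ℝ.*-congˡ (split x em)))))
        (ℝ.-‿cong (ℝ.+-congˡ (ℝ.*-congˡ (shell-fun N x)))))
      (R.solve 5 (λ t a e u w → (t R.:+ a R.:* (e R.:* (u R.:+ w))) R.:- (t R.:+ a R.:* (e R.:* u)) R.:= a R.:* (e R.:* w))
        ℝ.refl (fun θ x) α (extend ω x) (𝟏 (Shell N x)) (𝟏 (P (+ N) x)))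
    dominated : DominatedBy {F-space} (λ x → ∣ h x ℝ.- fun φ x ∣) ψ
    dominated x r sums = ≤.trans (R.∣∣-≤
        (R.≤-respˡ (ℝ.sym (difference x)) (proj₁ bound)) (R.≤-respˡ (ℝ.-‿cong (ℝ.sym (difference x))) (proj₂ bound)))
      (R.≤-respˡ (ℝ.trans (ℝ.+-identityˡ _) (ψ₀-fun x)) (sums 1))
      where
      e-bound = ext1 N x (P (+ N) x) ℝ.refl
      bound = abs-* α (proj₁ e-bound) (proj₂ e-bound)
    ∫ψ₀≤ε : ∫ ψ₀ ℝ.≤ ε
    ∫ψ₀≤ε = ≤.trans (R.≤-respˡ (ℝ.sym (ℝ.trans (scalar ∣ α ∣ (ball 0# (+ N)) ψ₀ (λ _ → ℝ.refl)) (ℝ.*-congˡ (vol-ball₀ (+ N)))))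
      (R.*-monoˡ-≤ (R.∣∣-nonneg α) (R.*-monoˡ-≤ (PW.qp-nonneg (+ N)) (R.≤-respˡ (ℝ.+-identityʳ volO) (R.+-mono-≤ ≤.refl volO-nonneg))))) αerr≤ε
    partial : ∀ n → sumℝ (λ j → ∫ (ψ j)) (suc n) ℝ.≈ ∫ ψ₀
    partial zero    = ℝ.+-identityˡ _
    partial (suc n) = ℝ.trans (ℝ.+-cong (partial n) (∫-zero 𝟎 (λ _ → ℝ.refl))) (ℝ.+-identityʳ _)
    small : ∀ n → sumℝ (λ j → ∫ (ψ j)) n ℝ.≤ ε
    small zero    = proj₁ 0<ε
    small (suc n) = R.≤-respˡ (ℝ.sym (partial n)) ∫ψ₀≤ε
    ∫φ-L : ∫ φ ℝ.- (∫ θ ℝ.+ α ℝ.* L) ℝ.≈ α ℝ.* (S N ℝ.- L)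
    ∫φ-L = ℝ.trans (ℝ.+-congʳ (ℝ.trans (additive θ (α ⊡ shell N) φ (λ _ → ℝ.refl)) (ℝ.+-congˡ (scalar α (shell N) (α ⊡ shell N) (λ _ → ℝ.refl)))))
      (R.solve 4 (λ t a s l → (t R.:+ a R.:* s) R.:- (t R.:+ a R.:* l) R.:= a R.:* (s R.:- l)) ℝ.refl (∫ θ) α (S N) L)
    close : ∣ ∫ φ ℝ.- (∫ θ ℝ.+ α ℝ.* L) ∣ ℝ.≤ ε
    close = ≤.trans (R.∣∣-≤ (R.≤-respˡ (ℝ.sym ∫φ-L) (proj₁ bound)) (R.≤-respˡ (ℝ.-‿cong (ℝ.sym ∫φ-L)) (proj₂ bound))) αerr≤ε
      where
      bound = abs-* α (proj₁ (S-close N))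
        (R.≤-respˡ (R.solve 2 (λ s l → l R.:- s R.:= R.:- (s R.:- l)) ℝ.refl (S N) L) (proj₂ (S-close N)))

-- Test functions on SL(2,F) and conjugates of unipotent matrices.

module GroupTests (em : ExcludedMiddle 0ℓ) (ℝ : RealField) (F : LocalField) where
  open LocalField F hiding (zero)
  open SL₂ F
  open GroupSpaces em F
  open Conjugation em F
  open TestFunctions em ℝ
  private
    module ℝ = RealField ℝ
    module OG = OnSpace G-near

  -- By compactness, every element of C_c^∞(SL(2,F)) has this form.
  record GTest : Set where
    field
      val   : SL2 → ℝ.Carrier
      N M   : ℤ
      supp  : ∀ x → val x ℝ.≉ ℝ.0# → B N x
      const : ∀ x y → NearG M x y → val x ℝ.≈ val y

  open GTest public

  val-≋ : ∀ g x y → x ≋ y → val g y ℝ.≈ val g x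
  val-≋ g x y x≋y = const g y x (nearG-sym {M g} {x} {y} (nearG-refl {M g} {x} {y} x≋y))

  module _ (φ : Cc∞ G-space ℝ.rawRing) where
    private
      C : Pred SL2 0ℓ
      C = proj₁ (Cc∞.compactSupport φ)
      C-compact : Compact G-space C
      C-compact = proj₁ (proj₂ (Cc∞.compactSupport φ))
      ∉C : ∀ x → ¬ C x → fun φ x ℝ.≈ ℝ.0#
      ∉C x ¬c = cases em
        where
        cases : Dec (fun φ x ℝ.≈ ℝ.0#) → fun φ x ℝ.≈ ℝ.0#
        cases (yes z) = z
        cases (no nz) = ⊥-elim (¬c (proj₂ (proj₂ (Cc∞.compactSupport φ)) x nz))

    abstract
      bounded-support : ∃ λ N → ∀ x → fun φ x ℝ.≉ ℝ.0# → B N x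
      bounded-support = low (proj₁ cover) , λ x nz →
        below (proj₁ cover) x (proj₂ cover x (proj₂ (proj₂ (Cc∞.compactSupport φ)) x nz))
        where
        cover : ∃ λ (ks : List ℤ) → ∀ x → C x → Any (λ k → B k x) ks
        cover = C-compact B (λ k x p → k , λ y near → B-near x y near p) (λ x _ → B-exists x)
        low : List ℤ → ℤ
        low []       = 0ℤ
        low (k ∷ ks) = k ℤ.⊓ low ks
        below : ∀ ks x → Any (λ k → B k x) ks → B (low ks) x
        below (k ∷ ks) x (here p)  = B-mono x (ℤ.i⊓j≤i k (low ks)) p
        below (k ∷ ks) x (there p) = B-mono x (ℤ.i⊓j≤j k (low ks)) (below ks x p)

      uniformly-constant : ∃ λ M → ∀ x y → NearG M x y → fun φ x ℝ.≈ fun φ y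
      uniformly-constant = high (proj₁ cover) , λ x y near → cases x y near em em
        where
        Index : Set
        Index = ∃ λ x → ∃ λ n → ∀ y → NearG n x y → fun φ y ℝ.≈ fun φ x
        U : Index → Pred SL2 0ℓ
        U (x , n , _) y = NearG n x y
        cover : ∃ λ (is : List Index) → ∀ x → C x → Any (λ i → U i x) is
        cover = C-compact U (λ (x , n , _) y near → n , λ z near′ → nearG-trans {n} {x} {y} {z} near near′)
          (λ x _ → (x , OG.Smooth.local (OG.smooth φ) x) , nearG-refl {x = x} {x} (≋-refl {x}))
        high : List Index → ℤ
        high []                 = 0ℤ
        high ((_ , n , _) ∷ is) = n ℤ.⊔ high is
        inside : ∀ is x y → Any (λ i → U i x) is → NearG (high is) x y → fun φ x ℝ.≈ fun φ y
        inside ((z , n , const) ∷ is) x y (here near) near′ = ℝ.trans (const x near)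
          (ℝ.sym (const y (nearG-trans {n} {z} {x} {y} near (nearG-mono {n} {_} {x} {y} (ℤ.i≤i⊔j n (high is)) near′))))
        inside ((z , n , const) ∷ is) x y (there p) near′ = inside is x y p (nearG-mono {high is} {_} {x} {y} (ℤ.i≤j⊔i n (high is)) near′)
        cases : ∀ x y → NearG (high (proj₁ cover)) x y → Dec (C x) → Dec (C y) → fun φ x ℝ.≈ fun φ y
        cases x y near (yes c) _       = inside (proj₁ cover) x y (proj₂ cover x c) near
        cases x y near (no _)  (yes c) = ℝ.sym (inside (proj₁ cover) y x (proj₂ cover y c) (nearG-sym {_} {x} {y} near))
        cases x y near (no ¬c) (no ¬d) = ℝ.trans (∉C x ¬c) (ℝ.sym (∉C y ¬d))

    fromCc : GTest
    fromCc = record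
      { val = fun φ ; N = proj₁ bounded-support ; M = proj₁ uniformly-constant
      ; supp = proj₂ bounded-support ; const = proj₂ uniformly-constant }

  lin : ℝ.Carrier → GTest → GTest → GTest
  lin α g h = record
    { val   = λ x → α ℝ.* val g x ℝ.+ val h x
    ; N     = N g ℤ.⊓ N h
    ; M     = M g ℤ.⊔ M h
    ; supp  = λ x nz → cases x nz em
    ; const = λ x y near → ℝ.+-cong
        (ℝ.*-congˡ (const g x y (nearG-mono {M g} {_} {x} {y} (ℤ.i≤i⊔j (M g) (M h)) near)))
        (const h x y (nearG-mono {M h} {_} {x} {y} (ℤ.i≤j⊔i (M g) (M h)) near))
    }
    where
    cases : ∀ x → α ℝ.* val g x ℝ.+ val h x ℝ.≉ ℝ.0# → Dec (val g x ℝ.≈ ℝ.0#) → B (N g ℤ.⊓ N h) x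
    cases x nz (no g≉0)  = B-mono x (ℤ.i⊓j≤i (N g) (N h)) (supp g x g≉0)
    cases x nz (yes g≈0) = B-mono x (ℤ.i⊓j≤j (N g) (N h)) (supp h x (λ h≈0 → nz
      (ℝ.trans (ℝ.+-cong (ℝ.trans (ℝ.*-congˡ g≈0) (ℝ.zeroʳ α)) h≈0) (ℝ.+-identityˡ ℝ.0#))))

  indicator-K : GTest
  indicator-K = record
    { val = λ x → 𝟏 (B 0ℤ x) ; N = 0ℤ ; M = 0ℤ ; supp = λ x nz → 𝟏≉0 nz
    ; const = λ x y near → 𝟏-cong (B-near x y near) (B-near y x (nearG-sym {0ℤ} {x} {y} near)) }

  reduced : GTest → GTest
  reduced g = lin (ℝ.- val g I) indicator-K g

  reduced-I : ∀ g → val (reduced g) I ℝ.≈ ℝ.0#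
  reduced-I g = ℝ.trans (ℝ.+-congʳ (ℝ.trans (ℝ.*-congˡ (𝟏-yes (P-1 , P-0 0ℤ , P-0 0ℤ , P-1))) (ℝ.*-identityʳ _))) (ℝ.-‿inverseˡ _)

  ballG : SL2 → ℤ → GTest
  ballG g m = record
    { val = λ x → 𝟏 (NearG m g x) ; N = N₀ ; M = m
    ; supp = λ x nz → inside x (𝟏≉0 nz)
    ; const = λ x y near → 𝟏-cong (λ p → nearG-trans {m} {g} {x} {y} p near)
                                  (λ p → nearG-trans {m} {g} {y} {x} p (nearG-sym {m} {x} {y} near)) }
    where
    N₀ : ℤ
    N₀ = proj₁ (B-exists g) ℤ.⊓ m
    inside : ∀ x → NearG m g x → B N₀ x
    inside x near = B-near g x (nearG-mono {N₀} {m} {g} {x} (ℤ.i⊓j≤j (proj₁ (B-exists g)) m) near)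
      (let p , q , r , s = proj₂ (B-exists g) ; le = ℤ.i⊓j≤i (proj₁ (B-exists g)) m
       in P-mono {N₀} le p , P-mono {N₀} le q , P-mono {N₀} le r , P-mono {N₀} le s)

  u : SL2 → Carrier → SL2
  u k n = cj k (unipotent n)

  module Conjugate (k : SL2) (n : Carrier) where
    u-b : b (u k n) ≈ n * (d k * d k)
    u-b = trans (proj₁ (proj₂ (cj-≋ k (unipotent n)))) (solve 3 (λ β δ n → (δ :* :1 :+ (:- β) :* :0) :* β :+ (δ :* n :+ (:- β) :* :1) :* δ := n :* (δ :* δ)) refl (b k) (d k) n)

    u-c : c (u k n) ≈ - (n * (c k * c k))
    u-c = trans (proj₁ (proj₂ (proj₂ (cj-≋ k (unipotent n))))) (solve 3 (λ α γ n → ((:- γ) :* :1 :+ α :* :0) :* α :+ ((:- γ) :* n :+ α :* :1) :* γ := :- (n :* (γ :* γ))) refl (a k) (c k) n)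

    u-a : a (u k n) ≈ 1# + n * (c k * d k)
    u-a = trans (trans (proj₁ (cj-≋ k (unipotent n))) (solve 5 (λ α β γ δ n → (δ :* :1 :+ (:- β) :* :0) :* α :+ (δ :* n :+ (:- β) :* :1) :* γ
      := (α :* δ :- β :* γ) :+ n :* (γ :* δ)) refl (a k) (b k) (c k) (d k) n)) (+-congʳ (det k))

    u-d : d (u k n) ≈ 1# - n * (c k * d k)
    u-d = trans (trans (proj₂ (proj₂ (proj₂ (cj-≋ k (unipotent n))))) (solve 5 (λ α β γ δ n → ((:- γ) :* :1 :+ α :* :0) :* β :+ ((:- γ) :* n :+ α :* :1) :* δ
      := (α :* δ :- β :* γ) :- n :* (γ :* δ)) refl (a k) (b k) (c k) (d k) n)) (+-congʳ (det k))

  u-near : ∀ j k k′ n n′ → P j (n * (c k * d k) - n′ * (c k′ * d k′)) → P j (n * (d k * d k) - n′ * (d k′ * d k′)) →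
           P j (n * (c k * c k) - n′ * (c k′ * c k′)) → NearG j (u k n) (u k′ n′)
  u-near j k k′ n n′ cd dd cc =
    P-resp {j} (trans (solve 2 (λ x y → x :- y := (:1 :+ x) :- (:1 :+ y)) refl (n * (c k * d k)) (n′ * (c k′ * d k′))) (+-cong (sym U.u-a) (-‿cong (sym U′.u-a)))) cd ,
    P-resp {j} (+-cong (sym U.u-b) (-‿cong (sym U′.u-b))) dd ,
    P-resp {j} (trans (solve 2 (λ x y → :- (x :- y) := (:- x) :- (:- y)) refl (n * (c k * c k)) (n′ * (c k′ * c k′))) (+-cong (sym U.u-c) (-‿cong (sym U′.u-c)))) (P-neg cc) ,
    P-resp {j} (trans (solve 2 (λ x y → :- (x :- y) := (:1 :- x) :- (:1 :- y)) refl (n * (c k * d k)) (n′ * (c k′ * d k′))) (+-cong (sym U.u-d) (-‿cong (sym U′.u-d)))) (P-neg cd)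
    where
    module U = Conjugate k n
    module U′ = Conjugate k′ n′

  module Integral (k : K) where
    private
      g = K.g k
      O* : ∀ {x y} → P 0ℤ x → P 0ℤ y → P 0ℤ (x * y)
      O* p r = P-*ˡ {0ℤ} p r

    u-near-n : ∀ j n n′ → P j (n - n′) → NearG j (u g n) (u g n′)
    u-near-n j n n′ p = u-near j g g n n′ (go (O* (K.cᵒ k) (K.dᵒ k))) (go (O* (K.dᵒ k) (K.dᵒ k))) (go (O* (K.cᵒ k) (K.cᵒ k)))
      where
      go : ∀ {w} → P 0ℤ w → P j (n * w - n′ * w)
      go {w} r = P-resp {j} (solve 3 (λ n n′ w → (n :- n′) :* w := n :* w :- n′ :* w) refl n n′ w) (P-*ʳ {j} p r)

    u-near-I : ∀ j n → P j n → NearG j (u g n) I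
    u-near-I j n p =
      P-resp {j} (trans (solve 1 (λ x → x := (:1 :+ x) :- :1) refl (n * (c g * d g))) (+-congʳ (sym u-a))) (P-*ʳ {j} p (O* (K.cᵒ k) (K.dᵒ k))) ,
      P-resp {j} (trans (solve 1 (λ x → x := x :- :0) refl (n * (d g * d g))) (+-congʳ (sym u-b))) (P-*ʳ {j} p (O* (K.dᵒ k) (K.dᵒ k))) ,
      P-resp {j} (trans (solve 1 (λ x → :- x := (:- x) :- :0) refl (n * (c g * c g))) (+-congʳ (sym u-c))) (P-neg (P-*ʳ {j} p (O* (K.cᵒ k) (K.cᵒ k)))) ,
      P-resp {j} (trans (solve 1 (λ x → :- x := (:1 :- x) :- :1) refl (n * (c g * d g))) (+-congʳ (sym u-d))) (P-neg (P-*ʳ {j} p (O* (K.cᵒ k) (K.dᵒ k))))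
      where open Conjugate g n

    unit-entry : ¬ P 1ℤ (c g) ⊎ ¬ P 1ℤ (d g)
    unit-entry = cases em
      where
      cases : Dec (P 1ℤ (c g)) → ¬ P 1ℤ (c g) ⊎ ¬ P 1ℤ (d g)
      cases (no ¬p) = inj₁ ¬p
      cases (yes p) = inj₂ (λ r → i+1≰i (P-val val-1 (P-resp {1ℤ} (det g) (P-- (P-*ˡ {1ℤ} (K.aᵒ k) r) (P-*ˡ {1ℤ} (K.bᵒ k) p)))))

    unit-cancel : ∀ {j n w} → P 0ℤ w → ¬ P 1ℤ w → P j (n * (w * w)) → P j n
    unit-cancel {j} {n} {w} p ¬p r = P-cancel {j} vw (P-cast (≡.sym (ℤ.+-identityˡ j)) (P-cancel {j} vw (P-cast (≡.sym (ℤ.+-identityˡ j))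
      (P-resp {j} (solve 2 (λ n w → n :* (w :* w) := w :* (w :* n)) refl n w) r))))
      where
      vw : v w ≡ fin 0ℤ
      vw = val-from p ¬p

    -- The off-diagonal entries are n d² and - n c², and one of the integral entries c, d is a unit
    -- since the determinant is 1.
    u-entries : ∀ j n → P j (b (u g n)) → P j (c (u g n)) → P j n
    u-entries j n pb pc = cases unit-entry
      where
      open Conjugate g n
      cases : ¬ P 1ℤ (c g) ⊎ ¬ P 1ℤ (d g) → P j n
      cases (inj₁ ¬c) = unit-cancel (K.cᵒ k) ¬c (P-resp {j} (trans (-‿cong u-c) (solve 1 (λ x → :- (:- x) := x) refl (n * (c g * c g)))) (P-neg pc))
      cases (inj₂ ¬d) = unit-cancel (K.dᵒ k) ¬d (P-resp {j} u-b pb)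

    u-bounded : ∀ j n → B j (u g n) → P j n
    u-bounded j n (_ , pb , pc , _) = u-entries j n pb pc

    u-far : ∀ j n → NearG j (u g n) I → P j n
    u-far j n (_ , pb , pc , _) = u-entries j n (P-resp {j} (drop-0 (b (u g n))) pb) (P-resp {j} (drop-0 (c (u g n))) pc)
      where
      drop-0 : ∀ x → x - 0# ≈ x
      drop-0 = solve 1 (λ x → x :- :0 := x) refl

    u-integral : ∀ n → P 0ℤ n → B 0ℤ (u g n)
    u-integral n p = B-near I (u g n) (nearG-sym {0ℤ} {u g n} {I} (u-near-I 0ℤ n p)) (P-1 , P-0 0ℤ , P-0 0ℤ , P-1)

  u-near-k : ∀ (k l : K) N j n → P N n → NearG j (K.g k) (K.g l) → NearG (N ℤ.+ j) (u (K.g k) n) (u (K.g l) n)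
  u-near-k k l N j n p (_ , _ , pc , pd) = u-near (N ℤ.+ j) (K.g k) (K.g l) n n
    (go (c (K.g k)) (d (K.g k)) (c (K.g l)) (d (K.g l)) (K.dᵒ k) (K.cᵒ l) pc pd)
    (go (d (K.g k)) (d (K.g k)) (d (K.g l)) (d (K.g l)) (K.dᵒ k) (K.dᵒ l) pd pd)
    (go (c (K.g k)) (c (K.g k)) (c (K.g l)) (c (K.g l)) (K.cᵒ k) (K.cᵒ l) pc pc)
    where
    go : ∀ x y x′ y′ → P 0ℤ y → P 0ℤ x′ → P j (x - x′) → P j (y - y′) → P (N ℤ.+ j) (n * (x * y) - n * (x′ * y′))
    go x y x′ y′ py px′ dx dy = P-resp {N ℤ.+ j}
      (solve 5 (λ n x y x′ y′ → n :* ((x :- x′) :* y :+ x′ :* (y :- y′)) := n :* (x :* y) :- n :* (x′ :* y′)) refl n x y x′ y′)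
      (P-* {N} {j} p (P-+ (P-*ʳ {j} dx py) (P-*ˡ {j} px′ dy)))

-- The unipotent integrals as linear functionals.

module UnipotentIntegrals (em : ExcludedMiddle 0ℓ) (ℝ : RealField) (F : LocalField) (E : SeparableQuadraticExtension F)
    (dk : Integration.Measure ℝ (SL₂.K-space F))
    (dk-invariant : ∀ k → Integration.InvariantUnder ℝ dk (SL₂._·ᴷ_ F k))
    (dn : Integration.Measure ℝ (LocalField.F-space F))
    (dn-invariant : ∀ x → Integration.InvariantUnder ℝ dn (LocalField._+_ F x))
    (ω : LocalField.QuadraticCharacter F) where
  open LocalField F hiding (zero)
  open SL₂ F
  open GroupSpaces em F
  open GroupTests em ℝ F
  open TestFunctions em ℝ
  open Integration ℝ
  open OrbitalIntegrals ℝ F E using (extend)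
  open Characters em ℝ F E
  open ImproperIntegral em ℝ F E dn dn-invariant ω using (hasIntegral-extend)
  open ImproperIntegral em ℝ F E dn dn-invariant ω public using (L)
  private
    module ℝ = RealField ℝ
    module R = RealLemmas em ℝ
    module HF = HaarField em ℝ F dn dn-invariant
    module HK = HaarCompact em ℝ F dk dk-invariant
    module dn = Measure dn
    module dk = Measure dk

  module _ (f : GTest) (fI≈0 : val f I ℝ.≈ ℝ.0#) where
    private
      -- Near n = 0 the character jumps, but there k⁻¹ u(n) k is close to 1, where f vanishes;
      -- elsewhere both factors are locally constant.
      θ-local : ∀ (k : K) n → Dec (n ≈ 0#) → ∃ λ m → ∀ n′ → NearF m n n′ →
                extend ω n′ ℝ.* val f (u (K.g k) n′) ℝ.≈ extend ω n ℝ.* val f (u (K.g k) n)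
      θ-local k n (yes n≈0) = M f , λ n′ near → ℝ.trans (vanish n′ (P-resp {M f} (solve 2 (λ n n′ → n :- (n :- n′) := n′) refl n n′) (P-- (P-≈0 n≈0) near)))
          (ℝ.sym (vanish n (P-≈0 n≈0)))
        where
        vanish : ∀ n → P (M f) n → extend ω n ℝ.* val f (u (K.g k) n) ℝ.≈ ℝ.0#
        vanish n p = ℝ.trans (ℝ.*-congˡ (ℝ.trans (const f (u (K.g k) n) I (Integral.u-near-I k (M f) n p)) fI≈0)) (ℝ.zeroʳ _)
      θ-local k n (no n≉0) = let m , loc = extend-local ω n n≉0 in m ℤ.⊔ M f , λ n′ near →
        ℝ.*-cong (ℝ.reflexive (loc n′ (P-mono {m} (ℤ.i≤i⊔j m (M f)) near)))
          (const f (u (K.g k) n′) (u (K.g k) n) (Integral.u-near-n k (M f) n′ n (P-swap (P-mono {M f} (ℤ.i≤j⊔i m (M f)) near))))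

    abstract
      θ : K → Cc∞ F-space ℝ.rawRing
      θ k = HF.mkCc (λ n → extend ω n ℝ.* val f (u (K.g k) n)) (record { local = λ n → θ-local k n em ; invar = λ () })
        (P (N f) , F-compact (N f) , λ n nz → Integral.u-bounded k (N f) n
          (supp f (u (K.g k) n) (λ z → nz (ℝ.trans (ℝ.*-congˡ z) (ℝ.zeroʳ _)))))

      θ-fun : ∀ k n → fun (θ k) n ℝ.≈ extend ω n ℝ.* val f (u (K.g k) n)
      θ-fun k n = ℝ.refl

    private
      -- Only n ∈ P^N contributes, N being the support bound of f. For such n a change of k modulo
      -- P^(M-N) changes k⁻¹ u(n) k modulo P^M, which f does not see.
      J-local : ∀ k → ∃ λ j → ∀ l → NearG j (K.g k) (K.g l) → dn.∫ (θ l) ℝ.≈ dn.∫ (θ k)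
      J-local k = M f ℤ.- N f , λ l near → HF.∫-cong (θ l) (θ k) λ n → ℝ.trans (θ-fun l n) (ℝ.trans
          (ℝ.*-congˡ (cases l near n em)) (ℝ.sym (θ-fun k n)))
        where
        cases : ∀ l → NearG (M f ℤ.- N f) (K.g k) (K.g l) → ∀ n → Dec (P (N f) n) → val f (u (K.g l) n) ℝ.≈ val f (u (K.g k) n)
        cases l near n (yes p) = const f (u (K.g l) n) (u (K.g k) n) (≡.subst (λ i → NearG i (u (K.g l) n) (u (K.g k) n))
          (ℤS.solve 2 (λ M N → N ℤS.:+ (M ℤS.:- N) ℤS.:= M) ≡.refl (M f) (N f))
          (u-near-k l k (N f) (M f ℤ.- N f) n p (nearG-sym {_} {K.g k} {K.g l} near)))
        cases l near n (no ¬p) = ℝ.trans (zero-out l n ¬p em) (ℝ.sym (zero-out k n ¬p em))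
          where
          zero-out : ∀ k n → ¬ P (N f) n → Dec (val f (u (K.g k) n) ℝ.≈ ℝ.0#) → val f (u (K.g k) n) ℝ.≈ ℝ.0#
          zero-out k n ¬p (yes z) = z
          zero-out k n ¬p (no nz) = ⊥-elim (¬p (Integral.u-bounded k (N f) n (supp f (u (K.g k) n) nz)))

    abstract
      J : Cc∞ K-space ℝ.rawRing
      J = HK.mkCcK (λ k → dn.∫ (θ k)) J-local

      J-fun : ∀ k → fun J k ℝ.≈ dn.∫ (θ k)
      J-fun k = ℝ.refl

    Λ : ℝ.Carrier
    Λ = dk.∫ J

  Λ-lin : ∀ α g gI h hI f fI → (∀ x → val f x ℝ.≈ α ℝ.* val g x ℝ.+ val h x) →
          Λ f fI ℝ.≈ α ℝ.* Λ g gI ℝ.+ Λ h hI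
  Λ-lin α g gI h hI f fI eq = HK.∫-lin α (J g gI) (J h hI) (J f fI) λ k →
    ℝ.trans (J-fun f fI k) (ℝ.trans (HF.∫-lin α (θ g gI k) (θ h hI k) (θ f fI k) (λ n →
        ℝ.trans (θ-fun f fI k n) (ℝ.trans (ℝ.*-congˡ (eq (u (K.g k) n)))
        (ℝ.trans (R.solve 4 (λ e a x y → e R.:* (a R.:* x R.:+ y) R.:= a R.:* (e R.:* x) R.:+ e R.:* y) ℝ.refl (extend ω n) α (val g (u (K.g k) n)) (val h (u (K.g k) n)))
          (ℝ.+-cong (ℝ.*-congˡ (ℝ.sym (θ-fun g gI k n))) (ℝ.sym (θ-fun h hI k n)))))))
      (ℝ.+-cong (ℝ.*-congˡ (ℝ.sym (J-fun g gI k))) (ℝ.sym (J-fun h hI k))))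

  Λ-zero : ∀ f fI → (∀ k n → val f (u k n) ℝ.≈ ℝ.0#) → Λ f fI ℝ.≈ ℝ.0#
  Λ-zero f fI eq = HK.∫-zero (J f fI) λ k → ℝ.trans (J-fun f fI k)
    (HF.∫-zero (θ f fI k) λ n → ℝ.trans (θ-fun f fI k n) (ℝ.trans (ℝ.*-congˡ (eq (K.g k) n)) (ℝ.zeroʳ _)))

  Jᵍ : GTest → K → ℝ.Carrier
  Jᵍ g k = dn.∫ (θ (reduced g) (reduced-I g) k) ℝ.+ val g I ℝ.* L

  unipotent-value : GTest → ℝ.Carrier
  unipotent-value g = Λ (reduced g) (reduced-I g) ℝ.+ val g I ℝ.* (L ℝ.* HK.volK)

  -- k⁻¹ u(n) k lies in K exactly when n is integral. So the multiple of the indicator function of K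
  -- that was subtracted contributes g(1) times the integral L of ω over O, for every k.
  inner-integral : ∀ g k {h} → (∀ n → h n ℝ.≈ extend ω n ℝ.* val g (u (K.g k) n)) →
                   HasIntegralℝ dn h (Jᵍ g k)
  inner-integral g k {h} eq = hasIntegral-extend (θ (reduced g) (reduced-I g) k) (val g I) λ n →
    ℝ.trans (eq n) (ℝ.trans
      (R.solve 4 (λ e x i w → e R.:* x R.:= e R.:* ((R.:- i) R.:* w R.:+ x) R.:+ i R.:* (e R.:* w)) ℝ.refl
        (extend ω n) (val g (u (K.g k) n)) (val g I) (𝟏 (B 0ℤ (u (K.g k) n))))
      (ℝ.+-cong (ℝ.sym (θ-fun (reduced g) (reduced-I g) k n))
        (ℝ.*-congˡ (ℝ.*-congˡ (𝟏-cong (Integral.u-bounded k 0ℤ n) (Integral.u-integral k n))))))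

  outer-integral : ∀ g {h} → (∀ k → h k ℝ.≈ Jᵍ g k) → ∃ λ A → HasIntegralℝ dk h A × A ℝ.≈ unipotent-value g
  outer-integral g {h} eq = dk.∫ φ , HK.hasIntegral-test φ (λ k → ℝ.trans (eq k)
        (ℝ.trans (ℝ.+-comm _ _) (ℝ.+-cong (ℝ.sym (ℝ.*-identityʳ _)) (ℝ.sym (J-fun (reduced g) (reduced-I g) k))))) ,
    ℝ.trans (HK.∫-lin (val g I ℝ.* L) HK.one (J (reduced g) (reduced-I g)) φ (λ _ → ℝ.refl))
      (ℝ.trans (ℝ.+-comm _ _) (ℝ.+-congˡ (ℝ.*-assoc _ _ _)))
    where
    φ : Cc∞ K-space ℝ.rawRing
    φ = ((val g I ℝ.* L) HK.⊡ HK.one) HK.⊞ J (reduced g) (reduced-I g)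

-- Matrices of trace 2 and neighbourhoods of u(n₀).

module UnipotentForms (em : ExcludedMiddle 0ℓ) (ℝ : RealField) (F : LocalField) where
  open LocalField F hiding (zero)
  open SL₂ F
  open GroupSpaces em F
  open GroupTests em ℝ F
  open SetoidReasoning setoid

  private
    ≤-half : ∀ {w l} → w ℤ.+ w ℤ.≤ l ℤ.+ l → w ℤ.≤ l
    ≤-half {w} {l} p with ≤-split l w
    ... | inj₂ w≤l = w≤l
    ... | inj₁ l<w = ⊥-elim (i+1≰i (ℤ.≤-trans (i≤i+1 (l ℤ.+ l ℤ.+ 1ℤ)) (ℤ.≤-trans 2l+2≤2w p)))
      where
      2l+2≤2w : l ℤ.+ l ℤ.+ 1ℤ ℤ.+ 1ℤ ℤ.≤ w ℤ.+ w
      2l+2≤2w = ≤-by₂ {c = l ℤ.+ 1ℤ} {d = w} {e = l ℤ.+ 1ℤ} {f = w} l<w l<w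
        (ℤS.solve 2 (λ l w → (w ℤS.:+ w) ℤS.:- (l ℤS.:+ l ℤS.:+ ℤS.con 1ℤ ℤS.:+ ℤS.con 1ℤ) ℤS.:=
          (w ℤS.:- (l ℤS.:+ ℤS.con 1ℤ)) ℤS.:+ (w ℤS.:- (l ℤS.:+ ℤS.con 1ℤ))) ≡.refl l w)

    P-√ : ∀ {w e} → P (w ℤ.+ w) (e * e) → P w e
    P-√ {w} {e} p = cases em
      where
      cases : Dec (e ≈ 0#) → P w e
      cases (yes z) = P-≈0 z
      cases (no nz) = let l , ve = val-exists nz in P-mono {w} {l} (≤-half (P-val (val-* ve ve) p)) (val⇒P ve)

  module NormalForm (h : SL2) (tr : a h + d h ≈ 1# + 1#) where
    e : Carrier
    e = a h - 1#

    d≈ : d h ≈ 1# - e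
    d≈ = trans (solve 2 (λ a d → d := (a :+ d) :- a) refl (a h) (d h)) (trans (+-congʳ tr)
      (solve 1 (λ a → (:1 :+ :1) :- a := :1 :- (a :- :1)) refl (a h)))

    a≈ : a h ≈ 1# + e
    a≈ = solve 1 (λ a → a := :1 :+ (a :- :1)) refl (a h)

    e² : e * e ≈ - (b h * c h)
    e² = begin
      e * e                                         ≈⟨ solve 2 (λ e bc → e :* e := (:1 :- ((:1 :+ e) :* (:1 :- e) :- bc)) :- bc) refl e (b h * c h) ⟩
      (1# - ((1# + e) * (1# - e) - b h * c h)) - b h * c h   ≈⟨ +-congʳ (+-congˡ (-‿cong (trans (+-congʳ (*-cong (sym a≈) (sym d≈))) (det h)))) ⟩
      (1# - 1#) - b h * c h                         ≈⟨ solve 1 (λ x → (:1 :- :1) :- x := :- x) refl (b h * c h) ⟩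
      - (b h * c h)                                 ∎

    Result : Set
    Result = ∃ λ (k : K) → ∃ λ n → n ≉ 0# × h ≋ u (K.g k) n

    private
      quotient : ∀ {y w} → v y ≡ fin w → y * (e * y ⁻¹) ≈ e
      quotient {y} vy = begin
        y * (e * y ⁻¹)    ≈⟨ solve 3 (λ y e i → y :* (e :* i) := e :* (y :* i)) refl y e (y ⁻¹) ⟩
        e * (y * y ⁻¹)    ≈⟨ *-congˡ (*-inverse (val⇒≉0 vy)) ⟩
        e * 1#            ≈⟨ *-identityʳ e ⟩
        e                 ∎

      quotient² : ∀ {y z w} → v y ≡ fin w → e * e ≈ - (y * z) → y * ((e * y ⁻¹) * (e * y ⁻¹)) ≈ - z
      quotient² {y} {z} vy eq = begin
        y * ((e * y ⁻¹) * (e * y ⁻¹))       ≈⟨ *-assoc _ _ _ ⟨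
        y * (e * y ⁻¹) * (e * y ⁻¹)         ≈⟨ *-congʳ (quotient vy) ⟩
        e * (e * y ⁻¹)                      ≈⟨ *-assoc _ _ _ ⟨
        e * e * y ⁻¹                        ≈⟨ *-congʳ eq ⟩
        - (y * z) * y ⁻¹                    ≈⟨ solve 3 (λ y z i → (:- (y :* z)) :* i := :- (z :* (y :* i))) refl y z (y ⁻¹) ⟩
        - (z * (y * y ⁻¹))                  ≈⟨ -‿cong (trans (*-congˡ (*-inverse (val⇒≉0 vy))) (*-identityʳ z)) ⟩
        - z                                 ∎

      ratio-integral : ∀ {y z w} → v y ≡ fin w → P w z → e * e ≈ - (y * z) → P 0ℤ (e * y ⁻¹)
      ratio-integral {w = w} vy pz eq = P-cast (ℤ.+-inverseʳ w)
        (P-* (P-√ {w} (P-resp {w ℤ.+ w} (sym eq) (P-neg (P-* (val⇒P vy) pz)))) (val⇒P (val-⁻¹ vy)))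

      upper-dominant : ∀ {w} → v (b h) ≡ fin w → P w (c h) → Result
      upper-dominant vb pc = intg k P-1 (P-0 0ℤ) γ-int P-1 , b h , val⇒≉0 vb ,
        trans a≈ (trans (+-congˡ (sym (trans (*-congˡ (*-identityʳ γ)) (quotient vb)))) (sym u-a)) ,
        trans (solve 1 (λ b → b := b :* (:1 :* :1)) refl (b h)) (sym u-b) ,
        trans (solve 1 (λ c → c := :- (:- c)) refl (c h)) (trans (-‿cong (sym (quotient² vb e²))) (sym u-c)) ,
        trans d≈ (trans (+-congˡ (-‿cong (sym (trans (*-congˡ (*-identityʳ γ)) (quotient vb))))) (sym u-d))
        where
        γ : Carrier
        γ = e * b h ⁻¹
        γ-int : P 0ℤ γ
        γ-int = ratio-integral vb pc e²
        k : SL2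
        k = mat 1# 0# γ 1# (solve 1 (λ y → :1 :* :1 :- :0 :* y := :1) refl γ)
        open Conjugate k (b h)

      lower-dominant : ∀ {w} → v (c h) ≡ fin w → P w (b h) → Result
      lower-dominant vc pb = intg k (P-0 0ℤ) (P-neg P-1) P-1 (P-neg δ-int) , - c h , -‿≉0 (val⇒≉0 vc) ,
        trans a≈ (trans (+-congˡ (sym ce)) (sym u-a)) ,
        trans (solve 1 (λ b → b := :- (:- b)) refl (b h)) (trans (-‿cong (sym (quotient² vc e²′)))
          (trans (solve 2 (λ c δ → :- (c :* (δ :* δ)) := (:- c) :* ((:- δ) :* (:- δ))) refl (c h) δ) (sym u-b))) ,
        trans (solve 1 (λ c → c := :- ((:- c) :* (:1 :* :1))) refl (c h)) (sym u-c) ,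
        trans d≈ (trans (+-congˡ (-‿cong (sym ce))) (sym u-d))
        where
        δ : Carrier
        δ = e * c h ⁻¹
        e²′ : e * e ≈ - (c h * b h)
        e²′ = trans e² (-‿cong (*-comm _ _))
        δ-int : P 0ℤ δ
        δ-int = ratio-integral vc pb e²′
        k : SL2
        k = mat 0# (- 1#) 1# (- δ) (solve 1 (λ δ → :0 :* δ :- (:- :1) :* :1 := :1) refl (- δ))
        open Conjugate k (- c h)
        ce : - c h * (1# * - δ) ≈ e
        ce = trans (solve 2 (λ c δ → (:- c) :* (:1 :* (:- δ)) := c :* δ) refl (c h) δ) (quotient vc)

    -- With e = a - 1 the determinant gives e² = - b c. If v(b) ≤ v(c) then e / b is integral and n
    -- = b works with a lower triangular k; otherwise e / c is integral and n = - c. It is the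
    -- Iwasawa decomposition made explicit.
    normal-form : ¬ (h ≋ I) → Result
    normal-form h≉I = cases em em
      where
      both : ∀ {w l} → v (b h) ≡ fin w → v (c h) ≡ fin l → w ℤ.≤ l ⊎ l ℤ.≤ w → Result
      both {w} {l} vb vc (inj₁ w≤l) = upper-dominant vb (P-mono {w} {l} w≤l (val⇒P vc))
      both {w} {l} vb vc (inj₂ l≤w) = lower-dominant vc (P-mono {l} {w} l≤w (val⇒P vb))
      cases : Dec (b h ≈ 0#) → Dec (c h ≈ 0#) → Result
      cases (no nb) (yes c≈0) = upper-dominant (proj₂ (val-exists nb)) (P-≈0 c≈0)
      cases (yes b≈0) (no nc) = lower-dominant (proj₂ (val-exists nc)) (P-≈0 b≈0)
      cases (no nb) (no nc) = both (proj₂ (val-exists nb)) (proj₂ (val-exists nc)) (ℤ.≤-total _ _)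
      cases (yes b≈0) (yes c≈0) = ⊥-elim (h≉I (trans a≈ (trans (+-congˡ e≈0) (+-identityʳ 1#)) , b≈0 , c≈0 ,
          trans d≈ (trans (+-congˡ (-‿cong e≈0)) (solve 0 (:1 :- :0 := :1) refl))))
        where
        e≈0 : e ≈ 0#
        e≈0 = root em
          where
          root : Dec (e ≈ 0#) → e ≈ 0#
          root (yes z) = z
          root (no nz) = *-zero-cancel nz (trans e² (trans (-‿cong (trans (*-congʳ b≈0) (zeroˡ _))) (solve 0 (:- :0 := :0) refl)))

  module NearUnipotent {n₀ w} (vn₀ : v n₀ ≡ fin w) (m : ℕ) (h : K) (n : Carrier) where
    private
      ρ : ℤ
      ρ = w ℤ.+ + suc m
      γ = c (K.g h)
      δ = d (K.g h)
      open Conjugate (K.g h) n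
      w<M : w ℤ.+ 1ℤ ℤ.≤ ρ
      w<M = ℤ.+-monoʳ-≤ w (ℤ.+≤+ (ℕ.s≤s ℕ.z≤n))

    unit-δ : P (+ suc m) γ → v δ ≡ fin 0ℤ
    unit-δ p = val-from (K.dᵒ h) (λ r → i+1≰i (P-val val-1 (P-resp {1ℤ} (det (K.g h))
      (P-- (P-*ˡ {1ℤ} (K.aᵒ h) r) (P-*ˡ {1ℤ} (K.bᵒ h) (P-mono {1ℤ} {+ suc m} (ℤ.+≤+ (ℕ.s≤s ℕ.z≤n)) p))))))

    val-n : v δ ≡ fin 0ℤ → P ρ (n * (δ * δ) - n₀) → v n ≡ fin w
    val-n vδ p with em {n ≈ 0#}
    ... | yes z = ⊥-elim (i+1≰i (ℤ.≤-trans w<M (P-val vn₀ (P-resp {ρ}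
          (trans (-‿cong (+-congʳ (trans (*-congʳ z) (zeroˡ _)))) (solve 1 (λ n → :- (:0 :- n) := n) refl n₀)) (P-neg p)))))
    ... | no nz = let l , vn = val-exists nz in ≡.trans vn (≡.trans (≡.cong fin (≡.sym (ℤ.+-identityʳ l)))
          (≡.trans (≡.sym (val-* vn (val-* vδ vδ))) (val-near vn₀ (P-swap p) w<M)))

    -- Were δ not a unit, γ would be one, and n γ² ∈ P^ρ would force n ∈ P^ρ. Then n δ² could not be
    -- congruent modulo P^ρ to n₀, whose valuation is w < ρ. Once δ is a unit, v(n) = w, and n γ δ ∈
    -- P^ρ bounds γ.
    to : NearG ρ (unipotent n₀) (u (K.g h) n) → P (+ suc m) γ × P ρ (n * (δ * δ) - n₀)
    to (pa , pb , pc , _) = P-cancel {+ suc m} (val-n vδ pδ) nγ , pδ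
      where
      pδ : P ρ (n * (δ * δ) - n₀)
      pδ = P-swap (P-resp {ρ} (+-congˡ (-‿cong u-b)) pb)
      nγδ : P ρ (n * (γ * δ))
      nγδ = P-resp {ρ} (trans (-‿cong (+-congˡ (-‿cong u-a))) (solve 1 (λ x → :- (:1 :- (:1 :+ x)) := x) refl (n * (γ * δ)))) (P-neg pa)
      nγ² : P ρ (n * (γ * γ))
      nγ² = P-resp {ρ} (trans (+-congˡ (-‿cong u-c)) (solve 1 (λ x → :0 :- (:- x) := x) refl (n * (γ * γ)))) pc
      vδ : v δ ≡ fin 0ℤ
      vδ = val-from (K.dᵒ h) λ δ∈P →
        let γ∉P : ¬ P 1ℤ γ
            γ∉P γ∈P = i+1≰i (P-val val-1 (P-resp {1ℤ} (det (K.g h)) (P-- (P-*ˡ {1ℤ} (K.aᵒ h) δ∈P) (P-*ˡ {1ℤ} (K.bᵒ h) γ∈P))))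
            n∈P : P ρ n
            n∈P = Integral.unit-cancel h (K.cᵒ h) γ∉P nγ²
        in i+1≰i (ℤ.≤-trans w<M (P-val vn₀ (P-resp {ρ} (solve 2 (λ x n → x :- (x :- n) := n) refl (n * (δ * δ)) n₀)
             (P-- (P-*ʳ {ρ} n∈P (P-*ˡ {0ℤ} (K.dᵒ h) (K.dᵒ h))) pδ))))
      nγ : P ρ (n * γ)
      nγ = P-cancel {ρ} vδ (P-cast (≡.sym (ℤ.+-identityˡ ρ)) (P-resp {ρ} (solve 3 (λ n γ δ → n :* (γ :* δ) := δ :* (n :* γ)) refl n γ δ) nγδ))

    from : P (+ suc m) γ → P ρ (n * (δ * δ) - n₀) → NearG ρ (unipotent n₀) (u (K.g h) n)
    from pγ pδ =
      P-resp {ρ} (trans (solve 1 (λ x → :- x := :1 :- (:1 :+ x)) refl (n * (γ * δ))) (+-congˡ (-‿cong (sym u-a)))) (P-neg nγδ) ,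
      P-swap (P-resp {ρ} (+-congʳ (sym u-b)) pδ) ,
      P-resp {ρ} (trans (solve 1 (λ x → x := :0 :- (:- x)) refl (n * (γ * γ))) (+-congˡ (-‿cong (sym u-c)))) nγ² ,
      P-resp {ρ} (trans (solve 1 (λ x → x := :1 :- (:1 :- x)) refl (n * (γ * δ))) (+-congˡ (-‿cong (sym u-d)))) nγδ
      where
      vn : v n ≡ fin w
      vn = val-n (unit-δ pγ) pδ
      nγ : P ρ (n * γ)
      nγ = P-* {w} {+ suc m} (val⇒P vn) pγ
      nγδ : P ρ (n * (γ * δ))
      nγδ = P-resp {ρ} (*-assoc n γ δ) (P-*ʳ {ρ} nγ (K.dᵒ h))
      nγ² : P ρ (n * (γ * γ))
      nγ² = P-resp {ρ} (*-assoc n γ γ) (P-*ʳ {ρ} nγ (K.cᵒ h))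

-- Orbital integrands as test functions on the quotient.

module OrbitalTests (em : ExcludedMiddle 0ℓ) (ℝ : RealField) (F : LocalField) (E : SeparableQuadraticExtension F) where
  open LocalField F hiding (zero)
  open GroupSpaces em F
  open GroupTests em ℝ F
  open Conjugation em F
  open NormForm em F E using (s; n)
  open TorusQuotient em ℝ F E
  open Boxes em ℝ F E
  open OrbitalIntegrals ℝ F E hiding (F-space; 𝟙; χ; Fˣ; QuadraticCharacter)
  private
    module ℝ = RealField ℝ

  cont-rc : Cont rc
  cont-rc = cont-Q cont-a cont-c

  module Regular (t : RegularT) where
    private module TE = TorusElement (RegularT.elt t)
    open TE public hiding (conj-a; conj-b; conj-c; conj-d)
    g : SL2
    g = RegularT.t t

    conj-a : ∀ x → a (cj x g) ≈ ta + tc * pc x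
    conj-a x = trans (proj₁ (cj-≋ x g)) (TE.conj-a x)
    conj-b : ∀ x → b (cj x g) ≈ tc * bc x
    conj-b x = trans (proj₁ (proj₂ (cj-≋ x g))) (TE.conj-b x)
    conj-c : ∀ x → c (cj x g) ≈ tc * rc x
    conj-c x = trans (proj₁ (proj₂ (proj₂ (cj-≋ x g)))) (TE.conj-c x)
    conj-d : ∀ x → d (cj x g) ≈ ta + tc * (s - pc x)
    conj-d x = trans (proj₂ (proj₂ (proj₂ (cj-≋ x g)))) (TE.conj-d x)

    -- With c = 0 the matrix is a scalar a, and a² = Q(a , 0) = 1, so it would be 1 or - 1.
    tc≉0 : tc ≉ 0#
    tc≉0 tc≈0 = cases em
      where
      b≈0 : b g ≈ 0#
      b≈0 = trans (proj₁ columns) (trans (-‿cong (trans (*-congʳ tc≈0) (zeroˡ n))) (solve 0 (:- :0 := :0) refl))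
      d≈a : d g ≈ ta
      d≈a = trans (proj₂ columns) (trans (+-congˡ (trans (*-congʳ tc≈0) (zeroˡ s))) (+-identityʳ ta))
      square : (ta - 1#) * (ta + 1#) ≈ 0#
      square = trans (solve 3 (λ a s n → (a :- :1) :* (a :+ :1) := (a :* a :+ s :* a :* :0 :+ n :* :0 :* :0) :- :1) refl ta s n)
        (x≈y⇒x-y≈0 (trans (Q-cong refl (sym tc≈0)) Q-one))
      cases : Dec (ta - 1# ≈ 0#) → ⊥
      cases (yes z) = RegularT.t≉I t (a≈1 , b≈0 , tc≈0 , trans d≈a a≈1)
        where
        a≈1 : ta ≈ 1#
        a≈1 = x-y≈0⇒x≈y z
      cases (no nz) = RegularT.t≉-I t (a≈-1 , b≈0 , tc≈0 , trans d≈a a≈-1)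
        where
        a≈-1 : ta ≈ - 1#
        a≈-1 = x-y≈0⇒x≈y (trans (solve 1 (λ a → a :- (:- :1) := a :+ :1) refl ta) (*-zero-cancel nz square))

    abstract
      cj-near : ∀ j x → ∃ λ m → ∀ y → NearG m x y → NearG j (cj x g) (cj y g)
      cj-near j x = combine (scaled cont-pc x j) (scaled cont-bc x j) (scaled cont-rc x j)
        where
        scaled : ∀ {e} → Cont e → Cont (λ x → tc * e x)
        scaled = cont-* (cont-const tc)
        Close : (SL2 → Carrier) → Set
        Close e = ∃ λ m → ∀ y → NearG m x y → P j (tc * e x - tc * e y)
        combine : Close pc → Close bc → Close rc → ∃ λ m → ∀ y → NearG m x y → NearG j (cj x g) (cj y g)
        combine (m₁ , r₁) (m₂ , r₂) (m₃ , r₃) = m , λ y near → close y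
            (r₁ y (nearG-mono {m₁} {m} {x} {y} (ℤ.i≤i⊔j m₁ (m₂ ℤ.⊔ m₃)) near))
            (r₂ y (nearG-mono {m₂} {m} {x} {y} (ℤ.≤-trans (ℤ.i≤i⊔j m₂ m₃) (ℤ.i≤j⊔i m₁ (m₂ ℤ.⊔ m₃))) near))
            (r₃ y (nearG-mono {m₃} {m} {x} {y} (ℤ.≤-trans (ℤ.i≤j⊔i m₂ m₃) (ℤ.i≤j⊔i m₁ (m₂ ℤ.⊔ m₃))) near))
          where
          m : ℤ
          m = m₁ ℤ.⊔ (m₂ ℤ.⊔ m₃)
          close : ∀ y → P j (tc * pc x - tc * pc y) → P j (tc * bc x - tc * bc y) → P j (tc * rc x - tc * rc y) →
                  NearG j (cj x g) (cj y g)
          close y q₁ q₂ q₃ =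
            P-resp {j} (trans (solve 4 (λ a c p r → c :* p :- c :* r := (a :+ c :* p) :- (a :+ c :* r)) refl ta tc (pc x) (pc y)) (+-cong (sym (conj-a x)) (-‿cong (sym (conj-a y))))) q₁ ,
            P-resp {j} (+-cong (sym (conj-b x)) (-‿cong (sym (conj-b y)))) q₂ ,
            P-resp {j} (+-cong (sym (conj-c x)) (-‿cong (sym (conj-c y)))) q₃ ,
            P-resp {j} (trans (solve 5 (λ a c s p r → :- (c :* p :- c :* r) := (a :+ c :* (s :- p)) :- (a :+ c :* (s :- r))) refl ta tc s (pc x) (pc y)) (+-cong (sym (conj-d x)) (-‿cong (sym (conj-d y))))) (P-neg q₁)

    cj-invariant : ∀ (t′ : T) x → cj x g ≋ cj (T.t t′ · x) g
    cj-invariant t′ x =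
      trans (conj-a x) (trans (+-congˡ (*-congˡ (sym (S.pc-invariant x)))) (sym (conj-a (T.t t′ · x)))) ,
      trans (conj-b x) (trans (*-congˡ (sym (S.bc-invariant x))) (sym (conj-b (T.t t′ · x)))) ,
      trans (conj-c x) (trans (*-congˡ (sym (S.rc-invariant x))) (sym (conj-c (T.t t′ · x)))) ,
      trans (conj-d x) (trans (+-congˡ (*-congˡ (+-congˡ (-‿cong (sym (S.pc-invariant x)))))) (sym (conj-d (T.t t′ · x))))
      where
      module S = TorusElement t′

    trace-cj : ∀ x → a (cj x g) + d (cj x g) ≈ a g + d g
    trace-cj x = trans (+-cong (conj-a x) (conj-d x)) (trans
      (solve 4 (λ a c s p → (a :+ c :* p) :+ (a :+ c :* (s :- p)) := a :+ (a :+ c :* s)) refl ta tc s (pc x))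
      (+-congˡ (sym (proj₂ columns))))

    abstract
      -- The off-diagonal entries of x⁻¹ t x are c b and c r with c ≠ 0; bounding them bounds b and
      -- r, hence x.
      support : ∀ N → ∃ λ N′ → ∀ x → B N (cj x g) → B N′ x
      support N = bounds (val-exists tc≉0)
        where
        bounds : (∃ λ l → v tc ≡ fin l) → ∃ λ N′ → ∀ x → B N (cj x g) → B N′ x
        bounds (l , vc) = proj₁ (bc-rc-bounded (ℤ.- l ℤ.+ N)) , λ x (_ , pb , pc , _) →
            proj₂ (bc-rc-bounded (ℤ.- l ℤ.+ N)) x (cancel (conj-b x) pb) (cancel (conj-c x) pc)
          where
          cancel : ∀ {y z} → z ≈ tc * y → P N z → P (ℤ.- l ℤ.+ N) y
          cancel {y} {z} eq p = P-cancel vc (P-cast (ℤS.solve 2 (λ l N → N ℤS.:= l ℤS.:+ (ℤS.:- l ℤS.:+ N)) ≡.refl l N) (P-resp {N} eq p))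

    private
      orb-local : ∀ f x → ∃ λ m → ∀ y → NearG m x y → val f (cj y g) ℝ.≈ val f (cj x g)
      orb-local f x = proj₁ (cj-near (M f) x) , λ y nr →
        const f (cj y g) (cj x g) (nearG-sym {M f} {cj x g} {cj y g} (proj₂ (cj-near (M f) x) y nr))

      orb-invariant : ∀ f {x y} → (∃ λ (t′ : T) → y ≡ T.t t′ · x) → val f (cj x g) ℝ.≈ val f (cj y g)
      orb-invariant f {x} (t′ , ≡.refl) = const f (cj x g) (cj (T.t t′ · x) g)
        (nearG-refl {M f} {cj x g} {cj (T.t t′ · x) g} (cj-invariant t′ x))

      orb-support : ∀ f → CompactlySupported (λ x → val f (cj x g))
      orb-support f = B (proj₁ (support (N f))) , B-compact (proj₁ (support (N f))) ,
        λ x nz → proj₂ (support (N f)) x (supp f (cj x g) nz)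

    abstract
      orb : GTest → Cc∞ T\G-space ℝ.rawRing
      orb f = mkCc (λ x → val f (cj x g)) (record { local = orb-local f ; invar = orb-invariant f }) (orb-support f)

      orb-fun : ∀ f x → fun (orb f) x ℝ.≈ val f (cj x g)
      orb-fun f x = ℝ.refl

-- Conductors and the unipotent integrals of balls.

module Conductor (em : ExcludedMiddle 0ℓ) (F : LocalField) where
  open LocalField F hiding (zero)
  open GroupSpaces em F

  -- Constancy on the cosets of 1 + P^(m₀+1), phrased with absolute radii so that it applies to
  -- boxes and balls as they stand.
  Conducts : QuadraticCharacter → ℕ → Set
  Conducts ω m₀ = ∀ x y {k} → v (proj₁ x) ≡ fin k → P (k ℤ.+ + suc m₀) (proj₁ y - proj₁ x) → χ ω y ≡ χ ω x

  𝟙-conducts : ∀ m₀ → Conducts 𝟙 m₀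
  𝟙-conducts m₀ _ _ _ _ = ≡.refl

  private
    idem : ∀ σ → σ ≡ σ Sign.* σ → σ ≡ Sign.+
    idem Sign.+ _ = ≡.refl
    idem Sign.- ()

  module _ (ω : QuadraticCharacter) where
    open QuadraticCharacter ω hiding (χ)

    χ-one : ∀ x → proj₁ x ≈ 1# → χ ω x ≡ Sign.+
    χ-one x x≈1 = idem (χ ω x) (χ-* x x x (trans x≈1 (trans (sym (*-identityˡ 1#)) (*-cong (sym x≈1) (sym x≈1)))))

    χ-square : ∀ x y → proj₁ y ≈ proj₁ x * proj₁ x → χ ω y ≡ Sign.+
    χ-square x y eq = ≡.trans (χ-* x x y eq) (square (χ ω x))
      where
      square : ∀ σ → σ Sign.* σ ≡ Sign.+
      square Sign.+ = ≡.refl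
      square Sign.- = ≡.refl

    -- By multiplicativity, continuity at 1 applied to y / x gives a relative radius that is uniform
    -- in x.
    conductor : ∃ (Conducts ω)
    conductor =
      let n₁ , near = continuous (1# , 1≉0)
      in ℤ.∣ n₁ ∣ , λ x y {k} vx close →
        let y/x : Fˣ
            y/x = proj₁ y * proj₁ x ⁻¹ , *-≉0 (proj₂ y) (⁻¹-≉0 (proj₂ x))
            near-one : P (+ suc ℤ.∣ n₁ ∣) (1# - proj₁ y/x)
            near-one = P-swap (P-cancel vx (P-resp {k ℤ.+ + suc ℤ.∣ n₁ ∣}
              (sym (trans (solve 3 (λ x y i → x :* (y :* i :- :1) := y :* (x :* i) :- x) refl (proj₁ x) (proj₁ y) (proj₁ x ⁻¹))
                (+-congʳ (trans (*-congˡ (*-inverse (proj₂ x))) (*-identityʳ (proj₁ y)))))) close))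
            one : χ ω y/x ≡ Sign.+
            one = ≡.trans (near y/x (P-mono {n₁} (ℤ.≤-trans (i≤∣i∣ n₁) (ℤ.+≤+ (ℕ.n≤1+n _))) near-one)) (χ-one (1# , 1≉0) refl)
        in ≡.trans (χ-* x y/x y (sym (trans (solve 3 (λ x y i → x :* (y :* i) := y :* (x :* i)) refl (proj₁ x) (proj₁ y) (proj₁ x ⁻¹))
             (trans (*-congˡ (*-inverse (proj₂ x))) (*-identityʳ (proj₁ y))))))
           (≡.trans (≡.cong (χ ω x Sign.*_) one) (Sign.*-identityʳ (χ ω x)))

module UnipotentBalls (em : ExcludedMiddle 0ℓ) (ℝ : RealField) (F : LocalField) (E : SeparableQuadraticExtension F)
    (dk : Integration.Measure ℝ (SL₂.K-space F))
    (dk-invariant : ∀ k → Integration.InvariantUnder ℝ dk (SL₂._·ᴷ_ F k))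
    (dn : Integration.Measure ℝ (LocalField.F-space F))
    (dn-invariant : ∀ x → Integration.InvariantUnder ℝ dn (LocalField._+_ F x)) where
  open LocalField F hiding (zero)
  open SL₂ F
  open GroupSpaces em F
  open GroupTests em ℝ F
  open Conjugation em F
  open Conductor em F
  open UnipotentForms em ℝ F
  open TestFunctions em ℝ
  open OrbitalIntegrals ℝ F E using (extend; signℝ)
  open Characters em ℝ F E
  module HF = HaarField em ℝ F dn dn-invariant
  module HK = HaarCompact em ℝ F dk dk-invariant
  module Λω = UnipotentIntegrals em ℝ F E dk dk-invariant dn dn-invariant
  private
    module ℝ = RealField ℝ
    module R = RealLemmas em ℝ
    module dn = Integration.Measure dn
    module dk = Integration.Measure dk
  module PW = R.Powers q 2≤q

  -- The volume of the congruence subgroup of level 𝔭, whose index in K is q + 1.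
  CK : ℝ.Carrier
  CK = (PW.Q ℝ.+ ℝ.1#) ℝ.⁻¹ ℝ.* HK.volK

  module Ball (k₀ : K) (n₀ : Carrier) {w : ℤ} (vn₀ : v n₀ ≡ fin w) (m : ℕ) where
    ρ : ℤ
    ρ = w ℤ.+ + suc m

    ball : GTest
    ball = ballG (u (K.g k₀) n₀) ρ

    w<ρ : w ℤ.+ 1ℤ ℤ.≤ ρ
    w<ρ = ℤ.+-monoʳ-≤ w (ℤ.+≤+ (ℕ.s≤s ℕ.z≤n))

    near⇒ : ∀ y → NearG ρ (u (K.g k₀) n₀) y → NearG ρ (unipotent n₀) (cj (inv (K.g k₀)) y)
    near⇒ y = near-move {ρ} k₀ (unipotent n₀) y

    ⇐near : ∀ y → NearG ρ (unipotent n₀) (cj (inv (K.g k₀)) y) → NearG ρ (u (K.g k₀) n₀) y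
    ⇐near y = near-back {ρ} k₀ (unipotent n₀) y

    ball-I : val ball I ℝ.≈ ℝ.0#
    ball-I = 𝟏-no λ near → i+1≰i (ℤ.≤-trans w<ρ (P-val vn₀ (Integral.u-far k₀ ρ n₀ near)))

    n₀ˣ : Fˣ
    n₀ˣ = n₀ , val⇒≉0 vn₀

    module _ (ω : QuadraticCharacter) (cond : Conducts ω m) where
      private
        open QuadraticCharacter ω using (χ-*)
        Λ = Λω.Λ ω ball ball-I
        θ = Λω.θ ω ball ball-I
        σ : ℝ.Carrier
        σ = signℝ (χ ω n₀ˣ)

        h : K → K
        h k = k ·ᴷ invᴷ k₀

        u-h : ∀ k n → u (K.g (h k)) n ≋ cj (inv (K.g k₀)) (u (K.g k) n)
        u-h k n = begin
          cj (K.g (h k)) (unipotent n)                  ≈⟨ cj-cong (K.g (h k)) (K.g k · inv (K.g k₀)) (unipotent n) (refl , refl , refl , refl) ⟩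
          cj (K.g k · inv (K.g k₀)) (unipotent n)       ≈⟨ cj-· (K.g k) (inv (K.g k₀)) (unipotent n) ⟩
          cj (inv (K.g k₀)) (cj (K.g k) (unipotent n))  ∎
          where open SetoidReasoning SL2-setoid

        near-h⇒ : ∀ k n → NearG ρ (u (K.g k₀) n₀) (u (K.g k) n) → NearG ρ (unipotent n₀) (u (K.g (h k)) n)
        near-h⇒ k n near = near-≋ {ρ} {unipotent n₀} {unipotent n₀} {cj (inv (K.g k₀)) (u (K.g k) n)} {u (K.g (h k)) n}
          (≋-refl {unipotent n₀}) (≋-sym {u (K.g (h k)) n} {cj (inv (K.g k₀)) (u (K.g k) n)} (u-h k n))
          (near⇒ (u (K.g k) n) near)

        ⇐near-h : ∀ k n → NearG ρ (unipotent n₀) (u (K.g (h k)) n) → NearG ρ (u (K.g k₀) n₀) (u (K.g k) n)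
        ⇐near-h k n near = ⇐near (u (K.g k) n) (near-≋ {ρ} {unipotent n₀} {unipotent n₀} {u (K.g (h k)) n} {cj (inv (K.g k₀)) (u (K.g k) n)}
          (≋-refl {unipotent n₀}) (u-h k n) near)

        module Inside (k : K) (pγ : P (+ suc m) (c (K.g (h k)))) where
          δ = d (K.g (h k))
          vδ : v δ ≡ fin 0ℤ
          vδ = NearUnipotent.unit-δ vn₀ m (h k) 0# pγ
          centre : Carrier
          centre = n₀ * (δ ⁻¹ * δ ⁻¹)
          δδ⁻¹ : (n : Carrier) → δ * δ * (n - centre) ≈ n * (δ * δ) - n₀
          δδ⁻¹ n = begin
            δ * δ * (n - n₀ * (δ ⁻¹ * δ ⁻¹))                ≈⟨ solve 4 (λ δ i n n₀ → δ :* δ :* (n :- n₀ :* (i :* i)) := n :* (δ :* δ) :- n₀ :* ((δ :* i) :* (δ :* i))) refl δ (δ ⁻¹) n n₀ ⟩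
            n * (δ * δ) - n₀ * ((δ * δ ⁻¹) * (δ * δ ⁻¹))    ≈⟨ +-congˡ (-‿cong (*-congˡ (*-cong (*-inverse (val⇒≉0 vδ)) (*-inverse (val⇒≉0 vδ))))) ⟩
            n * (δ * δ) - n₀ * (1# * 1#)                    ≈⟨ solve 2 (λ x n₀ → x :- n₀ :* (:1 :* :1) := x :- n₀) refl (n * (δ * δ)) n₀ ⟩
            n * (δ * δ) - n₀                                ∎
            where open SetoidReasoning setoid
          to-ball : ∀ n → P ρ (n * (δ * δ) - n₀) → P ρ (n - centre)
          to-ball n p = P-cancel (val-* vδ vδ) (P-cast (≡.sym (ℤ.+-identityˡ ρ)) (P-resp {ρ} (sym (δδ⁻¹ n)) p))
          from-ball : ∀ n → P ρ (n - centre) → P ρ (n * (δ * δ) - n₀)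
          from-ball n p = P-resp {ρ} (δδ⁻¹ n) (P-*ˡ {ρ} (val⇒P (val-* vδ vδ)) p)
          -- n δ² differs from n by a square and from n₀ by less than the conductor, so ω(n) =
          -- ω(n₀).
          sign : ∀ n → P ρ (n * (δ * δ) - n₀) → extend ω n ℝ.≈ σ
          sign n p = ℝ.reflexive (≡.trans (extend-≉0 ω n n≉0) (≡.cong signℝ (≡.trans (≡.sym χnδ²) (cond n₀ˣ nδ² vn₀ p))))
            where
            n≉0 : n ≉ 0#
            n≉0 = val⇒≉0 (NearUnipotent.val-n vn₀ m (h k) n vδ p)
            δ² nδ² : Fˣ
            δ²  = δ * δ , val⇒≉0 (val-* vδ vδ)
            nδ² = n * (δ * δ) , *-≉0 n≉0 (val⇒≉0 (val-* vδ vδ))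
            χnδ² : χ ω nδ² ≡ χ ω (n , n≉0)
            χnδ² = ≡.trans (χ-* (n , n≉0) δ² nδ² refl) (≡.trans (≡.cong (χ ω (n , n≉0) Sign.*_)
              (χ-square ω (δ , val⇒≉0 vδ) δ² refl)) (Sign.*-identityʳ _))
          θ≈ : ∀ n → Dec (P ρ (n - centre)) → fun (θ k) n ℝ.≈ σ ℝ.* fun (HF.ball centre ρ) n
          θ≈ n (yes p) = ℝ.trans (Λω.θ-fun ω ball ball-I k n) (ℝ.*-cong (sign n (from-ball n p))
            (ℝ.trans (𝟏-yes (⇐near-h k n (NearUnipotent.from vn₀ m (h k) n pγ (from-ball n p)))) (ℝ.sym (ℝ.trans (HF.ball-fun centre ρ n) (𝟏-yes p)))))
          θ≈ n (no ¬p) = ℝ.trans (Λω.θ-fun ω ball ball-I k n) (ℝ.trans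
            (ℝ.*-congˡ (𝟏-no (λ near → ¬p (to-ball n (proj₂ (NearUnipotent.to vn₀ m (h k) n (near-h⇒ k n near)))))))
            (ℝ.trans (ℝ.zeroʳ _) (ℝ.sym (ℝ.trans (ℝ.*-congˡ (ℝ.trans (HF.ball-fun centre ρ n) (𝟏-no ¬p))) (ℝ.zeroʳ σ)))))
          value : dn.∫ (θ k) ℝ.≈ σ ℝ.* (PW.qp ρ ℝ.* HF.volO)
          value = ℝ.trans (dn.scalar σ (HF.ball centre ρ) (θ k) (λ n → θ≈ n em)) (ℝ.*-congˡ (HF.vol-ball centre ρ))

        ψ = HK.ψ (invᴷ k₀) (suc m)

        J≈ : ∀ k → Dec (P (+ suc m) (c (K.g (h k)))) → dn.∫ (θ k) ℝ.≈ σ ℝ.* (PW.qp ρ ℝ.* HF.volO) ℝ.* fun ψ k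
        J≈ k (yes pγ) = ℝ.trans (Inside.value k pγ) (ℝ.sym (ℝ.trans (ℝ.*-congˡ (ℝ.trans (HK.ψ-fun (invᴷ k₀) (suc m) k) (𝟏-yes pγ))) (ℝ.*-identityʳ _)))
        J≈ k (no ¬pγ) = ℝ.trans (HF.∫-zero (θ k) (λ n → ℝ.trans (Λω.θ-fun ω ball ball-I k n) (ℝ.trans
            (ℝ.*-congˡ (𝟏-no (λ near → ¬pγ (proj₁ (NearUnipotent.to vn₀ m (h k) n (near-h⇒ k n near)))))) (ℝ.zeroʳ _))))
          (ℝ.sym (ℝ.trans (ℝ.*-congˡ (ℝ.trans (HK.ψ-fun (invᴷ k₀) (suc m) k) (𝟏-no ¬pγ))) (ℝ.zeroʳ _)))

      -- The ball is a product set. After translation by k₀⁻¹, k runs through the congruence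
      -- subgroup of level m + 1; for each such k, n runs through a ball of radius ρ around n₀ / δ²,
      -- on which ω is constant.
      Λ-ball : Λω.Λ ω ball ball-I ℝ.≈ signℝ (χ ω n₀ˣ) ℝ.* (PW.qp ρ ℝ.* HF.volO) ℝ.* (PW.qp (+ m) ℝ.* CK)
      Λ-ball = ℝ.trans (dk.scalar (σ ℝ.* (PW.qp ρ ℝ.* HF.volO)) ψ (Λω.J ω ball ball-I)
        (λ k → ℝ.trans (Λω.J-fun ω ball ball-I k) (J≈ k em))) (ℝ.*-congˡ (HK.vol-ψ (invᴷ k₀) m))

-- Germs of balls around unipotent matrices.

module AbsoluteValue (em : ExcludedMiddle 0ℓ) (ℝ : RealField) (F : LocalField) (E : SeparableQuadraticExtension F) where
  open LocalField F hiding (zero)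
  open Valuation F
  open OrbitalIntegrals ℝ F E using (∣_∣F; qℝ)
  private
    module ℝ = RealField ℝ
    module R = RealLemmas em ℝ
    module PW = R.Powers q 2≤q

  private
    ∣∣F-+ : ∀ x k → v x ≡ fin (+ k) → ∣ x ∣F ≡ (qℝ ℝ.⁻¹) R.^ k
    ∣∣F-+ x k eq with v x
    ∣∣F-+ x k ≡.refl | fin (+ _) = ≡.refl

    ∣∣F-- : ∀ x k → v x ≡ fin (-[1+ k ]) → ∣ x ∣F ≡ qℝ R.^ suc k
    ∣∣F-- x k eq with v x
    ∣∣F-- x k ≡.refl | fin (-[1+ _ ]) = ≡.refl

  ∣∣F-val : ∀ {x} k → v x ≡ fin k → ∣ x ∣F ≡ PW.qp k
  ∣∣F-val {x} (+ k)      = ∣∣F-+ x k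
  ∣∣F-val {x} (-[1+ k ]) = ∣∣F-- x k

  ∣∣F⁻¹-val : ∀ {x k} → v x ≡ fin k → (∣ x ∣F) ℝ.⁻¹ ℝ.≈ PW.qp (ℤ.- k)
  ∣∣F⁻¹-val {x} {k} vx = ℝ.trans (ℝ.⁻¹-cong (ℝ.reflexive (∣∣F-val k vx))) (ℝ.sym (R.⁻¹-unique (PW.qp-≉0 k)
    (ℝ.trans (ℝ.sym (PW.qp-+ k (ℤ.- k))) (ℝ.reflexive (≡.cong PW.qp (ℤ.+-inverseʳ k))))))

module Germs (em : ExcludedMiddle 0ℓ) (ℝ : RealField) (F : LocalField) (E : SeparableQuadraticExtension F)
    (κ : LocalField.QuadraticCharacter F) (κ-norm : OrbitalIntegrals.HasNormKernel ℝ F E κ)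
    (dx : Integration.Measure ℝ (OrbitalIntegrals.T\G-space ℝ F E))
    (dx-invariant : OrbitalIntegrals.IsInvariantT\G ℝ F E dx)
    (dk : Integration.Measure ℝ (SL₂.K-space F))
    (dk-invariant : ∀ k → Integration.InvariantUnder ℝ dk (SL₂._·ᴷ_ F k))
    (dn : Integration.Measure ℝ (LocalField.F-space F))
    (dn-invariant : ∀ x → Integration.InvariantUnder ℝ dn (LocalField._+_ F x)) where
  open LocalField F hiding (zero)
  open GroupSpaces em F
  open Conjugation em F
  open GroupTests em ℝ F
  open Conductor em F
  open UnipotentForms em ℝ F
  open TestFunctions em ℝ
  open NormForm em F E using (s; n; Q; Norm-≈; independent)
  open TorusQuotient em ℝ F E using (pc; bc; rc; bc*-rc; Q-cong)
  open Boxes em ℝ F E using (Box; box; box-fun)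
  open OrbitalIntegrals ℝ F E hiding (F-space; 𝟙; χ; Fˣ; QuadraticCharacter)
  open Characters em ℝ F E
  open AbsoluteValue em ℝ F E public
  open OrbitalTests em ℝ F E public
  open UnipotentBalls em ℝ F E dk dk-invariant dn dn-invariant public
  open Volumes em ℝ F E dx dx-invariant
  private
    module ℝ = RealField ℝ
    module R = RealLemmas em ℝ
    module E = SeparableQuadraticExtension E
    module dx = Integration.Measure dx
    module TGI = Boxes.Integrals em ℝ F E dx

  norm⇒+ : ∀ x p r → Q p r ≈ proj₁ x → χ κ x ≡ Sign.+
  norm⇒+ x p r eq = Equivalence.from (κ-norm x) (y , y≉0 , trans (Norm-≈ E.refl) eq)
    where
    y : E.Carrier
    y = E.ι p E.+ E.ι r E.* E.τ
    y≉0 : y E.≉ E.0#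
    y≉0 y≈0 = proj₂ x (trans (sym eq) (trans (Q-cong (proj₁ (independent y≈0)) (proj₂ (independent y≈0)))
      (solve 2 (λ s n → :0 :* :0 :+ s :* :0 :* :0 :+ n :* :0 :* :0 := :0) refl s n)))

  +⇒norm : ∀ x → χ κ x ≡ Sign.+ → IsNorm (proj₁ x)
  +⇒norm x eq = let y , _ , N = Equivalence.to (κ-norm x) eq ; p , r , y≈ = E.span y
                in proj₂ x , p , r , trans (sym (Norm-≈ y≈)) N

  m₀ : ℕ
  m₀ = proj₁ (conductor κ)

  κ-conducts : ∀ i → Conducts κ (m₀ ℕ.+ i)
  κ-conducts i x y {k} vx close = proj₂ (conductor κ) x y vx
    (P-mono {k ℤ.+ + suc m₀} (ℤ.+-monoʳ-≤ k (ℤ.+≤+ (ℕ.s≤s (ℕ.m≤m+n m₀ i)))) close)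

  -- κ is trivial on 1 + P^(m₀+1), and its kernel is the norm group. This feeds the hypothesis of
  -- `vol-value`.
  norms : ∀ x → P (+ suc m₀) (x - 1#) → IsNorm x
  norms x close = +⇒norm (x , x≉0) (≡.trans (proj₂ (conductor κ) (1# , 1≉0) (x , x≉0) val-1 close) (χ-one κ (1# , 1≉0) refl))
    where
    x≉0 : x ≉ 0#
    x≉0 = val⇒≉0 (val-near {m = + suc m₀} val-1 (P-swap close) (ℤ.+≤+ (ℕ.s≤s ℕ.z≤n)))

  D₀ : ℝ.Carrier
  D₀ = density m₀ norms

  module Λ¹ = Λω 𝟙
  module Λᵏ = Λω κ

  O : RegularT → GTest → ℝ.Carrier
  O t f = dx.∫ (Regular.orb t f)

  O-lin : ∀ t α φ ψ f → (∀ x → val f x ℝ.≈ α ℝ.* val φ x ℝ.+ val ψ x) → O t f ℝ.≈ α ℝ.* O t φ ℝ.+ O t ψ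
  O-lin t α φ ψ f eq = TGI.∫-lin α (orb φ) (orb ψ) (orb f) λ x → ℝ.trans (orb-fun f x) (ℝ.trans (eq (cj x (RegularT.t t)))
    (ℝ.+-cong (ℝ.*-congˡ (ℝ.sym (orb-fun φ x))) (ℝ.sym (orb-fun ψ x))))
    where open Regular t

  O-zero : ∀ t f → (∀ x → val f (cj x (RegularT.t t)) ℝ.≈ ℝ.0#) → O t f ℝ.≈ ℝ.0#
  O-zero t f eq = TGI.∫-zero (orb f) λ x → ℝ.trans (orb-fun f x) (eq x)
    where open Regular t

  -- The sign in κ(- c) arises because the coordinate b is minus a norm and n₀ is approximately c b.
  σ : RegularT → ℝ.Carrier
  σ t = extend κ (- c (RegularT.t t))

  -- Cst = D₀ / (2 Y), the ratio of the box volumes to the unipotent volumes with all radii removed.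
  -- The half compensates for 1 + κ(- c) κ(n₀) being 2 when the box is nonempty.
  Y ½ Cst : ℝ.Carrier
  Y    = PW.qp (+ m₀) ℝ.* CK ℝ.* HF.volO
  ½    = (ℝ.1# ℝ.+ ℝ.1#) ℝ.⁻¹
  Cst  = D₀ ℝ.* Y ℝ.⁻¹ ℝ.* ½

  coef : RegularT → ℝ.Carrier
  coef t = (∣ c (RegularT.t t) ∣F) ℝ.⁻¹ ℝ.* Cst

  -- The expansion without the identity term, with a radius j depending on f. Both sides are linear
  -- in f, so it can be checked on indicator functions of balls.
  Germ : (f : GTest) → val f I ℝ.≈ ℝ.0# → Set
  Germ f fI = ∃ λ j → ∀ t → NearG j I (RegularT.t t) →
              O t f ℝ.≈ coef t ℝ.* (Λ¹.Λ f fI ℝ.+ σ t ℝ.* Λᵏ.Λ f fI)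

  2≉0 : ℝ.1# ℝ.+ ℝ.1# ℝ.≉ ℝ.0#
  2≉0 = R.≥1⇒≉0 (R.≤-respˡ (ℝ.+-identityʳ ℝ.1#) (R.+-mono-≤ (RealOps.≤.refl ℝ) R.0≤1))

  Y≉0 : Y ℝ.≉ ℝ.0#
  Y≉0 = R.*-≉0 (R.*-≉0 (PW.qp-≉0 (+ m₀)) (R.*-≉0 (R.⁻¹-≉0 HK.Q+1≉0) HK.volK≉0)) HF.volO≉0

  module BallGerm (k₀ : K) (n₀ : Carrier) {w : ℤ} (vn₀ : v n₀ ≡ fin w) (i : ℕ) where
    m : ℕ
    m = m₀ ℕ.+ i
    open Ball k₀ n₀ vn₀ m

    module AtElement (t : RegularT) {l : ℤ} (vc : v (c (RegularT.t t)) ≡ fin l) (t-near : NearG ρ I (RegularT.t t)) where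
      open Regular t

      b₀ : Carrier
      b₀ = n₀ * tc ⁻¹
      vb : v b₀ ≡ fin (w ℤ.- l)
      vb = val-* vn₀ (val-⁻¹ vc)
      e₀ r₀ : ℤ
      e₀ = ρ ℤ.- l
      r₀ = (w ℤ.- l) ℤ.+ + suc m

      r₀≡e₀ : r₀ ≡ e₀
      r₀≡e₀ = ℤS.solve 3 (λ w l m → (w ℤS.:- l) ℤS.:+ m ℤS.:= (w ℤS.:+ m) ℤS.:- l) ≡.refl w l (+ suc m)

      tc*b₀ : tc * b₀ ≈ n₀
      tc*b₀ = trans (solve 3 (λ c n i → c :* (n :* i) := n :* (c :* i)) refl tc n₀ (tc ⁻¹))
        (trans (*-congˡ (*-inverse tc≉0)) (*-identityʳ n₀))

      private
        a-near : P ρ (1# - ta)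
        a-near = proj₁ t-near
        l+e₀ : l ℤ.+ e₀ ≡ ρ
        l+e₀ = ℤS.solve 2 (λ l r → l ℤS.:+ (r ℤS.:- l) ℤS.:= r) ≡.refl l ρ
        tc∈ : P ρ tc
        tc∈ = P-resp {ρ} (solve 1 (λ c → :- (:0 :- c) := c) refl tc) (P-neg (proj₁ (proj₂ (proj₂ t-near))))
        tcn∈ : P ρ (tc * n)
        tcn∈ = P-resp {ρ} (trans (+-congˡ (-‿cong (proj₁ columns))) (solve 1 (λ x → :0 :- (:- x) := x) refl (tc * n))) (proj₁ (proj₂ t-near))
        tcs∈ : P ρ (tc * s)
        tcs∈ = P-resp {ρ} (trans (+-congˡ (-‿cong (+-congˡ (-‿cong (proj₂ columns))))) (solve 2 (λ a x → (:1 :- a) :- (:1 :- (a :+ x)) := x) refl ta (tc * s)))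
          (P-- a-near (proj₂ (proj₂ (proj₂ t-near))))

      -- As t is congruent to 1 modulo P^ρ, the first row of y⁻¹ t y is close to that of u(n₀) only
      -- if c p ∈ P^ρ and c b ∈ n₀ + P^ρ; dividing by c lowers the radius to ρ - v(c).
      to-box : ∀ y → NearG ρ (unipotent n₀) (cj y g) → Box 0# e₀ b₀ r₀ y
      to-box y (na , nb , _ , _) =
        P-resp {e₀} (solve 1 (λ p → p := p :- :0) refl (pc y)) (P-cancel {e₀} vc (P-cast (≡.sym l+e₀) tcp)) ,
        P-cast (≡.sym r₀≡e₀) (P-cancel {e₀} vc (P-cast (≡.sym l+e₀)
          (P-resp {ρ} (trans (-‿cong (+-cong (sym tc*b₀) (-‿cong (conj-b y)))) (solve 3 (λ c b₀ b → :- (c :* b₀ :- c :* b) := c :* (b :- b₀)) refl tc b₀ (bc y))) (P-neg nb))))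
        where
        tcp : P ρ (tc * pc y)
        tcp = P-resp {ρ} (trans (+-congˡ (-‿cong (+-congˡ (-‿cong (conj-a y))))) (solve 2 (λ a x → (:1 :- a) :- (:1 :- (a :+ x)) := x) refl ta (tc * pc y)))
          (P-- a-near na)

      from-box : ∀ y → Box 0# e₀ b₀ r₀ y → NearG ρ (unipotent n₀) (cj y g)
      from-box y (p , r) =
        P-resp {ρ} (trans (solve 2 (λ a x → (:1 :- a) :- x := :1 :- (a :+ x)) refl ta (tc * pc y)) (+-congˡ (-‿cong (sym (conj-a y))))) (P-- a-near tcp) ,
        P-resp {ρ} (trans (solve 3 (λ c b₀ b → :- (c :* (b :- b₀)) := c :* b₀ :- c :* b) refl tc b₀ (bc y)) (+-cong tc*b₀ (-‿cong (sym (conj-b y))))) (P-neg tcb) ,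
        P-resp {ρ} (trans (solve 1 (λ x → :- x := :0 :- x) refl (tc * rc y)) (+-congˡ (-‿cong (sym (conj-c y))))) (P-neg tcr) ,
        P-resp {ρ} (trans (solve 4 (λ a c s p → ((:1 :- a) :- c :* s) :+ c :* p := :1 :- (a :+ c :* (s :- p))) refl ta tc s (pc y)) (+-congˡ (-‿cong (sym (conj-d y))))) (P-+ (P-- a-near tcs∈) tcp)
        where
        tcp : P ρ (tc * pc y)
        tcp = P-cast l+e₀ (P-* (val⇒P vc) (P-resp {e₀} (solve 1 (λ p → p :- :0 := p) refl (pc y)) p))
        tcb : P ρ (tc * (bc y - b₀))
        tcb = P-cast l+e₀ (P-* (val⇒P vc) (P-cast r₀≡e₀ r))
        v-tcb : v (tc * bc y) ≡ fin w
        v-tcb = val-near {m = ρ} vn₀ (P-resp {ρ} (trans (solve 3 (λ c b₀ b → :- (c :* (b :- b₀)) := c :* b₀ :- c :* b) refl tc b₀ (bc y)) (+-congʳ tc*b₀)) (P-neg tcb)) w<ρ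
        -- c r · c b = − ((c p)² − (c s)(c p) + c (c n)), and all factors are in P^ρ.
        product : P (ρ ℤ.+ ρ) (tc * bc y * (tc * rc y))
        product = P-resp {ρ ℤ.+ ρ} (trans (solve 4 (λ c p s n → :- ((c :* p) :* (c :* p) :- (c :* s) :* (c :* p) :+ c :* (c :* n))
              := :- (c :* c :* ((:- p) :* (:- p) :+ s :* (:- p) :* :1 :+ n :* :1 :* :1))) refl tc (pc y) s n)
            (trans (-‿cong (*-congˡ (sym (bc*-rc y)))) (solve 3 (λ c b r → :- (c :* c :* (b :* (:- r))) := c :* b :* (c :* r)) refl tc (bc y) (rc y))))
          (P-neg (P-+ (P-- (P-* tcp tcp) (P-* tcs∈ tcp)) (P-* tc∈ tcn∈)))
        tcr : P ρ (tc * rc y)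
        tcr = P-cancel {ρ} v-tcb (P-mono {w ℤ.+ ρ} {ρ ℤ.+ ρ} (ℤ.+-monoˡ-≤ ρ (ℤ.≤-trans (i≤i+1 w) w<ρ)) product)

      private
        Shifted : SL2 → SL2 → Set
        Shifted x y = cj y g ≋ cj (inv (K.g k₀)) (cj x g)

        to : ∀ x y → Shifted x y → NearG ρ (u (K.g k₀) n₀) (cj x g) → Box 0# e₀ b₀ r₀ y
        to x y eq near = to-box y (near-≋ {ρ} {unipotent n₀} {unipotent n₀} {cj (inv (K.g k₀)) (cj x g)} {cj y g}
          (≋-refl {unipotent n₀}) (≋-sym {cj y g} {cj (inv (K.g k₀)) (cj x g)} eq) (near⇒ (cj x g) near))

        from : ∀ x y → Shifted x y → Box 0# e₀ b₀ r₀ y → NearG ρ (u (K.g k₀) n₀) (cj x g)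
        from x y eq bx = ⇐near (cj x g) (near-≋ {ρ} {unipotent n₀} {unipotent n₀} {cj y g} {cj (inv (K.g k₀)) (cj x g)}
          (≋-refl {unipotent n₀}) eq (from-box y bx))

        transfer : ∀ x y → Shifted x y → fun (orb ball) x ℝ.≈ fun (box 0# e₀ b₀ vb m) y
        transfer x y eq = ℝ.trans (orb-fun ball x) (ℝ.trans (𝟏-cong (to x y eq) (from x y eq)) (ℝ.sym (box-fun 0# e₀ b₀ vb m y)))

        -- Right translation by k₀⁻¹ moves the ball to one centred at u(n₀) itself, where `to-box`
        -- and `from-box` apply.
        O≈∫box : O t ball ℝ.≈ dx.∫ (box 0# e₀ b₀ vb m)
        O≈∫box = dx-invariant (inv (K.g k₀)) (box 0# e₀ b₀ vb m) (orb ball)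
          λ x → transfer x (x · inv (K.g k₀)) (cj-· x (inv (K.g k₀)) g)

        -b₀ˣ -tcˣ : Fˣ
        -b₀ˣ = - b₀ , -‿≉0 (val⇒≉0 vb)
        -tcˣ = - tc , -‿≉0 tc≉0

        χ-n₀ : χ κ n₀ˣ ≡ χ κ -b₀ˣ Sign.* χ κ -tcˣ
        χ-n₀ = QuadraticCharacter.χ-* κ -b₀ˣ -tcˣ n₀ˣ (trans (sym tc*b₀) (solve 2 (λ c b → c :* b := (:- b) :* (:- c)) refl tc b₀))

        positive : χ κ -b₀ˣ ≡ Sign.+ → O t ball ℝ.≈ PW.qp e₀ ℝ.* (PW.qp (+ i) ℝ.* D₀)
        positive eq = ℝ.trans O≈∫box (vol-value m₀ norms e₀ b₀ vb i (+⇒norm -b₀ˣ eq))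

        -- On the box κ(- b) equals κ(- b₀) by the choice of the conductor, whereas - b is always a
        -- norm: the box is empty.
        negative : χ κ -b₀ˣ ≡ Sign.- → O t ball ℝ.≈ ℝ.0#
        negative eq = ℝ.trans O≈∫box (TGI.∫-zero (box 0# e₀ b₀ vb m) λ y → ℝ.trans (box-fun 0# e₀ b₀ vb m y) (𝟏-no (empty y)))
          where
          absurd : ¬ (Sign.- ≡ Sign.+)
          absurd ()
          empty : ∀ y → ¬ Box 0# e₀ b₀ r₀ y
          empty y (_ , r) = absurd (≡.trans (≡.sym eq) (≡.trans
              (≡.sym (κ-conducts i -b₀ˣ -bcˣ (val-neg vb) close))
              (norm⇒+ -bcˣ (b y) (d y) (solve 1 (λ x → x := :- (:- x)) refl (Q (b y) (d y))))))
            where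
            -bcˣ : Fˣ
            -bcˣ = - bc y , -‿≉0 (val⇒≉0 (val-near {m = r₀} vb (P-swap r) (ℤ.+-monoʳ-≤ (w ℤ.- l) (ℤ.+≤+ (ℕ.s≤s ℕ.z≤n)))))
            close : P ((w ℤ.- l) ℤ.+ + suc (m₀ ℕ.+ i)) (- bc y - - b₀)
            close = P-resp {r₀} (solve 2 (λ b b₀ → :- (b :- b₀) := (:- b) :- (:- b₀)) refl (bc y) b₀) (P-neg r)

        X : ℝ.Carrier
        X = PW.qp ρ ℝ.* HF.volO ℝ.* (PW.qp (+ m) ℝ.* CK)

        expand : ∀ {τ₁ τ₀} → signℝ (χ κ -tcˣ) ℝ.≈ τ₁ → signℝ (χ κ n₀ˣ) ℝ.≈ τ₀ →
                 coef t ℝ.* (Λ¹.Λ ball ball-I ℝ.+ σ t ℝ.* Λᵏ.Λ ball ball-I) ℝ.≈ coef t ℝ.* ((ℝ.1# ℝ.+ τ₁ ℝ.* τ₀) ℝ.* X)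
        expand {τ₁} {τ₀} eq₁ eq₀ = ℝ.*-congˡ (ℝ.trans (ℝ.+-cong (Λ-ball 𝟙 (𝟙-conducts m))
            (ℝ.*-cong (ℝ.trans (ℝ.reflexive (extend-≉0 κ (- tc) (-‿≉0 tc≉0))) eq₁)
              (ℝ.trans (Λ-ball κ (κ-conducts i)) (ℝ.*-congʳ (ℝ.*-congʳ eq₀)))))
          (R.solve 4 (λ a b x y → R.:1 R.:* x R.:* y R.:+ a R.:* (b R.:* x R.:* y) R.:= (R.:1 R.:+ a R.:* b) R.:* (x R.:* y))
            ℝ.refl τ₁ τ₀ (PW.qp ρ ℝ.* HF.volO) (PW.qp (+ m) ℝ.* CK)))

        -- The comparison that dictates `Cst`: the powers of q from the radii cancel and leave
        -- |c|⁻¹.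
        double : coef t ℝ.* ((ℝ.1# ℝ.+ ℝ.1#) ℝ.* X) ℝ.≈ PW.qp e₀ ℝ.* (PW.qp (+ i) ℝ.* D₀)
        double = ℝ.trans (ℝ.*-cong (ℝ.*-congʳ (∣∣F⁻¹-val vc)) (ℝ.*-congˡ (ℝ.*-congˡ (ℝ.*-congʳ (PW.qp-+ (+ m₀) (+ i))))))
          (ℝ.trans (R.solve 9 (λ L D y h a o r j k →
              L R.:* (D R.:* y R.:* h) R.:* ((R.:1 R.:+ R.:1) R.:* (a R.:* o R.:* (r R.:* j R.:* k))) R.:=
              ((r R.:* k R.:* o) R.:* y) R.:* ((R.:1 R.:+ R.:1) R.:* h) R.:* (a R.:* L R.:* (j R.:* D)))
              ℝ.refl (PW.qp (ℤ.- l)) D₀ (Y ℝ.⁻¹) ½ (PW.qp ρ) HF.volO (PW.qp (+ m₀)) (PW.qp (+ i)) CK)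
          (ℝ.trans (ℝ.*-congʳ (ℝ.trans (ℝ.*-cong (ℝ.*-inverse Y≉0) (ℝ.*-inverse 2≉0)) (ℝ.*-identityˡ ℝ.1#)))
          (ℝ.trans (ℝ.*-identityˡ _) (ℝ.*-congʳ (ℝ.sym (PW.qp-+ ρ (ℤ.- l)))))))

        vanish : ∀ {τ} → τ ℝ.≈ ℝ.- ℝ.1# → coef t ℝ.* ((ℝ.1# ℝ.+ τ) ℝ.* X) ℝ.≈ ℝ.0#
        vanish eq = ℝ.trans (ℝ.*-congˡ (ℝ.*-congʳ (ℝ.+-congˡ eq)))
          (R.solve 2 (λ c x → c R.:* ((R.:1 R.:+ (R.:- R.:1)) R.:* x) R.:= R.:0) ℝ.refl (coef t) X)

        keep : ∀ {τ} → τ ℝ.≈ ℝ.1# → coef t ℝ.* ((ℝ.1# ℝ.+ τ) ℝ.* X) ℝ.≈ PW.qp e₀ ℝ.* (PW.qp (+ i) ℝ.* D₀)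
        keep eq = ℝ.trans (ℝ.*-congˡ (ℝ.*-congʳ (ℝ.+-congˡ eq))) double

        1*1 : ℝ.1# ℝ.* ℝ.1# ℝ.≈ ℝ.1#
        1*1 = ℝ.*-identityˡ ℝ.1#
        -1*-1 : ℝ.- ℝ.1# ℝ.* ℝ.- ℝ.1# ℝ.≈ ℝ.1#
        -1*-1 = R.solve 0 ((R.:- R.:1) R.:* (R.:- R.:1) R.:= R.:1) ℝ.refl

        sgn : ∀ {x y} → x ≡ y → signℝ x ℝ.≈ signℝ y
        sgn eq = ℝ.reflexive (≡.cong signℝ eq)

        n₀-sign : ∀ {β τ} → χ κ -b₀ˣ ≡ β → χ κ -tcˣ ≡ τ → χ κ n₀ˣ ≡ β Sign.* τ
        n₀-sign eq eq′ = ≡.trans χ-n₀ (≡.cong₂ Sign._*_ eq eq′)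

        -- Since n₀ = (- b₀)(- c), the number 1 + κ(- c) κ(n₀) equals 1 + κ(- b₀), that is 2 or 0.
        signs : ∀ β τ → χ κ -b₀ˣ ≡ β → χ κ -tcˣ ≡ τ →
                O t ball ℝ.≈ coef t ℝ.* (Λ¹.Λ ball ball-I ℝ.+ σ t ℝ.* Λᵏ.Λ ball ball-I)
        signs Sign.+ Sign.+ eq eq′ = ℝ.trans (positive eq) (ℝ.sym (ℝ.trans (expand (sgn eq′) (sgn (n₀-sign eq eq′))) (keep 1*1)))
        signs Sign.+ Sign.- eq eq′ = ℝ.trans (positive eq) (ℝ.sym (ℝ.trans (expand (sgn eq′) (sgn (n₀-sign eq eq′))) (keep -1*-1)))
        signs Sign.- Sign.+ eq eq′ = ℝ.trans (negative eq) (ℝ.sym (ℝ.trans (expand (sgn eq′) (sgn (n₀-sign eq eq′))) (vanish (ℝ.*-identityˡ _))))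
        signs Sign.- Sign.- eq eq′ = ℝ.trans (negative eq) (ℝ.sym (ℝ.trans (expand (sgn eq′) (sgn (n₀-sign eq eq′))) (vanish (ℝ.*-identityʳ _))))

      value : O t ball ℝ.≈ coef t ℝ.* (Λ¹.Λ ball ball-I ℝ.+ σ t ℝ.* Λᵏ.Λ ball ball-I)
      value = signs (χ κ -b₀ˣ) (χ κ -tcˣ) ≡.refl ≡.refl

    germ : Germ ball ball-I
    germ = ρ , λ t near → AtElement.value t (proj₂ (val-exists (Regular.tc≉0 t))) near

-- Germ expansion of functions vanishing at 1.

module GermExpansion (em : ExcludedMiddle 0ℓ) (ℝ : RealField) (F : LocalField) (E : SeparableQuadraticExtension F)
    (κ : LocalField.QuadraticCharacter F) (κ-norm : OrbitalIntegrals.HasNormKernel ℝ F E κ)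
    (dx : Integration.Measure ℝ (OrbitalIntegrals.T\G-space ℝ F E))
    (dx-invariant : OrbitalIntegrals.IsInvariantT\G ℝ F E dx)
    (dk : Integration.Measure ℝ (SL₂.K-space F))
    (dk-invariant : ∀ k → Integration.InvariantUnder ℝ dk (SL₂._·ᴷ_ F k))
    (dn : Integration.Measure ℝ (LocalField.F-space F))
    (dn-invariant : ∀ x → Integration.InvariantUnder ℝ dn (LocalField._+_ F x)) where
  open LocalField F hiding (zero)
  open GroupSpaces em F
  open Conjugation em F
  open GroupTests em ℝ F
  open UnipotentForms em ℝ F
  open TestFunctions em ℝ
  open TorusQuotient em ℝ F E using (Cont; cont-+; cont-const; cont-a; cont-d)
  open OrbitalIntegrals ℝ F E hiding (F-space; 𝟙; χ; Fˣ; QuadraticCharacter)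
  open Germs em ℝ F E κ κ-norm dx dx-invariant dk dk-invariant dn dn-invariant public
  private
    module ℝ = RealField ℝ
    module R = RealLemmas em ℝ

  Λ-zeros : ∀ t f fI → (∀ k n → val f (u k n) ℝ.≈ ℝ.0#) →
            coef t ℝ.* (Λ¹.Λ f fI ℝ.+ σ t ℝ.* Λᵏ.Λ f fI) ℝ.≈ ℝ.0#
  Λ-zeros t f fI eq = ℝ.trans (ℝ.*-congˡ (ℝ.+-cong (Λ¹.Λ-zero f fI eq) (ℝ.*-congˡ (Λᵏ.Λ-zero f fI eq))))
    (R.solve 2 (λ c s → c R.:* (R.:0 R.:+ s R.:* R.:0) R.:= R.:0) ℝ.refl (coef t) (σ t))

  germ-zero : ∀ f fI → (∀ x → val f x ℝ.≈ ℝ.0#) → Germ f fI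
  germ-zero f fI eq = 0ℤ , λ t _ → ℝ.trans (O-zero t f (λ x → eq (cj x (RegularT.t t)))) (ℝ.sym (Λ-zeros t f fI (λ k n → eq (u k n))))

  germ-lin : ∀ α φ φI ψ ψI f fI → (∀ x → val f x ℝ.≈ α ℝ.* val φ x ℝ.+ val ψ x) →
             Germ φ φI → Germ ψ ψI → Germ f fI
  germ-lin α φ φI ψ ψI f fI eq (i , p) (j , r) = i ℤ.⊔ j , λ t near →
    ℝ.trans (O-lin t α φ ψ f eq) (ℝ.trans
      (ℝ.+-cong (ℝ.*-congˡ (p t (nearG-mono {i} {_} {I} {RegularT.t t} (ℤ.i≤i⊔j i j) near))) (r t (nearG-mono {j} {_} {I} {RegularT.t t} (ℤ.i≤j⊔i i j) near)))
      (ℝ.trans (R.solve 7 (λ a c s x y z w → a R.:* (c R.:* (x R.:+ s R.:* y)) R.:+ c R.:* (z R.:+ s R.:* w) R.:=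
          c R.:* ((a R.:* x R.:+ z) R.:+ s R.:* (a R.:* y R.:+ w))) ℝ.refl α (coef t) (σ t) (Λ¹.Λ φ φI) (Λᵏ.Λ φ φI) (Λ¹.Λ ψ ψI) (Λᵏ.Λ ψ ψI))
        (ℝ.*-congˡ (ℝ.+-cong (ℝ.sym (Λ¹.Λ-lin α φ φI ψ ψI f fI eq)) (ℝ.*-congˡ (ℝ.sym (Λᵏ.Λ-lin α φ φI ψ ψI f fI eq)))))))

  private
    zeroG : GTest
    zeroG = record { val = λ _ → ℝ.0# ; N = 0ℤ ; M = 0ℤ ; supp = λ x nz → ⊥-elim (nz ℝ.refl) ; const = λ _ _ _ → ℝ.refl }

  germ-cong : ∀ φ φI f fI → (∀ x → val f x ℝ.≈ val φ x) → Germ φ φI → Germ f fI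
  germ-cong φ φI f fI eq germ-φ = germ-lin ℝ.1# φ φI zeroG ℝ.refl f fI
    (λ x → ℝ.trans (eq x) (R.solve 1 (λ y → y R.:= R.:1 R.:* y R.:+ R.:0) ℝ.refl (val φ x))) germ-φ (germ-zero zeroG ℝ.refl (λ _ → ℝ.refl))

  Unipotent : SL2 → Set
  Unipotent h = a h + d h ≈ 1# + 1#

  u-unipotent : ∀ k n → Unipotent (u k n)
  u-unipotent k n = trans (+-cong u-a u-d) (solve 1 (λ x → (:1 :+ x) :+ (:1 :- x) := :1 :+ :1) refl (n * (c k * d k)))
    where open Conjugate k n

  module _ (g : SL2) (ρ : ℤ) (ball-I : val (ballG g ρ) I ℝ.≈ ℝ.0#) where
    private
      f : GTest
      f = ballG g ρ

    -- Without elements of trace 2 the ball, being compact, has trace - 2 bounded away from 0.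
    -- Conjugation preserves the trace of t, which tends to 2, so both sides vanish for t near 1.
    germ-away : ¬ (∃ λ h → NearG ρ g h × Unipotent h) → Germ f ball-I
    germ-away none = germ-from avoid
      where
      tr-2 : SL2 → Carrier
      tr-2 h = (a h + d h) - (1# + 1#)
      tr-cont : Cont tr-2
      tr-cont = cont-+ (cont-+ cont-a cont-d) (cont-const (- (1# + 1#)))
      avoid : ∃ λ j → ∀ h → B (N f) h → NearG ρ g h → ¬ P j (tr-2 h)
      avoid = NonVanishing.compact-avoid em F NearG (λ {m} {n} {x} {y} → nearG-mono {m} {n} {x} {y}) (G-compact (N f))
        (λ x → ρ , λ y near p → nearG-trans {ρ} {g} {y} {x} p (nearG-sym {ρ} {x} {y} near)) tr-cont
        (λ h _ near z → none (h , near , x-y≈0⇒x≈y z))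
      germ-from : (∃ λ j → ∀ h → B (N f) h → NearG ρ g h → ¬ P j (tr-2 h)) → Germ f ball-I
      germ-from (j , far) = j , λ t near → ℝ.trans (O-zero t f (λ x → 𝟏-no (λ p → outside t near x p)))
          (ℝ.sym (Λ-zeros t f ball-I (λ k n → 𝟏-no (λ p → none (u k n , p , u-unipotent k n)))))
        where
        outside : ∀ t → NearG j I (RegularT.t t) → ∀ x → ¬ NearG ρ g (cj x (RegularT.t t))
        outside t (pa , _ , _ , pd) x p = far (cj x (RegularT.t t)) (supp f (cj x (RegularT.t t)) (λ z → ℝ.1≉0 (ℝ.trans (ℝ.sym (𝟏-yes p)) z))) p
          (P-resp {j} (trans (solve 2 (λ a d → :- ((:1 :- a) :+ (:1 :- d)) := (a :+ d) :- (:1 :+ :1)) refl (a (RegularT.t t)) (d (RegularT.t t)))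
            (+-congʳ (sym (Regular.trace-cj t x)))) (P-neg (P-+ pa pd)))

    module _ (far : ¬ NearG (ρ ℤ.- + m₀) g I) where
      private
        ρ-m₀≤ρ : ρ ℤ.- + m₀ ℤ.≤ ρ
        ρ-m₀≤ρ = ≤-by {c = 0ℤ} {d = + m₀} (ℤ.+≤+ ℕ.z≤n)
          (ℤS.solve 2 (λ r m → r ℤS.:- (r ℤS.:- m) ℤS.:= m ℤS.:- ℤS.con 0ℤ) ≡.refl ρ (+ m₀))

        -- A ball at distance more than 𝔭^(ρ-m₀) from 1 meets the unipotent set only in u(n) with
        -- v(n) < ρ - m₀, so ρ is small relative to v(n) by at least m₀ + 1, as the conductor
        -- requires.
        far-unipotent : ∀ k n → NearG ρ g (u (K.g k) n) → ¬ P (ρ ℤ.- + m₀) n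
        far-unipotent k n near p = far (nearG-trans {ρ ℤ.- + m₀} {g} {u (K.g k) n} {I}
          (nearG-mono {ρ ℤ.- + m₀} {ρ} {g} {u (K.g k) n} ρ-m₀≤ρ near) (Integral.u-near-I k (ρ ℤ.- + m₀) n p))

        -- Every point of an ultrametric ball is a centre, so the ball may be taken around a
        -- conjugate of u(n₀).
        recentre : ∀ k n₀ {w} (vn₀ : v n₀ ≡ fin w) i → ρ ≡ w ℤ.+ + suc (m₀ ℕ.+ i) → NearG ρ g (u (K.g k) n₀) → Germ f ball-I
        recentre k n₀ vn₀ i ρ≡ near = germ-cong ball′ ball′-I f ball-I
            (λ x → 𝟏-cong (forward x) (backward x)) (BallGerm.germ k n₀ vn₀ i)
          where
          ball′ = Ball.ball k n₀ vn₀ (m₀ ℕ.+ i)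
          ball′-I = Ball.ball-I k n₀ vn₀ (m₀ ℕ.+ i)
          c₀ : SL2
          c₀ = u (K.g k) n₀
          forward : ∀ x → NearG ρ g x → NearG (Ball.ρ k n₀ vn₀ (m₀ ℕ.+ i)) c₀ x
          forward x p = ≡.subst (λ r → NearG r c₀ x) ρ≡ (nearG-trans {ρ} {c₀} {g} {x} (nearG-sym {ρ} {g} {c₀} near) p)
          backward : ∀ x → NearG (Ball.ρ k n₀ vn₀ (m₀ ℕ.+ i)) c₀ x → NearG ρ g x
          backward x p = nearG-trans {ρ} {g} {c₀} {x} near (≡.subst (λ r → NearG r c₀ x) (≡.sym ρ≡) p)

        offset : ∀ {w} → w ℤ.+ + suc m₀ ℤ.≤ ρ → ∃ λ i → ρ ≡ w ℤ.+ + suc (m₀ ℕ.+ i)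
        offset {w} le = ℤ.∣ δ ∣ , ≡.trans (ℤS.solve 3 (λ r w m → r ℤS.:= w ℤS.:+ (m ℤS.:+ (r ℤS.:- (w ℤS.:+ m)))) ≡.refl ρ w (+ suc m₀))
            (≡.cong (λ e → w ℤ.+ (+ suc m₀ ℤ.+ e)) (≡.sym (ℤ.0≤i⇒+∣i∣≡i (ℤ.i≤j⇒0≤j-i le))))
          where
          δ : ℤ
          δ = ρ ℤ.- (w ℤ.+ + suc m₀)

        at-unipotent : ∀ h → NearG ρ g h → Unipotent h → Germ f ball-I
        at-unipotent h near uni = from-form (NormalForm.normal-form h uni h≉I)
          where
          h≉I : ¬ (h ≋ I)
          h≉I h≋I = far (nearG-trans {ρ ℤ.- + m₀} {g} {h} {I} (nearG-mono {ρ ℤ.- + m₀} {ρ} {g} {h} ρ-m₀≤ρ near) (nearG-refl {ρ ℤ.- + m₀} {h} {I} h≋I))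
          from-val : ∀ k n {w} (vn : v n ≡ fin w) → NearG ρ g (u (K.g k) n) → w ℤ.+ + suc m₀ ℤ.≤ ρ ⊎ ρ ℤ.+ 1ℤ ℤ.≤ w ℤ.+ + suc m₀ → Germ f ball-I
          from-val k n {w} vn near′ (inj₁ le) = let i , ρ≡ = offset {w} le in recentre k n vn i ρ≡ near′
          from-val k n {w} vn near′ (inj₂ gt) = ⊥-elim (far-unipotent k n near′ (P-mono {ρ ℤ.- + m₀} {w}
            (≤-by {ρ ℤ.- + m₀} {w} {ρ ℤ.+ 1ℤ} {w ℤ.+ + suc m₀} gt (ℤS.solve 3 (λ r w m → w ℤS.:- (r ℤS.:- m) ℤS.:= (w ℤS.:+ (ℤS.con 1ℤ ℤS.:+ m)) ℤS.:- (r ℤS.:+ ℤS.con 1ℤ)) ≡.refl ρ w (+ m₀))) (val⇒P vn)))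
          from-form : NormalForm.Result h uni → Germ f ball-I
          from-form (k , n , n≉0 , eq) = with-val (val-exists n≉0)
            where
            with-val : (∃ λ w → v n ≡ fin w) → Germ f ball-I
            with-val (w , vn) = from-val k n vn
              (nearG-trans {ρ} {g} {h} {u (K.g k) n} near (nearG-refl {ρ} {h} {u (K.g k) n} eq)) (Sum.swap (≤-split ρ (w ℤ.+ + suc m₀)))

      germ-ball : Germ f ball-I
      germ-ball = cases em
        where
        cases : Dec (∃ λ h → NearG ρ g h × Unipotent h) → Germ f ball-I
        cases (yes (h , near , uni)) = at-unipotent h near uni
        cases (no none)              = germ-away none

  private
    module Decompose (M₀ : ℤ) where
      ρ : ℤ
      -- f is constant on balls of radius M₀ and vanishes on the one around 1. Cutting m₀ steps
      -- finer makes every remaining ball small relative to its distance from 1.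
      ρ = M₀ ℤ.+ + m₀

      M₀≤ρ : M₀ ℤ.≤ ρ
      M₀≤ρ = ℤ.≤-trans (ℤ.≤-reflexive (≡.sym (ℤ.+-identityʳ M₀))) (ℤ.+-monoʳ-≤ M₀ (ℤ.+≤+ ℕ.z≤n))

      ρ-m₀ : ρ ℤ.- + m₀ ≡ M₀
      ρ-m₀ = ℤS.solve 2 (λ r m → (r ℤS.:+ m) ℤS.:- m ℤS.:= r) ≡.refl M₀ (+ m₀)

      -- Subtracting f(g) times the indicator function of the ball at g clears that ball, and keeps
      -- the value 0 near 1 because the ball stays away from it. So one centre of the covering list
      -- is used up.
      peel : ∀ (gs : List SL2) f fI → (∀ x y → NearG ρ x y → val f x ℝ.≈ val f y) →
             (∀ x → NearG M₀ x I → val f x ℝ.≈ ℝ.0#) → (∀ x → val f x ℝ.≉ ℝ.0# → Any (λ g → NearG ρ g x) gs) → Germ f fI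
      peel [] f fI f-const f-I cover = germ-zero f fI (λ x → cases x em)
        where
        cases : ∀ x → Dec (val f x ℝ.≈ ℝ.0#) → val f x ℝ.≈ ℝ.0#
        cases x (yes z) = z
        cases x (no nz) with cover x nz
        ... | ()
      peel (g ∷ gs) f fI f-const f-I cover = cases em
        where
        ball : GTest
        ball = ballG g ρ
        cases : Dec (val f g ℝ.≈ ℝ.0#) → Germ f fI
        cases (yes z) = peel gs f fI f-const f-I (λ x nz → drop x nz (cover x nz))
          where
          drop : ∀ x → val f x ℝ.≉ ℝ.0# → Any (λ g → NearG ρ g x) (g ∷ gs) → Any (λ g → NearG ρ g x) gs
          drop x nz (here near) = ⊥-elim (nz (ℝ.trans (ℝ.sym (f-const g x near)) z))
          drop x nz (there p)   = p
        cases (no nz) = germ-lin (val f g) ball ball-I rest rest-I f fI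
            (λ x → R.solve 3 (λ e b y → y R.:= e R.:* b R.:+ ((R.:- e) R.:* b R.:+ y)) ℝ.refl (val f g) (val ball x) (val f x))
            (germ-ball g ρ ball-I (λ near → far (≡.subst (λ r → NearG r g I) ρ-m₀ near)))
            (peel gs rest rest-I rest-const rest-vanish (λ x nz → drop x nz em))
          where
          far : ¬ NearG M₀ g I
          far near = nz (f-I g near)
          outside : ∀ x → NearG M₀ x I → ¬ NearG ρ g x
          outside x near p = far (nearG-trans {M₀} {g} {x} {I} (nearG-mono {M₀} {ρ} {g} {x} M₀≤ρ p) near)
          ball-I : val ball I ℝ.≈ ℝ.0#
          ball-I = 𝟏-no (outside I (nearG-refl {M₀} {I} {I} (≋-refl {I})))
          rest : GTest
          rest = lin (ℝ.- val f g) ball f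
          clear : ∀ {e b y} → b ℝ.≈ ℝ.0# → y ℝ.≈ ℝ.0# → ℝ.- e ℝ.* b ℝ.+ y ℝ.≈ ℝ.0#
          clear {e} b≈0 y≈0 = ℝ.trans (ℝ.+-cong (ℝ.*-congˡ b≈0) y≈0) (R.solve 1 (λ e → (R.:- e) R.:* R.:0 R.:+ R.:0 R.:= R.:0) ℝ.refl e)
          rest-I : val rest I ℝ.≈ ℝ.0#
          rest-I = clear ball-I fI
          rest-const : ∀ x y → NearG ρ x y → val rest x ℝ.≈ val rest y
          rest-const x y near = ℝ.+-cong (ℝ.*-congˡ (GTest.const ball x y near)) (f-const x y near)
          rest-vanish : ∀ x → NearG M₀ x I → val rest x ℝ.≈ ℝ.0#
          rest-vanish x near = clear (𝟏-no (outside x near)) (f-I x near)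
          drop : ∀ x → val rest x ℝ.≉ ℝ.0# → Dec (NearG ρ g x) → Any (λ g → NearG ρ g x) gs
          drop x nz (yes near) = ⊥-elim (nz (ℝ.trans (ℝ.+-cong (ℝ.trans (ℝ.*-congˡ (𝟏-yes near)) (ℝ.*-identityʳ _)) (ℝ.sym (f-const g x near))) (ℝ.-‿inverseˡ _)))
          drop x nz (no ¬near) = later (cover x (λ z → nz (clear (𝟏-no ¬near) z)))
            where
            later : Any (λ g → NearG ρ g x) (g ∷ gs) → Any (λ g → NearG ρ g x) gs
            later (here near) = ⊥-elim (¬near near)
            later (there p)   = p

  -- f is a combination of indicator functions of balls, subtracted one at a time.
  germ : ∀ f fI → Germ f fI
  germ f fI = peel (proj₁ cover) f fI
      (λ x y near → GTest.const f x y (nearG-mono {M f} {ρ} {x} {y} M₀≤ρ near))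
      (λ x near → ℝ.trans (GTest.const f x I near) fI)
      (λ x nz → proj₂ cover x (supp f x nz))
    where
    open Decompose (M f)
    cover : ∃ λ (gs : List SL2) → ∀ x → B (N f) x → Any (λ g → NearG ρ g x) gs
    cover = G-compact (N f) (λ g x → NearG ρ g x) (λ g x near → ρ , λ y near′ → nearG-trans {ρ} {g} {x} {y} near near′)
      (λ x _ → x , nearG-refl {ρ} {x} {x} (≋-refl {x}))

-- Constants, transfer factor and the general expansion.

module Expansion (em : ExcludedMiddle 0ℓ) (ℝ : RealField) (F : LocalField) (E : SeparableQuadraticExtension F)
    (κ : LocalField.QuadraticCharacter F) (κ-norm : OrbitalIntegrals.HasNormKernel ℝ F E κ)
    (l : RealOps.ℂ ℝ) (l⁴≈1 : RawRing._≈_ (RealOps.ℂ-rawRing ℝ) (OrbitalIntegrals._^ᶜ_ ℝ F E l 4) (OrbitalIntegrals.1ᶜ ℝ F E))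
    (dx : Integration.Measure ℝ (OrbitalIntegrals.T\G-space ℝ F E))
    (dx-invariant : OrbitalIntegrals.IsInvariantT\G ℝ F E dx)
    (dk : Integration.Measure ℝ (SL₂.K-space F))
    (dk-invariant : ∀ k → Integration.InvariantUnder ℝ dk (SL₂._·ᴷ_ F k))
    (dn : Integration.Measure ℝ (LocalField.F-space F))
    (dn-invariant : ∀ x → Integration.InvariantUnder ℝ dn (LocalField._+_ F x)) where
  open LocalField F hiding (zero)
  open GroupSpaces em F
  open Conjugation em F
  open GroupTests em ℝ F
  open TestFunctions em ℝ
  open Characters em ℝ F E
  open OrbitalIntegrals ℝ F E hiding (F-space; 𝟙; χ; Fˣ; QuadraticCharacter)
  open NormForm em F E using (D; D≉0; module Difference)
  open GermExpansion em ℝ F E κ κ-norm dx dx-invariant dk dk-invariant dn dn-invariant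
  private
    module ℝ = RealField ℝ
    module R = RealLemmas em ℝ
    module E = SeparableQuadraticExtension E
    module TGI = Boxes.Integrals em ℝ F E dx

  l₁ l₂ ∣l∣² : ℝ.Carrier
  l₁ = proj₁ l
  l₂ = proj₂ l
  ∣l∣² = l₁ ℝ.* l₁ ℝ.+ l₂ ℝ.* l₂

  ∣l∣²≉0 : ∣l∣² ℝ.≉ ℝ.0#
  ∣l∣²≉0 e≈0 = ℝ.1≉0 (ℝ.trans (ℝ.sym (proj₁ l⁴≈1)) re≈0)
    where
    x≈0 : l₁ ℝ.≈ ℝ.0#
    x≈0 = R.x²+y²≈0⇒x≈0 e≈0
    y≈0 : l₂ ℝ.≈ ℝ.0#
    y≈0 = R.x²+y²≈0⇒x≈0 (ℝ.trans (ℝ.+-comm _ _) e≈0)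
    re≈0 : proj₁ (l ^ᶜ 4) ℝ.≈ ℝ.0#
    re≈0 = ℝ.trans (ℝ.+-cong (ℝ.trans (ℝ.*-congʳ x≈0) (ℝ.zeroˡ _)) (ℝ.-‿cong (ℝ.trans (ℝ.*-congʳ y≈0) (ℝ.zeroˡ _))))
      (R.solve 0 (R.:0 R.:- R.:0 R.:= R.:0) ℝ.refl)

  √D : ℝ.Carrier
  √D = √ ∣ D ∣F

  kD : ℤ
  kD = proj₁ (val-exists D≉0)

  vD : v D ≡ fin kD
  vD = proj₂ (val-exists D≉0)

  √D≉0 : √D ℝ.≉ ℝ.0#
  √D≉0 = R.√-≉0 (R.≤-respʳ (ℝ.sym eq) (PW.qp-nonneg kD)) (R.≉-resp (ℝ.sym eq) (PW.qp-≉0 kD))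
    where
    eq : ∣ D ∣F ℝ.≈ PW.qp kD
    eq = ℝ.reflexive (∣∣F-val kD vD)

  ε₋₁ : ℝ.Carrier
  ε₋₁ = signℝ (χ κ (- 1# , -‿≉0 1≉0))

  -- The product of `coef t`, `σ t` and the real part `r` of the transfer factor without λ. It does
  -- not depend on t because κ(c)² = 1 and |c|⁻¹ |c| = 1; what remains is κ(- 1) and the root of
  -- |D|.
  c₁ : ℝ.Carrier
  c₁ = Cst ℝ.* ε₋₁ ℝ.* √D

  c₀ : ℂ
  c₀ = c₁ ℝ.* l₁ , c₁ ℝ.* l₂

  signℝ-* : ∀ α β → signℝ (α Sign.* β) ℝ.≈ signℝ α ℝ.* signℝ β
  signℝ-* Sign.+ β = ℝ.sym (ℝ.*-identityˡ _)
  signℝ-* Sign.- Sign.+ = ℝ.sym (ℝ.*-identityʳ _)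
  signℝ-* Sign.- Sign.- = R.solve 0 (R.:1 R.:= (R.:- R.:1) R.:* (R.:- R.:1)) ℝ.refl

  signℝ² : ∀ α → signℝ α ℝ.* signℝ α ℝ.≈ ℝ.1#
  signℝ² Sign.+ = ℝ.*-identityˡ ℝ.1#
  signℝ² Sign.- = R.solve 0 ((R.:- R.:1) R.:* (R.:- R.:1) R.:= R.:1) ℝ.refl

  module AtRegular (t : RegularT) where
    open Regular t

    k : ℤ
    k = proj₁ (val-exists tc≉0)
    vc : v tc ≡ fin k
    vc = proj₂ (val-exists tc≉0)

    open Difference (proj₁ (RegularT.represents t))

    -- `r` is the transfer factor divided by λ; by `Difference` it equals κ(c) |c| times the root of
    -- |D|.
    σ₀ r : ℝ.Carrier
    σ₀ = signℝ (χ κ (tc , tc≉0))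
    r  = extend κ (E.toF (δ E.* (E.τ E.- E.bar E.τ) E.⁻¹)) ℝ.* √ ∣ E.Norm δ ∣F

    r≈ : r ℝ.≈ σ₀ ℝ.* (PW.qp k ℝ.* √D)
    r≈ = ℝ.*-cong (ℝ.reflexive (≡.trans (extend-cong κ ratio) (extend-≉0 κ tc tc≉0)))
      (ℝ.trans (R.√-cong abs) (R.√-scale (PW.qp-nonneg k) (PW.qp-≉0 k)))
      where
      abs : ∣ E.Norm δ ∣F ℝ.≈ PW.qp k ℝ.* PW.qp k ℝ.* ∣ D ∣F
      abs = ℝ.trans (ℝ.reflexive (∣∣F-val ((k ℤ.+ k) ℤ.+ kD) (val-resp (sym norm-δ) (val-* (val-* vc vc) vD))))
        (ℝ.trans (PW.qp-+ (k ℤ.+ k) kD) (ℝ.*-cong (PW.qp-+ k k) (ℝ.reflexive (≡.sym (∣∣F-val kD vD)))))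

    σ≈ : σ t ℝ.≈ ε₋₁ ℝ.* σ₀
    σ≈ = ℝ.trans (ℝ.reflexive (≡.trans (extend-≉0 κ (- tc) (-‿≉0 tc≉0)) (≡.cong signℝ
      (QuadraticCharacter.χ-* κ (- 1# , -‿≉0 1≉0) (tc , tc≉0) (- tc , -‿≉0 tc≉0) (solve 1 (λ c → :- c := (:- :1) :* c) refl tc)))))
      (signℝ-* (χ κ (- 1# , -‿≉0 1≉0)) (χ κ (tc , tc≉0)))

    coef≈ : coef t ℝ.≈ PW.qp (ℤ.- k) ℝ.* Cst
    coef≈ = ℝ.*-congʳ (∣∣F⁻¹-val vc)

    c₁≈ : coef t ℝ.* σ t ℝ.* r ℝ.≈ c₁
    c₁≈ = ℝ.trans (ℝ.*-cong (ℝ.*-cong coef≈ σ≈) r≈)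
      (ℝ.trans (R.solve 6 (λ L C ε s q D → L R.:* C R.:* (ε R.:* s) R.:* (s R.:* (q R.:* D)) R.:= (q R.:* L) R.:* (s R.:* s) R.:* (C R.:* ε R.:* D))
          ℝ.refl (PW.qp (ℤ.- k)) Cst ε₋₁ σ₀ (PW.qp k) √D)
      (ℝ.trans (ℝ.*-congʳ (ℝ.*-cong (ℝ.trans (ℝ.sym (PW.qp-+ k (ℤ.- k))) (ℝ.reflexive (≡.cong PW.qp (ℤ.+-inverseʳ k)))) (signℝ² (χ κ (tc , tc≉0)))))
        (R.solve 1 (λ c → R.:1 R.:* R.:1 R.:* c R.:= c) ℝ.refl c₁)))

    r≉0 : r ℝ.≉ ℝ.0#
    r≉0 = R.≉-resp (ℝ.sym r≈) (R.*-≉0 σ₀≉0 (R.*-≉0 (PW.qp-≉0 k) √D≉0))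
      where
      σ₀≉0 : σ₀ ℝ.≉ ℝ.0#
      σ₀≉0 z = ℝ.1≉0 (ℝ.trans (ℝ.sym (signℝ² (χ κ (tc , tc≉0)))) (ℝ.trans (ℝ.*-congʳ z) (ℝ.zeroˡ _)))

    private
      Δ₁ Δ₂ d⁻¹ : ℝ.Carrier
      Δ₁ = proj₁ (transferFactor l κ t)
      Δ₂ = proj₂ (transferFactor l κ t)
      d⁻¹ = (Δ₁ ℝ.* Δ₁ ℝ.+ Δ₂ ℝ.* Δ₂) ℝ.⁻¹

      Δ₁≈ : Δ₁ ℝ.≈ l₁ ℝ.* r
      Δ₁≈ = R.solve 3 (λ x y r → x R.:* r R.:- y R.:* R.:0 R.:= x R.:* r) ℝ.refl l₁ l₂ r
      Δ₂≈ : Δ₂ ℝ.≈ l₂ ℝ.* r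
      Δ₂≈ = R.solve 3 (λ x y r → x R.:* R.:0 R.:+ y R.:* r R.:= y R.:* r) ℝ.refl l₁ l₂ r

      d≈ : Δ₁ ℝ.* Δ₁ ℝ.+ Δ₂ ℝ.* Δ₂ ℝ.≈ r ℝ.* r ℝ.* ∣l∣²
      d≈ = ℝ.trans (ℝ.+-cong (ℝ.*-cong Δ₁≈ Δ₁≈) (ℝ.*-cong Δ₂≈ Δ₂≈))
        (R.solve 3 (λ x y r → (x R.:* r) R.:* (x R.:* r) R.:+ (y R.:* r) R.:* (y R.:* r) R.:= r R.:* r R.:* (x R.:* x R.:+ y R.:* y)) ℝ.refl l₁ l₂ r)

      unit : r ℝ.* r ℝ.* ∣l∣² ℝ.* d⁻¹ ℝ.≈ ℝ.1#
      unit = ℝ.trans (ℝ.*-congʳ (ℝ.sym d≈)) (ℝ.*-inverse (R.≉-resp (ℝ.sym d≈) (R.*-≉0 (R.*-≉0 r≉0 r≉0) ∣l∣²≉0)))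

      p₁ q₁ : ℝ.Carrier
      p₁ = l₁ ℝ.* r ℝ.* d⁻¹
      q₁ = ℝ.- (l₂ ℝ.* r) ℝ.* d⁻¹

      inv≈ : (Δ₁ ℝ.* d⁻¹ ℝ.≈ p₁) × (ℝ.- Δ₂ ℝ.* d⁻¹ ℝ.≈ q₁)
      inv≈ = ℝ.*-congʳ Δ₁≈ , ℝ.*-congʳ (ℝ.-‿cong Δ₂≈)

      scaleᶜ : coef t ℝ.* σ t ℝ.≈ c₁ ℝ.* (r ℝ.* ∣l∣² ℝ.* d⁻¹)
      scaleᶜ = ℝ.sym (ℝ.trans (ℝ.*-congʳ (ℝ.sym c₁≈)) (ℝ.trans
        (R.solve 4 (λ a r e d → a R.:* r R.:* (r R.:* e R.:* d) R.:= a R.:* (r R.:* r R.:* e R.:* d)) ℝ.refl (coef t ℝ.* σ t) r ∣l∣² d⁻¹)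
        (ℝ.trans (ℝ.*-congˡ unit) (ℝ.*-identityʳ _))))

    -- The transfer factor is λ r and c₀ = λ c₁, so λ cancels and the real number c₁ / r = `coef t`
    -- `σ t` is left.
    factor : ∀ z → (c₀ *ᶜ ((transferFactor l κ t) ⁻¹ᶜ *ᶜ z)) ≈ᶜ (coef t ℝ.* σ t ℝ.* proj₁ z , coef t ℝ.* σ t ℝ.* proj₂ z)
    factor (z₁ , z₂) =
      ℝ.trans (ℝ.+-cong (ℝ.*-congˡ (ℝ.+-cong (ℝ.*-congʳ (proj₁ inv≈)) (ℝ.-‿cong (ℝ.*-congʳ (proj₂ inv≈)))))
                        (ℝ.-‿cong (ℝ.*-congˡ (ℝ.+-cong (ℝ.*-congʳ (proj₁ inv≈)) (ℝ.*-congʳ (proj₂ inv≈))))))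
        (ℝ.trans (R.solve 7 (λ c x y r d z w →
            (c R.:* x) R.:* ((x R.:* r R.:* d) R.:* z R.:- ((R.:- (y R.:* r)) R.:* d) R.:* w) R.:-
            (c R.:* y) R.:* ((x R.:* r R.:* d) R.:* w R.:+ ((R.:- (y R.:* r)) R.:* d) R.:* z) R.:=
            c R.:* (r R.:* (x R.:* x R.:+ y R.:* y) R.:* d) R.:* z) ℝ.refl c₁ l₁ l₂ r d⁻¹ z₁ z₂)
          (ℝ.*-congʳ (ℝ.sym scaleᶜ))) ,
      ℝ.trans (ℝ.+-cong (ℝ.*-congˡ (ℝ.+-cong (ℝ.*-congʳ (proj₁ inv≈)) (ℝ.*-congʳ (proj₂ inv≈))))
                        (ℝ.*-congˡ (ℝ.+-cong (ℝ.*-congʳ (proj₁ inv≈)) (ℝ.-‿cong (ℝ.*-congʳ (proj₂ inv≈))))))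
        (ℝ.trans (R.solve 7 (λ c x y r d z w →
            (c R.:* x) R.:* ((x R.:* r R.:* d) R.:* w R.:+ ((R.:- (y R.:* r)) R.:* d) R.:* z) R.:+
            (c R.:* y) R.:* ((x R.:* r R.:* d) R.:* z R.:- ((R.:- (y R.:* r)) R.:* d) R.:* w) R.:=
            c R.:* (r R.:* (x R.:* x R.:+ y R.:* y) R.:* d) R.:* w) ℝ.refl c₁ l₁ l₂ r d⁻¹ z₁ z₂)
          (ℝ.*-congʳ (ℝ.sym scaleᶜ)))

  -- Solved from the expansion for the indicator function of K, whose value at 1 is 1 and whose
  -- unipotent integrals are L vol(K); for that function the identity then holds at every regular t.
  γ₁ : RegularT → ℝ.Carrier
  γ₁ t = O t indicator-K ℝ.- coef t ℝ.* (Λ¹.L ℝ.* HK.volK ℝ.+ σ t ℝ.* (Λᵏ.L ℝ.* HK.volK))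

  coef-cong : ∀ {t t′} → RegularT.t t ≋ RegularT.t t′ → coef t ℝ.≈ coef t′
  coef-cong {t} {t′} (_ , _ , c≈c′ , _) = ℝ.trans (coef≈ t) (ℝ.trans
      (ℝ.*-congʳ (ℝ.reflexive (≡.cong (λ i → PW.qp (ℤ.- i)) (fin-injective (≡.trans (≡.sym (vc t)) (≡.trans (v-cong c≈c′) (vc t′)))))))
      (ℝ.sym (coef≈ t′)))
    where open AtRegular

  γ₁-cong : ∀ {t t′} → RegularT.t t ≋ RegularT.t t′ → γ₁ t ℝ.≈ γ₁ t′
  γ₁-cong {t} {t′} t≋t′ = ℝ.+-cong O≈ (ℝ.-‿cong (ℝ.*-cong (coef-cong {t} {t′} t≋t′)
      (ℝ.+-congˡ (ℝ.*-congʳ (ℝ.reflexive (extend-cong κ (-‿cong (proj₁ (proj₂ (proj₂ t≋t′))))))))))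
    where
    tests : ∀ z → cj z (RegularT.t t) ≋ cj z (RegularT.t t′)
    tests z = begin
      cj z (RegularT.t t)           ≈⟨ cj-≋ z (RegularT.t t) ⟩
      inv z · RegularT.t t · z      ≈⟨ ·-congʳ (inv z · RegularT.t t) (inv z · RegularT.t t′) z (·-congˡ (inv z) (RegularT.t t) (RegularT.t t′) t≋t′) ⟩
      inv z · RegularT.t t′ · z     ≈⟨ cj-≋ z (RegularT.t t′) ⟨
      cj z (RegularT.t t′)          ∎
      where open SetoidReasoning SL2-setoid
    O≈ : O t indicator-K ℝ.≈ O t′ indicator-K
    O≈ = TGI.∫-cong (Regular.orb t indicator-K) (Regular.orb t′ indicator-K) λ z →
      ℝ.trans (Regular.orb-fun t indicator-K z) (ℝ.trans
        (GTest.const indicator-K (cj z (RegularT.t t)) (cj z (RegularT.t t′)) (nearG-refl {0ℤ} {cj z (RegularT.t t)} {cj z (RegularT.t t′)} (tests z)))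
        (ℝ.sym (Regular.orb-fun t′ indicator-K z)))

  Γ₁ Γν : Func RegularT-setoid ℂ-setoid
  Γ₁ = record { to = λ t → fromℝ (γ₁ t) ; cong = λ {t} {t′} eq → γ₁-cong {t} {t′} eq , ℝ.refl }
  Γν = record { to = λ t → fromℝ (coef t) ; cong = λ {t} {t′} eq → coef-cong {t} {t′} eq , ℝ.refl }

  -- g is g(1) times the indicator function of K plus `reduced g`. The definition of `γ₁` accounts
  -- for the first summand and `germ` for the second.
  real-expansion : ∀ g → ∃ λ j → ∀ t → NearG j I (RegularT.t t) → O t g ℝ.≈
                   (γ₁ t ℝ.* val g I ℝ.+ coef t ℝ.* Λ¹.unipotent-value g) ℝ.+ coef t ℝ.* σ t ℝ.* Λᵏ.unipotent-value g
  real-expansion g = expand (germ (reduced g) (reduced-I g))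
    where
    expand : Germ (reduced g) (reduced-I g) → ∃ λ j → ∀ t → NearG j I (RegularT.t t) → O t g ℝ.≈
             (γ₁ t ℝ.* val g I ℝ.+ coef t ℝ.* Λ¹.unipotent-value g) ℝ.+ coef t ℝ.* σ t ℝ.* Λᵏ.unipotent-value g
    expand (j , eq) = j , λ t near → ℝ.trans
      (O-lin t (val g I) indicator-K (reduced g) g (λ z → R.solve 3 (λ i k y → y R.:= i R.:* k R.:+ ((R.:- i) R.:* k R.:+ y)) ℝ.refl (val g I) (val indicator-K z) (val g z)))
      (ℝ.trans (ℝ.+-congˡ (eq t near))
        (R.solve 8 (λ i o c s u w m n → i R.:* o R.:+ c R.:* (u R.:+ s R.:* w) R.:=
            ((o R.:- c R.:* (m R.:+ s R.:* n)) R.:* i R.:+ c R.:* (u R.:+ i R.:* m)) R.:+ c R.:* s R.:* (w R.:+ i R.:* n))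
          ℝ.refl (val g I) (O t indicator-K) (coef t) (σ t) (Λ¹.Λ (reduced g) (reduced-I g)) (Λᵏ.Λ (reduced g) (reduced-I g))
          (Λ¹.L ℝ.* HK.volK) (Λᵏ.L ℝ.* HK.volK)))

  module ForFunction (f : Cc∞ G-space ℂ-rawRing) where
    open Integration ℝ

    component : (part : ℂ → ℝ.Carrier) → (∀ {z w} → z ≈ᶜ w → part z ℝ.≈ part w) → part (RawRing.0# ℂ-rawRing) ℝ.≈ ℝ.0# → Cc∞ G-space ℝ.rawRing
    component part part-cong part-0 = record
      { fun             = λ z → part (fun f z)
      ; locallyConstant = λ z → let U , U-open , Uz , const = Cc∞.locallyConstant f z in U , U-open , Uz , λ w Uw → part-cong (const w Uw)
      ; compactSupport  = let C , C-compact , inside = Cc∞.compactSupport f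
                          in C , C-compact , λ z nz → inside z (λ z≈0 → nz (ℝ.trans (part-cong z≈0) part-0))
      }

    re im : GTest
    re = fromCc (component proj₁ proj₁ ℝ.refl)
    im = fromCc (component proj₂ proj₂ ℝ.refl)

    module Unipotent (ω : LocalField.QuadraticCharacter F) where
      private
        module W = Λω ω
        reᵒ = W.outer-integral re {W.Jᵍ re} (λ _ → ℝ.refl)
        imᵒ = W.outer-integral im {W.Jᵍ im} (λ _ → ℝ.refl)

      value : ℂ
      value = proj₁ reᵒ , proj₁ imᵒ

      value≈ : (proj₁ value ℝ.≈ W.unipotent-value re) × (proj₂ value ℝ.≈ W.unipotent-value im)
      value≈ = proj₂ (proj₂ reᵒ) , proj₂ (proj₂ imᵒ)

      private
        integrand-re : ∀ k n z → u (K.g k) n ≋ z → proj₁ (fromℝ (extend ω n) *ᶜ fun f z) ℝ.≈ extend ω n ℝ.* val re (u (K.g k) n)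
        integrand-re k n z eq = ℝ.trans (R.solve 3 (λ e x y → e R.:* x R.:- R.:0 R.:* y R.:= e R.:* x) ℝ.refl (extend ω n) (val re z) (val im z))
          (ℝ.*-congˡ (val-≋ re (u (K.g k) n) z eq))

        integrand-im : ∀ k n z → u (K.g k) n ≋ z → proj₂ (fromℝ (extend ω n) *ᶜ fun f z) ℝ.≈ extend ω n ℝ.* val im (u (K.g k) n)
        integrand-im k n z eq = ℝ.trans (R.solve 3 (λ e x y → e R.:* y R.:+ R.:0 R.:* x R.:= e R.:* y) ℝ.refl (extend ω n) (val re z) (val im z))
          (ℝ.*-congˡ (val-≋ im (u (K.g k) n) z eq))

      isIntegral : IsUnipotentIntegral dk dn ω f value
      isIntegral = (λ k → W.Jᵍ re k , W.Jᵍ im k) ,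
        (λ k → W.inner-integral re k (λ n → integrand-re k n _ (cj-≋ (K.g k) (unipotent n))) ,
               W.inner-integral im k (λ n → integrand-im k n _ (cj-≋ (K.g k) (unipotent n)))) ,
        proj₁ (proj₂ reᵒ) , proj₁ (proj₂ imᵒ)

    module U¹ = Unipotent 𝟙
    module Uᵏ = Unipotent κ

    orbital : RegularT → ℂ
    orbital t = O t re , O t im

    private
      orbit-re : ∀ t z w → cj z (RegularT.t t) ≋ w → proj₁ (fun f w) ℝ.≈ fun (Regular.orb t re) z
      orbit-re t z w eq = ℝ.trans (val-≋ re (cj z (RegularT.t t)) w eq) (ℝ.sym (Regular.orb-fun t re z))

      orbit-im : ∀ t z w → cj z (RegularT.t t) ≋ w → proj₂ (fun f w) ℝ.≈ fun (Regular.orb t im) z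
      orbit-im t z w eq = ℝ.trans (val-≋ im (cj z (RegularT.t t)) w eq) (ℝ.sym (Regular.orb-fun t im z))

    orbital-isIntegral : ∀ t → IsOrbitalIntegral dx t f (orbital t)
    orbital-isIntegral t =
      TGI.hasIntegral-test (Regular.orb t re) (λ z → orbit-re t z _ (cj-≋ z (RegularT.t t))) ,
      TGI.hasIntegral-test (Regular.orb t im) (λ z → orbit-im t z _ (cj-≋ z (RegularT.t t)))

    radius : ℤ
    radius = proj₁ (real-expansion re) ℤ.⊔ proj₁ (real-expansion im)

    V : Pred SL2 0ℓ
    V z = NearG radius I z

    V-open : Space.Open G-space V
    V-open z Vz = radius , λ w near → nearG-trans {radius} {I} {z} {w} Vz near

    V-I : V I
    V-I = nearG-refl {radius} {I} {I} (≋-refl {I})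

    expansion : ∀ t → V (RegularT.t t) →
                orbital t ≈ᶜ ((Func.to Γ₁ t *ᶜ fun f I +ᶜ Func.to Γν t *ᶜ U¹.value) +ᶜ c₀ *ᶜ ((transferFactor l κ t) ⁻¹ᶜ *ᶜ Uᵏ.value))
    expansion t near =
      ℝ.trans (proj₂ (real-expansion re) t (nearG-mono {proj₁ (real-expansion re)} {radius} {I} {RegularT.t t} (ℤ.i≤i⊔j (proj₁ (real-expansion re)) (proj₁ (real-expansion im))) near))
        (ℝ.+-cong (ℝ.trans (ℝ.+-congˡ (ℝ.*-congˡ (ℝ.sym (proj₁ U¹.value≈))))
            (R.solve 6 (λ g i i′ c u u′ → g R.:* i R.:+ c R.:* u R.:= (g R.:* i R.:- R.:0 R.:* i′) R.:+ (c R.:* u R.:- R.:0 R.:* u′)) ℝ.refl (γ₁ t) (val re I) (val im I) (coef t) (proj₁ U¹.value) (proj₂ U¹.value)))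
          (ℝ.trans (ℝ.*-congˡ (ℝ.sym (proj₁ Uᵏ.value≈))) (ℝ.sym (proj₁ (AtRegular.factor t Uᵏ.value))))) ,
      ℝ.trans (proj₂ (real-expansion im) t (nearG-mono {proj₁ (real-expansion im)} {radius} {I} {RegularT.t t} (ℤ.i≤j⊔i (proj₁ (real-expansion re)) (proj₁ (real-expansion im))) near))
        (ℝ.+-cong (ℝ.trans (ℝ.+-congˡ (ℝ.*-congˡ (ℝ.sym (proj₂ U¹.value≈))))
            (R.solve 6 (λ g i i′ c u u′ → g R.:* i′ R.:+ c R.:* u′ R.:= (g R.:* i′ R.:+ R.:0 R.:* i) R.:+ (c R.:* u′ R.:+ R.:0 R.:* u)) ℝ.refl (γ₁ t) (val re I) (val im I) (coef t) (proj₁ U¹.value) (proj₂ U¹.value)))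
          (ℝ.trans (ℝ.*-congˡ (ℝ.sym (proj₂ Uᵏ.value≈))) (ℝ.sym (proj₂ (AtRegular.factor t Uᵏ.value)))))

mainTheorem3 : (∀ {ℓ} → ExcludedMiddle ℓ) →
    (ℝ : RealField) (F : LocalField) (E : SeparableQuadraticExtension F) →
    let open OrbitalIntegrals ℝ F E in
    (κ : QuadraticCharacter) → HasNormKernel κ →
    (l : ℂ) → l ^ᶜ 4 ≈ᶜ 1ᶜ →
    (dx : Measure T\G-space) → IsInvariantT\G dx →
    (dk : Measure K-space) → IsHaarK dk →
    (dn : Measure F-space) → IsHaarF dn →
    ∃ λ (Γ₁ : Func RegularT-setoid ℂ-setoid) →
    ∃ λ (Γν : Func RegularT-setoid ℂ-setoid) →
    ∃ λ (c₀ : ℂ) →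
    (f : Cc∞ G-space ℂ-rawRing) →
    ∃ λ (O¹ : ℂ) → IsUnipotentIntegral dk dn 𝟙 f O¹ ×
    (∃ λ (Oᵏ : ℂ) → IsUnipotentIntegral dk dn κ f Oᵏ ×
    (∃ λ V → Space.Open G-space V × V I ×
    ((s : RegularT) → V (RegularT.t s) →
    ∃ λ (A : ℂ) → IsOrbitalIntegral dx s f A ×
    (A ≈ᶜ (Func.to Γ₁ s *ᶜ fun f I +ᶜ Func.to Γν s *ᶜ O¹)
    +ᶜ c₀ *ᶜ (transferFactor l κ s ⁻¹ᶜ *ᶜ Oᵏ)))))
mainTheorem3 em ℝ F E κ κ-norm l l⁴≈1 dx dx-inv dk dk-inv dn dn-inv =
  Γ₁ , Γν , c₀ , λ f → let open ForFunction f in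
    U¹.value , U¹.isIntegral , Uᵏ.value , Uᵏ.isIntegral , V , V-open , V-I ,
    λ t near → orbital t , orbital-isIntegral t , expansion t near
  where
  open Expansion em ℝ F E κ κ-norm l l⁴≈1 dx dx-inv dk dk-inv dn dn-inv
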